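{- Let $q\ge5$ be a prime power and let $\xi\in\{ -1,0,1\}$ with $q\equiv\xi\pmod 3$. Let $\mathcal{C}$ be the twisted cubic in $\mathrm{PG}(3,q)$ and $G_q$ its stabilizer group (see context). Then the following hold for the orbits of lines under $G_q$. (i) The following sets of lines each consist of a single $G_q$-orbit: the real chords, the tangents and the imaginary chords (for all $q$); the $\mathrm{U}\Gamma$-lines (for odd $q$); the $\mathrm{Un}\Gamma$-lines, and the $\mathrm{E}\Gamma$-lines (for even $q$); the real axes and the imaginary axes (for $\xi\ne0$); the axis $\Gamma_{\mathrm{A}}$ (for $\xi=0$). (ii) Let $q\ge8$ be even. The $\mathrm{U}\Gamma$-lines form two $G_q$-orbits, of sizes $q+1$ and $q^2-1$. The orbit of size $q+1$ consists of the lines of the regulus complementary to the regulus of the tangents. These orbits are $\{\ell_1\varphi:\varphi\in G_q\}$ and $\{\ell_2\varphi:\varphi\in G_q\}$ respectively, where $P_0=P(0,0,0,1)$, $\ell_1$ is the line through $P_0$ and $P(0,1,0,0)$, and $\ell_2$ is the line through $P_0$ and $P(0,1,1,0)$. (iii) Let $q\ge5$ be odd. The $\mathrm{Un}\Gamma$-lines form two $G_q$-orbits, each of size $(q^3-q)/2$. These are $\{\ell_j\varphi:\varphi\in G_q\}$, $j=1,2$, where $\ell_1$ is the line through $P_0=P(0,0,0,1)$ and $P(1,0,1,0)$, $\ell_2$ is the line through $P_0$ and $P(1,0,\rho,0)$, and $\rho$ is a non-square in $\mathbb{F}_q$. (iv) Let $q\ge5$ be odd with $q\not\equiv0\pmod3$.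 The $\mathrm{E}\Gamma$-lines form two $G_q$-orbits, each of size $(q^3-q)/2$. These are $\{\ell_j\varphi:\varphi\in G_q\}$, $j=1,2$, where $\ell_j=\pi_0\cap\pi_j$ with $\pi_0=\boldsymbol{\pi}(1,0,0,0)=\pi_{\mathrm{osc}}(0)$, $\pi_1=\boldsymbol{\pi}(0,-3,0,-1)$, $\pi_2=\boldsymbol{\pi}(0,-3\rho,0,-1)$, and $\rho$ a non-square in $\mathbb{F}_q$. (v) Let $q\equiv0\pmod3$, $q\ge9$. The $\mathrm{EA}$-lines form three $G_q$-orbits, of sizes $q^3-q$, $(q^2-1)/2$, $(q^2-1)/2$. The orbit of size $q^3-q$ is $\{\ell_1\varphi:\varphi\in G_q\}$ and the two orbits of size $(q^2-1)/2$ are $\{\ell_j\varphi:\varphi\in G_q\}$, $j=2,3$, where, with $P_0^{\mathrm{A}}=P(0,1,0,0)$, $\ell_1$ is the line through $P_0^{\mathrm{A}}$ and $P(0,0,1,1)$, $\ell_2$ the line through $P_0^{\mathrm{A}}$ and $P(1,0,1,0)$, $\ell_3$ the line through $P_0^{\mathrm{A}}$ and $P(1,0,\rho,0)$, and $\rho$ is a non-square in $\mathbb{F}_q$.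
   Context: $\mathrm{PG}(3,q)$ has points $P(x_0,x_1,x_2,x_3)$ (homogeneous coordinates over $\mathbb{F}_q$); $\boldsymbol{\pi}(c_0,c_1,c_2,c_3)$ denotes the plane $c_0x_0+c_1x_1+c_2x_2+c_3x_3=0$. For $t\in\mathbb{F}_q$ let $P_t=P(t^3,t^2,t,1)$ and $P_\infty=P(1,0,0,0)$; the twisted cubic is $\mathcal{C}=\{P_t:t\in\mathbb{F}_q\cup\{\infty\}\}$. $G_q$ is the group of projectivities of $\mathrm{PG}(3,q)$ mapping $\mathcal{C}$ to itself; $\ell\varphi$ denotes the image of $\ell$ under $\varphi$. The osculating plane at $P_t$ is $\pi_{\mathrm{osc}}(t)=\boldsymbol{\pi}(1,-3t,3t^2,-t^3)$ for $t\in\mathbb{F}_q$ and $\pi_{\mathrm{osc}}(\infty)=\boldsymbol{\pi}(0,0,0,1)$; $\Gamma$ is the set of these $q+1$ osculating planes ($\Gamma$-planes); for $t\in\mathbb{F}_{q^2}\setminus\mathbb{F}_q$ the same formulas define osculating planes over $\mathbb{F}_{q^2}$, and $P_t$ is a point of $\mathrm{PG}(3,q^2)$. Line types: a real chord is a line through two distinct points of $\mathcal{C}$; the tangent at $P_t$, $t\in\mathbb{F}_q$, is the line through $P_t$ and $P(3t^2,2t,1,0)$, and the tangent at $P_\infty$ is the line $x_2=x_3=0$; an imaginary chord is a line of $\mathrm{PG}(3,q)$ which, extended to $\mathrm{PG}(3,q^2)$, passes through $P_t$ and $P_{t^q}$ for some $t\in\mathbb{F}_{q^2}\setminus\mathbb{F}_q$.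 For $q\not\equiv0\pmod3$: a real axis is the intersection of two distinct $\Gamma$-planes; an imaginary axis is a line of $\mathrm{PG}(3,q)$ that is the intersection of $\pi_{\mathrm{osc}}(t)$ and $\pi_{\mathrm{osc}}(t^q)$ for some $t\in\mathbb{F}_{q^2}\setminus\mathbb{F}_q$. A $\mathrm{U}\Gamma$-line is a line meeting $\mathcal{C}$ in exactly one point, not a tangent, and contained in some $\Gamma$-plane; a $\mathrm{Un}\Gamma$-line is a line meeting $\mathcal{C}$ in exactly one point and contained in no $\Gamma$-plane; an $\mathrm{E}\Gamma$-line is a line containing no point of $\mathcal{C}$ and contained in some $\Gamma$-plane. For $q\equiv0\pmod3$ all $\Gamma$-planes share the line $\Gamma_{\mathrm{A}}$: $x_0=x_3=0$ (the axis of $\Gamma$), and an $\mathrm{EA}$-line is a line different from $\Gamma_{\mathrm{A}}$, containing no point of $\mathcal{C}$ and meeting $\Gamma_{\mathrm{A}}$. For $q$ even the $q+1$ tangents of $\mathcal{C}$ form a regulus, and the complementary regulus is the other family of $q+1$ lines on the same hyperbolic quadric.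
   Formalization: EΓ-lines are taken to exclude the real axes: with the definition as given, real axes (e.g. x₀=x₃=0 when q is not divisible by 3) would be EΓ-lines, contradicting the single orbit in (i) for even q and the sizes in (iv). -}

module Defs where

open import Algebra.Bundles using (CommutativeRing; Semiring)
open import Algebra.Morphism.Structures using (IsRingMonomorphism)
open import Algebra.Structures using (IsCommutativeRing)
import Algebra.Definitions.RawSemiring as RawSemiringDefs
import Algebra.Properties.Ring as RingProperties
import Algebra.Properties.Semiring.Sum as SemiringSum
open import Data.Empty using (⊥-elim)
open import Data.Fin using (Fin; zero; suc; #_)
import Data.Fin.Properties as Fin
open import Data.Maybe using (Maybe; just; nothing)
open import Data.Nat as ℕ using (ℕ; suc)
open import Data.Nat.Primality using (Prime)
open import Data.Product using (Σ; ∃; ∃₂; _×_; _,_; proj₁; proj₂)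
open import Data.Sum using (_⊎_)
open import Data.Vec.Functional using (Vector; []; _∷_)
open import Function using (_∘_; _⇔_; _↔_; Inverse; Bijection)
import Function.Properties.Equivalence as ⇔
open import Level using (0ℓ)
open import Relation.Binary using (Setoid; DecidableEquality)
open import Relation.Binary.PropositionalEquality
  using (_≡_; _≢_; refl; sym; trans; cong; cong₂; setoid; module ≡-Reasoning)
open import Relation.Nullary using (¬_; yes; no)
open import Relation.Nullary.Decidable using (map′)
open import Relation.Unary using (Pred; _≐_)

IsPrimePower : ℕ → Set
IsPrimePower q = ∃₂ λ p k → Prime p × q ≡ p ℕ.^ suc k

record FiniteField (q : ℕ) : Set₁ where
  infixl 6 _+_
  infixl 7 _*_
  infix  8 -_
  field
    Carrier           : Set
    _+_ _*_           : Carrier → Carrier → Carrier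
    -_                : Carrier → Carrier
    0# 1#             : Carrier
    isCommutativeRing : IsCommutativeRing _≡_ _+_ _*_ -_ 0# 1#
    1≢0               : 1# ≢ 0#
    inverse           : ∀ x → x ≢ 0# → ∃ λ y → x * y ≡ 1#
    cardinality       : Fin q ↔ Carrier

  commutativeRing : CommutativeRing 0ℓ 0ℓ
  commutativeRing = record { isCommutativeRing = isCommutativeRing }

  open CommutativeRing commutativeRing public
    using ( ring; semiring; rawRing; +-identityʳ
          ; *-identityˡ; *-identityʳ; *-assoc; *-comm; zeroˡ; zeroʳ )

  open RawSemiringDefs (Semiring.rawSemiring semiring) public
    using (_^_) renaming (_×_ to infixr 8 _·_)

  _≟_ : DecidableEquality Carrier
  x ≟ y = map′
    (λ e → trans (sym (strictlyInverseˡ x)) (trans (cong to e) (strictlyInverseˡ y)))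
    (cong from)
    (from x Fin.≟ from y)
    where open Inverse cardinality

  NonSquare : Pred Carrier 0ℓ
  NonSquare ρ = ¬ (∃ λ y → ρ ≡ y * y)

record Extension {q r} (F : FiniteField q) (K : FiniteField r) : Set where
  private
    module F = FiniteField F
    module K = FiniteField K
  field
    ι                  : F.Carrier → K.Carrier
    isRingMonomorphism : IsRingMonomorphism F.rawRing K.rawRing ι

------------------------------------------------------------------------

module ProjectiveSpace {q} (F : FiniteField q) where
  open FiniteField F
  open SemiringSum semiring
    using (sum; sum-syntax; *-distribˡ-sum; *-distribʳ-sum; sum-cong-≗; ∑-comm)
  open ≡-Reasoning

  -- Homogeneous coordinates, of a point or of a plane.
  record Coordinates : Set where
    constructor ⟨_,_⟩
    field
      coord   : Vector Carrier 4
      nonzero : ¬ (∀ i → coord i ≡ 0#)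

  open Coordinates public

  Point = Coordinates
  Plane = Coordinates

  infix 4 _∼_ _∈ₗ_ _∈ₚ_ _≈ₗ_ _⊆ₚ_

  _∼_ : Coordinates → Coordinates → Set
  X ∼ Y = ∃ λ c → ∀ i → coord X i ≡ c * coord Y i

  _∈ₚ_ : Point → Plane → Set
  X ∈ₚ π = ∑[ i < 4 ] (coord π i * coord X i) ≡ 0#

  record Line : Set where
    constructor join
    field
      pt₁ pt₂  : Point
      distinct : ¬ pt₁ ∼ pt₂

  open Line public

  _∈ₗ_ : Point → Line → Set
  X ∈ₗ ℓ = ∃₂ λ a b → ∀ i → coord X i ≡ a * coord (pt₁ ℓ) i + b * coord (pt₂ ℓ) i

  _≈ₗ_ : Line → Line → Set
  ℓ ≈ₗ m = ∀ X → X ∈ₗ ℓ ⇔ X ∈ₗ m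

  _⊆ₚ_ : Line → Plane → Set
  ℓ ⊆ₚ π = ∀ X → X ∈ₗ ℓ → X ∈ₚ π

  IsMeet : Line → Plane → Plane → Set
  IsMeet ℓ π π′ = ∀ X → X ∈ₗ ℓ ⇔ (X ∈ₚ π × X ∈ₚ π′)

  -- Sets of lines, lines being identified when they have the same points.
  ⟦_⟧ : Pred Line 0ℓ → Setoid 0ℓ 0ℓ
  ⟦ S ⟧ = record
    { Carrier       = Σ Line S
    ; _≈_           = λ ℓ m → proj₁ ℓ ≈ₗ proj₁ m
    ; isEquivalence = record
      { refl  = λ _ → ⇔.refl
      ; sym   = λ e X → ⇔.sym (e X)
      ; trans = λ e f X → ⇔.trans (e X) (f X)
      }
    }

  HasSize : Pred Line 0ℓ → ℕ → Set
  HasSize S n = Bijection (setoid (Fin n)) ⟦ S ⟧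

  -- Projectivities are represented by invertible matrices A, acting on row
  -- vectors by x ↦ xA. They are not quotiented by scalars: only images of
  -- points and lines matter below.
  Matrix : Set
  Matrix = Fin 4 → Fin 4 → Carrier

  _⊡_ : Matrix → Matrix → Matrix
  (A ⊡ B) i k = ∑[ j < 4 ] (A i j * B j k)

  I : Matrix
  I i j with i Fin.≟ j
  ... | yes _ = 1#
  ... | no  _ = 0#

  record Projectivity : Set where
    field
      matrix matrix⁻¹ : Matrix
      inverseʳ : ∀ i j → (matrix ⊡ matrix⁻¹) i j ≡ I i j
      inverseˡ : ∀ i j → (matrix⁻¹ ⊡ matrix) i j ≡ I i j

  open Projectivity

  _⊙_ : Vector Carrier 4 → Matrix → Vector Carrier 4
  (x ⊙ A) j = ∑[ i < 4 ] (x i * A i j)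

  private
    ⊙-⊡ : ∀ x A B k → ((x ⊙ A) ⊙ B) k ≡ (x ⊙ (A ⊡ B)) k
    ⊙-⊡ x A B k = begin
      ∑[ j < 4 ] (∑[ i < 4 ] (x i * A i j) * B j k)
        ≡⟨ sum-cong-≗ (λ j → *-distribʳ-sum (B j k) (λ i → x i * A i j)) ⟩
      ∑[ j < 4 ] ∑[ i < 4 ] (x i * A i j * B j k)
        ≡⟨ ∑-comm (λ j i → x i * A i j * B j k) ⟩
      ∑[ i < 4 ] ∑[ j < 4 ] (x i * A i j * B j k)
        ≡⟨ sum-cong-≗ (λ i → sum-cong-≗ (λ j → *-assoc (x i) (A i j) (B j k))) ⟩
      ∑[ i < 4 ] ∑[ j < 4 ] (x i * (A i j * B j k))
        ≡⟨ sum-cong-≗ (λ i → *-distribˡ-sum (x i) (λ j → A i j * B j k)) ⟨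
      ∑[ i < 4 ] (x i * ∑[ j < 4 ] (A i j * B j k)) ∎

    ∑-single : ∀ {n} (f : Vector Carrier n) k → (∀ i → i ≢ k → f i ≡ 0#) → sum f ≡ f k
    ∑-zero : ∀ {n} (f : Vector Carrier n) → (∀ i → f i ≡ 0#) → sum f ≡ 0#
    ∑-zero {ℕ.zero} f h = refl
    ∑-zero {suc n}  f h =
      trans (cong₂ _+_ (h zero) (∑-zero (f ∘ suc) (h ∘ suc))) (+-identityʳ 0#)
    ∑-single f zero h =
      trans (cong (f zero +_) (∑-zero (f ∘ suc) (λ i → h (suc i) λ ()))) (+-identityʳ _)
    ∑-single f (suc k) h = trans
      (cong₂ _+_ (h zero λ ())
        (∑-single (f ∘ suc) k λ i i≢k → h (suc i) (i≢k ∘ Fin.suc-injective)))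
      (CommutativeRing.+-identityˡ commutativeRing _)

    I-diag : ∀ k → I k k ≡ 1#
    I-diag k with k Fin.≟ k
    ... | yes _   = refl
    ... | no  k≢k = ⊥-elim (k≢k refl)

    I-off : ∀ i k → i ≢ k → I i k ≡ 0#
    I-off i k i≢k with i Fin.≟ k
    ... | yes i≡k = ⊥-elim (i≢k i≡k)
    ... | no  _   = refl

    ⊙-I : ∀ x k → (x ⊙ I) k ≡ x k
    ⊙-I x k = begin
      ∑[ i < 4 ] (x i * I i k)
        ≡⟨ ∑-single (λ i → x i * I i k) k
             (λ i i≢k → trans (cong (x i *_) (I-off i k i≢k)) (zeroʳ (x i))) ⟩
      x k * I k k  ≡⟨ cong (x k *_) (I-diag k) ⟩
      x k * 1#     ≡⟨ *-identityʳ (x k) ⟩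
      x k          ∎

    ⊙-inverse : ∀ φ x k → ((x ⊙ matrix φ) ⊙ matrix⁻¹ φ) k ≡ x k
    ⊙-inverse φ x k = begin
      ((x ⊙ matrix φ) ⊙ matrix⁻¹ φ) k  ≡⟨ ⊙-⊡ x (matrix φ) (matrix⁻¹ φ) k ⟩
      (x ⊙ (matrix φ ⊡ matrix⁻¹ φ)) k
        ≡⟨ sum-cong-≗ (λ i → cong (x i *_) (inverseʳ φ i k)) ⟩
      (x ⊙ I) k                        ≡⟨ ⊙-I x k ⟩
      x k                              ∎

    ⊙-zero : ∀ {x} A → (∀ i → x i ≡ 0#) → ∀ j → (x ⊙ A) j ≡ 0#
    ⊙-zero A h j = ∑-zero _ (λ i → trans (cong (_* A i j) (h i)) (zeroˡ (A i j)))

    ⊙-scale : ∀ {x y c} A → (∀ i → x i ≡ c * y i) → ∀ j → (x ⊙ A) j ≡ c * (y ⊙ A) j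
    ⊙-scale {x} {y} {c} A h j = begin
      ∑[ i < 4 ] (x i * A i j)
        ≡⟨ sum-cong-≗ (λ i → trans (cong (_* A i j) (h i)) (*-assoc c (y i) (A i j))) ⟩
      ∑[ i < 4 ] (c * (y i * A i j))
        ≡⟨ *-distribˡ-sum c (λ i → y i * A i j) ⟨
      c * (y ⊙ A) j ∎

  infixl 9 _▹_ _▸_

  _▹_ : Point → Projectivity → Point
  X ▹ φ = ⟨ coord X ⊙ matrix φ
          , (λ h → nonzero X λ i →
              trans (sym (⊙-inverse φ (coord X) i)) (⊙-zero (matrix⁻¹ φ) h i)) ⟩

  _▸_ : Line → Projectivity → Line
  ℓ ▸ φ = join (pt₁ ℓ ▹ φ) (pt₂ ℓ ▹ φ) λ (c , h) → distinct ℓ (c , λ i → begin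
    coord (pt₁ ℓ) i
      ≡⟨ ⊙-inverse φ (coord (pt₁ ℓ)) i ⟨
    ((coord (pt₁ ℓ) ⊙ matrix φ) ⊙ matrix⁻¹ φ) i
      ≡⟨ ⊙-scale (matrix⁻¹ φ) h i ⟩
    c * ((coord (pt₂ ℓ) ⊙ matrix φ) ⊙ matrix⁻¹ φ) i
      ≡⟨ cong (c *_) (⊙-inverse φ (coord (pt₂ ℓ)) i) ⟩
    c * coord (pt₂ ℓ) i ∎)

  -- Hyperbolic quadrics are the point sets projectively equivalent to
  -- x₀x₁ + x₂x₃ = 0; OnQuadric φ is the preimage of this one under φ.
  OnQuadric : Projectivity → Pred Point 0ℓ
  OnQuadric φ X = y (# 0) * y (# 1) + y (# 2) * y (# 3) ≡ 0#
    where y = coord (X ▹ φ)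

  PairwiseSkew : Pred Line 0ℓ → Set
  PairwiseSkew S = ∀ ℓ m → S ℓ → S m → ¬ ℓ ≈ₗ m → ¬ (∃ λ X → X ∈ₗ ℓ × X ∈ₗ m)

  -- The lines of some hyperbolic quadric are those of R and those of S, each
  -- family being pairwise skew. The two reguli of a hyperbolic quadric are, up
  -- to order, the only way to split its lines like this.
  ComplementaryReguli : Pred Line 0ℓ → Pred Line 0ℓ → Set
  ComplementaryReguli R S =
    (∃ λ φ → ∀ ℓ → (∀ X → X ∈ₗ ℓ → OnQuadric φ X) ⇔ (R ℓ ⊎ S ℓ))
    × PairwiseSkew R × PairwiseSkew S

  unit : ∀ {x : Vector Carrier 4} i → x i ≡ 1# → ¬ (∀ j → x j ≡ 0#)
  unit i xᵢ≡1 h = 1≢0 (trans (sym xᵢ≡1) (h i))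

  joinAt : ∀ i X Y → coord X i ≡ 1# → coord Y i ≡ 0# → Line
  joinAt i X Y xᵢ≡1 yᵢ≡0 = join X Y λ (c , h) → 1≢0 (begin
    1#              ≡⟨ xᵢ≡1 ⟨
    coord X i       ≡⟨ h i ⟩
    c * coord Y i   ≡⟨ cong (c *_) yᵢ≡0 ⟩
    c * 0#          ≡⟨ zeroʳ c ⟩
    0#              ∎)

  -1≢0 : - 1# ≢ 0#
  -1≢0 e = 1≢0 (begin
    1#        ≡⟨ RingProperties.-‿involutive ring 1# ⟨
    - (- 1#)  ≡⟨ cong -_ e ⟩
    - 0#      ≡⟨ RingProperties.-0#≈0# ring ⟩
    0#        ∎)

  nonzeroCoord : ∀ X → ∃ λ i → coord X i ≢ 0#
  nonzeroCoord X = Fin.¬∀⟶∃¬ 4 _ (λ i → coord X i ≟ 0#) (nonzero X)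

------------------------------------------------------------------------

module TwistedCubic {q} (F : FiniteField q) where
  open FiniteField F
  open ProjectiveSpace F

  Parameter : Set
  Parameter = Maybe Carrier

  pattern ∞ = nothing

  P : Parameter → Point
  P (just t) = ⟨ t ^ 3 ∷ t ^ 2 ∷ t ∷ 1# ∷ [] , unit (# 3) refl ⟩
  P ∞        = ⟨ 1# ∷ 0# ∷ 0# ∷ 0# ∷ [] , unit (# 0) refl ⟩

  osc : Parameter → Plane
  osc (just t) = ⟨ 1# ∷ - (3 · t) ∷ 3 · t ^ 2 ∷ - (t ^ 3) ∷ [] , unit (# 0) refl ⟩
  osc ∞        = ⟨ 0# ∷ 0# ∷ 0# ∷ 1# ∷ [] , unit (# 3) refl ⟩

  _∈𝒞 : Pred Point 0ℓ
  X ∈𝒞 = ∃ λ t → X ∼ P t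

  -- Membership in G_q.
  StabilizesCubic : Projectivity → Set
  StabilizesCubic φ = ∀ X → X ∈𝒞 ⇔ (X ▹ φ) ∈𝒞

  Orbit : Line → Pred Line 0ℓ
  Orbit ℓ m = ∃ λ φ → StabilizesCubic φ × ℓ ▸ φ ≈ₗ m

  IsOrbit : Pred Line 0ℓ → Set
  IsOrbit S = ∃ λ ℓ → S ≐ Orbit ℓ

------------------------------------------------------------------------

module LineTypes {q} (F : FiniteField q) (K : FiniteField (q ℕ.^ 2)) (E : Extension F K) where
  open FiniteField F
  open ProjectiveSpace F
  open TwistedCubic F
  open Extension E
  open IsRingMonomorphism isRingMonomorphism
    using (*-homo; 0#-homo; injective)

  private
    module K  = FiniteField K
    module PK = ProjectiveSpace K
    module CK = TwistedCubic K

  x₀=0 x₂=0 x₃=0 : Plane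
  x₀=0 = ⟨ 1# ∷ 0# ∷ 0# ∷ 0# ∷ [] , unit (# 0) refl ⟩
  x₂=0 = ⟨ 0# ∷ 0# ∷ 1# ∷ 0# ∷ [] , unit (# 2) refl ⟩
  x₃=0 = ⟨ 0# ∷ 0# ∷ 0# ∷ 1# ∷ [] , unit (# 3) refl ⟩

  extendPoint : Point → PK.Point
  extendPoint X = PK.⟨ ι ∘ coord X
    , (λ h → nonzero X λ i → injective (trans (h i) (sym 0#-homo))) ⟩

  extend : Line → PK.Line
  extend ℓ = PK.join (extendPoint (pt₁ ℓ)) (extendPoint (pt₂ ℓ)) λ (c , h) →
    let x = coord (pt₁ ℓ)
        y = coord (pt₂ ℓ)
        (j , yⱼ≢0)  = nonzeroCoord (pt₂ ℓ)
        (z , yⱼz≡1) = inverse (y j) yⱼ≢0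
        c≡ : c ≡ ι (x j * z)
        c≡ = begin
          c                        ≡⟨ K.*-identityʳ c ⟨
          c K.* K.1#               ≡⟨ cong (c K.*_) (IsRingMonomorphism.1#-homo isRingMonomorphism) ⟨
          c K.* ι 1#               ≡⟨ cong (λ w → c K.* ι w) yⱼz≡1 ⟨
          c K.* ι (y j * z)        ≡⟨ cong (c K.*_) (*-homo (y j) z) ⟩
          c K.* (ι (y j) K.* ι z)  ≡⟨ K.*-assoc c (ι (y j)) (ι z) ⟨
          c K.* ι (y j) K.* ι z    ≡⟨ cong (K._* ι z) (h j) ⟨
          ι (x j) K.* ι z          ≡⟨ *-homo (x j) z ⟨
          ι (x j * z)              ∎
    in distinct ℓ (x j * z , λ i → injective (begin
          ι (x i)                    ≡⟨ h i ⟩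
          c K.* ι (y i)              ≡⟨ cong (K._* ι (y i)) c≡ ⟩
          ι (x j * z) K.* ι (y i)    ≡⟨ *-homo (x j * z) (y i) ⟨
          ι (x j * z * y i)          ∎))
    where open ≡-Reasoning

  Imaginary : Pred K.Carrier 0ℓ
  Imaginary t = ∀ s → t ≢ ι s

  RealChord : Pred Line 0ℓ
  RealChord ℓ = ∃₂ λ X Y → X ∈𝒞 × Y ∈𝒞 × ¬ X ∼ Y × X ∈ₗ ℓ × Y ∈ₗ ℓ

  TangentAt : Parameter → Pred Line 0ℓ
  TangentAt (just t) ℓ =
    P (just t) ∈ₗ ℓ × ⟨ 3 · t ^ 2 ∷ 2 · t ∷ 1# ∷ 0# ∷ [] , unit (# 2) refl ⟩ ∈ₗ ℓ
  TangentAt ∞ ℓ = IsMeet ℓ x₂=0 x₃=0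

  Tangent : Pred Line 0ℓ
  Tangent ℓ = ∃ λ t → TangentAt t ℓ

  ImaginaryChord : Pred Line 0ℓ
  ImaginaryChord ℓ = ∃ λ t → Imaginary t
    × CK.P (just t) PK.∈ₗ extend ℓ × CK.P (just (t K.^ q)) PK.∈ₗ extend ℓ

  RealAxis : Pred Line 0ℓ
  RealAxis ℓ = ∃₂ λ s t → ¬ osc s ∼ osc t × IsMeet ℓ (osc s) (osc t)

  ImaginaryAxis : Pred Line 0ℓ
  ImaginaryAxis ℓ = ∃ λ t → Imaginary t
    × PK.IsMeet (extend ℓ) (CK.osc (just t)) (CK.osc (just (t K.^ q)))

  External : Pred Line 0ℓ
  External ℓ = ¬ (∃ λ X → X ∈𝒞 × X ∈ₗ ℓ)

  Unisecant : Pred Line 0ℓ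
  Unisecant ℓ = ∃ λ X → (X ∈𝒞 × X ∈ₗ ℓ) × (∀ Y → Y ∈𝒞 → Y ∈ₗ ℓ → Y ∼ X)

  InΓPlane : Pred Line 0ℓ
  InΓPlane ℓ = ∃ λ t → ℓ ⊆ₚ osc t

  UΓ : Pred Line 0ℓ
  UΓ ℓ = Unisecant ℓ × ¬ Tangent ℓ × InΓPlane ℓ

  UnΓ : Pred Line 0ℓ
  UnΓ ℓ = Unisecant ℓ × ¬ InΓPlane ℓ

  -- A real axis is also an external line lying in a Γ-plane (in two of them,
  -- when 3 ∤ q), but the real axes form a class of their own.
  EΓ : Pred Line 0ℓ
  EΓ ℓ = External ℓ × InΓPlane ℓ × ¬ RealAxis ℓ

  ΓAxis : Pred Line 0ℓ
  ΓAxis ℓ = IsMeet ℓ x₀=0 x₃=0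

  EA : Pred Line 0ℓ
  EA ℓ = ¬ ΓAxis ℓ × External ℓ × (∃ λ X → X ∈ₗ ℓ × X ∈ₚ x₀=0 × X ∈ₚ x₃=0)

  P₀ P₀ᴬ : Point
  P₀  = ⟨ 0# ∷ 0# ∷ 0# ∷ 1# ∷ [] , unit (# 3) refl ⟩
  P₀ᴬ = ⟨ 0# ∷ 1# ∷ 0# ∷ 0# ∷ [] , unit (# 1) refl ⟩

  ℓ-UΓ₁ ℓ-UΓ₂ : Line
  ℓ-UΓ₁ = joinAt (# 3) P₀ ⟨ 0# ∷ 1# ∷ 0# ∷ 0# ∷ [] , unit (# 1) refl ⟩ refl refl
  ℓ-UΓ₂ = joinAt (# 3) P₀ ⟨ 0# ∷ 1# ∷ 1# ∷ 0# ∷ [] , unit (# 1) refl ⟩ refl refl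

  ℓ-UnΓ : Carrier → Line
  ℓ-UnΓ ρ = joinAt (# 3) P₀ ⟨ 1# ∷ 0# ∷ ρ ∷ 0# ∷ [] , unit (# 0) refl ⟩ refl refl

  π₀ : Plane
  π₀ = x₀=0

  -- π-EΓ 1# = π(0,-3,0,-1); likewise ℓ-UnΓ and ℓ-EA are used at 1# and at a
  -- non-square.
  π-EΓ : Carrier → Plane
  π-EΓ ρ = ⟨ 0# ∷ - (3 · ρ) ∷ 0# ∷ - 1# ∷ [] , (λ h → -1≢0 (h (# 3))) ⟩

  ℓ-EA₁ : Line
  ℓ-EA₁ = joinAt (# 1) P₀ᴬ ⟨ 0# ∷ 0# ∷ 1# ∷ 1# ∷ [] , unit (# 2) refl ⟩ refl refl

  ℓ-EA : Carrier → Line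
  ℓ-EA ρ = joinAt (# 1) P₀ᴬ ⟨ 1# ∷ 0# ∷ ρ ∷ 0# ∷ [] , unit (# 0) refl ⟩ refl refl

{-# OPTIONS --safe #-}

-- An element of G taking P O to itself and P ∞ to itself is diagonal, because
-- the conditions x₀x₂ = x₁² and x₁x₃ = x₂² on the images of the other points are
-- cubic equations with q - 1 ≥ 4 roots. So the stabilizer of P O consists of
-- the maps induced by t ↦ at/(ct + 1), and G contains a map taking any given
-- point of the cubic to P O. For every rational line type, the lines are moved
-- so that a point of the cubic (or an osculating plane, or a point of the axis
-- of Γ) attached to the line becomes the one at P O; those lines have normal
-- forms with one or two field parameters, on which the stabilizer of P O acts by
-- translation and scaling. A parameter that is scaled by squares produces the two
-- orbits distinguished by a non-square. If the attached point is unique, an orbit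
-- has q + 1 times as many lines as there are normal forms.
-- An imaginary chord or axis is determined by an element of K \ F, and G acts on
-- these as a group of fractional linear maps over F, which is transitive on them
-- because K = F + Ft.
-- For q even the tangents form a regulus of a quadric equivalent to
-- x₀x₃ = x₁x₂, whose other regulus is the orbit of size q + 1.
module Submission where

open import Defs
open import Algebra.Bundles using (CommutativeRing)
open import Algebra.Morphism.Structures using (IsRingMonomorphism)
import Algebra.Properties.CommutativeMonoid.Sum as MonoidSum
import Algebra.Properties.Ring as RingProperties
import Algebra.Properties.Semiring.Exp.TCOptimised as SemiringExp
import Algebra.Properties.Semiring.Mult as SemiringMult
import Algebra.Properties.Semiring.Sum as SemiringSum
open import Data.Bool using (true; false)
open import Data.Empty as Empty using (⊥-elim)
open import Data.Fin as Fin using (Fin; zero; suc; #_; punchOut)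
import Data.Fin.Permutation as Permutation
import Data.Fin.Properties as Fin
open import Data.Integer as ℤ using (ℤ; -[1+_]; 0ℤ; 1ℤ; -1ℤ) renaming (+_ to pos)
import Data.Integer.Divisibility as ℤ
import Data.Integer.Properties as ℤ
open import Data.List using (List; []; _∷_)
open import Data.Maybe using (Maybe; just; nothing)
import Data.Maybe.Properties as Maybe
open import Data.Maybe.Properties using (just-injective)
open import Data.Nat as ℕ using (ℕ; zero; suc; _<_)
open import Data.Nat.Divisibility using (_∣_; _∤_; ∣m+n∣m⇒∣n; ∣1⇒≡1; m%n≡0⇒n∣m)
open import Data.Nat.DivMod using (_/_; _%_; m≡m%n+[m/n]*n; m%n<n; m*n/n≡m)
open import Data.Nat.Primality using (Prime; prime[2]; prime?; euclidsLemma; prime⇒irreducible; ¬prime[1])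
import Data.Nat.Properties as ℕ
open import Data.Nat.Tactic.RingSolver using (solve-∀)
open import Data.Product using (∃; ∃₂; _×_; _,_; proj₁; proj₂)
import Data.Product.Function.NonDependent.Propositional as Product
open import Data.Sum as Sum using (_⊎_; inj₁; inj₂)
import Data.Sum.Function.Propositional as Sum
open import Data.Unit using (⊤; tt)
open import Data.Vec as Vec using (Vec; []; _∷_)
open import Data.Vec.Functional as Functional using (Vector; removeAt)
open import Data.Vec.N-ary using (N-ary; _$ⁿ_)
open import Data.Vec.Relation.Unary.All using (All; []; _∷_)
open import Function using (_∘_; mk⇔; Equivalence; _↔_; Inverse; mk↔ₛ′; Bijection)
open import Function.Definitions using (Injective)
import Function.Properties.Inverse as ↔
open import Level using (0ℓ)
open import Relation.Binary using (tri<; tri≈; tri>)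
open import Relation.Binary.PropositionalEquality
open import Relation.Nullary using (¬_; ¬?; Dec; yes; no)
open import Relation.Nullary.Decidable using (map′; from-yes)
open import Relation.Unary using (Pred; Decidable; Satisfiable; _≐_; _∪_; _⊥_)
open import Tactic.RingSolver.Core.AlmostCommutativeRing using (AlmostCommutativeRing; fromCommutativeRing)
open import Tactic.RingSolver.Core.Expression using (Expr; Κ; Ι; _⊕_; _⊗_; ⊝_; _⊛_; module Eval)
open import Tactic.RingSolver.Core.Polynomial.Parameters using (RawCoeff; Homomorphism)

-- The group is given only as the setwise stabilizer of the cubic, with no identification with
-- PGL(2,q). Computing the stabilizer of one point is enough, since a set of lines in standard
-- position is invariant as soon as dilations and shears preserve it. The characteristic enters
-- through the coefficients 2 and 3. A shear by u translates the parameter of a line through `P O`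
-- in its osculating plane by 2u, so these lines form one orbit or two according as 2 is invertible
-- or zero. Osculating planes have coefficients 1, -3t, 3t², -t³, so axes are normalised by division
-- by 3; if 3 = 0, the point where a tangent meets the axis of Γ identifies the base parameter
-- instead. All algebra is done by certificates: the goal follows from the hypotheses with explicit
-- cofactors, and the resulting identity holds over ℤ, so that 2 = 0 and 3 = 0 are hypotheses like
-- any other. Of K only the order and the embedding of F are given; conjugation is the plain power
-- map x ↦ x^q, and surjectivity statements come from counting.

-- Certified polynomial identities

ℤ-coefficients : RawCoeff 0ℓ 0ℓ
ℤ-coefficients = record { rawRing = ℤ.+-*-rawRing ; isZero = λ { (pos 0) → true ; _ → false } }

module Normal where
  open import Tactic.RingSolver.Core.Polynomial.Base ℤ-coefficients

  -- Independent of the field: the coefficients are integers, so two normal forms are compared by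
  -- closed computation and `refl` suffices.
  norm : ∀ {n} → Expr ℤ n → Poly n
  norm (Κ x)   = κ x
  norm (Ι x)   = ι x
  norm (x ⊕ y) = norm x ⊞ norm y
  norm (x ⊗ y) = norm x ⊠ norm y
  norm (⊝ x)   = ⊟ norm x
  norm (x ⊛ i) = norm x ⊡ i

open Normal public using (norm)

infix  4 _:=_ _∶_:=_
infixl 6 _:+_ _:-_
infixl 7 _:*_
infix  8 :-_
infixr 8 _:^_ _:·_
infix  2 _given_
infixr 3 _and_

pattern _:+_ x y = x ⊕ y
pattern _:*_ x y = x ⊗ y
pattern :-_ x = ⊝ x

_:-_ : ∀ {n} → Expr ℤ n → Expr ℤ n → Expr ℤ n
x :- y = x :+ :- y

:0 :1 : ∀ {n} → Expr ℤ n
:0 = Κ 0ℤ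
:1 = Κ 1ℤ

-- Unrolled like the field's `_^_`, and `_:·_` like `_·_`, so that an expression evaluates by
-- computation to the term written with the field operations.
_:^_ : ∀ {n} → Expr ℤ n → ℕ → Expr ℤ n
x :^ zero  = :1
x :^ suc k = x :* x :^ k

_:·_ : ∀ {n} → ℕ → Expr ℤ n → Expr ℤ n
zero  :· x = :0
suc k :· x = x :+ k :· x

record Equation (n : ℕ) : Set where
  constructor _:=_
  field lhs rhs : Expr ℤ n

record Hypothesis (n : ℕ) : Set where
  constructor _∶_:=_
  field factor lhs rhs : Expr ℤ n

record Claim (n : ℕ) : Set where
  constructor _given_
  field
    goal : Equation n
    hyps : List (Hypothesis n)

pattern _and_ h hs = h ∷ hs

instantiate : ∀ {n} → N-ary n (Expr ℤ n) (Claim n) → Claim n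
instantiate f = f $ⁿ Vec.map Ι (Vec.allFin _)

-- The goal lhs = rhs follows from Lᵢ = Rᵢ when lhs + ∑ cᵢRᵢ = rhs + ∑ cᵢLᵢ.
moved : ∀ {n} → Claim n → Equation n
moved (goal given []) = goal
moved (goal given ((c ∶ l := r) ∷ hs)) with moved (goal given hs)
... | a := b = a :+ c :* r := b :+ c :* l

module _ {q} (F : FiniteField q) where
  open FiniteField F
  open CommutativeRing commutativeRing using (+-assoc; +-comm; +-identityˡ; -‿inverseʳ)
  open RingProperties ring
  open SemiringMult semiring using (×-homo-+; ×1-homo-*)
  open ≡-Reasoning

  private
    target : AlmostCommutativeRing 0ℓ 0ℓ
    target = fromCommutativeRing commutativeRing (λ _ → nothing)

    -- The cases 0 and 1 are separate so that `:0` and `:1` evaluate to `0#` and `1#` by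
    -- computation; the general clause would turn 1 into `1# + 0#`.
    ⟦_⟧ℤ : ℤ → Carrier
    ⟦ pos 0 ⟧ℤ      = 0#
    ⟦ pos 1 ⟧ℤ      = 1#
    ⟦ pos n ⟧ℤ      = n · 1#
    ⟦ -[1+ n ] ⟧ℤ = - (suc n · 1#)

    ⟦⟧-pos : ∀ n → ⟦ pos n ⟧ℤ ≡ n · 1#
    ⟦⟧-pos 0 = refl
    ⟦⟧-pos 1 = sym (+-identityʳ 1#)
    ⟦⟧-pos (suc (suc n)) = refl

    cancel : ∀ a x y → x + - y ≡ (a + x) + - (a + y)
    cancel a x y = sym (begin
      (a + x) + - (a + y)      ≡⟨ cong ((a + x) +_) (sym (-‿+-comm a y)) ⟩
      (a + x) + (- a + - y)    ≡⟨ cong (_+ (- a + - y)) (+-comm a x) ⟩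
      (x + a) + (- a + - y)    ≡⟨ +-assoc x a _ ⟩
      x + (a + (- a + - y))    ≡⟨ cong (x +_) (sym (+-assoc a (- a) (- y))) ⟩
      x + ((a + - a) + - y)    ≡⟨ cong (λ z → x + (z + - y)) (-‿inverseʳ a) ⟩
      x + (0# + - y)           ≡⟨ cong (x +_) (+-identityˡ _) ⟩
      x + - y ∎)

    ⟦⟧-⊖ : ∀ m n → ⟦ m ℤ.⊖ n ⟧ℤ ≡ m · 1# + - (n · 1#)
    ⟦⟧-⊖ m zero = trans (⟦⟧-pos m) (sym (trans (cong ((m · 1#) +_) -0#≈0#) (+-identityʳ _)))
    ⟦⟧-⊖ zero (suc n) = sym (+-identityˡ _)
    ⟦⟧-⊖ (suc m) (suc n) = begin
      ⟦ suc m ℤ.⊖ suc n ⟧ℤ  ≡⟨ cong ⟦_⟧ℤ (ℤ.[1+m]⊖[1+n]≡m⊖n m n) ⟩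
      ⟦ m ℤ.⊖ n ⟧ℤ          ≡⟨ ⟦⟧-⊖ m n ⟩
      m · 1# + - (n · 1#)  ≡⟨ cancel 1# (m · 1#) (n · 1#) ⟩
      suc m · 1# + - (suc n · 1#) ∎

    ⟦⟧-homo-+ : ∀ x y → ⟦ x ℤ.+ y ⟧ℤ ≡ ⟦ x ⟧ℤ + ⟦ y ⟧ℤ
    ⟦⟧-homo-+ (pos m) (pos n) = begin
      ⟦ pos (m ℕ.+ n) ⟧ℤ      ≡⟨ ⟦⟧-pos (m ℕ.+ n) ⟩
      (m ℕ.+ n) · 1#        ≡⟨ ×-homo-+ 1# m n ⟩
      m · 1# + n · 1#       ≡⟨ cong₂ _+_ (⟦⟧-pos m) (⟦⟧-pos n) ⟨
      ⟦ pos m ⟧ℤ + ⟦ pos n ⟧ℤ   ∎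
    ⟦⟧-homo-+ (pos m) -[1+ n ] = trans (⟦⟧-⊖ m (suc n)) (cong (_+ _) (sym (⟦⟧-pos m)))
    ⟦⟧-homo-+ -[1+ m ] (pos n) = trans (⟦⟧-⊖ n (suc m)) (trans (+-comm _ _) (cong (_ +_) (sym (⟦⟧-pos n))))
    ⟦⟧-homo-+ -[1+ m ] -[1+ n ] = begin
      - (suc (suc (m ℕ.+ n)) · 1#)      ≡⟨ cong (λ k → - (k · 1#)) (cong suc (sym (ℕ.+-suc m n))) ⟩
      - ((suc m ℕ.+ (suc n)) · 1#)        ≡⟨ cong -_ (×-homo-+ 1# (suc m) (suc n)) ⟩
      - (suc m · 1# + suc n · 1#)       ≡⟨ -‿+-comm _ _ ⟨
      - (suc m · 1#) + - (suc n · 1#)   ∎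

    ⟦⟧-homo-neg : ∀ x → ⟦ ℤ.- x ⟧ℤ ≡ - ⟦ x ⟧ℤ
    ⟦⟧-homo-neg (pos 0) = sym -0#≈0#
    ⟦⟧-homo-neg (pos 1) = cong -_ (+-identityʳ 1#)
    ⟦⟧-homo-neg (pos (suc (suc n))) = refl
    ⟦⟧-homo-neg -[1+ n ] = trans (⟦⟧-pos (suc n)) (sym (-‿involutive _))

    ⟦⟧-homo-*-+ : ∀ m n → ⟦ pos m ℤ.* pos n ⟧ℤ ≡ ⟦ pos m ⟧ℤ * ⟦ pos n ⟧ℤ
    ⟦⟧-homo-*-+ m n = begin
      ⟦ pos m ℤ.* pos n ⟧ℤ     ≡⟨ cong ⟦_⟧ℤ (ℤ.pos-* m n) ⟨
      ⟦ pos (m ℕ.* n) ⟧ℤ     ≡⟨ ⟦⟧-pos (m ℕ.* n) ⟩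
      (m ℕ.* n) · 1#       ≡⟨ ×1-homo-* m n ⟩
      m · 1# * n · 1#      ≡⟨ cong₂ _*_ (⟦⟧-pos m) (⟦⟧-pos n) ⟨
      ⟦ pos m ⟧ℤ * ⟦ pos n ⟧ℤ  ∎

    ⟦⟧-homo-* : ∀ x y → ⟦ x ℤ.* y ⟧ℤ ≡ ⟦ x ⟧ℤ * ⟦ y ⟧ℤ
    ⟦⟧-homo-* (pos m) (pos n) = ⟦⟧-homo-*-+ m n
    ⟦⟧-homo-* (pos m) -[1+ n ] = begin
      ⟦ pos m ℤ.* -[1+ n ] ⟧ℤ          ≡⟨ cong ⟦_⟧ℤ (sym (ℤ.neg-distribʳ-* (pos m) (pos (suc n)))) ⟩
      ⟦ ℤ.- (pos m ℤ.* pos (suc n)) ⟧ℤ     ≡⟨ ⟦⟧-homo-neg (pos m ℤ.* pos (suc n)) ⟩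
      - ⟦ pos m ℤ.* pos (suc n) ⟧ℤ         ≡⟨ cong -_ (⟦⟧-homo-*-+ m (suc n)) ⟩
      - (⟦ pos m ⟧ℤ * ⟦ pos (suc n) ⟧ℤ)    ≡⟨ -‿distribʳ-* _ _ ⟩
      ⟦ pos m ⟧ℤ * - ⟦ pos (suc n) ⟧ℤ      ≡⟨ cong (λ z → ⟦ pos m ⟧ℤ * - z) (⟦⟧-pos (suc n)) ⟩
      ⟦ pos m ⟧ℤ * ⟦ -[1+ n ] ⟧ℤ       ∎
    ⟦⟧-homo-* -[1+ m ] y = begin
      ⟦ -[1+ m ] ℤ.* y ⟧ℤ            ≡⟨ cong ⟦_⟧ℤ (sym (ℤ.neg-distribˡ-* (pos (suc m)) y)) ⟩
      ⟦ ℤ.- (pos (suc m) ℤ.* y) ⟧ℤ       ≡⟨ ⟦⟧-homo-neg (pos (suc m) ℤ.* y) ⟩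
      - ⟦ pos (suc m) ℤ.* y ⟧ℤ           ≡⟨ cong -_ (go y) ⟩
      - (⟦ pos (suc m) ⟧ℤ * ⟦ y ⟧ℤ)      ≡⟨ -‿distribˡ-* _ _ ⟩
      - ⟦ pos (suc m) ⟧ℤ * ⟦ y ⟧ℤ        ≡⟨ cong (λ z → - z * ⟦ y ⟧ℤ) (⟦⟧-pos (suc m)) ⟩
      ⟦ -[1+ m ] ⟧ℤ * ⟦ y ⟧ℤ         ∎
      where
      go : ∀ y → ⟦ pos (suc m) ℤ.* y ⟧ℤ ≡ ⟦ pos (suc m) ⟧ℤ * ⟦ y ⟧ℤ
      go (pos n)    = ⟦⟧-homo-*-+ (suc m) n
      go -[1+ n ] = ⟦⟧-homo-* (pos (suc m)) -[1+ n ]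

    homomorphism : Homomorphism 0ℓ 0ℓ 0ℓ 0ℓ
    homomorphism = record
      { from = ℤ-coefficients
      ; to = target
      ; morphism = record
        { ⟦_⟧ = ⟦_⟧ℤ ; +-homo = ⟦⟧-homo-+ ; *-homo = ⟦⟧-homo-* ; -‿homo = ⟦⟧-homo-neg
        ; 0-homo = refl ; 1-homo = refl }
      ; Zero-C⟶Zero-R = λ { (pos 0) _ → refl }
      }

    open import Tactic.RingSolver.Core.Polynomial.Semantics homomorphism renaming (⟦_⟧ to ⟦_⟧ₚ)
    open import Tactic.RingSolver.Core.Polynomial.Homomorphism homomorphism

  open Eval rawRing ⟦_⟧ℤ public renaming (⟦_⟧ to evaluate)

  private
    open SemiringExp semiring using (^-congˡ)

    norm-correct : ∀ {n} (e : Expr ℤ n) ρ → ⟦ norm e ⟧ₚ ρ ≡ evaluate e ρ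
    norm-correct (Κ x)   ρ = κ-hom x ρ
    norm-correct (Ι x)   ρ = ι-hom x ρ
    norm-correct (x ⊕ y) ρ = trans (⊞-hom (norm x) (norm y) ρ) (cong₂ _+_ (norm-correct x ρ) (norm-correct y ρ))
    norm-correct (x ⊗ y) ρ = trans (⊠-hom (norm x) (norm y) ρ) (cong₂ _*_ (norm-correct x ρ) (norm-correct y ρ))
    norm-correct (⊝ x)   ρ = trans (⊟-hom (norm x) ρ) (cong -_ (norm-correct x ρ))
    norm-correct (x ⊛ i) ρ = trans (⊡-hom (norm x) i ρ) (^-congˡ i (norm-correct x ρ))

  Holds : ∀ {n} → Claim n → Vec Carrier n → Set
  Holds ((l := r) given []) ρ = evaluate l ρ ≡ evaluate r ρ
  Holds (goal given ((c ∶ l := r) ∷ hs)) ρ = evaluate l ρ ≡ evaluate r ρ → Holds (goal given hs) ρ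

  private
    unmove : ∀ {n} (c : Claim n) ρ → evaluate (Equation.lhs (moved c)) ρ ≡ evaluate (Equation.rhs (moved c)) ρ → Holds c ρ
    unmove (goal given []) ρ e = e
    unmove (goal given ((c ∶ l := r) ∷ hs)) ρ e h = unmove (goal given hs) ρ
      (+-cancelʳ _ _ _ (trans e (cong (λ z → _ + evaluate c ρ * z) h)))

  -- The factors listed with the hypotheses are the cofactors of a certificate that the goal lies in
  -- the ideal generated by the hypotheses. Equality of normal forms checks the certificate; proofs
  -- of the hypotheses follow as further arguments.
  solve : ∀ {n} (ρ : Vec Carrier n) (f : N-ary n (Expr ℤ n) (Claim n)) →
          norm (Equation.lhs (moved (instantiate f))) ≡ norm (Equation.rhs (moved (instantiate f))) →
          Holds (instantiate f) ρ
  solve ρ f e = unmove (instantiate f) ρ (begin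
    evaluate (Equation.lhs eq) ρ         ≡⟨ norm-correct (Equation.lhs eq) ρ ⟨
    ⟦ norm (Equation.lhs eq) ⟧ₚ ρ ≡⟨ cong (λ p → ⟦ p ⟧ₚ ρ) e ⟩
    ⟦ norm (Equation.rhs eq) ⟧ₚ ρ ≡⟨ norm-correct (Equation.rhs eq) ρ ⟩
    evaluate (Equation.rhs eq) ρ         ∎)
    where eq = moved (instantiate f)

-- Counting in finite sets

module Finite where
  open Inverse using (to; from; strictlyInverseˡ; strictlyInverseʳ)

  to-injective : ∀ {A B : Set} (A↔B : A ↔ B) → Injective _≡_ _≡_ (to A↔B)
  to-injective A↔B {x} {y} e =
    trans (sym (strictlyInverseʳ A↔B x)) (trans (cong (from A↔B) e) (strictlyInverseʳ A↔B y))

  from-injective : ∀ {A B : Set} (A↔B : A ↔ B) → Injective _≡_ _≡_ (from A↔B)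
  from-injective A↔B = to-injective (↔.↔-sym A↔B)

  private
    -- Deleting the missed value by `punchOut` would leave an injection into a set with one element
    -- fewer.
    missed : ∀ {n} (f : Fin n → Fin n) → Injective _≡_ _≡_ f → ∀ y → ¬ (∀ x → f x ≢ y)
    missed {suc n} f inj y y∉f = Fin.<⇒notInjective {f = λ x → punchOut (y∉f x ∘ sym)} (ℕ.n<1+n n)
      (λ {x} {x′} e → inj (Fin.punchOut-injective (y∉f x ∘ sym) (y∉f x′ ∘ sym) e))

    Fin-injective⇒surjective : ∀ {n} (f : Fin n → Fin n) → Injective _≡_ _≡_ f → ∀ y → ∃ λ x → f x ≡ y
    Fin-injective⇒surjective f inj y with Fin.any? (λ x → f x Fin.≟ y)
    ... | yes hit = hit
    ... | no ¬hit = ⊥-elim (missed f inj y λ x e → ¬hit (x , e))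

    conjugate-injective : ∀ {m n} {A B : Set} (#A : Fin m ↔ A) (#B : Fin n ↔ B) (f : A → B) →
      Injective _≡_ _≡_ f → Injective _≡_ _≡_ (from #B ∘ f ∘ to #A)
    conjugate-injective #A #B f inj = to-injective #A ∘ inj ∘ from-injective #B

  -- Many existence statements rest on this: square roots in characteristic 2, cube roots in
  -- characteristic 3, the two square classes, and the decomposition K = F + Ft all come from an
  -- injection between sets of equal size.
  injective⇒surjective : ∀ {n} {A B : Set} → Fin n ↔ A → Fin n ↔ B → (f : A → B) →
    Injective _≡_ _≡_ f → ∀ b → ∃ λ a → f a ≡ b
  injective⇒surjective #A #B f inj b
    with Fin-injective⇒surjective _ (conjugate-injective #A #B f inj) (from #B b)
  ... | x , e = to #A x , from-injective #B e

  -- A section of a surjection is injective, hence onto by counting; so every element is a value of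
  -- the section, and on such values `f` is injective.
  surjective⇒injective : ∀ {n} {A B : Set} → Fin n ↔ A → Fin n ↔ B → (f : A → B) →
    (∀ b → ∃ λ a → f a ≡ b) → Injective _≡_ _≡_ f
  surjective⇒injective #A #B f surj {x} {y} e = trans (sym (proj₂ (hit x))) (trans (cong g fx≡fy) (proj₂ (hit y)))
    where
    g : _ → _
    g b = proj₁ (surj b)
    g-injective : Injective _≡_ _≡_ g
    g-injective {b} {b′} e = trans (sym (proj₂ (surj b))) (trans (cong f e) (proj₂ (surj b′)))
    hit : ∀ a → ∃ λ b → g b ≡ a
    hit = injective⇒surjective #B #A g g-injective
    fx≡fy : proj₁ (hit x) ≡ proj₁ (hit y)
    fx≡fy = trans (f∘hit x) (trans e (sym (f∘hit y)))
      where
      f∘hit : ∀ a → proj₁ (hit a) ≡ f a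
      f∘hit a = trans (sym (proj₂ (surj _))) (cong f (proj₂ (hit a)))

  hit? : ∀ {m n} {A B : Set} → Fin m ↔ A → Fin n ↔ B → (f : A → B) → Decidable (λ b → ∃ λ a → f a ≡ b)
  hit? #A #B f b = map′
    (λ (i , e) → to #A i , from-injective #B e)
    (λ (a , e) → from #A a , cong (from #B) (trans (cong f (strictlyInverseˡ #A a)) e))
    (Fin.any? (λ i → from #B (f (to #A i)) Fin.≟ from #B b))

  -- Failure of surjectivity is turned into an actual missed value by a finite search.
  missing : ∀ {m n} {A B : Set} → Fin m ↔ A → Fin n ↔ B → (f : A → B) →
    ¬ (∀ b → ∃ λ a → f a ≡ b) → ∃ λ b → ¬ (∃ λ a → f a ≡ b)
  missing #A #B f ¬surj
    with Fin.¬∀⟶∃¬ _ _ (λ j → hit? #A #B f (to #B j))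
           (λ surj → ¬surj λ b → subst (λ b → ∃ λ a → f a ≡ b) (strictlyInverseˡ #B b) (surj (from #B b)))
  ... | j , miss = to #B j , miss

  ¬surjective : ∀ {m n} {A B : Set} → Fin m ↔ A → Fin n ↔ B → m < n → (f : A → B) →
    ¬ (∀ b → ∃ λ a → f a ≡ b)
  ¬surjective #A #B m<n f surj = Fin.<⇒notInjective m<n
    (conjugate-injective #B #A (proj₁ ∘ surj) λ {b} {b′} e →
      trans (sym (proj₂ (surj b))) (trans (cong f e) (proj₂ (surj b′))))

  sizes-agree : ∀ {m n} {A B : Set} → Fin m ↔ A → Fin n ↔ B → (f : A → B) (g : B → A) →
    Injective _≡_ _≡_ f → Injective _≡_ _≡_ g → m ≡ n
  sizes-agree #A #B f g f-inj g-inj = Fin.cantor-schröder-bernstein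
    (conjugate-injective #A #B f f-inj) (conjugate-injective #B #A g g-inj)

  Maybe↔ : ∀ {n} {A : Set} → Fin n ↔ A → Fin (suc n) ↔ Maybe A
  Maybe↔ #A = mk↔ₛ′
    (λ { zero → nothing ; (suc i) → just (to #A i) })
    (λ { nothing → zero ; (just a) → suc (from #A a) })
    (λ { nothing → refl ; (just a) → cong just (strictlyInverseˡ #A a) })
    (λ { zero → refl ; (suc i) → cong suc (strictlyInverseʳ #A i) })

  ×↔ : ∀ {m n} {A B : Set} → Fin m ↔ A → Fin n ↔ B → Fin (m ℕ.* n) ↔ (A × B)
  ×↔ #A #B = ↔.↔-trans Fin.*↔× (#A Product.×-↔ #B)

  ⊎↔ : ∀ {m n} {A B : Set} → Fin m ↔ A → Fin n ↔ B → Fin (m ℕ.+ n) ↔ (A ⊎ B)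
  ⊎↔ #A #B = ↔.↔-trans Fin.+↔⊎ (#A Sum.⊎-↔ #B)

  -- The size of a decidable subset is whatever the search finds; it is related to q afterwards, by
  -- comparison with a disjoint union, as in `q≡1+nonzero` and `q≡1+2half`.
  record Enumeration {A : Set} (P : Pred A 0ℓ) : Set where
    field
      size       : ℕ
      element    : Fin size → A
      injective  : Injective _≡_ _≡_ element
      satisfies  : ∀ i → P (element i)
      surjective : ∀ {a} → P a → ∃ λ i → element i ≡ a

  private
    enumerateFin : ∀ n {P : Pred (Fin n) 0ℓ} → Decidable P → Enumeration P
    enumerateFin ℕ.zero P? = record
      { size = 0 ; element = λ () ; injective = λ {x} → ⊥-elim (Fin.¬Fin0 x)
      ; satisfies = λ () ; surjective = λ {a} → ⊥-elim (Fin.¬Fin0 a) }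
    enumerateFin (suc n) {P} P? with enumerateFin n (P? ∘ suc) | P? zero
    ... | E | yes p = record
      { size       = suc size
      ; element    = λ { zero → zero ; (suc i) → suc (element i) }
      ; injective  = λ { {zero} {zero} _ → refl ; {suc i} {suc j} e → cong suc (injective (Fin.suc-injective e)) }
      ; satisfies  = λ { zero → p ; (suc i) → satisfies i }
      ; surjective = λ { {zero} _ → zero , refl ; {suc a} pa → let (i , e) = surjective pa in suc i , cong suc e }
      }
      where open Enumeration E
    ... | E | no ¬p = record
      { size       = size
      ; element    = suc ∘ element
      ; injective  = injective ∘ Fin.suc-injective
      ; satisfies  = satisfies
      ; surjective = λ { {zero} pa → ⊥-elim (¬p pa) ; {suc a} pa → let (i , e) = surjective pa in i , cong suc e }
      }
      where open Enumeration E

  enumerate : ∀ {n} {A : Set} → Fin n ↔ A → {P : Pred A 0ℓ} → Decidable P → Enumeration P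
  enumerate #A {P} P? = record
    { size       = size
    ; element    = to #A ∘ element
    ; injective  = injective ∘ to-injective #A
    ; satisfies  = satisfies
    ; surjective = λ {a} pa →
        let (i , e) = surjective (subst P (sym (strictlyInverseˡ #A a)) pa)
        in i , trans (cong (to #A) e) (strictlyInverseˡ #A a)
    }
    where open Enumeration (enumerateFin _ (P? ∘ to #A))

open Finite

-- Arithmetic of finite fields

module Arithmetic {q} (F : FiniteField q) where
  open FiniteField F
  open CommutativeRing commutativeRing using (_-_; +-comm; +-identityˡ; *-commutativeMonoid; +-commutativeMonoid)
  open ≡-Reasoning

  zero-product : ∀ {x y} → x * y ≡ 0# → x ≢ 0# → y ≡ 0#
  zero-product {x} {y} xy≡0 x≢0 with inverse x x≢0
  ... | z , xz≡1 = solve F (x ∷ y ∷ z ∷ []) (λ x y z → y := :0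
    given z ∶ x :* y := :0 and :- y ∶ x :* z := :1 and []) refl xy≡0 xz≡1

  *-nonzero : ∀ {x y} → x ≢ 0# → y ≢ 0# → x * y ≢ 0#
  *-nonzero x≢0 y≢0 e = y≢0 (zero-product e x≢0)

  *-nonzeroˡ : ∀ {x y} → x * y ≢ 0# → x ≢ 0#
  *-nonzeroˡ {x} {y} xy≢0 x≡0 = xy≢0 (trans (cong (_* y) x≡0) (zeroˡ y))

  *-nonzeroʳ : ∀ {x y} → x * y ≢ 0# → y ≢ 0#
  *-nonzeroʳ {x} {y} xy≢0 y≡0 = xy≢0 (trans (cong (x *_) y≡0) (zeroʳ x))

  unit⇒nonzero : ∀ {x y} → x * y ≡ 1# → x ≢ 0#
  unit⇒nonzero xy≡1 = *-nonzeroˡ (λ e → 1≢0 (trans (sym xy≡1) e))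

  unit⇒nonzeroʳ : ∀ {x y} → x * y ≡ 1# → y ≢ 0#
  unit⇒nonzeroʳ xy≡1 = *-nonzeroʳ (λ e → 1≢0 (trans (sym xy≡1) e))

  *-cancelˡ : ∀ {x y z} → x ≢ 0# → x * y ≡ x * z → y ≡ z
  *-cancelˡ {x} {y} {z} x≢0 e = solve F (y ∷ z ∷ []) (λ y z → y := z
      given :1 ∶ y :- z := :0 and []) refl
    (zero-product (solve F (x ∷ y ∷ z ∷ []) (λ x y z → x :* (y :- z) := :0
      given :1 ∶ x :* y := x :* z and []) refl e) x≢0)

  difference≢0 : ∀ {x y} → x ≢ y → x + - y ≢ 0#
  difference≢0 {x} {y} x≢y e = x≢y (solve F (x ∷ y ∷ []) (λ x y → x := y given :1 ∶ x :- y := :0 and []) refl e)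

  neg-nonzero : ∀ {x} → x ≢ 0# → - x ≢ 0#
  neg-nonzero {x} x≢0 e = x≢0 (solve F (x ∷ []) (λ x → x := :0 given :- :1 ∶ :- x := :0 and []) refl e)

  square≡0 : ∀ {x} → x * x ≡ 0# → x ≡ 0#
  square≡0 {x} e with x ≟ 0#
  ... | yes x≡0 = x≡0
  ... | no  x≢0 = zero-product e x≢0

  square-roots : ∀ {x y} → x * x ≡ y * y → x ≢ y → x ≡ - y
  square-roots {x} {y} e x≢y = solve F (x ∷ y ∷ []) (λ x y → x := :- y given :1 ∶ x :+ y := :0 and []) refl
    (zero-product (solve F (x ∷ y ∷ []) (λ x y → (x :- y) :* (x :+ y) := :0
      given :1 ∶ x :* x := y :* y and []) refl e) (difference≢0 x≢y))

  private
    module ∑ = MonoidSum +-commutativeMonoid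
    module ∏ = MonoidSum *-commutativeMonoid
    open Inverse cardinality using (to; from; strictlyInverseˡ; strictlyInverseʳ)

  -- Translation by 1 permutes F, so ∑ x = ∑ (x + 1) = ∑ x + q.
  q·1≡0 : q · 1# ≡ 0#
  q·1≡0 = solve F (∑.sum to ∷ (q · 1#) ∷ []) (λ s k → k := :0 given :- :1 ∶ s := s :+ k and []) refl (begin
    ∑.sum to                                 ≡⟨ ∑.sum-permute to π ⟩
    ∑.sum (λ i → to (from (to i + 1#)))      ≡⟨ ∑.sum-cong-≗ (λ i → strictlyInverseˡ (to i + 1#)) ⟩
    ∑.sum (λ i → to i + 1#)                  ≡⟨ ∑.∑-distrib-+ to (λ _ → 1#) ⟩
    ∑.sum to + ∑.sum {q} (λ _ → 1#)          ≡⟨ cong (∑.sum to +_) (∑.sum-replicate q) ⟩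
    ∑.sum to + q · 1#                        ∎)
    where
    translation : Carrier ↔ Carrier
    translation = mk↔ₛ′ (_+ 1#) (_+ - 1#)
      (λ x → solve F (x ∷ []) (λ x → (x :- :1) :+ :1 := x given []) refl)
      (λ x → solve F (x ∷ []) (λ x → (x :+ :1) :- :1 := x given []) refl)
    π : Permutation.Permutation q q
    π = ↔.↔-trans cardinality (↔.↔-trans translation (↔.↔-sym cardinality))

  private
    ∏-nonzero : ∀ {n} (f : Fin n → Carrier) → (∀ i → f i ≢ 0#) → ∏.sum f ≢ 0#
    ∏-nonzero {zero}  f f≢0 = 1≢0
    ∏-nonzero {suc n} f f≢0 = *-nonzero (f≢0 zero) (∏-nonzero (f ∘ suc) (f≢0 ∘ suc))

    ∏-single : ∀ {n} (f : Fin n → Carrier) k → (∀ i → i ≢ k → f i ≡ 1#) → ∏.sum f ≡ f k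
    ∏-single {suc n} f k f≡1 = begin
      ∏.sum f                         ≡⟨ ∏.sum-remove f ⟩
      f k * ∏.sum (removeAt f k)      ≡⟨ cong (f k *_) (∏.sum-cong-≗ (λ i → f≡1 _ (Fin.punchInᵢ≢i k i))) ⟩
      f k * ∏.sum {n} (λ _ → 1#)      ≡⟨ cong (f k *_) (∏.sum-replicate-zero n) ⟩
      f k * 1#                        ≡⟨ *-identityʳ (f k) ⟩
      f k                             ∎

    ∏-const : ∀ n a → ∏.sum {n} (λ _ → a) ≡ a ^ n
    ∏-const zero a = refl
    ∏-const (suc n) a = cong (a *_) (∏-const n a)

    if≡0_then_else_ : Carrier → Carrier → Carrier → Carrier
    if≡0 x then y else z with x ≟ 0#
    ... | yes _ = y
    ... | no  _ = z

    if-yes : ∀ {x} y z → x ≡ 0# → if≡0 x then y else z ≡ y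
    if-yes {x} y z x≡0 with x ≟ 0#
    ... | yes _ = refl
    ... | no x≢0 = ⊥-elim (x≢0 x≡0)

    if-no : ∀ {x} y z → x ≢ 0# → if≡0 x then y else z ≡ z
    if-no {x} y z x≢0 with x ≟ 0#
    ... | yes x≡0 = ⊥-elim (x≢0 x≡0)
    ... | no _ = refl

  -- Multiplication by a permutes the nonzero elements; h equals a on them.
  fermat : ∀ a → a ^ q ≡ a
  fermat a with a ≟ 0#
  -- The index of `0#` shows that q is not 0; `0# ^ 0` would be `1#`.
  ... | yes refl = 0^ q (from 0#)
    where
    0^ : ∀ n → Fin n → 0# ^ n ≡ 0#
    0^ (suc n) _ = zeroˡ _
  ... | no a≢0 with inverse a a≢0
  ...   | b , ab≡1 = begin
      a ^ q                                        ≡⟨ ∏-const q a ⟨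
      ∏.sum {q} (λ _ → a)                          ≡⟨ ∏.sum-cong-≗ (λ i → split (to i)) ⟨
      ∏.sum (λ i → h (to i) * k (to i))            ≡⟨ ∏.∑-distrib-+ (h ∘ to) (k ∘ to) ⟩
      ∏.sum (h ∘ to) * ∏.sum (k ∘ to)              ≡⟨ cong₂ _*_ ∏h≡1 ∏k≡a ⟩
      1# * a                                       ≡⟨ *-identityˡ a ⟩
      a                                            ∎
    where
    g h k : Carrier → Carrier
    -- `g` replaces 0 by 1, so that its product over all of F is nonzero and can be cancelled. The
    -- constant a is split into `h`, trivial at 0, and `k`, trivial elsewhere.
    g x = if≡0 x then 1# else x
    h x = if≡0 x then 1# else a
    k x = if≡0 x then a else 1#
    split : ∀ x → h x * k x ≡ a
    split x with x ≟ 0#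
    ... | yes _ = *-identityˡ a
    ... | no  _ = *-identityʳ a
    g-nonzero : ∀ x → g x ≢ 0#
    g-nonzero x with x ≟ 0#
    ... | yes _  = 1≢0
    ... | no x≢0 = x≢0
    g-scale : ∀ x → g (a * x) ≡ h x * g x
    g-scale x with x ≟ 0#
    ... | yes x≡0 = trans (if-yes _ _ (trans (cong (a *_) x≡0) (zeroʳ a))) (sym (*-identityˡ 1#))
    ... | no  x≢0 = if-no _ _ (*-nonzero a≢0 x≢0)
    scaling : Carrier ↔ Carrier
    scaling = mk↔ₛ′ (a *_) (b *_)
      (λ x → solve F (a ∷ b ∷ x ∷ []) (λ a b x → a :* (b :* x) := x given x ∶ a :* b := :1 and []) refl ab≡1)
      (λ x → solve F (a ∷ b ∷ x ∷ []) (λ a b x → b :* (a :* x) := x given x ∶ a :* b := :1 and []) refl ab≡1)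
    π : Permutation.Permutation q q
    π = ↔.↔-trans cardinality (↔.↔-trans scaling (↔.↔-sym cardinality))
    ∏h≡1 : ∏.sum (h ∘ to) ≡ 1#
    ∏h≡1 = *-cancelˡ (∏-nonzero (g ∘ to) (g-nonzero ∘ to)) (begin
      ∏.sum (g ∘ to) * ∏.sum (h ∘ to)              ≡⟨ *-comm _ _ ⟩
      ∏.sum (h ∘ to) * ∏.sum (g ∘ to)              ≡⟨ ∏.∑-distrib-+ (h ∘ to) (g ∘ to) ⟨
      ∏.sum (λ i → h (to i) * g (to i))            ≡⟨ ∏.sum-cong-≗ (λ i → trans (cong g (strictlyInverseˡ (a * to i))) (g-scale (to i))) ⟨
      ∏.sum (λ i → g (to (from (a * to i))))       ≡⟨ ∏.sum-permute (g ∘ to) π ⟨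
      ∏.sum (g ∘ to)                               ≡⟨ *-identityʳ _ ⟨
      ∏.sum (g ∘ to) * 1#                          ∎)
    ∏k≡a : ∏.sum (k ∘ to) ≡ a
    ∏k≡a = begin
      ∏.sum (k ∘ to)    ≡⟨ ∏-single (k ∘ to) (from 0#) (λ i i≢ → if-no _ _ λ e → i≢ (trans (sym (strictlyInverseʳ i)) (cong from e))) ⟩
      k (to (from 0#))  ≡⟨ if-yes _ _ (strictlyInverseˡ 0#) ⟩
      a                 ∎

  -- Polynomials as coefficient vectors, constant term first.
  eval : ∀ {n} → Vec Carrier n → Carrier → Carrier
  eval []      x = 0#
  eval (c ∷ p) x = c + x * eval p x

  private
    -- Horner's division by X - a; the remainder is `eval p a`.
    quotient : ∀ {n} → Vec Carrier (suc n) → Carrier → Vec Carrier n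
    quotient (c ∷ [])     a = []
    quotient (c ∷ d ∷ p) a = eval (d ∷ p) a ∷ quotient (d ∷ p) a

    eval-quotient : ∀ {n} (p : Vec Carrier (suc n)) a x →
      eval p x ≡ eval p a + (x + - a) * eval (quotient p a) x
    eval-quotient (c ∷ [])    a x = solve F (c ∷ a ∷ x ∷ []) (λ c a x →
      c :+ x :* :0 := c :+ a :* :0 :+ (x :- a) :* :0 given []) refl
    eval-quotient (c ∷ d ∷ p) a x = solve F (c ∷ a ∷ x ∷ eval (d ∷ p) x ∷ eval (d ∷ p) a ∷ eval (quotient (d ∷ p) a) x ∷ [])
      (λ c a x u v w → c :+ x :* u := c :+ a :* v :+ (x :- a) :* (v :+ x :* w)
        given x ∶ u := v :+ (x :- a) :* w and []) refl (eval-quotient (d ∷ p) a x)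

    -- The first entry of the quotient is the value of the tail at `a`, so a zero quotient and a
    -- zero remainder force the coefficients to vanish one after another.
    quotient-zero : ∀ {n} (p : Vec Carrier (suc n)) a → eval p a ≡ 0# → All (_≡ 0#) (quotient p a) → All (_≡ 0#) p
    quotient-zero (c ∷ [])    a pa≡0 [] = solve F (c ∷ a ∷ []) (λ c a → c := :0 given :1 ∶ c :+ a :* :0 := :0 and []) refl pa≡0 ∷ []
    quotient-zero (c ∷ d ∷ p) a pa≡0 (v≡0 ∷ quotient≡0) =
      solve F (c ∷ a ∷ eval (d ∷ p) a ∷ []) (λ c a v → c := :0 given :1 ∶ c :+ a :* v := :0 and :- a ∶ v := :0 and []) refl pa≡0 v≡0
      ∷ quotient-zero (d ∷ p) a v≡0 quotient≡0

  -- Dividing off one root leaves the others to the quotient, because their differences from it are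
  -- nonzero; n roots thus exhaust n coefficients.
  roots⇒zero : ∀ {n} (p : Vec Carrier n) (root : Fin n → Carrier) → Injective _≡_ _≡_ root →
    (∀ i → eval p (root i) ≡ 0#) → All (_≡ 0#) p
  roots⇒zero {zero}  []  root inj p≡0 = []
  roots⇒zero {suc n} p root inj p≡0 = quotient-zero p a (p≡0 zero)
    (roots⇒zero (quotient p a) (root ∘ suc) (Fin.suc-injective ∘ inj) λ i → zero-product
      (solve F (eval p (root (suc i)) ∷ eval p a ∷ eval (quotient p a) (root (suc i)) ∷ (root (suc i) + - a) ∷ [])
        (λ u v w d → d :* w := :0 given :- :1 ∶ u := v :+ d :* w and :1 ∶ u := :0 and :- :1 ∶ v := :0 and []) refl
        (eval-quotient p a (root (suc i))) (p≡0 (suc i)) (p≡0 zero))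
      (difference≢0 (λ e → Fin.0≢1+n (inj (sym e)))))
    where a = root zero

  zero⇒eval≡0 : ∀ {n} {p : Vec Carrier n} → All (_≡ 0#) p → ∀ x → eval p x ≡ 0#
  zero⇒eval≡0 [] x = refl
  zero⇒eval≡0 (_∷_ {x = c} {xs = p} c≡0 p≡0) x = solve F (c ∷ x ∷ eval p x ∷ []) (λ c x u → c :+ x :* u := :0
    given :1 ∶ c := :0 and x ∶ u := :0 and []) refl c≡0 (zero⇒eval≡0 p≡0 x)

  -- Subtracting `c` from the constant term reduces this to `roots⇒zero`. The argument of type
  -- `Fin n` rules out the empty polynomial, which has no constant term.
  roots⇒constant : ∀ {n} (p : Vec Carrier n) c (root : Fin n → Carrier) → Fin n → Injective _≡_ _≡_ root →
    (∀ i → eval p (root i) ≡ c) → ∀ x → eval p x ≡ c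
  roots⇒constant (d ∷ p) c root _ inj p≡c x = solve F (c ∷ d ∷ x ∷ eval p x ∷ []) (λ c d x u → d :+ x :* u := c
    given :1 ∶ (d :- c) :+ x :* u := :0 and []) refl
    (zero⇒eval≡0 (roots⇒zero ((d + - c) ∷ p) root inj λ i →
      solve F (c ∷ d ∷ root i ∷ eval p (root i) ∷ []) (λ c d x u → (d :- c) :+ x :* u := :0
        given :1 ∶ d :+ x :* u := c and []) refl (p≡c i)) x)

  element : ∀ {n} → n ℕ.≤ q → Fin n → Carrier
  element n≤q i = to (Fin.inject≤ i n≤q)

  element-injective : ∀ {n} (n≤q : n ℕ.≤ q) → Injective _≡_ _≡_ (element n≤q)
  element-injective n≤q = Fin.inject≤-injective n≤q n≤q _ _ ∘ to-injective cardinality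

  X^ : ∀ n → Vec Carrier (suc n)
  X^ zero    = 1# ∷ []
  X^ (suc n) = 0# ∷ X^ n

  eval-X^ : ∀ n x → eval (X^ n) x ≡ x ^ n
  eval-X^ zero x = solve F (x ∷ []) (λ x → :1 :+ x :* :0 := :1 given []) refl
  eval-X^ (suc n) x = trans (CommutativeRing.+-identityˡ commutativeRing _) (cong (x *_) (eval-X^ n x))

  -- The polynomial X^(n+2) - X has n+3 coefficients, so n+3 roots would make its linear coefficient
  -- -1 vanish. The exponent is written as 2 + n to keep the linear term apart from the leading one.
  few-fixed-powers : ∀ n (root : Fin (3 ℕ.+ n) → Carrier) → Injective _≡_ _≡_ root → (∀ i → root i ^ (2 ℕ.+ n) ≡ root i) → Empty.⊥
  few-fixed-powers n root inj fixed = conclude (roots⇒zero (0# ∷ - 1# ∷ X^ n) root inj (λ i →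
    solve F (root i ∷ eval (X^ n) (root i) ∷ (root i ^ n) ∷ []) (λ x u m → :0 :+ x :* (:- :1 :+ x :* u) := :0
      given x :* x ∶ u := m and :1 ∶ x :* (x :* m) := x and []) refl (eval-X^ n (root i)) (fixed i)))
    where
    conclude : All (_≡ 0#) (0# ∷ - 1# ∷ X^ n) → Empty.⊥
    conclude (_ ∷ -1≡0 ∷ _) = neg-nonzero 1≢0 -1≡0

  private
    -- (X + a)(l + Xⁿ) + c without its leading term.
    timesX+ : ∀ {n} → Carrier → Carrier → Vec Carrier n → Vec Carrier (suc n)
    timesX+ a c []      = (c + a) ∷ []
    timesX+ a c (l ∷ p) = (c + a * l) ∷ timesX+ a l p

    eval-timesX+ : ∀ {n} a c (p : Vec Carrier n) x →
      eval (timesX+ a c p) x ≡ c + a * (eval p x + x ^ n) + x * eval p x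
    eval-timesX+ a c [] x = solve F (a ∷ c ∷ x ∷ []) (λ a c x →
      c :+ a :+ x :* :0 := c :+ a :* (:0 :+ :1) :+ x :* :0 given []) refl
    eval-timesX+ {suc n} a c (l ∷ p) x = solve F (a ∷ c ∷ l ∷ x ∷ eval p x ∷ (x ^ n) ∷ eval (timesX+ a l p) x ∷ [])
      (λ a c l x u m w → c :+ a :* l :+ x :* w := c :+ a :* (l :+ x :* u :+ x :* m) :+ x :* (l :+ x :* u)
        given x ∶ w := l :+ a :* (u :+ m) :+ x :* u and []) refl (eval-timesX+ a l p x)

  -- (X + a)ⁿ without its leading term.
  lower : ∀ n → Carrier → Vec Carrier n
  lower zero    a = []
  lower (suc n) a = timesX+ a 0# (lower n a)

  eval-lower : ∀ n a x → (x + a) ^ n ≡ eval (lower n a) x + x ^ n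
  eval-lower zero    a x = sym (+-identityˡ 1#)
  eval-lower (suc n) a x = solve F (x ∷ a ∷ ((x + a) ^ n) ∷ eval (lower n a) x ∷ (x ^ n) ∷ eval (lower (suc n) a) x ∷ [])
    (λ x a p u m w → (x :+ a) :* p := w :+ x :* m
      given (x :+ a) ∶ p := u :+ m and :- :1 ∶ w := :0 :+ a :* (u :+ m) :+ x :* u and []) refl
    (eval-lower n a x) (eval-timesX+ a 0# (lower n a) x)

  ·1-* : ∀ m n → (m ℕ.* n) · 1# ≡ m · 1# * n · 1#
  ·1-* = ×1-homo-*
    where open import Algebra.Properties.Semiring.Mult semiring

  ·1-+ : ∀ m n → (m ℕ.+ n) · 1# ≡ m · 1# + n · 1#
  ·1-+ = ×-homo-+ 1#
    where open import Algebra.Properties.Semiring.Mult semiring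

  ^·1≡0⇒·1≡0 : ∀ p k → (p ℕ.^ k) · 1# ≡ 0# → p · 1# ≡ 0#
  ^·1≡0⇒·1≡0 p zero e = ⊥-elim (1≢0 (trans (sym (+-identityʳ 1#)) e))
  ^·1≡0⇒·1≡0 p (suc k) e with (p · 1#) ≟ 0#
  ... | yes p≡0 = p≡0
  ... | no  p≢0 = ^·1≡0⇒·1≡0 p k (zero-product (trans (sym (·1-* p (p ℕ.^ k))) e) p≢0)

  -- The equation q · 1 = 0 is a product of copies of p · 1, and a field has no zero divisors, so p
  -- · 1 = 0; a prime divisor of a power of p is p itself.
  prime-divisor⇒·1≡0 : IsPrimePower q → ∀ {r} → Prime r → r ∣ q → r · 1# ≡ 0#
  prime-divisor⇒·1≡0 (p , k , p-prime , q≡) {r} r-prime r∣q =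
    subst (λ p → p · 1# ≡ 0#) (sym r≡p) (^·1≡0⇒·1≡0 p (suc k) (trans (cong (_· 1#) (sym q≡)) q·1≡0))
    where
    ∣^⇒∣ : ∀ n → r ∣ p ℕ.^ n → r ∣ p
    ∣^⇒∣ zero r∣1 = ⊥-elim (¬prime[1] (subst Prime (∣1⇒≡1 r∣1) r-prime))
    ∣^⇒∣ (suc n) r∣ with euclidsLemma p (p ℕ.^ n) r-prime r∣
    ... | inj₁ r∣p = r∣p
    ... | inj₂ r∣pⁿ = ∣^⇒∣ n r∣pⁿ
    r≡p : r ≡ p
    r≡p with prime⇒irreducible p-prime (∣^⇒∣ (suc k) (subst (r ∣_) q≡ r∣q))
    ... | inj₁ refl = ⊥-elim (¬prime[1] r-prime)
    ... | inj₂ e = e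

  private
    remainder : ∀ r .{{_ : ℕ.NonZero r}} → r · 1# ≡ 0# → (q % r) · 1# ≡ 0#
    remainder r r≡0 = begin
      (q % r) · 1#                           ≡⟨ solve F (((q % r) · 1#) ∷ ((q / r) · 1#) ∷ (r · 1#) ∷ []) (λ m k r → m := m :+ k :* r
                                                given :- k ∶ r := :0 and []) refl r≡0 ⟩
      (q % r) · 1# + (q / r) · 1# * r · 1#   ≡⟨ cong ((q % r) · 1# +_) (·1-* (q / r) r) ⟨
      (q % r) · 1# + ((q / r) ℕ.* r) · 1#    ≡⟨ ·1-+ (q % r) ((q / r) ℕ.* r) ⟨
      (q % r ℕ.+ (q / r) ℕ.* r) · 1#         ≡⟨ cong (_· 1#) (m≡m%n+[m/n]*n q r) ⟨
      q · 1#                                 ≡⟨ q·1≡0 ⟩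
      0#                                     ∎

  -- If 2 = 0 in the field, then q · 1 = 0 reduces to (q mod 2) · 1 = 0, and the remainder 1 is
  -- impossible.
  2∤q⇒2≢0 : 2 ∤ q → 2 · 1# ≢ 0#
  2∤q⇒2≢0 2∤q 2≡0 with q % 2 | remainder 2 2≡0 | m%n≡0⇒n∣m q 2 | m%n<n q 2
  ... | 0 | _   | 2∣q | _ = 2∤q (2∣q refl)
  ... | 1 | 1≡0 | _ | _ = 1≢0 (trans (sym (+-identityʳ 1#)) 1≡0)
  ... | suc (suc _) | _ | _ | ℕ.s≤s (ℕ.s≤s ())

  3∤q⇒3≢0 : 3 ∤ q → 3 · 1# ≢ 0#
  3∤q⇒3≢0 3∤q 3≡0 with q % 3 | remainder 3 3≡0 | m%n≡0⇒n∣m q 3 | m%n<n q 3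
  ... | 0 | _   | 3∣q | _ = 3∤q (3∣q refl)
  ... | 1 | 1≡0 | _ | _ = 1≢0 (trans (sym (+-identityʳ 1#)) 1≡0)
  ... | 2 | 2≡0 | _ | _ = 1≢0 (solve F [] (:1 := :0 given :1 ∶ 3 :· :1 := :0 and :- :1 ∶ 2 :· :1 := :0 and []) refl 3≡0 2≡0)
  ... | suc (suc (suc _)) | _ | _ | ℕ.s≤s (ℕ.s≤s (ℕ.s≤s ()))

  -- Modulo 2, (x - y)² = x² - y², so squaring is injective and, by counting, onto.
  char2⇒square : 2 · 1# ≡ 0# → ∀ x → ∃ λ y → y * y ≡ x
  char2⇒square 2≡0 = injective⇒surjective cardinality cardinality (λ y → y * y) λ {x} {y} e →
    solve F (x ∷ y ∷ []) (λ x y → x := y given :1 ∶ x :- y := :0 and []) refl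
      (square≡0 (solve F (x ∷ y ∷ []) (λ x y → (x :- y) :* (x :- y) := :0
        given (y :* y :- x :* y) ∶ 2 :· :1 := :0 and :1 ∶ x :* x := y :* y and []) refl 2≡0 e))

  -- The analogue for cubes: modulo 3 the mixed terms of (x - y)³ vanish.
  char3⇒cube : 3 · 1# ≡ 0# → ∀ x → ∃ λ y → y * y * y ≡ x
  char3⇒cube 3≡0 = injective⇒surjective cardinality cardinality (λ y → y * y * y) λ {x} {y} e →
    solve F (x ∷ y ∷ []) (λ x y → x := y given :1 ∶ x :- y := :0 and []) refl
      (cube≡0 (solve F (x ∷ y ∷ []) (λ x y → (x :- y) :* (x :- y) :* (x :- y) := :0
        given (x :* y :* y :- x :* x :* y) ∶ 3 :· :1 := :0 and :1 ∶ x :* x :* x := y :* y :* y and []) refl 3≡0 e))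
    where
    cube≡0 : ∀ {x} → x * x * x ≡ 0# → x ≡ 0#
    cube≡0 {x} e with x ≟ 0#
    ... | yes x≡0 = x≡0
    ... | no  x≢0 = ⊥-elim (*-nonzero (*-nonzero x≢0 x≢0) x≢0 e)

  nonzeroElements : Enumeration (_≢ 0#)
  nonzeroElements = enumerate cardinality (λ x → ¬? (x ≟ 0#))

  q≡1+nonzero : q ≡ suc (Enumeration.size nonzeroElements)
  q≡1+nonzero = sym (sizes-agree (Maybe↔ (↔.↔-refl)) cardinality f g f-injective g-injective)
    where
    open Enumeration nonzeroElements renaming (element to nz)
    f : Maybe (Fin size) → Carrier
    f nothing  = 0#
    f (just i) = nz i
    f-injective : Injective _≡_ _≡_ f
    f-injective {nothing} {nothing} _ = refl
    f-injective {nothing} {just j} e = ⊥-elim (satisfies j (sym e))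
    f-injective {just i} {nothing} e = ⊥-elim (satisfies i e)
    f-injective {just i} {just j} e = cong just (injective e)
    hit : ∀ x → ∃ λ m → f m ≡ x
    hit x with x ≟ 0#
    ... | yes x≡0 = nothing , sym x≡0
    ... | no  x≢0 = let (i , e) = surjective x≢0 in just i , e
    g : Carrier → Maybe (Fin size)
    g x = proj₁ (hit x)
    g-injective : Injective _≡_ _≡_ g
    g-injective {x} {y} e = trans (sym (proj₂ (hit x))) (trans (cong f e) (proj₂ (hit y)))

  module OddCharacteristic (2≢0 : 2 · 1# ≢ 0#) where

    private
      x≢-x : ∀ {x} → x ≢ 0# → x ≢ - x
      x≢-x {x} x≢0 e = *-nonzero 2≢0 x≢0
        (solve F (x ∷ []) (λ x → (2 :· :1) :* x := :0 given :1 ∶ x := :- x and []) refl e)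

    -- Not a field ordering: the enumeration of F is used only to choose one element from each pair
    -- x, -x.
    Positive : Carrier → Set
    Positive x = from x Fin.< from (- x)

    Positive⇒nonzero : ∀ {x} → Positive x → x ≢ 0#
    Positive⇒nonzero {x} x>0 x≡0 = Fin.<-irrefl
      (cong from (solve F (x ∷ []) (λ x → x := :- x given 2 :· :1 ∶ x := :0 and []) refl x≡0)) x>0

    private
      Positive-asym : ∀ {x} → Positive x → ¬ Positive (- x)
      Positive-asym {x} x>0 -x>0 = Fin.<-asym x>0
        (subst (λ y → from (- x) Fin.< from y) (solve F (x ∷ []) (λ x → :- :- x := x given []) refl) -x>0)

      sign : ∀ {x} → x ≢ 0# → Positive x ⊎ Positive (- x)
      sign {x} x≢0 with Fin.<-cmp (from x) (from (- x))
      ... | tri< x>0 _ _ = inj₁ x>0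
      ... | tri≈ _ e _ = ⊥-elim (x≢-x x≢0 (from-injective cardinality e))
      ... | tri> _ _ x<0 = inj₂ (subst (λ y → from (- x) Fin.< from y) (solve F (x ∷ []) (λ x → x := :- :- x given []) refl) x<0)

    positives : Enumeration Positive
    positives = enumerate cardinality (λ x → from x Fin.<? from (- x))

    open Enumeration positives public using () renaming (size to half; element to positive;
      injective to positive-injective; satisfies to positive-Positive; surjective to positive-surjective)

    positive-nonzero : ∀ i → positive i ≢ 0#
    positive-nonzero i = Positive⇒nonzero (positive-Positive i)

    -- With `positive-square-injective` this parametrises the nonzero squares without repetition,
    -- which is how lines depending on y only through y² are counted.
    positive-root : ∀ {y} → y ≢ 0# → ∃ λ i → positive i * positive i ≡ y * y
    positive-root {y} y≢0 with sign y≢0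
    ... | inj₁ y>0 = let (i , e) = positive-surjective y>0 in i , cong₂ _*_ e e
    ... | inj₂ y<0 = let (i , e) = positive-surjective y<0 in i , trans (cong₂ _*_ e e) (solve F (y ∷ []) (λ y → :- y :* :- y := y :* y given []) refl)

    positive-square-injective : ∀ {i j} → positive i * positive i ≡ positive j * positive j → i ≡ j
    positive-square-injective {i} {j} e with positive i ≟ positive j
    ... | yes e′ = positive-injective e′
    ... | no ≢ = ⊥-elim (Positive-asym (positive-Positive j) (subst Positive (square-roots e ≢) (positive-Positive i)))

    q≡1+2half : q ≡ suc (half ℕ.+ half)
    q≡1+2half = sym (sizes-agree (Maybe↔ (⊎↔ (↔.↔-refl {A = Fin half}) (↔.↔-refl {A = Fin half}))) cardinality f g f-injective g-injective)
      where
      f : Maybe (Fin half ⊎ Fin half) → Carrier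
      f nothing         = 0#
      f (just (inj₁ i)) = positive i
      f (just (inj₂ i)) = - positive i
      neg-injective : ∀ {x y} → - x ≡ - y → x ≡ y
      neg-injective {x} {y} e = solve F (x ∷ y ∷ []) (λ x y → x := y given :- :1 ∶ :- x := :- y and []) refl e
      opposite : ∀ i j → positive i ≢ - positive j
      opposite i j e = Positive-asym (positive-Positive j) (subst Positive e (positive-Positive i))
      f-injective : Injective _≡_ _≡_ f
      f-injective {nothing}       {nothing}       _ = refl
      f-injective {nothing}       {just (inj₁ j)} e = ⊥-elim (positive-nonzero j (sym e))
      f-injective {nothing}       {just (inj₂ j)} e = ⊥-elim (neg-nonzero (positive-nonzero j) (sym e))
      f-injective {just (inj₁ i)} {nothing}       e = ⊥-elim (positive-nonzero i e)
      f-injective {just (inj₂ i)} {nothing}       e = ⊥-elim (neg-nonzero (positive-nonzero i) e)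
      f-injective {just (inj₁ i)} {just (inj₁ j)} e = cong (just ∘ inj₁) (positive-injective e)
      f-injective {just (inj₁ i)} {just (inj₂ j)} e = ⊥-elim (opposite i j e)
      f-injective {just (inj₂ i)} {just (inj₁ j)} e = ⊥-elim (opposite j i (sym e))
      f-injective {just (inj₂ i)} {just (inj₂ j)} e = cong (just ∘ inj₂) (positive-injective (neg-injective e))
      hit : ∀ x → ∃ λ m → f m ≡ x
      hit x with x ≟ 0#
      ... | yes x≡0 = nothing , sym x≡0
      ... | no  x≢0 with sign x≢0
      ...   | inj₁ x>0 = let (i , e) = positive-surjective x>0 in just (inj₁ i) , e
      ...   | inj₂ x<0 = let (i , e) = positive-surjective x<0 in just (inj₂ i) , trans (cong -_ e) (solve F (x ∷ []) (λ x → :- :- x := x given []) refl)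
      g : Carrier → Maybe (Fin half ⊎ Fin half)
      g x = proj₁ (hit x)
      g-injective : Injective _≡_ _≡_ g
      g-injective {x} {y} e = trans (sym (proj₂ (hit x))) (trans (cong f e) (proj₂ (hit y)))

    -- The distinct elements 1 and -1 have the same square, so squaring is not injective and hence
    -- misses a value.
    nonSquare-exists : Satisfiable NonSquare
    nonSquare-exists = proj₁ nonroot , λ (y , e) → proj₂ nonroot (y , sym e)
      where
      square : Carrier → Carrier
      square y = y * y
      ¬injective : ¬ Injective _≡_ _≡_ square
      ¬injective inj = x≢-x 1≢0 (inj (solve F [] (:1 :* :1 := :- :1 :* :- :1 given []) refl))
      nonroot : ∃ λ ρ → ¬ (∃ λ y → square y ≡ ρ)
      nonroot = missing cardinality cardinality square
        (¬injective ∘ surjective⇒injective cardinality cardinality square)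

    -- The squares and the ρ-multiples of squares are disjoint, and there are
    -- (q - 1)/2 nonzero ones of each kind, so they exhaust F.
    square-classes : ∀ {ρ} → NonSquare ρ → ∀ {x} → x ≢ 0# →
      (∃ λ y → y ≢ 0# × 1# * (y * y) ≡ x) ⊎ (∃ λ y → y ≢ 0# × ρ * (y * y) ≡ x)
    square-classes {ρ} ρ-nonsquare {x} x≢0 = classify (hit x)
      where
      f : Maybe (Fin half ⊎ Fin half) → Carrier
      f nothing         = 0#
      f (just (inj₁ i)) = positive i * positive i
      f (just (inj₂ i)) = ρ * (positive i * positive i)
      ρ≢0 : ρ ≢ 0#
      ρ≢0 ρ≡0 = ρ-nonsquare (0# , trans ρ≡0 (sym (zeroˡ 0#)))
      square≢0 : ∀ i → positive i * positive i ≢ 0#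
      square≢0 i = *-nonzero (positive-nonzero i) (positive-nonzero i)
      mixed : ∀ i j → positive i * positive i ≢ ρ * (positive j * positive j)
      mixed i j e with inverse (positive j) (positive-nonzero j)
      ... | z , jz≡1 = ρ-nonsquare (positive i * z , solve F (positive i ∷ positive j ∷ z ∷ ρ ∷ []) (λ i j z ρ →
        ρ := i :* z :* (i :* z) given :- (z :* z) ∶ i :* i := ρ :* (j :* j) and :- (ρ :* (:1 :+ j :* z)) ∶ j :* z := :1 and []) refl e jz≡1)
      f-injective : Injective _≡_ _≡_ f
      f-injective {nothing}       {nothing}       _ = refl
      f-injective {nothing}       {just (inj₁ j)} e = ⊥-elim (square≢0 j (sym e))
      f-injective {nothing}       {just (inj₂ j)} e = ⊥-elim (*-nonzero ρ≢0 (square≢0 j) (sym e))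
      f-injective {just (inj₁ i)} {nothing}       e = ⊥-elim (square≢0 i e)
      f-injective {just (inj₂ i)} {nothing}       e = ⊥-elim (*-nonzero ρ≢0 (square≢0 i) e)
      f-injective {just (inj₁ i)} {just (inj₁ j)} e = cong (just ∘ inj₁) (positive-square-injective e)
      f-injective {just (inj₁ i)} {just (inj₂ j)} e = ⊥-elim (mixed i j e)
      f-injective {just (inj₂ i)} {just (inj₁ j)} e = ⊥-elim (mixed j i (sym e))
      f-injective {just (inj₂ i)} {just (inj₂ j)} e = cong (just ∘ inj₂) (positive-square-injective (*-cancelˡ ρ≢0 e))
      hit : ∀ x → ∃ λ m → f m ≡ x
      hit = injective⇒surjective
        (subst (λ n → Fin n ↔ Maybe (Fin half ⊎ Fin half)) (sym q≡1+2half) (Maybe↔ (⊎↔ ↔.↔-refl ↔.↔-refl)))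
        cardinality f f-injective
      classify : (∃ λ m → f m ≡ x) → (∃ λ y → y ≢ 0# × 1# * (y * y) ≡ x) ⊎ (∃ λ y → y ≢ 0# × ρ * (y * y) ≡ x)
      classify (nothing , e)       = ⊥-elim (x≢0 (sym e))
      classify (just (inj₁ i) , e) = inj₁ (positive i , positive-nonzero i , trans (*-identityˡ _) e)
      classify (just (inj₂ i) , e) = inj₂ (positive i , positive-nonzero i , e)

-- Lines and projectivities

module Linear {q} (F : FiniteField q) where
  open FiniteField F
  open Arithmetic F
  open ProjectiveSpace F
  open Projectivity
  open SemiringSum semiring
    using (sum; sum-syntax; *-distribˡ-sum; *-distribʳ-sum; sum-cong-≗; ∑-comm; ∑-distrib-+)
  open ≡-Reasoning

  infix 4 _∈ᵥ_ _⊑_ _≅_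

  Vector₄ : Set
  Vector₄ = Vector Carrier 4

  -- Membership for bare vectors, including zero, so that linear combinations can be formed without
  -- proofs that they do not vanish. As a record it lets `v` and `ℓ` be inferred.
  record _∈ᵥ_ (v : Vector₄) (ℓ : Line) : Set where
    constructor span
    field
      a b         : Carrier
      combination : ∀ i → v i ≡ a * coord (pt₁ ℓ) i + b * coord (pt₂ ℓ) i

  ∈ₗ⇒∈ᵥ : ∀ {v ℓ} → (∃₂ λ a b → ∀ i → v i ≡ a * coord (pt₁ ℓ) i + b * coord (pt₂ ℓ) i) → v ∈ᵥ ℓ
  ∈ₗ⇒∈ᵥ (a , b , h) = span a b h

  ∈ᵥ⇒∈ₗ : ∀ {v ℓ} → v ∈ᵥ ℓ → ∃₂ λ a b → ∀ i → v i ≡ a * coord (pt₁ ℓ) i + b * coord (pt₂ ℓ) i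
  ∈ᵥ⇒∈ₗ (span a b h) = a , b , h

  coordinatewise : {P : Fin 4 → Set} → P (# 0) → P (# 1) → P (# 2) → P (# 3) → ∀ i → P i
  coordinatewise p₀ p₁ p₂ p₃ zero = p₀
  coordinatewise p₀ p₁ p₂ p₃ (suc zero) = p₁
  coordinatewise p₀ p₁ p₂ p₃ (suc (suc zero)) = p₂
  coordinatewise p₀ p₁ p₂ p₃ (suc (suc (suc zero))) = p₃

  pt₁∈ : ∀ ℓ → coord (pt₁ ℓ) ∈ᵥ ℓ
  pt₁∈ ℓ = span 1# 0# λ i → solve F (coord (pt₁ ℓ) i ∷ coord (pt₂ ℓ) i ∷ []) (λ p q → p := :1 :* p :+ :0 :* q given []) refl

  pt₂∈ : ∀ ℓ → coord (pt₂ ℓ) ∈ᵥ ℓ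
  pt₂∈ ℓ = span 0# 1# λ i → solve F (coord (pt₁ ℓ) i ∷ coord (pt₂ ℓ) i ∷ []) (λ p q → q := :0 :* p :+ :1 :* q given []) refl

  combination∈ : ∀ {ℓ u v w} a b → v ∈ᵥ ℓ → w ∈ᵥ ℓ → (∀ i → u i ≡ a * v i + b * w i) → u ∈ᵥ ℓ
  combination∈ {ℓ} {u} {v} {w} a b (span c d hv) (span e f hw) hu = span (a * c + b * e) (a * d + b * f) λ i →
    solve F (coord (pt₁ ℓ) i ∷ coord (pt₂ ℓ) i ∷ a ∷ b ∷ c ∷ d ∷ e ∷ f ∷ u i ∷ v i ∷ w i ∷ [])
      (λ p q a b c d e f u v w → u := (a :* c :+ b :* e) :* p :+ (a :* d :+ b :* f) :* q
        given :1 ∶ u := a :* v :+ b :* w and a ∶ v := c :* p :+ d :* q and b ∶ w := e :* p :+ f :* q and [])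
      refl (hu i) (hv i) (hw i)

  multiple∈ : ∀ {ℓ u v} a → v ∈ᵥ ℓ → (∀ i → u i ≡ a * v i) → u ∈ᵥ ℓ
  multiple∈ {u = u} {v} a v∈ℓ hu = combination∈ a 0# v∈ℓ v∈ℓ λ i → solve F (a ∷ u i ∷ v i ∷ [])
    (λ a u v → u := a :* v :+ :0 :* v given :1 ∶ u := a :* v and []) refl (hu i)

  ≗∈ : ∀ {ℓ u v} → v ∈ᵥ ℓ → (∀ i → u i ≡ v i) → u ∈ᵥ ℓ
  ≗∈ v∈ℓ u≗v = multiple∈ 1# v∈ℓ (λ i → trans (u≗v i) (sym (*-identityˡ _)))

  _⊑_ : Line → Line → Set
  ℓ ⊑ m = ∀ {v} → v ∈ᵥ ℓ → v ∈ᵥ m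

  -- A wrapper from which both lines can be inferred, whereas `_≈ₗ_` unfolds to a statement about
  -- points.
  record _≅_ (ℓ m : Line) : Set where
    constructor equal
    field ≅⇒≈ : ℓ ≈ₗ m

  open _≅_ public

  ≅⇒⊑ : ∀ {ℓ m} → ℓ ≅ m → ℓ ⊑ m
  ≅⇒⊑ {ℓ} {m} (equal ℓ≈m) (span a b h) = combination∈ a b
    (∈ₗ⇒∈ᵥ (Equivalence.to (ℓ≈m (pt₁ ℓ)) (∈ᵥ⇒∈ₗ (pt₁∈ ℓ)))) (∈ₗ⇒∈ᵥ (Equivalence.to (ℓ≈m (pt₂ ℓ)) (∈ᵥ⇒∈ₗ (pt₂∈ ℓ)))) h

  ≅-sym : ∀ {ℓ m} → ℓ ≅ m → m ≅ ℓ
  ≅-sym (equal ℓ≈m) = equal λ X → mk⇔ (Equivalence.from (ℓ≈m X)) (Equivalence.to (ℓ≈m X))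

  ≅-trans : ∀ {ℓ m n} → ℓ ≅ m → m ≅ n → ℓ ≅ n
  ≅-trans (equal ℓ≈m) (equal m≈n) = equal λ X →
    mk⇔ (Equivalence.to (m≈n X) ∘ Equivalence.to (ℓ≈m X)) (Equivalence.from (ℓ≈m X) ∘ Equivalence.from (m≈n X))

  ≅-refl : ∀ {ℓ} → ℓ ≅ ℓ
  ≅-refl = equal λ X → mk⇔ (λ h → h) (λ h → h)

  -- Points p and q of m spanning a line span m: their coordinate determinant
  -- with respect to the given points of m is nonzero, or p ∼ q.
  points⇒≅ : ∀ {ℓ m} → coord (pt₁ ℓ) ∈ᵥ m → coord (pt₂ ℓ) ∈ᵥ m → ℓ ≅ m
  points⇒≅ {ℓ} {m} p∈m@(span a b hp) q∈m@(span c d hq) = equal λ X → mk⇔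
    (λ { (x , y , h) → ∈ᵥ⇒∈ₗ (combination∈ x y p∈m q∈m h) })
    (back X invertible)
    where
    p = coord (pt₁ ℓ)
    q′ = coord (pt₂ ℓ)
    p₁ = coord (pt₁ m)
    p₂ = coord (pt₂ m)
    Δ = a * d + - (b * c)
    -- With Δ = 0 the rows (a, b) and (c, d) are proportional, with ratio a/c or b/d; c = d = 0 is
    -- excluded because `pt₂ ℓ` is nonzero.
    proportional : Δ ≡ 0# → pt₁ ℓ ∼ pt₂ ℓ
    proportional Δ≡0 with c ≟ 0#
    ... | no c≢0 with inverse c c≢0
    ...   | z , cz≡1 = a * z , λ i → solve F (a ∷ b ∷ c ∷ d ∷ z ∷ p i ∷ q′ i ∷ p₁ i ∷ p₂ i ∷ [])
      (λ a b c d z p q p₁ p₂ → p := a :* z :* q given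
        :1 ∶ p := a :* p₁ :+ b :* p₂ and :- (a :* z) ∶ q := c :* p₁ :+ d :* p₂
        and :- (z :* p₂) ∶ a :* d :- b :* c := :0 and :- (a :* p₁ :+ b :* p₂) ∶ c :* z := :1 and [])
      refl (hp i) (hq i) Δ≡0 cz≡1
    proportional Δ≡0 | yes c≡0 with d ≟ 0#
    ... | yes d≡0 = ⊥-elim (nonzero (pt₂ ℓ) λ i → solve F (c ∷ d ∷ q′ i ∷ p₁ i ∷ p₂ i ∷ []) (λ c d q p₁ p₂ → q := :0
      given :1 ∶ q := c :* p₁ :+ d :* p₂ and p₁ ∶ c := :0 and p₂ ∶ d := :0 and []) refl (hq i) c≡0 d≡0)
    ... | no d≢0 with inverse d d≢0
    ...   | z , dz≡1 = b * z , λ i → solve F (a ∷ b ∷ c ∷ d ∷ z ∷ p i ∷ q′ i ∷ p₁ i ∷ p₂ i ∷ [])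
      (λ a b c d z p q p₁ p₂ → p := b :* z :* q given
        :1 ∶ p := a :* p₁ :+ b :* p₂ and :- (b :* z) ∶ q := c :* p₁ :+ d :* p₂
        and (z :* p₁) ∶ a :* d :- b :* c := :0 and :- (a :* p₁ :+ b :* p₂) ∶ d :* z := :1 and [])
      refl (hp i) (hq i) Δ≡0 dz≡1
    invertible : ∃ λ z → Δ * z ≡ 1#
    invertible = inverse Δ (distinct ℓ ∘ proportional)
    -- Cramer's rule, with z the inverse of the determinant.
    back : ∀ X → (∃ λ z → Δ * z ≡ 1#) → X ∈ₗ m → X ∈ₗ ℓ
    back X (z , Δz≡1) (x , y , h) = (x * d + - (y * c)) * z , (y * a + - (x * b)) * z , λ i →
      solve F (a ∷ b ∷ c ∷ d ∷ z ∷ p i ∷ q′ i ∷ p₁ i ∷ p₂ i ∷ coord X i ∷ x ∷ y ∷ [])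
        (λ a b c d z p q p₁ p₂ X x y → X := (x :* d :- y :* c) :* z :* p :+ (y :* a :- x :* b) :* z :* q given
          :1 ∶ X := x :* p₁ :+ y :* p₂ and :- ((x :* d :- y :* c) :* z) ∶ p := a :* p₁ :+ b :* p₂
          and :- ((y :* a :- x :* b) :* z) ∶ q := c :* p₁ :+ d :* p₂
          and :- (x :* p₁ :+ y :* p₂) ∶ (a :* d :- b :* c) :* z := :1 and [])
        refl (h i) (hp i) (hq i) Δz≡1

  ⊑⇒≅ : ∀ {ℓ m} → ℓ ⊑ m → ℓ ≅ m
  ⊑⇒≅ {ℓ} ℓ⊑m = points⇒≅ (ℓ⊑m (pt₁∈ ℓ)) (ℓ⊑m (pt₂∈ ℓ))

  -- A pair that is the identity matrix in the coordinates i and j. A line has at most one such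
  -- basis for given i and j, so these bases serve as normal forms.
  record Echelon (i j : Fin 4) (v w : Vector₄) : Set where
    constructor echelon
    field
      vᵢ≡1 : v i ≡ 1#
      vⱼ≡0 : v j ≡ 0#
      wᵢ≡0 : w i ≡ 0#
      wⱼ≡1 : w j ≡ 1#

  private
    -- A right inverse of a 2 × 2 matrix is a left inverse. With R = AB - I,
    -- BA - I = det B · adj(A) R A - (tr R + det R)(BA - I).
    leftInverse : ∀ a b c d x y z w →
      a * x + b * z ≡ 1# → a * y + b * w ≡ 0# → c * x + d * z ≡ 0# → c * y + d * w ≡ 1# →
      x * a + y * c ≡ 1# × x * b + y * d ≡ 0#
    leftInverse a b c d x y z w h₁ h₂ h₃ h₄ =
      solve F (a ∷ b ∷ c ∷ d ∷ x ∷ y ∷ z ∷ w ∷ []) (λ a b c d x y z w →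
        let m = x :* w :- y :* z ; e₃ = c :* x :+ d :* z ; e₄ = c :* y :+ d :* w :- :1 ; T = x :* a :+ y :* c :- :1 in
        x :* a :+ y :* c := :1 given
        m :* d :* a :- (:1 :+ e₄) :* T ∶ a :* x :+ b :* z := :1 and m :* d :* c :+ e₃ :* T ∶ a :* y :+ b :* w := :0 and
        :- (m :* b :* a) ∶ c :* x :+ d :* z := :0 and :- (m :* b :* c) :- T ∶ c :* y :+ d :* w := :1 and []) refl h₁ h₂ h₃ h₄ ,
      solve F (a ∷ b ∷ c ∷ d ∷ x ∷ y ∷ z ∷ w ∷ []) (λ a b c d x y z w →
        let m = x :* w :- y :* z ; e₃ = c :* x :+ d :* z ; e₄ = c :* y :+ d :* w :- :1 ; T = x :* b :+ y :* d in
        x :* b :+ y :* d := :0 given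
        m :* d :* b :- (:1 :+ e₄) :* T ∶ a :* x :+ b :* z := :1 and m :* d :* d :+ e₃ :* T ∶ a :* y :+ b :* w := :0 and
        :- (m :* b :* b) ∶ c :* x :+ d :* z := :0 and :- (m :* b :* d) :- T ∶ c :* y :+ d :* w := :1 and []) refl h₁ h₂ h₃ h₄

  -- The matrix expressing `v` and `w` through the given points of the line is inverse to the matrix
  -- of coordinates i and j of those points. The echelon conditions give the product in one order;
  -- the other order, from `leftInverse`, expresses the given points through `v` and `w`.
  echelon-coordinates : ∀ {i j v w ℓ} → Echelon i j v w → v ∈ᵥ ℓ → w ∈ᵥ ℓ →
    ∀ {u} → u ∈ᵥ ℓ → ∀ k → u k ≡ u i * v k + u j * w k
  echelon-coordinates {i} {j} {v} {w} {ℓ} (echelon vᵢ vⱼ wᵢ wⱼ) (span a b hv) (span c d hw) {u} (span x y hu) k =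
    trans (solve F (a ∷ b ∷ c ∷ d ∷ x ∷ y ∷ p i ∷ p j ∷ p k ∷ r i ∷ r j ∷ r k ∷ u k ∷ [])
      (λ a b c d x y pi pj pk ri rj rk uk →
        uk := (x :* pi :+ y :* ri) :* (a :* pk :+ b :* rk) :+ (x :* pj :+ y :* rj) :* (c :* pk :+ d :* rk)
        given :1 ∶ uk := x :* pk :+ y :* rk
        and :- (x :* pk) ∶ pi :* a :+ pj :* c := :1 and :- (x :* rk) ∶ pi :* b :+ pj :* d := :0
        and :- (y :* rk) ∶ rj :* d :+ ri :* b := :1 and :- (y :* pk) ∶ rj :* c :+ ri :* a := :0 and [])
      refl (hu k) (proj₁ P) (proj₂ P) (proj₁ R) (proj₂ R))
    (sym (cong₂ _+_ (cong₂ _*_ (hu i) (hv k)) (cong₂ _*_ (hu j) (hw k))))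
    where
    p = coord (pt₁ ℓ)
    r = coord (pt₂ ℓ)
    P = leftInverse a b c d (p i) (p j) (r i) (r j)
      (trans (sym (hv i)) vᵢ) (trans (sym (hv j)) vⱼ) (trans (sym (hw i)) wᵢ) (trans (sym (hw j)) wⱼ)
    R = leftInverse d c b a (r j) (r i) (p j) (p i)
      (trans (CommutativeRing.+-comm commutativeRing _ _) (trans (sym (hw j)) wⱼ))
      (trans (CommutativeRing.+-comm commutativeRing _ _) (trans (sym (hw i)) wᵢ))
      (trans (CommutativeRing.+-comm commutativeRing _ _) (trans (sym (hv j)) vⱼ))
      (trans (CommutativeRing.+-comm commutativeRing _ _) (trans (sym (hv i)) vᵢ))

  echelon-≅ : ∀ {i j v w ℓ m} → Echelon i j v w → v ∈ᵥ ℓ → w ∈ᵥ ℓ → v ∈ᵥ m → w ∈ᵥ m → ℓ ≅ m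
  echelon-≅ E v∈ℓ w∈ℓ v∈m w∈m = ⊑⇒≅ λ {u} u∈ℓ → combination∈ _ _ v∈m w∈m (echelon-coordinates E v∈ℓ w∈ℓ u∈ℓ)

  echelonLine : ∀ i j {v w} → Echelon i j v w → Line
  echelonLine i j {v} {w} (echelon vᵢ vⱼ wᵢ wⱼ) = joinAt i
    ⟨ v , (λ h → 1≢0 (trans (sym vᵢ) (h i))) ⟩ ⟨ w , (λ h → 1≢0 (trans (sym wⱼ) (h j))) ⟩ vᵢ wᵢ

  -- A line meets every coordinate plane. This supplies the second point from which normal forms of
  -- lines through a known point are read off.
  coordinateSection : ∀ ℓ i → ∃ λ X → X ∈ₗ ℓ × coord X i ≡ 0#
  coordinateSection ℓ i with coord (pt₁ ℓ) i ≟ 0#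
  ... | yes p≡0 = pt₁ ℓ , ∈ᵥ⇒∈ₗ (pt₁∈ ℓ) , p≡0
  ... | no  p≢0 = ⟨ x , x≢0 ⟩ , ∈ᵥ⇒∈ₗ (combination∈ _ _ (pt₁∈ ℓ) (pt₂∈ ℓ) (λ _ → refl)) ,
      solve F (p i ∷ r i ∷ []) (λ p r → :- r :* p :+ p :* r := :0 given []) refl
    where
    p = coord (pt₁ ℓ)
    r = coord (pt₂ ℓ)
    x : Vector₄
    x k = - r i * p k + p i * r k
    x≢0 : ¬ (∀ k → x k ≡ 0#)
    x≢0 h with inverse (p i) p≢0
    ... | z , pz≡1 with r i ≟ 0#
    ...   | yes r≡0 = nonzero (pt₂ ℓ) λ k → zero-product
            (solve F (r i ∷ p i ∷ p k ∷ r k ∷ []) (λ ri pi pk rk → pi :* rk := :0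
              given :1 ∶ :- ri :* pk :+ pi :* rk := :0 and pk ∶ ri := :0 and []) refl (h k) r≡0) p≢0
    ...   | no  r≢0 with inverse (r i) r≢0
    ...     | w , rw≡1 = distinct ℓ (p i * w , λ k → solve F (r i ∷ p i ∷ p k ∷ r k ∷ w ∷ []) (λ ri pi pk rk w →
              pk := pi :* w :* rk given :- w ∶ :- ri :* pk :+ pi :* rk := :0 and :- pk ∶ ri :* w := :1 and []) refl (h k) rw≡1)

  ⊙-cong : ∀ {x y : Vector₄} A B → (∀ i → x i ≡ y i) → (∀ i j → A i j ≡ B i j) → ∀ j → (x ⊙ A) j ≡ (y ⊙ B) j
  ⊙-cong A B x≗y A≗B j = sum-cong-≗ (λ i → cong₂ _*_ (x≗y i) (A≗B i j))

  ⊙-⊡ : ∀ x A B k → ((x ⊙ A) ⊙ B) k ≡ (x ⊙ (A ⊡ B)) k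
  ⊙-⊡ x A B k = begin
    ∑[ j < 4 ] (∑[ i < 4 ] (x i * A i j) * B j k)    ≡⟨ sum-cong-≗ (λ j → *-distribʳ-sum (B j k) (λ i → x i * A i j)) ⟩
    ∑[ j < 4 ] ∑[ i < 4 ] (x i * A i j * B j k)      ≡⟨ ∑-comm (λ j i → x i * A i j * B j k) ⟩
    ∑[ i < 4 ] ∑[ j < 4 ] (x i * A i j * B j k)      ≡⟨ sum-cong-≗ (λ i → sum-cong-≗ (λ j → *-assoc (x i) (A i j) (B j k))) ⟩
    ∑[ i < 4 ] ∑[ j < 4 ] (x i * (A i j * B j k))    ≡⟨ sum-cong-≗ (λ i → *-distribˡ-sum (x i) (λ j → A i j * B j k)) ⟨
    ∑[ i < 4 ] (x i * ∑[ j < 4 ] (A i j * B j k))    ∎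

  ⊙-I : ∀ x k → (x ⊙ I) k ≡ x k
  ⊙-I x = coordinatewise
    (solve F ρ (λ a b c d → a :* :1 :+ (b :* :0 :+ (c :* :0 :+ (d :* :0 :+ :0))) := a given []) refl)
    (solve F ρ (λ a b c d → a :* :0 :+ (b :* :1 :+ (c :* :0 :+ (d :* :0 :+ :0))) := b given []) refl)
    (solve F ρ (λ a b c d → a :* :0 :+ (b :* :0 :+ (c :* :1 :+ (d :* :0 :+ :0))) := c given []) refl)
    (solve F ρ (λ a b c d → a :* :0 :+ (b :* :0 :+ (c :* :0 :+ (d :* :1 :+ :0))) := d given []) refl)
    where ρ = x (# 0) ∷ x (# 1) ∷ x (# 2) ∷ x (# 3) ∷ []

  ⊙-combination : ∀ {u v w : Vector₄} {a b} A → (∀ i → u i ≡ a * v i + b * w i) →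
    ∀ j → (u ⊙ A) j ≡ a * (v ⊙ A) j + b * (w ⊙ A) j
  ⊙-combination {u} {v} {w} {a} {b} A h j = begin
    ∑[ i < 4 ] (u i * A i j)   ≡⟨ sum-cong-≗ (λ i → trans (cong (_* A i j) (h i))
                                    (solve F (a ∷ b ∷ v i ∷ w i ∷ A i j ∷ []) (λ a b v w m →
                                      (a :* v :+ b :* w) :* m := a :* (v :* m) :+ b :* (w :* m) given []) refl)) ⟩
    ∑[ i < 4 ] (a * (v i * A i j) + b * (w i * A i j))
                               ≡⟨ ∑-distrib-+ (λ i → a * (v i * A i j)) (λ i → b * (w i * A i j)) ⟩
    ∑[ i < 4 ] (a * (v i * A i j)) + ∑[ i < 4 ] (b * (w i * A i j))
                               ≡⟨ cong₂ _+_ (*-distribˡ-sum a (λ i → v i * A i j)) (*-distribˡ-sum b (λ i → w i * A i j)) ⟨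
    a * (v ⊙ A) j + b * (w ⊙ A) j ∎

  ⊙-multiple : ∀ {u v : Vector₄} {a} A → (∀ i → u i ≡ a * v i) → ∀ j → (u ⊙ A) j ≡ a * (v ⊙ A) j
  ⊙-multiple {u} {v} {a} A h j = begin
    ∑[ i < 4 ] (u i * A i j)         ≡⟨ sum-cong-≗ (λ i → trans (cong (_* A i j) (h i)) (*-assoc a (v i) (A i j))) ⟩
    ∑[ i < 4 ] (a * (v i * A i j))   ≡⟨ *-distribˡ-sum a (λ i → v i * A i j) ⟨
    a * (v ⊙ A) j                    ∎

  ⊙-inverse : ∀ x A B → (∀ i j → (A ⊡ B) i j ≡ I i j) → ∀ k → ((x ⊙ A) ⊙ B) k ≡ x k
  ⊙-inverse x A B AB≡I k = trans (⊙-⊡ x A B k) (trans (⊙-cong {x} {x} (A ⊡ B) I (λ _ → refl) AB≡I k) (⊙-I x k))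

  -- Composition, inverses and the action on lines are opaque: comparing images
  -- of lines would otherwise unfold all matrix products.
  opaque
    infixl 10 _⊚_
    infix 11 _⁻¹

    _⊚_ : Projectivity → Projectivity → Projectivity
    φ ⊚ ψ = record
      { matrix   = matrix φ ⊡ matrix ψ
      ; matrix⁻¹ = matrix⁻¹ ψ ⊡ matrix⁻¹ φ
      ; inverseʳ = product (matrix φ) (matrix⁻¹ φ) (matrix ψ) (matrix⁻¹ ψ) (inverseʳ φ) (inverseʳ ψ)
      ; inverseˡ = product (matrix⁻¹ ψ) (matrix ψ) (matrix⁻¹ φ) (matrix φ) (inverseˡ ψ) (inverseˡ φ)
      }
      where
      product : ∀ A A′ B B′ → (∀ i j → (A ⊡ A′) i j ≡ I i j) → (∀ i j → (B ⊡ B′) i j ≡ I i j) →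
        ∀ i j → ((A ⊡ B) ⊡ (B′ ⊡ A′)) i j ≡ I i j
      product A A′ B B′ AA′≡I BB′≡I i j = begin
        ((A i ⊙ B) ⊙ (B′ ⊡ A′)) j      ≡⟨ ⊙-⊡ (A i ⊙ B) B′ A′ j ⟨
        (((A i ⊙ B) ⊙ B′) ⊙ A′) j      ≡⟨ ⊙-cong A′ A′ (⊙-inverse (A i) B B′ BB′≡I) (λ _ _ → refl) j ⟩
        (A i ⊙ A′) j                   ≡⟨ AA′≡I i j ⟩
        I i j                          ∎

    _⁻¹ : Projectivity → Projectivity
    φ ⁻¹ = record { matrix = matrix⁻¹ φ ; matrix⁻¹ = matrix φ ; inverseʳ = inverseˡ φ ; inverseˡ = inverseʳ φ }

    matrix-⁻¹ : ∀ φ i j → matrix (φ ⁻¹) i j ≡ matrix⁻¹ φ i j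
    matrix-⁻¹ φ i j = refl

  opaque
    unfolding _⊚_ _⁻¹

    infixl 9 _▶_
    _▶_ : Line → Projectivity → Line
    ℓ ▶ φ = ℓ ▸ φ

    ▶≅▸ : ∀ ℓ φ → ℓ ▶ φ ≅ ℓ ▸ φ
    ▶≅▸ ℓ φ = ≅-refl

    image∈ : ∀ {ℓ v} φ → v ∈ᵥ ℓ → (v ⊙ matrix φ) ∈ᵥ ℓ ▶ φ
    image∈ φ (span a b h) = span a b (⊙-combination (matrix φ) h)

    preimage∈ : ∀ {ℓ v} φ → v ∈ᵥ ℓ ▶ φ → (v ⊙ matrix⁻¹ φ) ∈ᵥ ℓ
    preimage∈ {ℓ} φ (span a b h) = span a b λ j → trans (⊙-combination (matrix⁻¹ φ) h j)
      (cong₂ _+_ (cong (a *_) (⊙-inverse (coord (pt₁ ℓ)) (matrix φ) (matrix⁻¹ φ) (inverseʳ φ) j)) (cong (b *_) (⊙-inverse (coord (pt₂ ℓ)) (matrix φ) (matrix⁻¹ φ) (inverseʳ φ) j)))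

    ▶-cong : ∀ {ℓ m} φ → ℓ ≅ m → ℓ ▶ φ ≅ m ▶ φ
    ▶-cong {ℓ} φ ℓ≅m = points⇒≅ (image∈ φ (≅⇒⊑ ℓ≅m (pt₁∈ ℓ))) (image∈ φ (≅⇒⊑ ℓ≅m (pt₂∈ ℓ)))

    ▶-⊚ : ∀ ℓ φ ψ → ℓ ▶ (φ ⊚ ψ) ≅ ℓ ▶ φ ▶ ψ
    ▶-⊚ ℓ φ ψ = points⇒≅
      (≗∈ (image∈ ψ (image∈ φ (pt₁∈ ℓ))) (λ j → sym (⊙-⊡ (coord (pt₁ ℓ)) (matrix φ) (matrix ψ) j)))
      (≗∈ (image∈ ψ (image∈ φ (pt₂∈ ℓ))) (λ j → sym (⊙-⊡ (coord (pt₂ ℓ)) (matrix φ) (matrix ψ) j)))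

    ▶-⁻¹ : ∀ ℓ φ → ℓ ▶ φ ▶ φ ⁻¹ ≅ ℓ
    ▶-⁻¹ ℓ φ = points⇒≅ (preimage∈ φ (pt₁∈ (ℓ ▶ φ))) (preimage∈ φ (pt₂∈ (ℓ ▶ φ)))

    ⁻¹-▶ : ∀ ℓ φ → ℓ ▶ φ ⁻¹ ▶ φ ≅ ℓ
    ⁻¹-▶ ℓ φ = ▶-⁻¹ ℓ (φ ⁻¹)

    scalar⇒▶≅ : ∀ ℓ φ ψ c → (∀ i j → matrix φ i j ≡ c * matrix ψ i j) → ℓ ▶ φ ≅ ℓ ▶ ψ
    scalar⇒▶≅ ℓ φ ψ c h = points⇒≅ (multiple∈ c (image∈ ψ (pt₁∈ ℓ)) (scaled (coord (pt₁ ℓ))))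
                                   (multiple∈ c (image∈ ψ (pt₂∈ ℓ)) (scaled (coord (pt₂ ℓ))))
      where
      scaled : ∀ x j → (x ⊙ matrix φ) j ≡ c * (x ⊙ matrix ψ) j
      scaled x j = begin
        ∑[ i < 4 ] (x i * matrix φ i j)        ≡⟨ sum-cong-≗ (λ i → trans (cong (x i *_) (h i j))
                                                    (solve F (x i ∷ c ∷ matrix ψ i j ∷ []) (λ x c m → x :* (c :* m) := c :* (x :* m) given []) refl)) ⟩
        ∑[ i < 4 ] (c * (x i * matrix ψ i j))  ≡⟨ *-distribˡ-sum c (λ i → x i * matrix ψ i j) ⟨
        c * (x ⊙ matrix ψ) j                   ∎

  ∼-refl : ∀ X → X ∼ X
  ∼-refl X = 1# , λ i → sym (*-identityˡ _)

  ∼-factor≢0 : ∀ X Y (X∼Y : X ∼ Y) → proj₁ X∼Y ≢ 0#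
  ∼-factor≢0 X Y (c , h) c≡0 = nonzero X λ i → trans (h i) (trans (cong (_* coord Y i) c≡0) (zeroˡ _))

  ∼-sym : ∀ X Y → X ∼ Y → Y ∼ X
  ∼-sym X Y X∼Y@(c , h) with inverse c (∼-factor≢0 X Y X∼Y)
  ... | z , cz≡1 = z , λ i → solve F (coord X i ∷ coord Y i ∷ c ∷ z ∷ []) (λ x y c z → y := z :* x
        given :- z ∶ x := c :* y and :- y ∶ c :* z := :1 and []) refl (h i) cz≡1

  ∼-trans : ∀ X Y Z → X ∼ Y → Y ∼ Z → X ∼ Z
  ∼-trans X Y Z (c , h) (d , k) = c * d , λ i → solve F (coord X i ∷ coord Y i ∷ coord Z i ∷ c ∷ d ∷ [])
    (λ x y z c d → x := c :* d :* z given :1 ∶ x := c :* y and c ∶ y := d :* z and []) refl (h i) (k i)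

  ▹-cong : ∀ X Y φ → X ∼ Y → X ▹ φ ∼ Y ▹ φ
  ▹-cong X Y φ (c , h) = c , ⊙-multiple (matrix φ) h

  opaque
    unfolding _⊚_ _⁻¹

    ▹-⁻¹ : ∀ X φ → X ▹ φ ▹ φ ⁻¹ ∼ X
    ▹-⁻¹ X φ = 1# , λ i → trans (⊙-inverse (coord X) (matrix φ) (matrix⁻¹ φ) (inverseʳ φ) i) (sym (*-identityˡ _))

    ⁻¹-▹ : ∀ X φ → X ▹ φ ⁻¹ ▹ φ ∼ X
    ⁻¹-▹ X φ = ▹-⁻¹ X (φ ⁻¹)

    ▹-⊚ : ∀ X φ ψ → X ▹ (φ ⊚ ψ) ∼ X ▹ φ ▹ ψ
    ▹-⊚ X φ ψ = 1# , λ i → trans (sym (⊙-⊡ (coord X) (matrix φ) (matrix ψ) i)) (sym (*-identityˡ _))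

  ∼∈ : ∀ X Y {ℓ} → X ∼ Y → coord Y ∈ᵥ ℓ → coord X ∈ᵥ ℓ
  ∼∈ X Y (c , h) Y∈ℓ = multiple∈ c Y∈ℓ h

-- The stabilizer of the twisted cubic

-- Associated to the right with a final 0, exactly as a sum over `Fin 4` unfolds, so that matrix
-- products evaluate to it by computation.
:∑ : ∀ {n} → (Fin 4 → Expr ℤ n) → Expr ℤ n
:∑ f = f (# 0) :+ (f (# 1) :+ (f (# 2) :+ (f (# 3) :+ :0)))

:vector : ∀ {n} → (x₀ x₁ x₂ x₃ : Expr ℤ n) → Fin 4 → Expr ℤ n
:vector x₀ x₁ x₂ x₃ zero                   = x₀
:vector x₀ x₁ x₂ x₃ (suc zero)             = x₁
:vector x₀ x₁ x₂ x₃ (suc (suc zero))       = x₂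
:vector x₀ x₁ x₂ x₃ (suc (suc (suc zero))) = x₃

-- The third symmetric power of the matrix (a b ; c d), which acts on the
-- parameter of the twisted cubic as t ↦ (at + b)/(ct + d).
:sym³ : ∀ {n} → (a b c d : Expr ℤ n) → Fin 4 → Fin 4 → Expr ℤ n
:sym³ a b c d zero                   = :vector (a :* a :* a) (a :* a :* c) (a :* c :* c) (c :* c :* c)
:sym³ a b c d (suc zero)             = :vector (3 :· (a :* a :* b)) (a :* a :* d :+ 2 :· (a :* b :* c))
                                               (2 :· (a :* c :* d) :+ b :* c :* c) (3 :· (c :* c :* d))
:sym³ a b c d (suc (suc zero))       = :vector (3 :· (a :* b :* b)) (b :* b :* c :+ 2 :· (a :* b :* d))
                                               (2 :· (b :* c :* d) :+ a :* d :* d) (3 :· (c :* d :* d))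
:sym³ a b c d (suc (suc (suc zero))) = :vector (b :* b :* b) (b :* b :* d) (b :* d :* d) (d :* d :* d)

-- The homogeneous parametrisation of the twisted cubic, which treats the parameter ∞ = (1 : 0) like
-- the others.
:ν : ∀ {n} → (s t : Expr ℤ n) → Fin 4 → Expr ℤ n
:ν s t = :vector (s :^ 3) (s :^ 2 :* t) (s :* t :^ 2) (t :^ 3)

-- The plane π(t³, -3st², 3s²t, -s³), that is, the osculating plane at s/t cleared of denominators.
:osc : ∀ {n} → (s t : Expr ℤ n) (x : Fin 4 → Expr ℤ n) → Expr ℤ n
:osc s t x = t :^ 3 :* x (# 0) :- 3 :· (s :* t :^ 2) :* x (# 1) :+ 3 :· (s :^ 2 :* t) :* x (# 2) :- s :^ 3 :* x (# 3)

module Projective {q} (F : FiniteField q) where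
  open FiniteField F
  open Arithmetic F
  open ProjectiveSpace F
  open TwistedCubic F
  open Linear F
  open Projectivity
  open ≡-Reasoning

  -- Obtained by evaluating the symbolic matrix, so that identities between its entries and products
  -- can be handed to `solve` as they stand.
  sym³ : (a b c d : Carrier) → Matrix
  sym³ a b c d i j = evaluate F (:sym³ (Ι (# 0)) (Ι (# 1)) (Ι (# 2)) (Ι (# 3)) i j) (a ∷ b ∷ c ∷ d ∷ [])

  private
    :I : ∀ {n} → Fin 4 → Fin 4 → Expr ℤ n
    :I i j with i Fin.≟ j
    ... | yes _ = :1
    ... | no  _ = :0

    :inverse : Fin 4 → Fin 4 → Expr ℤ 5 → Expr ℤ 5 → Expr ℤ 5 → Expr ℤ 5 → Expr ℤ 5 → Claim 5
    :inverse i j a b c d e = :∑ (λ k → :sym³ a b c d i k :* :sym³ (e :* d) (:- (e :* b)) (:- (e :* c)) (e :* a) k j) := :I i j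
      -- The product of the two symmetric cubes is δ³ times the identity, and δ³ - 1 = (δ² + δ +
      -- 1)(δ - 1).
      given :I i j :* (δ :* δ :+ δ :+ :1) ∶ δ := :1 and []
      where δ = e :* (a :* d :- b :* c)

  sym³-inverse : ∀ {a b c d e} → e * (a * d + - (b * c)) ≡ 1# →
    ∀ i j → (sym³ a b c d ⊡ sym³ (e * d) (- (e * b)) (- (e * c)) (e * a)) i j ≡ I i j
  sym³-inverse {a} {b} {c} {d} {e} h = coordinatewise
    (coordinatewise (solve F ρ (:inverse (# 0) (# 0)) refl h) (solve F ρ (:inverse (# 0) (# 1)) refl h)
                    (solve F ρ (:inverse (# 0) (# 2)) refl h) (solve F ρ (:inverse (# 0) (# 3)) refl h))
    (coordinatewise (solve F ρ (:inverse (# 1) (# 0)) refl h) (solve F ρ (:inverse (# 1) (# 1)) refl h)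
                    (solve F ρ (:inverse (# 1) (# 2)) refl h) (solve F ρ (:inverse (# 1) (# 3)) refl h))
    (coordinatewise (solve F ρ (:inverse (# 2) (# 0)) refl h) (solve F ρ (:inverse (# 2) (# 1)) refl h)
                    (solve F ρ (:inverse (# 2) (# 2)) refl h) (solve F ρ (:inverse (# 2) (# 3)) refl h))
    (coordinatewise (solve F ρ (:inverse (# 3) (# 0)) refl h) (solve F ρ (:inverse (# 3) (# 1)) refl h)
                    (solve F ρ (:inverse (# 3) (# 2)) refl h) (solve F ρ (:inverse (# 3) (# 3)) refl h))
    where ρ = a ∷ b ∷ c ∷ d ∷ e ∷ []

  inverse-det : ∀ {a b c d e} → e * (a * d + - (b * c)) ≡ 1# →
    (a * d + - (b * c)) * (e * d * (e * a) + - (- (e * b) * - (e * c))) ≡ 1#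
  inverse-det {a} {b} {c} {d} {e} h = solve F (a ∷ b ∷ c ∷ d ∷ e ∷ []) (λ a b c d e → let δ = a :* d :- b :* c in
    δ :* (e :* d :* (e :* a) :- :- (e :* b) :* :- (e :* c)) := :1 given e :* δ :+ :1 ∶ e :* δ := :1 and []) refl h

  möbius : ∀ a b c d {e} → e * (a * d + - (b * c)) ≡ 1# → Projectivity
  möbius a b c d {e} h = record
    { matrix   = sym³ a b c d
    ; matrix⁻¹ = sym³ (e * d) (- (e * b)) (- (e * c)) (e * a)
    ; inverseʳ = sym³-inverse h
    -- `sym³-inverse` is applied to the inverse matrix, whose determinant has inverse Δ; the factors
    -- e and Δ cancel and give back a, b, c, d.
    ; inverseˡ = λ i j → trans
        (⊙-cong {x = M′ i} {y = M′ i} (sym³ a b c d) (sym³ (Δ * (e * a)) (- (Δ * - (e * b))) (- (Δ * - (e * c))) (Δ * (e * d)))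
          (λ _ → refl) (λ k l → sym (sym³-cong (fix a) (fix- b) (fix- c) (fix d) k l)) j)
        (sym³-inverse {e = Δ} (inverse-det h) i j)
    }
    where
    Δ = a * d + - (b * c)
    M′ = sym³ (e * d) (- (e * b)) (- (e * c)) (e * a)
    fix : ∀ x → Δ * (e * x) ≡ x
    fix x = solve F (Δ ∷ e ∷ x ∷ []) (λ Δ e x → Δ :* (e :* x) := x given x ∶ e :* Δ := :1 and []) refl h
    fix- : ∀ x → - (Δ * - (e * x)) ≡ x
    fix- x = solve F (Δ ∷ e ∷ x ∷ []) (λ Δ e x → :- (Δ :* :- (e :* x)) := x given x ∶ e :* Δ := :1 and []) refl h
    sym³-cong : ∀ {a a′ b b′ c c′ d d′} → a ≡ a′ → b ≡ b′ → c ≡ c′ → d ≡ d′ → ∀ i j → sym³ a b c d i j ≡ sym³ a′ b′ c′ d′ i j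
    sym³-cong refl refl refl refl i j = refl

  ν : Carrier → Carrier → Vector₄
  ν s t i = evaluate F (:ν (Ι (# 0)) (Ι (# 1)) i) (s ∷ t ∷ [])

  oscForm : Carrier → Carrier → Vector₄ → Carrier
  oscForm s t x = evaluate F (:osc (Ι (# 0)) (Ι (# 1)) (:vector (Ι (# 2)) (Ι (# 3)) (Ι (# 4)) (Ι (# 5))))
    (s ∷ t ∷ x (# 0) ∷ x (# 1) ∷ x (# 2) ∷ x (# 3) ∷ [])

  ν-image : ∀ a b c d s t j → (ν s t ⊙ sym³ a b c d) j ≡ ν (a * s + b * t) (c * s + d * t) j
  ν-image a b c d s t = coordinatewise (solve F ρ (claim (# 0)) refl) (solve F ρ (claim (# 1)) refl)
                                       (solve F ρ (claim (# 2)) refl) (solve F ρ (claim (# 3)) refl)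
    where
    ρ = a ∷ b ∷ c ∷ d ∷ s ∷ t ∷ []
    claim : Fin 4 → Expr ℤ 6 → Expr ℤ 6 → Expr ℤ 6 → Expr ℤ 6 → Expr ℤ 6 → Expr ℤ 6 → Claim 6
    claim j a b c d s t = :∑ (λ i → :ν s t i :* :sym³ a b c d i j) := :ν (a :* s :+ b :* t) (c :* s :+ d :* t) j given []

  -- The osculating form is covariant up to the cube of the determinant, so fractional linear maps
  -- of the parameter permute the Γ-planes in every characteristic.
  oscForm-image : ∀ a b c d s t x → let Δ = a * d + - (b * c) in
    oscForm (a * s + b * t) (c * s + d * t) (x ⊙ sym³ a b c d) ≡ Δ * Δ * Δ * oscForm s t x
  oscForm-image a b c d s t x = solve F (a ∷ b ∷ c ∷ d ∷ s ∷ t ∷ x (# 0) ∷ x (# 1) ∷ x (# 2) ∷ x (# 3) ∷ [])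
    (λ a b c d s t x₀ x₁ x₂ x₃ → let Δ = a :* d :- b :* c ; x = :vector x₀ x₁ x₂ x₃ in
      :osc (a :* s :+ b :* t) (c :* s :+ d :* t) (λ j → :∑ (λ i → x i :* :sym³ a b c d i j)) := Δ :* Δ :* Δ :* :osc s t x
      given []) refl

  S T : Parameter → Carrier
  S (just t) = t
  S ∞        = 1#
  T (just t) = 1#
  T ∞        = 0#

  P≗ν : ∀ τ i → coord (P τ) i ≡ ν (S τ) (T τ) i
  P≗ν (just t) = coordinatewise refl (solve F (t ∷ []) (λ t → t :^ 2 := t :^ 2 :* :1 given []) refl)
    (solve F (t ∷ []) (λ t → t := t :* :1 :^ 2 given []) refl) (solve F [] (:1 := :1 :^ 3 given []) refl)
  P≗ν ∞ = coordinatewise (solve F [] (:1 := :1 :^ 3 given []) refl) (solve F [] (:0 := :1 :^ 2 :* :0 given []) refl)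
    (solve F [] (:0 := :1 :* :0 :^ 2 given []) refl) (solve F [] (:0 := :0 :^ 3 given []) refl)

  ν-scale : ∀ c s t i → ν (c * s) (c * t) i ≡ c ^ 3 * ν s t i
  ν-scale c s t = coordinatewise (solve F ρ (claim (# 0)) refl) (solve F ρ (claim (# 1)) refl)
                                 (solve F ρ (claim (# 2)) refl) (solve F ρ (claim (# 3)) refl)
    where
    ρ = c ∷ s ∷ t ∷ []
    claim : Fin 4 → Expr ℤ 3 → Expr ℤ 3 → Expr ℤ 3 → Claim 3
    claim i c s t = :ν (c :* s) (c :* t) i := c :^ 3 :* :ν s t i given []

  ν-zero : ∀ i → ν 0# 0# i ≡ 0#
  ν-zero = coordinatewise (zeroˡ _) (zeroʳ _) (zeroˡ _) (zeroˡ _)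

  normalize : ∀ s t → ¬ (s ≡ 0# × t ≡ 0#) → ∃₂ λ τ c → s ≡ c * S τ × t ≡ c * T τ
  normalize s t st≢0 with t ≟ 0#
  ... | yes t≡0 = ∞ , s , sym (*-identityʳ s) , trans t≡0 (sym (zeroʳ s))
  ... | no  t≢0 with inverse t t≢0
  ...   | z , tz≡1 = just (s * z) , t ,
          solve F (s ∷ t ∷ z ∷ []) (λ s t z → s := t :* (s :* z) given :- s ∶ t :* z := :1 and []) refl tz≡1 , sym (*-identityʳ t)

  multiple-ν∈𝒞 : ∀ X s t k → (∀ i → coord X i ≡ k * ν s t i) → X ∈𝒞
  multiple-ν∈𝒞 X s t k h with normalize s t (λ { (refl , refl) → nonzero X λ i → trans (h i) (trans (cong (k *_) (ν-zero i)) (zeroʳ k)) })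
  ... | τ , c , refl , refl = τ , k * c ^ 3 , λ i → begin
    coord X i                            ≡⟨ h i ⟩
    k * ν (c * S τ) (c * T τ) i          ≡⟨ cong (k *_) (ν-scale c (S τ) (T τ) i) ⟩
    k * (c ^ 3 * ν (S τ) (T τ) i)        ≡⟨ *-assoc k (c ^ 3) _ ⟨
    k * c ^ 3 * ν (S τ) (T τ) i          ≡⟨ cong (k * c ^ 3 *_) (P≗ν τ i) ⟨
    k * c ^ 3 * coord (P τ) i            ∎

  ST-injective : ∀ σ τ → T σ * S τ ≡ S σ * T τ → σ ≡ τ
  ST-injective (just s) (just t) e = cong just (solve F (s ∷ t ∷ []) (λ s t → s := t given :- :1 ∶ :1 :* t := s :* :1 and []) refl e)
  ST-injective (just s) ∞ e = ⊥-elim (1≢0 (solve F (s ∷ []) (λ s → :1 := :0 given :1 ∶ :1 :* :1 := s :* :0 and []) refl e))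
  ST-injective ∞ (just t) e = ⊥-elim (1≢0 (solve F (t ∷ []) (λ t → :1 := :0 given :- :1 ∶ :0 :* t := :1 :* :1 and []) refl e))
  ST-injective ∞ ∞ e = refl

  ∈osc⇒ : ∀ X τ → X ∈ₚ osc τ → oscForm (S τ) (T τ) (coord X) ≡ 0#
  ∈osc⇒ X (just t) = solve F (t ∷ coord X (# 0) ∷ coord X (# 1) ∷ coord X (# 2) ∷ coord X (# 3) ∷ [])
    (λ t x₀ x₁ x₂ x₃ → :osc t :1 (:vector x₀ x₁ x₂ x₃) := :0
      given :1 ∶ :1 :* x₀ :+ (:- (3 :· t) :* x₁ :+ (3 :· (t :^ 2) :* x₂ :+ (:- (t :^ 3) :* x₃ :+ :0))) := :0 and []) refl
  ∈osc⇒ X ∞ = solve F (coord X (# 0) ∷ coord X (# 1) ∷ coord X (# 2) ∷ coord X (# 3) ∷ [])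
    (λ x₀ x₁ x₂ x₃ → :osc :1 :0 (:vector x₀ x₁ x₂ x₃) := :0
      given :- :1 ∶ :0 :* x₀ :+ (:0 :* x₁ :+ (:0 :* x₂ :+ (:1 :* x₃ :+ :0))) := :0 and []) refl

  ⇒∈osc : ∀ X τ → oscForm (S τ) (T τ) (coord X) ≡ 0# → X ∈ₚ osc τ
  ⇒∈osc X (just t) = solve F (t ∷ coord X (# 0) ∷ coord X (# 1) ∷ coord X (# 2) ∷ coord X (# 3) ∷ [])
    (λ t x₀ x₁ x₂ x₃ → :1 :* x₀ :+ (:- (3 :· t) :* x₁ :+ (3 :· (t :^ 2) :* x₂ :+ (:- (t :^ 3) :* x₃ :+ :0))) := :0
      given :1 ∶ :osc t :1 (:vector x₀ x₁ x₂ x₃) := :0 and []) refl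
  ⇒∈osc X ∞ = solve F (coord X (# 0) ∷ coord X (# 1) ∷ coord X (# 2) ∷ coord X (# 3) ∷ [])
    (λ x₀ x₁ x₂ x₃ → :0 :* x₀ :+ (:0 :* x₁ :+ (:0 :* x₂ :+ (:1 :* x₃ :+ :0))) := :0
      given :- :1 ∶ :osc :1 :0 (:vector x₀ x₁ x₂ x₃) := :0 and []) refl

  oscForm-cong : ∀ s t {x y : Vector₄} → (∀ i → x i ≡ y i) → oscForm s t x ≡ oscForm s t y
  oscForm-cong s t {x} {y} h = solve F (s ∷ t ∷ x (# 0) ∷ x (# 1) ∷ x (# 2) ∷ x (# 3) ∷ y (# 0) ∷ y (# 1) ∷ y (# 2) ∷ y (# 3) ∷ [])
    (λ s t x₀ x₁ x₂ x₃ y₀ y₁ y₂ y₃ → :osc s t (:vector x₀ x₁ x₂ x₃) := :osc s t (:vector y₀ y₁ y₂ y₃)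
      given t :^ 3 ∶ x₀ := y₀ and :- (3 :· (s :* t :^ 2)) ∶ x₁ := y₁ and 3 :· (s :^ 2 :* t) ∶ x₂ := y₂ and :- (s :^ 3) ∶ x₃ := y₃ and [])
    refl (h (# 0)) (h (# 1)) (h (# 2)) (h (# 3))

  oscForm-combination : ∀ s t a b (x y : Vector₄) → oscForm s t (λ i → a * x i + b * y i) ≡ a * oscForm s t x + b * oscForm s t y
  oscForm-combination s t a b x y = solve F (s ∷ t ∷ a ∷ b ∷ x (# 0) ∷ x (# 1) ∷ x (# 2) ∷ x (# 3) ∷ y (# 0) ∷ y (# 1) ∷ y (# 2) ∷ y (# 3) ∷ [])
    (λ s t a b x₀ x₁ x₂ x₃ y₀ y₁ y₂ y₃ → let x = :vector x₀ x₁ x₂ x₃ ; y = :vector y₀ y₁ y₂ y₃ in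
      :osc s t (λ i → a :* x i :+ b :* y i) := a :* :osc s t x :+ b :* :osc s t y given []) refl

  oscForm-scale : ∀ c s t x → oscForm (c * s) (c * t) x ≡ c ^ 3 * oscForm s t x
  oscForm-scale c s t x = solve F (c ∷ s ∷ t ∷ x (# 0) ∷ x (# 1) ∷ x (# 2) ∷ x (# 3) ∷ [])
    (λ c s t x₀ x₁ x₂ x₃ → let x = :vector x₀ x₁ x₂ x₃ in
      :osc (c :* s) (c :* t) x := c :^ 3 :* :osc s t x given []) refl

  oscForm-ν : ∀ s t s′ t′ → oscForm s t (ν s′ t′) ≡ (t * s′ + - (s * t′)) ^ 3
  oscForm-ν s t s′ t′ = solve F (s ∷ t ∷ s′ ∷ t′ ∷ []) (λ s t s′ t′ → :osc s t (:ν s′ t′) := (t :* s′ :- s :* t′) :^ 3 given []) refl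

  ^3≡0 : ∀ {x} → x ^ 3 ≡ 0# → x ≡ 0#
  ^3≡0 {x} e with x ≟ 0#
  ... | yes x≡0 = x≡0
  ... | no  x≢0 = ⊥-elim (*-nonzero x≢0 (*-nonzero x≢0 (*-nonzero x≢0 1≢0)) e)

  -- Restricted to the cubic, the osculating form is the cube of a 2 × 2 determinant, which vanishes
  -- only for equal parameters.
  P∈osc⇒≡ : ∀ σ τ → P τ ∈ₚ osc σ → σ ≡ τ
  P∈osc⇒≡ σ τ h = ST-injective σ τ (solve F (T σ ∷ S τ ∷ S σ ∷ T τ ∷ []) (λ a b c d → a :* b := c :* d
    given :1 ∶ a :* b :- c :* d := :0 and []) refl (^3≡0 (begin
      (T σ * S τ + - (S σ * T τ)) ^ 3       ≡⟨ oscForm-ν (S σ) (T σ) (S τ) (T τ) ⟨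
      oscForm (S σ) (T σ) (ν (S τ) (T τ))   ≡⟨ oscForm-cong (S σ) (T σ) (P≗ν τ) ⟨
      oscForm (S σ) (T σ) (coord (P τ))     ≡⟨ ∈osc⇒ (P τ) σ h ⟩
      0#                                    ∎)))

  P-injective : ∀ σ τ → P σ ∼ P τ → σ ≡ τ
  P-injective σ τ (c , h) = sym (P∈osc⇒≡ τ σ (⇒∈osc (P σ) τ (begin
      oscForm (S τ) (T τ) (coord (P σ))                       ≡⟨ oscForm-cong (S τ) (T τ) (λ i → trans (h i) (trans (cong (c *_) (P≗ν τ i))
                                                                  (solve F (c ∷ ν (S τ) (T τ) i ∷ []) (λ c x → c :* x := c :* x :+ :0 :* x given []) refl))) ⟩
      oscForm (S τ) (T τ) (λ i → c * ν (S τ) (T τ) i + 0# * ν (S τ) (T τ) i)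
                                                              ≡⟨ oscForm-combination (S τ) (T τ) c 0# (ν (S τ) (T τ)) (ν (S τ) (T τ)) ⟩
      c * oscForm (S τ) (T τ) (ν (S τ) (T τ)) + 0# * oscForm (S τ) (T τ) (ν (S τ) (T τ))
                                                              ≡⟨ solve F (c ∷ S τ ∷ T τ ∷ oscForm (S τ) (T τ) (ν (S τ) (T τ)) ∷ [])
                                                                   (λ c s t o → c :* o :+ :0 :* o := :0 given c ∶ o := (t :* s :- s :* t) :^ 3 and []) refl
                                                                   (oscForm-ν (S τ) (T τ) (S τ) (T τ)) ⟩
      0#                                                      ∎)))

  _∈G : Projectivity → Set
  _∈G = StabilizesCubic

  ⊚∈G : ∀ φ ψ → φ ∈G → ψ ∈G → (φ ⊚ ψ) ∈G
  ⊚∈G φ ψ φ∈G ψ∈G X = mk⇔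
    (λ X∈𝒞 → let (τ , e) = Equivalence.to (ψ∈G (X ▹ φ)) (Equivalence.to (φ∈G X) X∈𝒞)
             in τ , ∼-trans (X ▹ (φ ⊚ ψ)) (X ▹ φ ▹ ψ) (P τ) (▹-⊚ X φ ψ) e)
    (λ (τ , e) → Equivalence.from (φ∈G X) (Equivalence.from (ψ∈G (X ▹ φ))
      (τ , ∼-trans (X ▹ φ ▹ ψ) (X ▹ (φ ⊚ ψ)) (P τ) (∼-sym (X ▹ (φ ⊚ ψ)) (X ▹ φ ▹ ψ) (▹-⊚ X φ ψ)) e)))

  ⁻¹∈G : ∀ φ → φ ∈G → (φ ⁻¹) ∈G
  ⁻¹∈G φ φ∈G X = mk⇔
    (λ (τ , e) → Equivalence.from (φ∈G (X ▹ φ ⁻¹)) (τ , ∼-trans (X ▹ φ ⁻¹ ▹ φ) X (P τ) (⁻¹-▹ X φ) e))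
    (λ h → let (τ , e) = Equivalence.to (φ∈G (X ▹ φ ⁻¹)) h
           in τ , ∼-trans X (X ▹ φ ⁻¹ ▹ φ) (P τ) (∼-sym (X ▹ φ ⁻¹ ▹ φ) X (⁻¹-▹ X φ)) e)

  private
    sym³-preserves : ∀ φ a b c d → (∀ i j → matrix φ i j ≡ sym³ a b c d i j) → ∀ X → X ∈𝒞 → (X ▹ φ) ∈𝒞
    sym³-preserves φ a b c d φ≗ X (τ , k , h) = multiple-ν∈𝒞 (X ▹ φ) (a * S τ + b * T τ) (c * S τ + d * T τ) k λ j → begin
      (coord X ⊙ matrix φ) j                         ≡⟨ ⊙-cong (matrix φ) (sym³ a b c d) (λ i → trans (h i) (cong (k *_) (P≗ν τ i))) φ≗ j ⟩
      ((λ i → k * ν (S τ) (T τ) i) ⊙ sym³ a b c d) j ≡⟨ ⊙-multiple {v = ν (S τ) (T τ)} (sym³ a b c d) (λ _ → refl) j ⟩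
      k * (ν (S τ) (T τ) ⊙ sym³ a b c d) j           ≡⟨ cong (k *_) (ν-image a b c d (S τ) (T τ) j) ⟩
      k * ν (a * S τ + b * T τ) (c * S τ + d * T τ) j ∎

  -- Symmetric cubes map 𝒞 into itself. The inverse matrix is again a symmetric cube, and this gives
  -- the converse implication.
  möbius∈G : ∀ a b c d {e} (h : e * (a * d + - (b * c)) ≡ 1#) → möbius a b c d h ∈G
  möbius∈G a b c d {e} h X = mk⇔ (sym³-preserves φ a b c d (λ _ _ → refl) X)
    (λ Xφ∈𝒞 → let (τ , e) = sym³-preserves (φ ⁻¹) _ _ _ _ (matrix-⁻¹ φ) (X ▹ φ) Xφ∈𝒞
              in τ , ∼-trans X (X ▹ φ ▹ φ ⁻¹) (P τ) (∼-sym (X ▹ φ ▹ φ ⁻¹) X (▹-⁻¹ X φ)) e)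
    where φ = möbius a b c d h

  möbius-P : ∀ a b c d {e} (h : e * (a * d + - (b * c)) ≡ 1#) σ τ k →
    a * S σ + b * T σ ≡ k * S τ → c * S σ + d * T σ ≡ k * T τ → P σ ▹ möbius a b c d h ∼ P τ
  möbius-P a b c d h σ τ k e₁ e₂ = k ^ 3 , λ j → begin
    (coord (P σ) ⊙ sym³ a b c d) j                   ≡⟨ ⊙-cong (sym³ a b c d) (sym³ a b c d) (P≗ν σ) (λ _ _ → refl) j ⟩
    (ν (S σ) (T σ) ⊙ sym³ a b c d) j                 ≡⟨ ν-image a b c d (S σ) (T σ) j ⟩
    ν (a * S σ + b * T σ) (c * S σ + d * T σ) j      ≡⟨ cong₂ (λ s t → ν s t j) e₁ e₂ ⟩
    ν (k * S τ) (k * T τ) j                          ≡⟨ ν-scale k (S τ) (T τ) j ⟩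
    k ^ 3 * ν (S τ) (T τ) j                          ≡⟨ cong (k ^ 3 *_) (P≗ν τ j) ⟨
    k ^ 3 * coord (P τ) j                            ∎

  dilation-det : ∀ r (r≢0 : r ≢ 0#) → proj₁ (inverse r r≢0) * (r * 1# + - (0# * 0#)) ≡ 1#
  dilation-det r r≢0 = solve F (r ∷ proj₁ (inverse r r≢0) ∷ []) (λ r z → z :* (r :* :1 :- :0 :* :0) := :1
    given :1 ∶ r :* z := :1 and []) refl (proj₂ (inverse r r≢0))

  shear-det : ∀ u → 1# * (1# * 1# + - (0# * u)) ≡ 1#
  shear-det u = solve F (u ∷ []) (λ u → :1 :* (:1 :* :1 :- :0 :* u) := :1 given []) refl

  translation-det : ∀ u → 1# * (1# * 1# + - (u * 0#)) ≡ 1#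
  translation-det u = solve F (u ∷ []) (λ u → :1 :* (:1 :* :1 :- u :* :0) := :1 given []) refl

  inversion-det : - 1# * (0# * 0# + - (1# * 1#)) ≡ 1#
  inversion-det = solve F [] (:- :1 :* (:0 :* :0 :- :1 :* :1) := :1 given []) refl

  dilation : ∀ r → r ≢ 0# → Projectivity
  dilation r r≢0 = möbius r 0# 0# 1# (dilation-det r r≢0)

  -- t ↦ t / (ut + 1)
  shear : Carrier → Projectivity
  shear u = möbius 1# 0# u 1# (shear-det u)

  translation : Carrier → Projectivity
  translation u = möbius 1# u 0# 1# (translation-det u)

  inversion : Projectivity
  inversion = möbius 0# 1# 1# 0# inversion-det

  dilation∈G : ∀ r r≢0 → dilation r r≢0 ∈G
  dilation∈G r r≢0 = möbius∈G r 0# 0# 1# (dilation-det r r≢0)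

  shear∈G : ∀ u → shear u ∈G
  shear∈G u = möbius∈G 1# 0# u 1# (shear-det u)

  O : Parameter
  O = just 0#

  -- move τ takes P τ to P O.
  move : Parameter → Projectivity
  move (just t) = translation (- t)
  move ∞        = inversion

  move∈G : ∀ τ → move τ ∈G
  move∈G (just t) = möbius∈G 1# (- t) 0# 1# (translation-det (- t))
  move∈G ∞        = möbius∈G 0# 1# 1# 0# inversion-det

  move-P : ∀ τ → P τ ▹ move τ ∼ P O
  move-P (just t) = möbius-P 1# (- t) 0# 1# (translation-det (- t)) (just t) O 1#
    (solve F (t ∷ []) (λ t → :1 :* t :+ :- t :* :1 := :1 :* :0 given []) refl) (solve F (t ∷ []) (λ t → :0 :* t :+ :1 :* :1 := :1 :* :1 given []) refl)
  move-P ∞ = möbius-P 0# 1# 1# 0# inversion-det ∞ O 1#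
    (solve F [] (:0 :* :1 :+ :1 :* :0 := :1 :* :0 given []) refl) (solve F [] (:1 :* :1 :+ :0 :* :0 := :1 :* :1 given []) refl)

  shear-shear⁻ : ∀ ℓ u → ℓ ▶ shear u ▶ shear (- u) ≅ ℓ
  shear-shear⁻ ℓ u = ≅-trans (scalar⇒▶≅ (ℓ ▶ shear u) (shear (- u)) (shear u ⁻¹) 1# (λ i j → trans (inverse-shear i j) (cong (1# *_) (sym (matrix-⁻¹ (shear u) i j)))))
    (▶-⁻¹ ℓ (shear u))
    where
    inverse-shear : ∀ i j → sym³ 1# 0# (- u) 1# i j ≡ 1# * sym³ (1# * 1#) (- (1# * 0#)) (- (1# * u)) (1# * 1#) i j
    inverse-shear = coordinatewise
      (coordinatewise (solve F ρ (claim (# 0) (# 0)) refl) (solve F ρ (claim (# 0) (# 1)) refl) (solve F ρ (claim (# 0) (# 2)) refl) (solve F ρ (claim (# 0) (# 3)) refl))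
      (coordinatewise (solve F ρ (claim (# 1) (# 0)) refl) (solve F ρ (claim (# 1) (# 1)) refl) (solve F ρ (claim (# 1) (# 2)) refl) (solve F ρ (claim (# 1) (# 3)) refl))
      (coordinatewise (solve F ρ (claim (# 2) (# 0)) refl) (solve F ρ (claim (# 2) (# 1)) refl) (solve F ρ (claim (# 2) (# 2)) refl) (solve F ρ (claim (# 2) (# 3)) refl))
      (coordinatewise (solve F ρ (claim (# 3) (# 0)) refl) (solve F ρ (claim (# 3) (# 1)) refl) (solve F ρ (claim (# 3) (# 2)) refl) (solve F ρ (claim (# 3) (# 3)) refl))
      where
      ρ = u ∷ []
      claim : Fin 4 → Fin 4 → Expr ℤ 1 → Claim 1
      claim i j u = :sym³ :1 :0 (:- u) :1 i j := :1 :* :sym³ (:1 :* :1) (:- (:1 :* :0)) (:- (:1 :* u)) (:1 :* :1) i j given []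

  -- This quadric and that of `on-curve₂` turn membership in 𝒞 into polynomial equations in the
  -- entries of a matrix.
  on-curve₁ : ∀ X → X ∈𝒞 → coord X (# 0) * coord X (# 2) ≡ coord X (# 1) * coord X (# 1)
  on-curve₁ X (τ , k , h) = begin
    coord X (# 0) * coord X (# 2)                       ≡⟨ cong₂ _*_ (x (# 0)) (x (# 2)) ⟩
    k * ν (S τ) (T τ) (# 0) * (k * ν (S τ) (T τ) (# 2)) ≡⟨ solve F (k ∷ S τ ∷ T τ ∷ []) (λ k s t →
      k :* :ν s t (# 0) :* (k :* :ν s t (# 2)) := k :* :ν s t (# 1) :* (k :* :ν s t (# 1)) given []) refl ⟩
    k * ν (S τ) (T τ) (# 1) * (k * ν (S τ) (T τ) (# 1)) ≡⟨ cong₂ _*_ (x (# 1)) (x (# 1)) ⟨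
    coord X (# 1) * coord X (# 1)                       ∎
    where
    x : ∀ i → coord X i ≡ k * ν (S τ) (T τ) i
    x i = trans (h i) (cong (k *_) (P≗ν τ i))

  on-curve₂ : ∀ X → X ∈𝒞 → coord X (# 1) * coord X (# 3) ≡ coord X (# 2) * coord X (# 2)
  on-curve₂ X (τ , k , h) = begin
    coord X (# 1) * coord X (# 3)                       ≡⟨ cong₂ _*_ (x (# 1)) (x (# 3)) ⟩
    k * ν (S τ) (T τ) (# 1) * (k * ν (S τ) (T τ) (# 3)) ≡⟨ solve F (k ∷ S τ ∷ T τ ∷ []) (λ k s t →
      k :* :ν s t (# 1) :* (k :* :ν s t (# 3)) := k :* :ν s t (# 2) :* (k :* :ν s t (# 2)) given []) refl ⟩
    k * ν (S τ) (T τ) (# 2) * (k * ν (S τ) (T τ) (# 2)) ≡⟨ cong₂ _*_ (x (# 2)) (x (# 2)) ⟨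
    coord X (# 2) * coord X (# 2)                       ∎
    where
    x : ∀ i → coord X i ≡ k * ν (S τ) (T τ) i
    x i = trans (h i) (cong (k *_) (P≗ν τ i))

  module Stabilizer (5≤q : 5 ℕ.≤ q) where

    private
      -- Multiplication by X adds the root 0, so that any five elements of the field are roots of a
      -- polynomial with five coefficients; this needs q ≥ 5.
      vanishing-cubic : ∀ g₀ g₁ g₂ g₃ → (∀ v → v ≢ 0# → eval (g₀ ∷ g₁ ∷ g₂ ∷ g₃ ∷ []) v ≡ 0#) →
        g₀ ≡ 0# × g₁ ≡ 0# × g₂ ≡ 0# × g₃ ≡ 0#
      vanishing-cubic g₀ g₁ g₂ g₃ h = coefficients (roots⇒zero _ (element 5≤q) (element-injective 5≤q) (λ i → root (element 5≤q i)))
        where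
        root : ∀ v → eval (0# ∷ g₀ ∷ g₁ ∷ g₂ ∷ g₃ ∷ []) v ≡ 0#
        root v with v ≟ 0#
        ... | yes refl = trans (cong (0# +_) (zeroˡ _)) (+-identityʳ 0#)
        ... | no  v≢0  = trans (cong (λ x → 0# + v * x) (h v v≢0)) (trans (cong (0# +_) (zeroʳ v)) (+-identityʳ 0#))
        coefficients : All (_≡ 0#) (0# ∷ g₀ ∷ g₁ ∷ g₂ ∷ g₃ ∷ []) → g₀ ≡ 0# × g₁ ≡ 0# × g₂ ≡ 0# × g₃ ≡ 0#
        coefficients (_ ∷ h₀ ∷ h₁ ∷ h₂ ∷ h₃ ∷ []) = h₀ , h₁ , h₂ , h₃

      P-row : ∀ A j → (coord (P O) ⊙ A) j ≡ A (# 3) j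
      P-row A j = solve F (A (# 0) j ∷ A (# 1) j ∷ A (# 2) j ∷ A (# 3) j ∷ []) (λ x y z w →
        :0 :^ 3 :* x :+ (:0 :^ 2 :* y :+ (:0 :* z :+ (:1 :* w :+ :0))) := w given []) refl

      P∞-row : ∀ A j → (coord (P ∞) ⊙ A) j ≡ A (# 0) j
      P∞-row A j = solve F (A (# 0) j ∷ A (# 1) j ∷ A (# 2) j ∷ A (# 3) j ∷ []) (λ x y z w →
        :1 :* x :+ (:0 :* y :+ (:0 :* z :+ (:0 :* w :+ :0))) := x given []) refl

    -- An element of G fixing P O and P ∞ has first row (a,0,0,0) and last row
    -- (0,0,0,d). That the images of the other points satisfy x₀x₂ = x₁² and
    -- x₁x₃ = x₂² says that two cubics vanish at the q - 1 ≥ 4 nonzero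
    -- elements; equating their coefficients to zero makes the matrix diagonal.
    diagonal : ∀ φ → φ ∈G → P O ▹ φ ∼ P O → P ∞ ▹ φ ∼ P ∞ →
      ∃₂ λ r d → r ≢ 0# × (∀ i j → matrix φ i j ≡ d * sym³ r 0# 0# 1# i j)
    diagonal φ φ∈G (d , hd) (a , ha) = r , d , *-nonzero b₁≢0 (unit⇒nonzeroʳ c₂z≡1) , coordinatewise
      (coordinatewise
        (solve F (a ∷ b₁ ∷ c₂ ∷ d ∷ z ∷ A (# 0) (# 0) ∷ []) (λ a b₁ c₂ d z A → let r = b₁ :* z in A := d :* (r :* r :* r)
          given :1 ∶ A := a and :- a ∶ c₂ :* z := :1 and z ∶ a :* c₂ := b₁ :* b₁
          and :- (b₁ :* b₁ :* z :* z :* z) ∶ b₁ :* d := c₂ :* c₂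
          and :- (b₁ :* b₁ :* z :* (c₂ :* z :+ :1)) ∶ c₂ :* z := :1 and []) refl A₀₀ c₂z≡1 ac₂≡b₁² b₁d≡c₂² c₂z≡1)
        (solve F (r ∷ d ∷ A (# 0) (# 1) ∷ []) (:off (# 0) (# 1)) refl A₀₁) (solve F (r ∷ d ∷ A (# 0) (# 2) ∷ []) (:off (# 0) (# 2)) refl A₀₂) (solve F (r ∷ d ∷ A (# 0) (# 3) ∷ []) (:off (# 0) (# 3)) refl A₀₃))
      (coordinatewise (solve F (r ∷ d ∷ A (# 1) (# 0) ∷ []) (:off (# 1) (# 0)) refl b₀≡0)
        (solve F (b₁ ∷ c₂ ∷ d ∷ z ∷ []) (λ b₁ c₂ d z → let r = b₁ :* z in b₁ := d :* (r :* r :* :1 :+ 2 :· (r :* :0 :* :0))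
          given :- (b₁ :* z :* z) ∶ b₁ :* d := c₂ :* c₂ and :- (b₁ :* (c₂ :* z :+ :1)) ∶ c₂ :* z := :1 and []) refl b₁d≡c₂² c₂z≡1)
        (solve F (r ∷ d ∷ A (# 1) (# 2) ∷ []) (:off (# 1) (# 2)) refl b₂≡0) (solve F (r ∷ d ∷ A (# 1) (# 3) ∷ []) (:off (# 1) (# 3)) refl b₃≡0))
      (coordinatewise (solve F (r ∷ d ∷ A (# 2) (# 0) ∷ []) (:off (# 2) (# 0)) refl c₀≡0) (solve F (r ∷ d ∷ A (# 2) (# 1) ∷ []) (:off (# 2) (# 1)) refl c₁≡0)
        (solve F (b₁ ∷ c₂ ∷ d ∷ z ∷ []) (λ b₁ c₂ d z → let r = b₁ :* z in c₂ := d :* (2 :· (:0 :* :0 :* :1) :+ r :* :1 :* :1)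
          given :- z ∶ b₁ :* d := c₂ :* c₂ and :- c₂ ∶ c₂ :* z := :1 and []) refl b₁d≡c₂² c₂z≡1)
        (solve F (r ∷ d ∷ A (# 2) (# 3) ∷ []) (:off (# 2) (# 3)) refl c₃≡0))
      (coordinatewise (solve F (r ∷ d ∷ A (# 3) (# 0) ∷ []) (:off (# 3) (# 0)) refl A₃₀) (solve F (r ∷ d ∷ A (# 3) (# 1) ∷ []) (:off (# 3) (# 1)) refl A₃₁) (solve F (r ∷ d ∷ A (# 3) (# 2) ∷ []) (:off (# 3) (# 2)) refl A₃₂)
        (solve F (d ∷ A (# 3) (# 3) ∷ []) (λ d A → A := d :* (:1 :* :1 :* :1) given :1 ∶ A := d and []) refl A₃₃))
      where
      A = matrix φ
      b₀ = A (# 1) (# 0) ; b₁ = A (# 1) (# 1) ; b₂ = A (# 1) (# 2) ; b₃ = A (# 1) (# 3)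
      c₀ = A (# 2) (# 0) ; c₁ = A (# 2) (# 1) ; c₂ = A (# 2) (# 2) ; c₃ = A (# 2) (# 3)
      A₀ : ∀ j → A (# 0) j ≡ a * coord (P ∞) j
      A₀ j = trans (sym (P∞-row A j)) (ha j)
      A₃ : ∀ j → A (# 3) j ≡ d * coord (P O) j
      A₃ j = trans (sym (P-row A j)) (hd j)
      A₀₀ = trans (A₀ (# 0)) (*-identityʳ a)
      A₀₁ = trans (A₀ (# 1)) (zeroʳ a)
      A₀₂ = trans (A₀ (# 2)) (zeroʳ a)
      A₀₃ = trans (A₀ (# 3)) (zeroʳ a)
      A₃₀ = trans (A₃ (# 0)) (trans (cong (d *_) (zeroˡ _)) (zeroʳ d))
      A₃₁ = trans (A₃ (# 1)) (trans (cong (d *_) (zeroˡ _)) (zeroʳ d))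
      A₃₂ = trans (A₃ (# 2)) (zeroʳ d)
      A₃₃ = trans (A₃ (# 3)) (*-identityʳ d)
      a≢0 : a ≢ 0#
      a≢0 = ∼-factor≢0 (P ∞ ▹ φ) (P ∞) (a , ha)
      d≢0 : d ≢ 0#
      d≢0 = ∼-factor≢0 (P O ▹ φ) (P O) (d , hd)
      image∈𝒞 : ∀ v → (P (just v) ▹ φ) ∈𝒞
      image∈𝒞 v = Equivalence.to (φ∈G (P (just v))) (just v , ∼-refl (P (just v)))
      :image : ∀ {n} → Expr ℤ n → (x₀ x₁ x₂ x₃ : Expr ℤ n) → Expr ℤ n
      :image v x₀ x₁ x₂ x₃ = v :^ 3 :* x₀ :+ (v :^ 2 :* x₁ :+ (v :* x₂ :+ (:1 :* x₃ :+ :0)))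
      -- With the first and last rows known, the coordinates x₀, x₁, x₂ of the image are divisible
      -- by v, so x₀x₂ - x₁² is v² times a cubic.
      cubic₁ : ∀ v → v ≢ 0# → eval ((c₀ * c₂ + - (c₁ * c₁)) ∷ (b₀ * c₂ + c₀ * b₂ + - (2 · (b₁ * c₁))) ∷
        (a * c₂ + b₀ * b₂ + - (b₁ * b₁)) ∷ (a * b₂) ∷ []) v ≡ 0#
      cubic₁ v v≢0 = zero-product (solve F (v ∷ a ∷ b₀ ∷ b₁ ∷ b₂ ∷ c₀ ∷ c₁ ∷ c₂ ∷ A (# 0) (# 0) ∷ A (# 0) (# 1) ∷ A (# 0) (# 2) ∷ A (# 3) (# 0) ∷ A (# 3) (# 1) ∷ A (# 3) (# 2) ∷ [])
        (λ v a b₀ b₁ b₂ c₀ c₁ c₂ A₀₀ A₀₁ A₀₂ A₃₀ A₃₁ A₃₂ →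
          let f₀ = :image v A₀₀ b₀ c₀ A₃₀ ; f₁ = :image v A₀₁ b₁ c₁ A₃₁ ; f₂ = :image v A₀₂ b₂ c₂ A₃₂
              y₁ = v :^ 2 :* b₁ :+ v :* c₁ ; y₂ = v :^ 2 :* b₂ :+ v :* c₂ in
          v :* v :* (c₀ :* c₂ :- c₁ :* c₁ :+ v :* (b₀ :* c₂ :+ c₀ :* b₂ :- 2 :· (b₁ :* c₁) :+ v :* (a :* c₂ :+ b₀ :* b₂ :- b₁ :* b₁ :+ v :* (a :* b₂ :+ v :* :0)))) := :0
          given :1 ∶ f₀ :* f₂ := f₁ :* f₁ and :- (v :^ 3 :* f₂) ∶ A₀₀ := a and :- f₂ ∶ A₃₀ := :0
          and :- (v :^ 3 :* (v :^ 3 :* a :+ v :^ 2 :* b₀ :+ v :* c₀)) ∶ A₀₂ := :0 and :- (v :^ 3 :* a :+ v :^ 2 :* b₀ :+ v :* c₀) ∶ A₃₂ := :0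
          and v :^ 3 :* (f₁ :+ y₁) ∶ A₀₁ := :0 and f₁ :+ y₁ ∶ A₃₁ := :0 and []) refl
          (on-curve₁ (P (just v) ▹ φ) (image∈𝒞 v)) A₀₀ A₃₀ A₀₂ A₃₂ A₀₁ A₃₁) (*-nonzero v≢0 v≢0)
      -- Here only one factor v splits off, because x₃ has the constant term d.
      cubic₂ : ∀ v → v ≢ 0# → eval ((c₁ * d) ∷ (b₁ * d + c₁ * c₃ + - (c₂ * c₂)) ∷
        (b₁ * c₃ + c₁ * b₃ + - (2 · (b₂ * c₂))) ∷ (b₁ * b₃ + - (b₂ * b₂)) ∷ []) v ≡ 0#
      cubic₂ v v≢0 = zero-product (solve F (v ∷ d ∷ b₁ ∷ b₂ ∷ b₃ ∷ c₁ ∷ c₂ ∷ c₃ ∷ A (# 0) (# 1) ∷ A (# 0) (# 2) ∷ A (# 0) (# 3) ∷ A (# 3) (# 1) ∷ A (# 3) (# 2) ∷ A (# 3) (# 3) ∷ [])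
        (λ v d b₁ b₂ b₃ c₁ c₂ c₃ A₀₁ A₀₂ A₀₃ A₃₁ A₃₂ A₃₃ →
          let f₁ = :image v A₀₁ b₁ c₁ A₃₁ ; f₂ = :image v A₀₂ b₂ c₂ A₃₂ ; f₃ = :image v A₀₃ b₃ c₃ A₃₃
              y₁ = v :^ 2 :* b₁ :+ v :* c₁ ; y₂ = v :^ 2 :* b₂ :+ v :* c₂ in
          v :* (c₁ :* d :+ v :* (b₁ :* d :+ c₁ :* c₃ :- c₂ :* c₂ :+ v :* (b₁ :* c₃ :+ c₁ :* b₃ :- 2 :· (b₂ :* c₂) :+ v :* (b₁ :* b₃ :- b₂ :* b₂ :+ v :* :0)))) := :0
          given :1 ∶ f₁ :* f₃ := f₂ :* f₂ and :- (v :^ 3 :* f₃) ∶ A₀₁ := :0 and :- f₃ ∶ A₃₁ := :0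
          and :- (v :^ 3 :* y₁) ∶ A₀₃ := :0 and :- y₁ ∶ A₃₃ := d
          and v :^ 3 :* (f₂ :+ y₂) ∶ A₀₂ := :0 and f₂ :+ y₂ ∶ A₃₂ := :0 and []) refl
          (on-curve₂ (P (just v) ▹ φ) (image∈𝒞 v)) A₀₁ A₃₁ A₀₃ A₃₃ A₀₂ A₃₂) v≢0
      g = vanishing-cubic _ _ _ _ cubic₁
      h = vanishing-cubic _ _ _ _ cubic₂
      b₂≡0 : b₂ ≡ 0#
      b₂≡0 = zero-product (proj₂ (proj₂ (proj₂ g))) a≢0
      c₁≡0 : c₁ ≡ 0#
      c₁≡0 = zero-product (trans (*-comm d c₁) (proj₁ h)) d≢0
      ac₂≡b₁² : a * c₂ ≡ b₁ * b₁
      ac₂≡b₁² = solve F (a ∷ b₀ ∷ b₁ ∷ b₂ ∷ c₂ ∷ []) (λ a b₀ b₁ b₂ c₂ → a :* c₂ := b₁ :* b₁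
        given :1 ∶ a :* c₂ :+ b₀ :* b₂ :- b₁ :* b₁ := :0 and :- b₀ ∶ b₂ := :0 and []) refl (proj₁ (proj₂ (proj₂ g))) b₂≡0
      b₁d≡c₂² : b₁ * d ≡ c₂ * c₂
      b₁d≡c₂² = solve F (b₁ ∷ c₁ ∷ c₂ ∷ c₃ ∷ d ∷ []) (λ b₁ c₁ c₂ c₃ d → b₁ :* d := c₂ :* c₂
        given :1 ∶ b₁ :* d :+ c₁ :* c₃ :- c₂ :* c₂ := :0 and :- c₃ ∶ c₁ := :0 and []) refl (proj₁ (proj₂ h)) c₁≡0
      b₁≢0 : b₁ ≢ 0#
      -- Otherwise column 1 of the matrix vanishes entirely, against invertibility.
      b₁≢0 b₁≡0 = 1≢0 (begin
        1#                          ≡⟨ inverseˡ φ (# 1) (# 1) ⟨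
        (matrix⁻¹ φ ⊡ A) (# 1) (# 1) ≡⟨ solve F (A′ (# 0) ∷ A′ (# 1) ∷ A′ (# 2) ∷ A′ (# 3) ∷ A (# 0) (# 1) ∷ b₁ ∷ c₁ ∷ A (# 3) (# 1) ∷ [])
          (λ p q r s x y z w → p :* x :+ (q :* y :+ (r :* z :+ (s :* w :+ :0))) := :0
            given p ∶ x := :0 and q ∶ y := :0 and r ∶ z := :0 and s ∶ w := :0 and []) refl A₀₁ b₁≡0 c₁≡0 A₃₁ ⟩
        0#                          ∎)
        where A′ = matrix⁻¹ φ (# 1)
      c₂≢0 : c₂ ≢ 0#
      c₂≢0 c₂≡0 = *-nonzero b₁≢0 d≢0 (trans b₁d≡c₂² (trans (cong (c₂ *_) c₂≡0) (zeroʳ c₂)))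
      b₀≡0 : b₀ ≡ 0#
      b₀≡0 = zero-product (solve F (b₀ ∷ b₁ ∷ b₂ ∷ c₀ ∷ c₁ ∷ c₂ ∷ []) (λ b₀ b₁ b₂ c₀ c₁ c₂ → c₂ :* b₀ := :0
        given :1 ∶ b₀ :* c₂ :+ c₀ :* b₂ :- 2 :· (b₁ :* c₁) := :0 and :- c₀ ∶ b₂ := :0 and 2 :· b₁ ∶ c₁ := :0 and [])
        refl (proj₁ (proj₂ g)) b₂≡0 c₁≡0) c₂≢0
      c₀≡0 : c₀ ≡ 0#
      c₀≡0 = zero-product (solve F (c₀ ∷ c₁ ∷ c₂ ∷ []) (λ c₀ c₁ c₂ → c₂ :* c₀ := :0
        given :1 ∶ c₀ :* c₂ :- c₁ :* c₁ := :0 and c₁ ∶ c₁ := :0 and []) refl (proj₁ g) c₁≡0) c₂≢0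
      b₃≡0 : b₃ ≡ 0#
      b₃≡0 = zero-product (solve F (b₁ ∷ b₂ ∷ b₃ ∷ []) (λ b₁ b₂ b₃ → b₁ :* b₃ := :0
        given :1 ∶ b₁ :* b₃ :- b₂ :* b₂ := :0 and b₂ ∶ b₂ := :0 and []) refl (proj₂ (proj₂ (proj₂ h))) b₂≡0) b₁≢0
      c₃≡0 : c₃ ≡ 0#
      c₃≡0 = zero-product (solve F (b₁ ∷ b₂ ∷ b₃ ∷ c₁ ∷ c₂ ∷ c₃ ∷ []) (λ b₁ b₂ b₃ c₁ c₂ c₃ → b₁ :* c₃ := :0
        given :1 ∶ b₁ :* c₃ :+ c₁ :* b₃ :- 2 :· (b₂ :* c₂) := :0 and :- b₃ ∶ c₁ := :0 and 2 :· c₂ ∶ b₂ := :0 and [])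
        refl (proj₁ (proj₂ (proj₂ h))) c₁≡0 b₂≡0) b₁≢0
      z = proj₁ (inverse c₂ c₂≢0)
      c₂z≡1 = proj₂ (inverse c₂ c₂≢0)
      -- The ratio of consecutive diagonal entries: the diagonal is (dr³, dr², dr, d).
      r = b₁ * z
      :off : Fin 4 → Fin 4 → Expr ℤ 3 → Expr ℤ 3 → Expr ℤ 3 → Claim 3
      :off i j r d A = A := d :* :sym³ r :0 :0 :1 i j given :1 ∶ A := :0 and []

-- Orbits of lines

module Action {q} (5≤q : 5 ℕ.≤ q) (F : FiniteField q) where
  open FiniteField F
  open Arithmetic F
  open ProjectiveSpace F
  open TwistedCubic F
  open Linear F
  open Projective F
  open Projectivity
  open Stabilizer 5≤q

  record Maps (φ : Projectivity) (σ τ : Parameter) : Set where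
    constructor maps
    field image-∼ : P σ ▹ φ ∼ P τ

  shear-O : ∀ u → Maps (shear u) O O
  shear-O u = maps (möbius-P 1# 0# u 1# (shear-det u) O O 1#
    (solve F [] (:1 :* :0 :+ :0 :* :1 := :1 :* :0 given []) refl) (solve F (u ∷ []) (λ u → u :* :0 :+ :1 :* :1 := :1 :* :1 given []) refl))

  shear-to-∞ : ∀ σ → σ ≢ O → ∃ λ u → Maps (shear u) σ ∞
  shear-to-∞ ∞ _ = 0# , maps (möbius-P 1# 0# 0# 1# (shear-det 0#) ∞ ∞ 1#
    (solve F [] (:1 :* :1 :+ :0 :* :0 := :1 :* :1 given []) refl) (solve F [] (:0 :* :1 :+ :1 :* :0 := :1 :* :0 given []) refl))
  -- The map t ↦ t/(ut + 1) has its pole at v for u = -1/v.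
  shear-to-∞ (just v) v≢O = - z , maps (möbius-P 1# 0# (- z) 1# (shear-det (- z)) (just v) ∞ v
    (solve F (v ∷ []) (λ v → :1 :* v :+ :0 :* :1 := v :* :1 given []) refl)
    (solve F (v ∷ z ∷ []) (λ v z → :- z :* v :+ :1 :* :1 := v :* :0 given :- :1 ∶ v :* z := :1 and []) refl (proj₂ v⁻¹)))
    where
    v⁻¹ = inverse v (v≢O ∘ cong just)
    z = proj₁ v⁻¹

  maps-move : ∀ τ → Maps (move τ) τ O
  maps-move τ = maps (move-P τ)

  maps-⊚ : ∀ {φ ψ ρ σ τ} → Maps φ ρ σ → Maps ψ σ τ → Maps (φ ⊚ ψ) ρ τ
  maps-⊚ {φ} {ψ} {ρ} {σ} {τ} (maps e) (maps f) = maps (∼-trans (P ρ ▹ (φ ⊚ ψ)) (P ρ ▹ φ ▹ ψ) (P τ) (▹-⊚ (P ρ) φ ψ)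
    (∼-trans (P ρ ▹ φ ▹ ψ) (P σ ▹ ψ) (P τ) (▹-cong (P ρ ▹ φ) (P σ) ψ e) f))

  maps-⁻¹ : ∀ {φ σ τ} → Maps φ σ τ → Maps (φ ⁻¹) τ σ
  maps-⁻¹ {φ} {σ} {τ} (maps e) = maps (∼-trans (P τ ▹ φ ⁻¹) (P σ ▹ φ ▹ φ ⁻¹) (P σ)
    (▹-cong (P τ) (P σ ▹ φ) (φ ⁻¹) (∼-sym (P σ ▹ φ) (P τ) e)) (▹-⁻¹ (P σ) φ))

  maps-unique : ∀ {φ ρ σ τ} → Maps φ ρ σ → Maps φ ρ τ → σ ≡ τ
  maps-unique {φ} {ρ} {σ} {τ} (maps e) (maps f) = P-injective σ τ (∼-trans (P σ) (P ρ ▹ φ) (P τ) (∼-sym (P ρ ▹ φ) (P σ) e) f)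

  maps-injective : ∀ {φ ρ σ τ} → Maps φ ρ τ → Maps φ σ τ → ρ ≡ σ
  maps-injective ρ↦τ σ↦τ = maps-unique (maps-⁻¹ ρ↦τ) (maps-⁻¹ σ↦τ)

  imageParameter : ∀ φ → φ ∈G → ∀ τ → ∃ λ σ → Maps φ τ σ
  imageParameter φ φ∈G τ = let (σ , e) = Equivalence.to (φ∈G (P τ)) (τ , ∼-refl (P τ)) in σ , maps e

  -- The image of `P ∞` is not `P O`, so a shear returns it to `P ∞` and the composite is diagonal.
  -- The matrices agree only up to a scalar, hence the formulation by images of lines.
  fixes-O⇒dilation-shear : ∀ φ → φ ∈G → Maps φ O O →
    ∃ λ r → ∃₂ λ (r≢0 : r ≢ 0#) u → ∀ ℓ → ℓ ▶ φ ≅ ℓ ▶ dilation r r≢0 ▶ shear u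
  fixes-O⇒dilation-shear φ φ∈G fixesO = straighten (shear-to-∞ σ σ≢O)
    where
    σ = proj₁ (imageParameter φ φ∈G ∞)
    ∞↦σ : Maps φ ∞ σ
    ∞↦σ = proj₂ (imageParameter φ φ∈G ∞)
    ∞≢O : ∞ ≢ O
    ∞≢O ()
    σ≢O : σ ≢ O
    σ≢O σ≡O = ∞≢O (maps-injective (subst (Maps φ ∞) σ≡O ∞↦σ) fixesO)
    straighten : (∃ λ u → Maps (shear u) σ ∞) →
      ∃ λ r → ∃₂ λ (r≢0 : r ≢ 0#) u → ∀ ℓ → ℓ ▶ φ ≅ ℓ ▶ dilation r r≢0 ▶ shear u
    straighten (u , σ↦∞) = conclude (diagonal (φ ⊚ shear u) (⊚∈G φ (shear u) φ∈G (shear∈G u))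
      (Maps.image-∼ (maps-⊚ fixesO (shear-O u))) (Maps.image-∼ (maps-⊚ ∞↦σ σ↦∞)))
      where
      conclude : (∃₂ λ r d → r ≢ 0# × (∀ i j → matrix (φ ⊚ shear u) i j ≡ d * sym³ r 0# 0# 1# i j)) →
        ∃ λ r → ∃₂ λ (r≢0 : r ≢ 0#) u → ∀ ℓ → ℓ ▶ φ ≅ ℓ ▶ dilation r r≢0 ▶ shear u
      conclude (r , d , r≢0 , e) = r , r≢0 , - u , λ ℓ →
        ≅-trans (≅-sym (shear-shear⁻ (ℓ ▶ φ) u)) (▶-cong (shear (- u))
          (≅-trans (≅-sym (▶-⊚ ℓ φ (shear u))) (scalar⇒▶≅ ℓ (φ ⊚ shear u) (dilation r r≢0) d e)))

  -- Lines in standard position with respect to P O and its osculating plane,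
  -- as a family invariant under the stabilizer of P O, which is transitive on it.
  record Family : Set₁ where
    no-eta-equality
    field
      Member  : Pred Line 0ℓ
      respect : ∀ {ℓ m} → ℓ ≅ m → Member ℓ → Member m
      dilate  : ∀ {ℓ} r r≢0 → Member ℓ → Member (ℓ ▶ dilation r r≢0)
      shift   : ∀ {ℓ} u → Member ℓ → Member (ℓ ▶ shear u)

    fixes-O : ∀ {ℓ} φ → φ ∈G → Maps φ O O → Member ℓ → Member (ℓ ▶ φ)
    fixes-O {ℓ} φ φ∈G e ℓ∈ = let (r , r≢0 , u , h) = fixes-O⇒dilation-shear φ φ∈G e in
      respect (≅-sym (h ℓ)) (shift u (dilate r r≢0 ℓ∈))

    Based : Pred Line 0ℓ
    Based ℓ = ∃ λ τ → Member (ℓ ▶ move τ)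

    Based-respect : ∀ {ℓ m} → ℓ ≅ m → Based ℓ → Based m
    Based-respect ℓ≅m (τ , h) = τ , respect (▶-cong (move τ) ℓ≅m) h

    -- If φ takes `P τ` to `P σ`, then the composite of `move τ ⁻¹`, φ and `move σ` fixes `P O` and
    -- therefore preserves the members.
    Based-invariant : ∀ {ℓ} φ → φ ∈G → Based ℓ → Based (ℓ ▶ φ)
    Based-invariant {ℓ} φ φ∈G (τ , h) = σ , respect
      (≅-trans (▶-⊚ (ℓ ▶ move τ) (move τ ⁻¹ ⊚ φ) (move σ)) (▶-cong (move σ)
        (≅-trans (▶-⊚ (ℓ ▶ move τ) (move τ ⁻¹) φ) (▶-cong φ (▶-⁻¹ ℓ (move τ))))))
      (fixes-O χ (⊚∈G (move τ ⁻¹ ⊚ φ) (move σ) (⊚∈G (move τ ⁻¹) φ (⁻¹∈G (move τ) (move∈G τ)) φ∈G) (move∈G σ))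
        (maps-⊚ (maps-⊚ (maps-⁻¹ (maps-move τ)) (proj₂ image)) (maps-move σ)) h)
      where
      image = imageParameter φ φ∈G τ
      σ = proj₁ image
      χ = (move τ ⁻¹ ⊚ φ) ⊚ move σ

    Transitive : Set
    Transitive = ∃ λ base → ∀ {ℓ} → Member ℓ → ∃ λ φ → φ ∈G × ℓ ▶ φ ≅ base

    Based⇒Orbit : Transitive → ∀ {ℓ} → Based ℓ → Based ≐ Orbit ℓ
    Based⇒Orbit (base , reduce) {ℓ} ℓ-based = connect , λ { {m} (φ , φ∈G , e) → Based-respect (≅-trans (▶≅▸ ℓ φ) (equal e)) (Based-invariant φ φ∈G ℓ-based) }
      where
      to-base : ∀ {m} → Based m → ∃ λ φ → φ ∈G × m ▶ φ ≅ base
      to-base {m} (τ , h) = let (φ , φ∈G , e) = reduce h in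
        move τ ⊚ φ , ⊚∈G (move τ) φ (move∈G τ) φ∈G , ≅-trans (▶-⊚ m (move τ) φ) e
      connect : ∀ {m} → Based m → Orbit ℓ m
      connect {m} m-based = let (φ , φ∈G , e) = to-base ℓ-based ; (ψ , ψ∈G , f) = to-base m-based in
        φ ⊚ ψ ⁻¹ , ⊚∈G φ (ψ ⁻¹) φ∈G (⁻¹∈G ψ ψ∈G) , ≅⇒≈
          (≅-trans (≅-sym (▶≅▸ ℓ (φ ⊚ ψ ⁻¹))) (≅-trans (▶-⊚ ℓ φ (ψ ⁻¹)) (≅-trans (▶-cong (ψ ⁻¹) (≅-trans e (≅-sym f))) (▶-⁻¹ m ψ))))

    BaseUnique : Set
    BaseUnique = ∀ {ℓ σ τ} → Member (ℓ ▶ move σ) → Member (ℓ ▶ move τ) → σ ≡ τ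

    record Listing (n : ℕ) : Set₁ where
      field
        {Index}    : Set
        index      : Fin n ↔ Index
        line       : Index → Line
        member     : ∀ a → Member (line a)
        separated  : ∀ {a b} → line a ≅ line b → a ≡ b
        exhaustive : ∀ {ℓ} → Member ℓ → ∃ λ a → line a ≅ ℓ

    Based-size : BaseUnique → ∀ {n} → Listing n → HasSize Based (ℕ.suc q ℕ.* n)
    Based-size base-unique listing = record
      { to = λ i → f (Inverse.to enumeration i) , f-based (Inverse.to enumeration i)
      ; cong = λ { {i} refl → ≅⇒≈ (≅-refl {f (Inverse.to enumeration i)}) }
      ; bijective = (λ e → to-injective enumeration (f-injective (equal e)))
                  , λ { (ℓ , ℓ-based) → let (a , e) = f-surjective ℓ-based in
                        Inverse.from enumeration a , λ { refl → ≅⇒≈ (≅-trans (≡⇒≅ (cong f (Inverse.strictlyInverseˡ enumeration a))) e) } }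
      }
      where
      open Listing listing
      enumeration : Fin _ ↔ (Parameter × Index)
      enumeration = ×↔ (Maybe↔ cardinality) index
      ≡⇒≅ : ∀ {ℓ m} → ℓ ≡ m → ℓ ≅ m
      ≡⇒≅ refl = ≅-refl
      f : Parameter × Index → Line
      f (τ , a) = line a ▶ move τ ⁻¹
      f-move : ∀ τ a → f (τ , a) ▶ move τ ≅ line a
      f-move τ a = ⁻¹-▶ (line a) (move τ)
      f-based : ∀ x → Based (f x)
      f-based (τ , a) = τ , respect (≅-sym (f-move τ a)) (member a)
      f-injective : ∀ {x y} → f x ≅ f y → x ≡ y
      f-injective {τ , a} {σ , b} e = same (base-unique {f (τ , a)} {τ} {σ}
        (respect (≅-sym (f-move τ a)) (member a)) (respect (≅-sym (≅-trans (▶-cong (move σ) e) (f-move σ b))) (member b))) e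
        where
        same : τ ≡ σ → f (τ , a) ≅ f (σ , b) → (τ , a) ≡ (σ , b)
        same refl e = cong (τ ,_) (separated (≅-trans (≅-sym (f-move τ a)) (≅-trans (▶-cong (move τ) e) (f-move τ b))))
      f-surjective : ∀ {ℓ} → Based ℓ → ∃ λ x → f x ≅ ℓ
      f-surjective {ℓ} (τ , h) = let (a , e) = exhaustive h in
        (τ , a) , ≅-trans (▶-cong (move τ ⁻¹) e) (▶-⁻¹ ℓ (move τ))

  HasSize-≐ : ∀ {S T n} → S ≐ T → HasSize S n → HasSize T n
  HasSize-≐ (S⊆T , T⊆S) b = record
    { to = λ i → proj₁ (to i) , S⊆T (proj₂ (to i))
    ; cong = cong-to
    ; bijective = (λ {x} {y} e → injective {x} {y} e) , λ { (ℓ , h) → surjective (ℓ , T⊆S h) }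
    }
    where open Bijection b renaming (cong to cong-to)

-- Families of lines in standard position

module Families {q} (5≤q : 5 ℕ.≤ q) (F : FiniteField q) where
  open FiniteField F
  open Arithmetic F
  open ProjectiveSpace F
  open TwistedCubic F
  open Linear F
  open Projective F
  open Projectivity
  open Action 5≤q F

  ⟪_,_,_,_⟫ : (x₀ x₁ x₂ x₃ : Carrier) → Vector₄
  ⟪ x₀ , x₁ , x₂ , x₃ ⟫ = x₀ Functional.∷ x₁ Functional.∷ x₂ Functional.∷ x₃ Functional.∷ Functional.[]

  e₀ e₁ e₂ e₃ : Vector₄
  e₀ = ⟪ 1# , 0# , 0# , 0# ⟫
  e₁ = ⟪ 0# , 1# , 0# , 0# ⟫
  e₂ = ⟪ 0# , 0# , 1# , 0# ⟫
  e₃ = ⟪ 0# , 0# , 0# , 1# ⟫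

  SpannedBy : (x v w : Vector₄) → Set
  SpannedBy x v w = ∃₂ λ α β → ∀ k → x k ≡ α * v k + β * w k

  spanned∈ : ∀ {ℓ x v w} → SpannedBy x v w → v ∈ᵥ ℓ → w ∈ᵥ ℓ → x ∈ᵥ ℓ
  spanned∈ (α , β , h) v∈ℓ w∈ℓ = combination∈ α β v∈ℓ w∈ℓ h

  -- A shape is kept from unfolding (no eta, inlined constructor): conversion
  -- checking would otherwise compare the proof fields.
  record Shape : Set₁ where
    no-eta-equality
    constructor mkShape
    field
      Parameters : Set
      v w        : Parameters → Vector₄
      i j        : Fin 4
      isEchelon  : ∀ a → Echelon i j (v a) (w a)
      dilateᵖ    : ∀ r → r ≢ 0# → Parameters → Parameters
      v-dilate   : ∀ r r≢0 a → SpannedBy (v (dilateᵖ r r≢0 a)) (v a ⊙ sym³ r 0# 0# 1#) (w a ⊙ sym³ r 0# 0# 1#)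
      w-dilate   : ∀ r r≢0 a → SpannedBy (w (dilateᵖ r r≢0 a)) (v a ⊙ sym³ r 0# 0# 1#) (w a ⊙ sym³ r 0# 0# 1#)
      shiftᵖ     : Carrier → Parameters → Parameters
      v-shift    : ∀ u a → SpannedBy (v (shiftᵖ u a)) (v a ⊙ sym³ 1# 0# u 1#) (w a ⊙ sym³ 1# 0# u 1#)
      w-shift    : ∀ u a → SpannedBy (w (shiftᵖ u a)) (v a ⊙ sym³ 1# 0# u 1#) (w a ⊙ sym³ 1# 0# u 1#)

  {-# INLINE mkShape #-}

  module ShapeTheory (shape : Shape) where
    open Shape shape public

    record HasBasis (ℓ : Line) (a : Parameters) : Set where
      constructor basis
      field
        v∈ : v a ∈ᵥ ℓ
        w∈ : w a ∈ᵥ ℓ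

    hasBasis-≅ : ∀ {ℓ m a} → HasBasis ℓ a → HasBasis m a → ℓ ≅ m
    hasBasis-≅ {a = a} (basis v∈ℓ w∈ℓ) (basis v∈m w∈m) = echelon-≅ (isEchelon a) v∈ℓ w∈ℓ v∈m w∈m

    hasBasis-dilate : ∀ {ℓ a} r r≢0 → HasBasis ℓ a → HasBasis (ℓ ▶ dilation r r≢0) (dilateᵖ r r≢0 a)
    hasBasis-dilate {ℓ} {a} r r≢0 (basis v∈ w∈) =
      basis (spanned∈ (v-dilate r r≢0 a) (image∈ (dilation r r≢0) v∈) (image∈ (dilation r r≢0) w∈))
            (spanned∈ (w-dilate r r≢0 a) (image∈ (dilation r r≢0) v∈) (image∈ (dilation r r≢0) w∈))

    hasBasis-shift : ∀ {ℓ a} u → HasBasis ℓ a → HasBasis (ℓ ▶ shear u) (shiftᵖ u a)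
    hasBasis-shift {ℓ} {a} u (basis v∈ w∈) =
      basis (spanned∈ (v-shift u a) (image∈ (shear u) v∈) (image∈ (shear u) w∈))
            (spanned∈ (w-shift u a) (image∈ (shear u) v∈) (image∈ (shear u) w∈))

    family : Family
    family = record
      { Member  = λ ℓ → ∃ (HasBasis ℓ)
      ; respect = λ { ℓ≅m (a , basis v∈ w∈) → a , basis (≅⇒⊑ ℓ≅m v∈) (≅⇒⊑ ℓ≅m w∈) }
      ; dilate  = λ { r r≢0 (a , h) → dilateᵖ r r≢0 a , hasBasis-dilate r r≢0 h }
      ; shift   = λ { u (a , h) → shiftᵖ u a , hasBasis-shift u h }
      }

    open Family family public

    lineOf : Parameters → Line
    lineOf a = echelonLine i j (isEchelon a)

    lineOf-basis : ∀ a → HasBasis (lineOf a) a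
    lineOf-basis a = basis (pt₁∈ (lineOf a)) (pt₂∈ (lineOf a))

    lineOf-separated : ∀ {a b} → lineOf a ≅ lineOf b → (∀ k → v a k ≡ v b k) × (∀ k → w a k ≡ w b k)
    lineOf-separated {a} {b} e =
      (λ k → trans (coordinates (HasBasis.v∈ (lineOf-basis a)) k)
        (solve F (v a i ∷ v a j ∷ v b k ∷ w b k ∷ []) (λ x y v w → x :* v :+ y :* w := v given v ∶ x := :1 and w ∶ y := :0 and [])
          refl (Echelon.vᵢ≡1 (isEchelon a)) (Echelon.vⱼ≡0 (isEchelon a)))) ,
      (λ k → trans (coordinates (HasBasis.w∈ (lineOf-basis a)) k)
        (solve F (w a i ∷ w a j ∷ v b k ∷ w b k ∷ []) (λ x y v w → x :* v :+ y :* w := w given v ∶ x := :0 and w ∶ y := :1 and [])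
          refl (Echelon.wᵢ≡0 (isEchelon a)) (Echelon.wⱼ≡1 (isEchelon a))))
      where
      coordinates : ∀ {u} → u ∈ᵥ lineOf a → ∀ k → u k ≡ u i * v b k + u j * w b k
      coordinates u∈ = echelon-coordinates (isEchelon b) (HasBasis.v∈ (lineOf-basis b)) (HasBasis.w∈ (lineOf-basis b)) (≅⇒⊑ e u∈)

    transitive : ∀ a₀ → (∀ a → ∃₂ λ u r → ∃ λ r≢0 → let b = dilateᵖ r r≢0 (shiftᵖ u a) in
      (∀ k → v a₀ k ≡ v b k) × (∀ k → w a₀ k ≡ w b k)) → Transitive
    transitive a₀ reduce = lineOf a₀ , λ { (a , h) → let (u , r , r≢0 , v≗ , w≗) = reduce a in moved-by u r r≢0 v≗ w≗ h }
      where
      moved-by : ∀ {ℓ a} u r r≢0 → let b = dilateᵖ r r≢0 (shiftᵖ u a) in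
        (∀ k → v a₀ k ≡ v b k) → (∀ k → w a₀ k ≡ w b k) → HasBasis ℓ a → ∃ λ φ → φ ∈G × ℓ ▶ φ ≅ lineOf a₀
      moved-by {ℓ} {a} u r r≢0 v≗ w≗ h = shear u ⊚ dilation r r≢0 , ⊚∈G (shear u) (dilation r r≢0) (shear∈G u) (dilation∈G r r≢0) ,
        ≅-trans (▶-⊚ ℓ (shear u) (dilation r r≢0)) (≅-sym (hasBasis-≅ (lineOf-basis a₀) (basis (≗∈ v∈ v≗) (≗∈ w∈ w≗))))
        where open HasBasis (hasBasis-dilate r r≢0 (hasBasis-shift u h))

    listing : ∀ {n} {B : Set} → Fin n ↔ B → (toParameters : B → Parameters) →
      (∀ {a b} → (∀ k → v (toParameters a) k ≡ v (toParameters b) k) → (∀ k → w (toParameters a) k ≡ w (toParameters b) k) → a ≡ b) →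
      (∀ a → ∃ λ b → (∀ k → v (toParameters b) k ≡ v a k) × (∀ k → w (toParameters b) k ≡ w a k)) →
      Listing n
    listing enumeration p separate cover = record
      { index      = enumeration
      ; line       = lineOf ∘ p
      ; member     = λ b → p b , lineOf-basis (p b)
      ; separated  = λ e → let (v≗ , w≗) = lineOf-separated e in separate v≗ w≗
      ; exhaustive = λ { (a , basis v∈ w∈) → let (b , v≗ , w≗) = cover a in
          b , hasBasis-≅ (lineOf-basis (p b)) (basis (≗∈ v∈ v≗) (≗∈ w∈ w≗)) }
      }

    -- `move O` is the translation by `- 0#`, which is not the identity by definition; it is enough
    -- that it fixes `P O`.
    based : ∀ {ℓ a} → HasBasis ℓ a → Based ℓ
    based {a = a} h = O , fixes-O (move O) (move∈G O) (maps-move O) (a , h)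

    ≐Based⇒IsOrbit : Transitive → Parameters → ∀ {R} → R ≐ Based → IsOrbit R
    ≐Based⇒IsOrbit transitive a {R} (R⊆ , ⊆R) = let (B⊆ , ⊆B) = Based⇒Orbit transitive (based (lineOf-basis a)) in
      lineOf a , (λ {m} r → B⊆ {m} (R⊆ {m} r)) , (λ {m} o → ⊆R {m} (⊆B {m} o))

    orbit-size : BaseUnique → ∀ {ℓ n m} → Based ≐ Orbit ℓ → Listing n → ℕ.suc q ℕ.* n ≡ m → HasSize (Orbit ℓ) m
    orbit-size base-unique {ℓ} B≐ listing e = subst (HasSize (Orbit ℓ)) e (HasSize-≐ B≐ (Based-size base-unique listing))

  private
    :e₂ :e₃ : ∀ {n} → Fin 4 → Expr ℤ n
    :e₂ = :vector :0 :0 :1 :0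
    :e₃ = :vector :0 :0 :0 :1

    _:⊙_ : ∀ {n} → (Fin 4 → Expr ℤ n) → (Fin 4 → Fin 4 → Expr ℤ n) → Fin 4 → Expr ℤ n
    (x :⊙ A) j = :∑ (λ i → x i :* A i j)

    :dilation :shear : ∀ {n} → Expr ℤ n → Fin 4 → Fin 4 → Expr ℤ n
    :dilation r = :sym³ r :0 :0 :1
    :shear u = :sym³ :1 :0 u :1

    e₃-dilate : ∀ r w → SpannedBy e₃ (e₃ ⊙ sym³ r 0# 0# 1#) w
    e₃-dilate r w = 1# , 0# , coordinatewise (solve F (ρ (# 0)) (claim (# 0)) refl) (solve F (ρ (# 1)) (claim (# 1)) refl)
                                       (solve F (ρ (# 2)) (claim (# 2)) refl) (solve F (ρ (# 3)) (claim (# 3)) refl)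
      where
      ρ : Fin 4 → Vec Carrier 2
      ρ k = r ∷ w k ∷ []
      claim : Fin 4 → Expr ℤ 2 → Expr ℤ 2 → Claim 2
      claim k r w = :e₃ k := :1 :* (:e₃ :⊙ :dilation r) k :+ :0 :* w given []

    e₃-shift : ∀ u w → SpannedBy e₃ (e₃ ⊙ sym³ 1# 0# u 1#) w
    e₃-shift u w = 1# , 0# , coordinatewise (solve F (ρ (# 0)) (claim (# 0)) refl) (solve F (ρ (# 1)) (claim (# 1)) refl)
                                       (solve F (ρ (# 2)) (claim (# 2)) refl) (solve F (ρ (# 3)) (claim (# 3)) refl)
      where
      ρ : Fin 4 → Vec Carrier 2
      ρ k = u ∷ w k ∷ []
      claim : Fin 4 → Expr ℤ 2 → Expr ℤ 2 → Claim 2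
      claim k u w = :e₃ k := :1 :* (:e₃ :⊙ :shear u) k :+ :0 :* w given []

  -- Lines through P O outside its osculating plane. For ρ = 0 these are the
  -- real chords through P O.
  secantShape : Carrier → Shape
  secantShape ρ = record
    { Parameters = Carrier × ∃ λ y → y ≢ 0#
    ; v = λ _ → e₃
    -- Modulo `e₃` the points of 𝒞 other than `P O` are (1, x, x², 0), so ρy² is the deviation from
    -- a chord. A shear by u adds u to x and keeps y; a dilation by r divides both by r, so the
    -- square class of the deviation is invariant.
    ; w = λ (x , y , _) → ⟪ 1# , x , x * x + ρ * (y * y) , 0# ⟫
    ; i = # 3 ; j = # 0
    ; isEchelon = λ _ → echelon refl refl refl refl
    ; dilateᵖ = λ { r r≢0 (x , y , y≢0) → proj₁ (inverse r r≢0) * x , proj₁ (inverse r r≢0) * y , *-nonzero (unit⇒nonzeroʳ (proj₂ (inverse r r≢0))) y≢0 }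
    ; v-dilate = λ { r r≢0 (x , y , _) → e₃-dilate r _ }
    ; w-dilate = λ { r r≢0 (x , y , _) → dil r (proj₁ (inverse r r≢0)) x y (proj₂ (inverse r r≢0)) }
    ; shiftᵖ = λ { u (x , y , y≢0) → u + x , y , y≢0 }
    ; v-shift = λ { u (x , y , _) → e₃-shift u _ }
    ; w-shift = λ { u (x , y , _) → shr u x y }
    }
    where
    :w : ∀ {n} → (ρ x y : Expr ℤ n) → Fin 4 → Expr ℤ n
    :w ρ x y = :vector :1 x (x :* x :+ ρ :* (y :* y)) :0
    dil : ∀ r z x y → r * z ≡ 1# → SpannedBy ⟪ 1# , z * x , z * x * (z * x) + ρ * (z * y * (z * y)) , 0# ⟫
      (e₃ ⊙ sym³ r 0# 0# 1#) (⟪ 1# , x , x * x + ρ * (y * y) , 0# ⟫ ⊙ sym³ r 0# 0# 1#)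
    dil r z x y rz≡1 = 0# , z * z * z , coordinatewise (solve F vars (claim (# 0)) refl rz≡1) (solve F vars (claim (# 1)) refl rz≡1)
                                                      (solve F vars (claim (# 2)) refl rz≡1) (solve F vars (claim (# 3)) refl rz≡1)
      where
      vars = ρ ∷ r ∷ z ∷ x ∷ y ∷ []
      factor : Expr ℤ 5 → Expr ℤ 5 → Expr ℤ 5 → Expr ℤ 5 → Expr ℤ 5 → Fin 4 → Expr ℤ 5
      factor ρ r z x y = :vector (:- (:1 :+ r :* z :+ r :* z :* r :* z)) (:- (z :* x :* (:1 :+ r :* z))) (:- (z :* z :* (x :* x :+ ρ :* (y :* y)))) :0
      claim : Fin 4 → Expr ℤ 5 → Expr ℤ 5 → Expr ℤ 5 → Expr ℤ 5 → Expr ℤ 5 → Claim 5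
      claim k ρ r z x y = :w ρ (z :* x) (z :* y) k := :0 :* (:e₃ :⊙ :dilation r) k :+ z :* z :* z :* (:w ρ x y :⊙ :dilation r) k
        given factor ρ r z x y k ∶ r :* z := :1 and []
    shr : ∀ u x y → SpannedBy ⟪ 1# , u + x , (u + x) * (u + x) + ρ * (y * y) , 0# ⟫
      (e₃ ⊙ sym³ 1# 0# u 1#) (⟪ 1# , x , x * x + ρ * (y * y) , 0# ⟫ ⊙ sym³ 1# 0# u 1#)
    shr u x y = - k , 1# , coordinatewise (solve F vars (claim (# 0)) refl) (solve F vars (claim (# 1)) refl)
                                          (solve F vars (claim (# 2)) refl) (solve F vars (claim (# 3)) refl)
      where
      vars = ρ ∷ u ∷ x ∷ y ∷ []
      :k : Expr ℤ 4 → Expr ℤ 4 → Expr ℤ 4 → Expr ℤ 4 → Expr ℤ 4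
      :k ρ u x y = (:w ρ x y :⊙ :shear u) (# 3)
      k = (⟪ 1# , x , x * x + ρ * (y * y) , 0# ⟫ ⊙ sym³ 1# 0# u 1#) (# 3)
      claim : Fin 4 → Expr ℤ 4 → Expr ℤ 4 → Expr ℤ 4 → Expr ℤ 4 → Claim 4
      claim i ρ u x y = :w ρ (u :+ x) y i := :- :k ρ u x y :* (:e₃ :⊙ :shear u) i :+ :1 :* (:w ρ x y :⊙ :shear u) i given []

  tangentShape : Shape
  tangentShape = record
    { Parameters = ⊤
    ; v = λ _ → e₃
    ; w = λ _ → e₂
    ; i = # 3 ; j = # 2
    ; isEchelon = λ _ → echelon refl refl refl refl
    ; dilateᵖ = λ _ _ _ → tt
    ; v-dilate = λ r r≢0 _ → e₃-dilate r _
    ; w-dilate = λ r r≢0 _ → dil r (proj₁ (inverse r r≢0)) (proj₂ (inverse r r≢0))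
    ; shiftᵖ = λ _ _ → tt
    ; v-shift = λ u _ → e₃-shift u _
    ; w-shift = λ u _ → shr u
    }
    where
    dil : ∀ r z → r * z ≡ 1# → SpannedBy e₂ (e₃ ⊙ sym³ r 0# 0# 1#) (e₂ ⊙ sym³ r 0# 0# 1#)
    dil r z h = 0# , z , coordinatewise
      (solve F vars (claim (# 0)) refl h) (solve F vars (claim (# 1)) refl h)
      (solve F vars (claim (# 2)) refl h) (solve F vars (claim (# 3)) refl h)
      where
      vars = r ∷ z ∷ []
      factor : Fin 4 → Expr ℤ 2 → Expr ℤ 2 → Expr ℤ 2
      factor k r z = :vector (:0) (:0) (:- :1) (:0) k
      claim : Fin 4 → Expr ℤ 2 → Expr ℤ 2 → Claim 2
      claim k r z = :e₂ k := :0 :* (:e₃ :⊙ :dilation r) k :+ z :* (:e₂ :⊙ :dilation r) k given factor k r z ∶ r :* z := :1 and []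
    shr : ∀ u → SpannedBy e₂ (e₃ ⊙ sym³ 1# 0# u 1#) (e₂ ⊙ sym³ 1# 0# u 1#)
    shr u = - (3 · u) , 1# , coordinatewise
      (solve F vars (claim (# 0)) refl) (solve F vars (claim (# 1)) refl)
      (solve F vars (claim (# 2)) refl) (solve F vars (claim (# 3)) refl)
      where
      vars = u ∷ []
      claim : Fin 4 → Expr ℤ 1 → Claim 1
      claim k u = :e₂ k := :- (3 :· u) :* (:e₃ :⊙ :shear u) k :+ :1 :* (:e₂ :⊙ :shear u) k given []

  -- Lines through P O in its osculating plane, other than the tangent.
  planarShape : (Q : Pred Carrier 0ℓ) → (∀ {x} z → z ≢ 0# → Q x → Q (z * x)) → (∀ {x} u → Q x → Q (2 · u + x)) → Shape
  planarShape Q Q-scale Q-shift = record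
    { Parameters = ∃ Q
    ; v = λ _ → e₃
    ; w = λ (x , _) → ⟪ 0# , 1# , x , 0# ⟫
    ; i = # 3 ; j = # 1
    ; isEchelon = λ _ → echelon refl refl refl refl
    ; dilateᵖ = λ r r≢0 (x , Qx) → proj₁ (inverse r r≢0) * x , Q-scale _ (unit⇒nonzeroʳ (proj₂ (inverse r r≢0))) Qx
    ; v-dilate = λ r r≢0 _ → e₃-dilate r _
    ; w-dilate = λ r r≢0 (x , _) → dil r (proj₁ (inverse r r≢0)) x (proj₂ (inverse r r≢0))
    ; shiftᵖ = λ u (x , Qx) → 2 · u + x , Q-shift u Qx
    ; v-shift = λ u _ → e₃-shift u _
    ; w-shift = λ u (x , _) → shr u x
    }
    where
    :w : ∀ {n} → Expr ℤ n → Fin 4 → Expr ℤ n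
    :w x = :vector :0 :1 x :0
    dil : ∀ r z x → r * z ≡ 1# → SpannedBy ⟪ 0# , 1# , z * x , 0# ⟫ (e₃ ⊙ sym³ r 0# 0# 1#) (⟪ 0# , 1# , x , 0# ⟫ ⊙ sym³ r 0# 0# 1#)
    dil r z x h = 0# , z * z , coordinatewise
      (solve F vars (claim (# 0)) refl h) (solve F vars (claim (# 1)) refl h)
      (solve F vars (claim (# 2)) refl h) (solve F vars (claim (# 3)) refl h)
      where
      vars = r ∷ z ∷ x ∷ []
      factor : Fin 4 → Expr ℤ 3 → Expr ℤ 3 → Expr ℤ 3 → Expr ℤ 3
      factor k r z x = :vector (:0) (:- (:1 :+ r :* z)) (:- (z :* x)) (:0) k
      claim : Fin 4 → Expr ℤ 3 → Expr ℤ 3 → Expr ℤ 3 → Claim 3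
      claim k r z x = :w (z :* x) k := :0 :* (:e₃ :⊙ :dilation r) k :+ (z :* z) :* (:w x :⊙ :dilation r) k given factor k r z x ∶ r :* z := :1 and []
    shr : ∀ u x → SpannedBy ⟪ 0# , 1# , 2 · u + x , 0# ⟫ (e₃ ⊙ sym³ 1# 0# u 1#) (⟪ 0# , 1# , x , 0# ⟫ ⊙ sym³ 1# 0# u 1#)
    shr u x = - (3 · (u * u) + 3 · (u * x)) , 1# , coordinatewise
      (solve F vars (claim (# 0)) refl) (solve F vars (claim (# 1)) refl)
      (solve F vars (claim (# 2)) refl) (solve F vars (claim (# 3)) refl)
      where
      vars = u ∷ x ∷ []
      claim : Fin 4 → Expr ℤ 2 → Expr ℤ 2 → Claim 2
      claim k u x = :w (2 :· u :+ x) k := :- (3 :· (u :* u) :+ 3 :· (u :* x)) :* (:e₃ :⊙ :shear u) k :+ :1 :* (:w x :⊙ :shear u) k given []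

  -- Lines in the osculating plane at P O, not through P O. For ρ = 0 these are
  -- the real axes in that plane.
  axialShape : Carrier → Shape
  axialShape ρ = record
    { Parameters = Carrier × ∃ λ y → y ≢ 0#
    -- Dual to the form used for secants: again a shear by u adds u to x and keeps y, and a dilation
    -- by r divides both by r.
    ; v = λ (x , y , _) → ⟪ 0# , 1# , 0# , - (3 · (x * x + ρ * (y * y))) ⟫
    ; w = λ (x , _) → ⟪ 0# , 0# , 1# , 3 · x ⟫
    ; i = # 1 ; j = # 2
    ; isEchelon = λ _ → echelon refl refl refl refl
    ; dilateᵖ = λ r r≢0 (x , y , y≢0) → proj₁ (inverse r r≢0) * x , proj₁ (inverse r r≢0) * y , *-nonzero (unit⇒nonzeroʳ (proj₂ (inverse r r≢0))) y≢0
    ; v-dilate = λ r r≢0 (x , y , _) → v-dil r (proj₁ (inverse r r≢0)) x y (proj₂ (inverse r r≢0))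
    ; w-dilate = λ r r≢0 (x , y , _) → w-dil r (proj₁ (inverse r r≢0)) x y (proj₂ (inverse r r≢0))
    ; shiftᵖ = λ u (x , y , y≢0) → u + x , y , y≢0
    ; v-shift = λ u (x , y , _) → v-shr u x y
    ; w-shift = λ u (x , y , _) → w-shr u x y
    }
    where
    :v :w : ∀ {n} → (ρ x y : Expr ℤ n) → Fin 4 → Expr ℤ n
    :v ρ x y = :vector :0 :1 :0 (:- (3 :· (x :* x :+ ρ :* (y :* y))))
    :w ρ x y = :vector :0 :0 :1 (3 :· x)
    v-dil : ∀ r z x y → r * z ≡ 1# → SpannedBy ⟪ 0# , 1# , 0# , - (3 · (z * x * (z * x) + ρ * (z * y * (z * y)))) ⟫ (⟪ 0# , 1# , 0# , - (3 · (x * x + ρ * (y * y))) ⟫ ⊙ sym³ r 0# 0# 1#) (⟪ 0# , 0# , 1# , 3 · x ⟫ ⊙ sym³ r 0# 0# 1#)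
    v-dil r z x y h = z * z , 0# , coordinatewise
      (solve F vars (claim (# 0)) refl h) (solve F vars (claim (# 1)) refl h)
      (solve F vars (claim (# 2)) refl h) (solve F vars (claim (# 3)) refl h)
      where
      vars = ρ ∷ r ∷ z ∷ x ∷ y ∷ []
      factor : Fin 4 → Expr ℤ 5 → Expr ℤ 5 → Expr ℤ 5 → Expr ℤ 5 → Expr ℤ 5 → Expr ℤ 5
      factor k ρ r z x y = :vector (:0) (:- (:1 :+ r :* z)) (:0) (:0) k
      claim : Fin 4 → Expr ℤ 5 → Expr ℤ 5 → Expr ℤ 5 → Expr ℤ 5 → Expr ℤ 5 → Claim 5
      claim k ρ r z x y = :v ρ (z :* x) (z :* y) k := (z :* z) :* (:v ρ x y :⊙ :dilation r) k :+ :0 :* (:w ρ x y :⊙ :dilation r) k given factor k ρ r z x y ∶ r :* z := :1 and []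
    w-dil : ∀ r z x y → r * z ≡ 1# → SpannedBy ⟪ 0# , 0# , 1# , 3 · (z * x) ⟫ (⟪ 0# , 1# , 0# , - (3 · (x * x + ρ * (y * y))) ⟫ ⊙ sym³ r 0# 0# 1#) (⟪ 0# , 0# , 1# , 3 · x ⟫ ⊙ sym³ r 0# 0# 1#)
    w-dil r z x y h = 0# , z , coordinatewise
      (solve F vars (claim (# 0)) refl h) (solve F vars (claim (# 1)) refl h)
      (solve F vars (claim (# 2)) refl h) (solve F vars (claim (# 3)) refl h)
      where
      vars = ρ ∷ r ∷ z ∷ x ∷ y ∷ []
      factor : Fin 4 → Expr ℤ 5 → Expr ℤ 5 → Expr ℤ 5 → Expr ℤ 5 → Expr ℤ 5 → Expr ℤ 5
      factor k ρ r z x y = :vector (:0) (:0) (:- :1) (:0) k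
      claim : Fin 4 → Expr ℤ 5 → Expr ℤ 5 → Expr ℤ 5 → Expr ℤ 5 → Expr ℤ 5 → Claim 5
      claim k ρ r z x y = :w ρ (z :* x) (z :* y) k := :0 :* (:v ρ x y :⊙ :dilation r) k :+ z :* (:w ρ x y :⊙ :dilation r) k given factor k ρ r z x y ∶ r :* z := :1 and []
    v-shr : ∀ u x y → SpannedBy ⟪ 0# , 1# , 0# , - (3 · ((u + x) * (u + x) + ρ * (y * y))) ⟫ (⟪ 0# , 1# , 0# , - (3 · (x * x + ρ * (y * y))) ⟫ ⊙ sym³ 1# 0# u 1#) (⟪ 0# , 0# , 1# , 3 · x ⟫ ⊙ sym³ 1# 0# u 1#)
    v-shr u x y = 1# , - (2 · u) , coordinatewise
      (solve F vars (claim (# 0)) refl) (solve F vars (claim (# 1)) refl)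
      (solve F vars (claim (# 2)) refl) (solve F vars (claim (# 3)) refl)
      where
      vars = ρ ∷ u ∷ x ∷ y ∷ []
      claim : Fin 4 → Expr ℤ 4 → Expr ℤ 4 → Expr ℤ 4 → Expr ℤ 4 → Claim 4
      claim k ρ u x y = :v ρ (u :+ x) y k := :1 :* (:v ρ x y :⊙ :shear u) k :+ :- (2 :· u) :* (:w ρ x y :⊙ :shear u) k given []
    w-shr : ∀ u x y → SpannedBy ⟪ 0# , 0# , 1# , 3 · (u + x) ⟫ (⟪ 0# , 1# , 0# , - (3 · (x * x + ρ * (y * y))) ⟫ ⊙ sym³ 1# 0# u 1#) (⟪ 0# , 0# , 1# , 3 · x ⟫ ⊙ sym³ 1# 0# u 1#)
    w-shr u x y = 0# , 1# , coordinatewise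
      (solve F vars (claim (# 0)) refl) (solve F vars (claim (# 1)) refl)
      (solve F vars (claim (# 2)) refl) (solve F vars (claim (# 3)) refl)
      where
      vars = ρ ∷ u ∷ x ∷ y ∷ []
      claim : Fin 4 → Expr ℤ 4 → Expr ℤ 4 → Expr ℤ 4 → Expr ℤ 4 → Claim 4
      claim k ρ u x y = :w ρ (u :+ x) y k := :0 :* (:v ρ x y :⊙ :shear u) k :+ :1 :* (:w ρ x y :⊙ :shear u) k given []

  module CharacteristicThree (3≡0 : 3 · 1# ≡ 0#) where

    private
      e₂-dilate : ∀ r z w₀ w₁ w₂ w₃ → r * z ≡ 1# → SpannedBy e₂ (e₂ ⊙ sym³ r 0# 0# 1#) (⟪ w₀ , w₁ , w₂ , w₃ ⟫ ⊙ sym³ r 0# 0# 1#)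
      e₂-dilate r z w₀ w₁ w₂ w₃ h = z , 0# , coordinatewise
        (solve F vars (claim (# 0)) refl h) (solve F vars (claim (# 1)) refl h)
        (solve F vars (claim (# 2)) refl h) (solve F vars (claim (# 3)) refl h)
        where
        vars = r ∷ z ∷ w₀ ∷ w₁ ∷ w₂ ∷ w₃ ∷ []
        factor : Fin 4 → Expr ℤ 6 → Expr ℤ 6 → Expr ℤ 6 → Expr ℤ 6 → Expr ℤ 6 → Expr ℤ 6 → Expr ℤ 6
        factor k r z w₀ w₁ w₂ w₃ = :vector (:0) (:0) (:- :1) (:0) k
        claim : Fin 4 → Expr ℤ 6 → Expr ℤ 6 → Expr ℤ 6 → Expr ℤ 6 → Expr ℤ 6 → Expr ℤ 6 → Claim 6
        claim k r z w₀ w₁ w₂ w₃ = :e₂ k := z :* (:e₂ :⊙ :dilation r) k :+ :0 :* (:vector w₀ w₁ w₂ w₃ :⊙ :dilation r) k given factor k r z w₀ w₁ w₂ w₃ ∶ r :* z := :1 and []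
      e₂-shift : ∀ u w₀ w₁ w₂ w₃ → 3 · 1# ≡ 0# → SpannedBy e₂ (e₂ ⊙ sym³ 1# 0# u 1#) (⟪ w₀ , w₁ , w₂ , w₃ ⟫ ⊙ sym³ 1# 0# u 1#)
      e₂-shift u w₀ w₁ w₂ w₃ h = 1# , 0# , coordinatewise
        (solve F vars (claim (# 0)) refl h) (solve F vars (claim (# 1)) refl h)
        (solve F vars (claim (# 2)) refl h) (solve F vars (claim (# 3)) refl h)
        where
        vars = u ∷ w₀ ∷ w₁ ∷ w₂ ∷ w₃ ∷ []
        factor : Fin 4 → Expr ℤ 5 → Expr ℤ 5 → Expr ℤ 5 → Expr ℤ 5 → Expr ℤ 5 → Expr ℤ 5
        factor k u w₀ w₁ w₂ w₃ = :vector (:0) (:0) (:0) (:- u) k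
        claim : Fin 4 → Expr ℤ 5 → Expr ℤ 5 → Expr ℤ 5 → Expr ℤ 5 → Expr ℤ 5 → Claim 5
        claim k u w₀ w₁ w₂ w₃ = :e₂ k := :1 :* (:e₂ :⊙ :shear u) k :+ :0 :* (:vector w₀ w₁ w₂ w₃ :⊙ :shear u) k given factor k u w₀ w₁ w₂ w₃ ∶ 3 :· :1 := :0 and []

    -- In characteristic 3 the tangent at P O meets the axis of Γ in e₂. These
    -- are the lines through e₂ missing 𝒞, outside the osculating plane at P O.
    skewShape : Shape
    skewShape = record
      { Parameters = Carrier × ∃ λ y → y ≢ 0#
      ; v = λ _ → e₂
      -- Modulo `e₂` a point of 𝒞 other than `P O` is (1, x, 0, x³). Every element is a cube in
      -- exactly one way, so the last coordinate fixes x, and y measures the deviation from 𝒞.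
      ; w = λ (x , y , _) → ⟪ 1# , x + y , 0# , x ^ 3 ⟫
      ; i = # 2 ; j = # 0
      ; isEchelon = λ _ → echelon refl refl refl refl
      ; dilateᵖ = λ r r≢0 (x , y , y≢0) → proj₁ (inverse r r≢0) * x , proj₁ (inverse r r≢0) * y , *-nonzero (unit⇒nonzeroʳ (proj₂ (inverse r r≢0))) y≢0
      ; v-dilate = λ r r≢0 (x , y , _) → e₂-dilate r (proj₁ (inverse r r≢0)) _ _ _ _ (proj₂ (inverse r r≢0))
      ; w-dilate = λ r r≢0 (x , y , _) → dil r (proj₁ (inverse r r≢0)) x y (proj₂ (inverse r r≢0))
      ; shiftᵖ = λ u (x , y , y≢0) → u + x , y , y≢0
      ; v-shift = λ u (x , y , _) → e₂-shift u _ _ _ _ 3≡0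
      ; w-shift = λ u (x , y , _) → shr u x y 3≡0
      }
      where
      :w : ∀ {n} → (x y : Expr ℤ n) → Fin 4 → Expr ℤ n
      :w x y = :vector :1 (x :+ y) :0 (x :^ 3)
      dil : ∀ r z x y → r * z ≡ 1# → SpannedBy ⟪ 1# , z * x + z * y , 0# , (z * x) ^ 3 ⟫ (e₂ ⊙ sym³ r 0# 0# 1#) (⟪ 1# , x + y , 0# , x ^ 3 ⟫ ⊙ sym³ r 0# 0# 1#)
      dil r z x y h = 0# , z * z * z , coordinatewise
        (solve F vars (claim (# 0)) refl h) (solve F vars (claim (# 1)) refl h)
        (solve F vars (claim (# 2)) refl h) (solve F vars (claim (# 3)) refl h)
        where
        vars = r ∷ z ∷ x ∷ y ∷ []
        factor : Fin 4 → Expr ℤ 4 → Expr ℤ 4 → Expr ℤ 4 → Expr ℤ 4 → Expr ℤ 4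
        factor k r z x y = :vector (:- (:1 :+ r :* z :+ r :* z :* r :* z)) (:- (z :* (x :+ y) :* (:1 :+ r :* z))) (:0) (:0) k
        claim : Fin 4 → Expr ℤ 4 → Expr ℤ 4 → Expr ℤ 4 → Expr ℤ 4 → Claim 4
        claim k r z x y = :w (z :* x) (z :* y) k := :0 :* (:e₂ :⊙ :dilation r) k :+ (z :* z :* z) :* (:w x y :⊙ :dilation r) k given factor k r z x y ∶ r :* z := :1 and []
      shr : ∀ u x y → 3 · 1# ≡ 0# → SpannedBy ⟪ 1# , u + x + y , 0# , (u + x) ^ 3 ⟫ (e₂ ⊙ sym³ 1# 0# u 1#) (⟪ 1# , x + y , 0# , x ^ 3 ⟫ ⊙ sym³ 1# 0# u 1#)
      shr u x y h = - (u * u + 2 · (u * (x + y))) , 1# , coordinatewise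
        (solve F vars (claim (# 0)) refl h) (solve F vars (claim (# 1)) refl h)
        (solve F vars (claim (# 2)) refl h) (solve F vars (claim (# 3)) refl h)
        where
        vars = u ∷ x ∷ y ∷ []
        factor : Fin 4 → Expr ℤ 3 → Expr ℤ 3 → Expr ℤ 3 → Expr ℤ 3
        factor k u x y = :vector (:0) (:0) (:0) (u :^ 2 :* x :+ u :* x :^ 2 :- u :* u :* (x :+ y) :+ u :* (u :* u :+ 2 :· (u :* (x :+ y)))) k
        claim : Fin 4 → Expr ℤ 3 → Expr ℤ 3 → Expr ℤ 3 → Claim 3
        claim k u x y = :w (u :+ x) y k := :- (u :* u :+ 2 :· (u :* (x :+ y))) :* (:e₂ :⊙ :shear u) k :+ :1 :* (:w x y :⊙ :shear u) k given factor k u x y ∶ 3 :· :1 := :0 and []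

    -- Lines through e₂ missing 𝒞, in the osculating plane at P O.
    flatShape : Carrier → Shape
    flatShape ρ = record
      { Parameters = ∃ λ y → y ≢ 0#
      ; v = λ _ → e₂
      ; w = λ (y , _) → ⟪ 0# , ρ * (y * y) , 0# , 1# ⟫
      ; i = # 2 ; j = # 3
      ; isEchelon = λ _ → echelon refl refl refl refl
      ; dilateᵖ = λ r r≢0 (y , y≢0) → r * y , *-nonzero r≢0 y≢0
      ; v-dilate = λ r r≢0 (y , _) → e₂-dilate r (proj₁ (inverse r r≢0)) _ _ _ _ (proj₂ (inverse r r≢0))
      ; w-dilate = λ r r≢0 (y , _) → dil r y
      ; shiftᵖ = λ u (y , y≢0) → y , y≢0
      ; v-shift = λ u (y , _) → e₂-shift u _ _ _ _ 3≡0
      ; w-shift = λ u (y , _) → shr u y 3≡0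
      }
      where
      :w : ∀ {n} → (ρ y : Expr ℤ n) → Fin 4 → Expr ℤ n
      :w ρ y = :vector :0 (ρ :* (y :* y)) :0 :1
      dil : ∀ r y → SpannedBy ⟪ 0# , ρ * (r * y * (r * y)) , 0# , 1# ⟫ (e₂ ⊙ sym³ r 0# 0# 1#) (⟪ 0# , ρ * (y * y) , 0# , 1# ⟫ ⊙ sym³ r 0# 0# 1#)
      dil r y = 0# , 1# , coordinatewise
        (solve F vars (claim (# 0)) refl) (solve F vars (claim (# 1)) refl)
        (solve F vars (claim (# 2)) refl) (solve F vars (claim (# 3)) refl)
        where
        vars = ρ ∷ r ∷ y ∷ []
        claim : Fin 4 → Expr ℤ 3 → Expr ℤ 3 → Expr ℤ 3 → Claim 3
        claim k ρ r y = :w ρ (r :* y) k := :0 :* (:e₂ :⊙ :dilation r) k :+ :1 :* (:w ρ y :⊙ :dilation r) k given []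
      shr : ∀ u y → 3 · 1# ≡ 0# → SpannedBy ⟪ 0# , ρ * (y * y) , 0# , 1# ⟫ (e₂ ⊙ sym³ 1# 0# u 1#) (⟪ 0# , ρ * (y * y) , 0# , 1# ⟫ ⊙ sym³ 1# 0# u 1#)
      shr u y h = - (2 · (u * (ρ * (y * y)))) , 1# , coordinatewise
        (solve F vars (claim (# 0)) refl h) (solve F vars (claim (# 1)) refl h)
        (solve F vars (claim (# 2)) refl h) (solve F vars (claim (# 3)) refl h)
        where
        vars = ρ ∷ u ∷ y ∷ []
        factor : Fin 4 → Expr ℤ 3 → Expr ℤ 3 → Expr ℤ 3 → Expr ℤ 3
        factor k ρ u y = :vector (:0) (:0) (:0) (u :* u :* (ρ :* (y :* y))) k
        claim : Fin 4 → Expr ℤ 3 → Expr ℤ 3 → Expr ℤ 3 → Claim 3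
        claim k ρ u y = :w ρ y k := :- (2 :· (u :* (ρ :* (y :* y)))) :* (:e₂ :⊙ :shear u) k :+ :1 :* (:w ρ y :⊙ :shear u) k given factor k ρ u y ∶ 3 :· :1 := :0 and []

    -- A family with a single member, so that the general orbit argument also covers the axis of Γ.
    -- Shears preserve its span because 3 = 0.
    axisShape : Shape
    axisShape = record
      { Parameters = ⊤
      ; v = λ _ → e₁
      ; w = λ _ → e₂
      ; i = # 1 ; j = # 2
      ; isEchelon = λ _ → echelon refl refl refl refl
      ; dilateᵖ = λ _ _ _ → tt
      ; v-dilate = λ r r≢0 _ → v-dil r (proj₁ (inverse r r≢0)) (proj₂ (inverse r r≢0))
      ; w-dilate = λ r r≢0 _ → w-dil r (proj₁ (inverse r r≢0)) (proj₂ (inverse r r≢0))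
      ; shiftᵖ = λ _ _ → tt
      ; v-shift = λ u _ → v-shr u 3≡0
      ; w-shift = λ u _ → w-shr u 3≡0
      }
      where
      :e₁ : ∀ {n} → Fin 4 → Expr ℤ n
      :e₁ = :vector :0 :1 :0 :0
      v-dil : ∀ r z → r * z ≡ 1# → SpannedBy e₁ (e₁ ⊙ sym³ r 0# 0# 1#) (e₂ ⊙ sym³ r 0# 0# 1#)
      v-dil r z h = z * z , 0# , coordinatewise
        (solve F vars (claim (# 0)) refl h) (solve F vars (claim (# 1)) refl h)
        (solve F vars (claim (# 2)) refl h) (solve F vars (claim (# 3)) refl h)
        where
        vars = r ∷ z ∷ []
        factor : Fin 4 → Expr ℤ 2 → Expr ℤ 2 → Expr ℤ 2
        factor k r z = :vector (:0) (:- (:1 :+ r :* z)) (:0) (:0) k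
        claim : Fin 4 → Expr ℤ 2 → Expr ℤ 2 → Claim 2
        claim k r z = :e₁ k := (z :* z) :* (:e₁ :⊙ :dilation r) k :+ :0 :* (:e₂ :⊙ :dilation r) k given factor k r z ∶ r :* z := :1 and []
      w-dil : ∀ r z → r * z ≡ 1# → SpannedBy e₂ (e₁ ⊙ sym³ r 0# 0# 1#) (e₂ ⊙ sym³ r 0# 0# 1#)
      w-dil r z h = 0# , z , coordinatewise
        (solve F vars (claim (# 0)) refl h) (solve F vars (claim (# 1)) refl h)
        (solve F vars (claim (# 2)) refl h) (solve F vars (claim (# 3)) refl h)
        where
        vars = r ∷ z ∷ []
        factor : Fin 4 → Expr ℤ 2 → Expr ℤ 2 → Expr ℤ 2
        factor k r z = :vector (:0) (:0) (:- :1) (:0) k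
        claim : Fin 4 → Expr ℤ 2 → Expr ℤ 2 → Claim 2
        claim k r z = :e₂ k := :0 :* (:e₁ :⊙ :dilation r) k :+ z :* (:e₂ :⊙ :dilation r) k given factor k r z ∶ r :* z := :1 and []
      v-shr : ∀ u → 3 · 1# ≡ 0# → SpannedBy e₁ (e₁ ⊙ sym³ 1# 0# u 1#) (e₂ ⊙ sym³ 1# 0# u 1#)
      v-shr u h = 1# , - (2 · u) , coordinatewise
        (solve F vars (claim (# 0)) refl h) (solve F vars (claim (# 1)) refl h)
        (solve F vars (claim (# 2)) refl h) (solve F vars (claim (# 3)) refl h)
        where
        vars = u ∷ []
        factor : Fin 4 → Expr ℤ 1 → Expr ℤ 1
        factor k u = :vector (:0) (:0) (:0) (u :* u) k
        claim : Fin 4 → Expr ℤ 1 → Claim 1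
        claim k u = :e₁ k := :1 :* (:e₁ :⊙ :shear u) k :+ :- (2 :· u) :* (:e₂ :⊙ :shear u) k given factor k u ∶ 3 :· :1 := :0 and []
      w-shr : ∀ u → 3 · 1# ≡ 0# → SpannedBy e₂ (e₁ ⊙ sym³ 1# 0# u 1#) (e₂ ⊙ sym³ 1# 0# u 1#)
      w-shr u h = 0# , 1# , coordinatewise
        (solve F vars (claim (# 0)) refl h) (solve F vars (claim (# 1)) refl h)
        (solve F vars (claim (# 2)) refl h) (solve F vars (claim (# 3)) refl h)
        where
        vars = u ∷ []
        factor : Fin 4 → Expr ℤ 1 → Expr ℤ 1
        factor k u = :vector (:0) (:0) (:0) (:- u) k
        claim : Fin 4 → Expr ℤ 1 → Claim 1
        claim k u = :e₂ k := :0 :* (:e₁ :⊙ :shear u) k :+ :1 :* (:e₂ :⊙ :shear u) k given factor k u ∶ 3 :· :1 := :0 and []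

-- Incidence with the cubic and its osculating planes in standard position

module StandardPosition {q} (5≤q : 5 ℕ.≤ q) (F : FiniteField q) where
  open FiniteField F
  open Arithmetic F
  open ProjectiveSpace F
  open TwistedCubic F
  open Linear F
  open Projective F
  open Projectivity
  open Action 5≤q F
  open Families 5≤q F
  open ≡-Reasoning

  PO≗e₃ : ∀ i → coord (P O) i ≡ e₃ i
  PO≗e₃ = coordinatewise (zeroˡ _) (zeroˡ _) refl refl

  e₃∈⇒PO∈ : ∀ {ℓ} → e₃ ∈ᵥ ℓ → coord (P O) ∈ᵥ ℓ
  e₃∈⇒PO∈ e₃∈ = ≗∈ e₃∈ PO≗e₃

  PO∈⇒e₃∈ : ∀ {ℓ} → coord (P O) ∈ᵥ ℓ → e₃ ∈ᵥ ℓ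
  PO∈⇒e₃∈ PO∈ = ≗∈ PO∈ (sym ∘ PO≗e₃)

  P∈-image : ∀ {ℓ φ σ τ} → Maps φ σ τ → coord (P σ) ∈ᵥ ℓ → coord (P τ) ∈ᵥ ℓ ▶ φ
  P∈-image {ℓ} {φ} {σ} {τ} (maps e) Pσ∈ℓ = ∼∈ (P τ) (P σ ▹ φ) (∼-sym (P σ ▹ φ) (P τ) e) (image∈ φ Pσ∈ℓ)

  P∈-preimage : ∀ {ℓ φ σ τ} → Maps φ σ τ → coord (P τ) ∈ᵥ ℓ ▶ φ → coord (P σ) ∈ᵥ ℓ
  P∈-preimage {ℓ} {φ} m Pτ∈ = ≅⇒⊑ (▶-⁻¹ ℓ φ) (P∈-image (maps-⁻¹ m) Pτ∈)

  OnlyO : Line → Set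
  OnlyO ℓ = ∀ χ → coord (P χ) ∈ᵥ ℓ → χ ≡ O

  -- The base parameter is recovered from the line as that of its only point on 𝒞.
  OnlyO⇒BaseUnique : (S : Family) → (∀ {ℓ} → Family.Member S ℓ → coord (P O) ∈ᵥ ℓ) →
    (∀ {ℓ} → Family.Member S ℓ → OnlyO ℓ) → Family.BaseUnique S
  OnlyO⇒BaseUnique S PO∈ onlyO {ℓ} {σ} {τ} ℓσ ℓτ = maps-injective
    (subst (Maps (move τ) σ) (onlyO ℓτ _ (P∈-image σ↦ (P∈-preimage (maps-move σ) (PO∈ ℓσ)))) σ↦) (maps-move τ)
    where σ↦ = proj₂ (imageParameter (move τ) (move∈G τ) σ)

  infix 4 _⊑osc_

  _⊑osc_ : Line → Parameter → Set
  ℓ ⊑osc τ = ∀ {x} → x ∈ᵥ ℓ → oscForm (S τ) (T τ) x ≡ 0#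

  ⊑osc-span : ∀ {ℓ} τ → oscForm (S τ) (T τ) (coord (pt₁ ℓ)) ≡ 0# → oscForm (S τ) (T τ) (coord (pt₂ ℓ)) ≡ 0# → ℓ ⊑osc τ
  ⊑osc-span {ℓ} τ h₁ h₂ {x} (span a b h) = begin
    oscForm (S τ) (T τ) x                    ≡⟨ oscForm-cong (S τ) (T τ) h ⟩
    oscForm (S τ) (T τ) (λ i → a * coord (pt₁ ℓ) i + b * coord (pt₂ ℓ) i)
                                             ≡⟨ oscForm-combination (S τ) (T τ) a b (coord (pt₁ ℓ)) (coord (pt₂ ℓ)) ⟩
    a * oscForm (S τ) (T τ) (coord (pt₁ ℓ)) + b * oscForm (S τ) (T τ) (coord (pt₂ ℓ))
                                             ≡⟨ solve F (a ∷ b ∷ oscForm (S τ) (T τ) (coord (pt₁ ℓ)) ∷ oscForm (S τ) (T τ) (coord (pt₂ ℓ)) ∷ [])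
                                                  (λ a b x y → a :* x :+ b :* y := :0 given a ∶ x := :0 and b ∶ y := :0 and []) refl h₁ h₂ ⟩
    0#                                       ∎

  ⊆ₚ⇒⊑osc : ∀ {ℓ} τ → ℓ ⊆ₚ osc τ → ℓ ⊑osc τ
  ⊆ₚ⇒⊑osc {ℓ} τ h = ⊑osc-span τ (∈osc⇒ (pt₁ ℓ) τ (h (pt₁ ℓ) (∈ᵥ⇒∈ₗ (pt₁∈ ℓ)))) (∈osc⇒ (pt₂ ℓ) τ (h (pt₂ ℓ) (∈ᵥ⇒∈ₗ (pt₂∈ ℓ))))

  ⊑osc⇒⊆ₚ : ∀ {ℓ} τ → ℓ ⊑osc τ → ℓ ⊆ₚ osc τ
  ⊑osc⇒⊆ₚ τ h X X∈ℓ = ⇒∈osc X τ (h (∈ₗ⇒∈ᵥ X∈ℓ))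

  -- The action on osculating planes is recorded beside that on points because it is read off from
  -- the symmetric cube, whereas membership in G speaks only of points.
  record OscMaps (φ : Projectivity) (σ τ : Parameter) : Set where
    field
      maps-point : Maps φ σ τ
      form-image : ∀ x → oscForm (S σ) (T σ) x ≡ 0# → oscForm (S τ) (T τ) (x ⊙ matrix φ) ≡ 0#
      onto       : ∀ {ℓ} → ℓ ⊑osc σ → ℓ ▶ φ ⊑osc τ
      back       : ∀ {ℓ} → ℓ ▶ φ ⊑osc τ → ℓ ⊑osc σ

  möbius-osc : ∀ a b c d {e} (h : e * (a * d + - (b * c)) ≡ 1#) σ → ∃ λ τ → OscMaps (möbius a b c d h) σ τ
  möbius-osc a b c d {e} h σ = conclude (normalize s t st≢0)
    where
    φ = möbius a b c d h
    s = a * S σ + b * T σ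
    t = c * S σ + d * T σ
    Δ = a * d + - (b * c)
    st≢0 : ¬ (s ≡ 0# × t ≡ 0#)
    st≢0 (s≡0 , t≡0) = nonzero (P σ ▹ φ) λ j → begin
      (coord (P σ) ⊙ sym³ a b c d) j           ≡⟨ ⊙-cong (sym³ a b c d) (sym³ a b c d) (P≗ν σ) (λ _ _ → refl) j ⟩
      (ν (S σ) (T σ) ⊙ sym³ a b c d) j         ≡⟨ ν-image a b c d (S σ) (T σ) j ⟩
      ν s t j                                  ≡⟨ cong₂ (λ s t → ν s t j) s≡0 t≡0 ⟩
      ν 0# 0# j                                ≡⟨ ν-zero j ⟩
      0#                                       ∎
    Δ³≢0 : Δ * Δ * Δ ≢ 0#
    Δ³≢0 = *-nonzero (*-nonzero Δ≢0 Δ≢0) Δ≢0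
      where Δ≢0 = unit⇒nonzeroʳ h
    conclude : (∃₂ λ τ k → s ≡ k * S τ × t ≡ k * T τ) → ∃ λ τ → OscMaps φ σ τ
    conclude (τ , k , e₁ , e₂) = τ , record
      { maps-point = maps σ↦τ
      ; form-image = image
      ; onto = λ {ℓ} h {x} x∈ → trans
          (oscForm-cong (S τ) (T τ) (λ i → sym (⊙-inverse x (matrix⁻¹ φ) (matrix φ) (inverseˡ φ) i)))
          (image (x ⊙ matrix⁻¹ φ) (h (preimage∈ φ x∈)))
      ; back = λ {ℓ} h {x} x∈ → zero-product (begin
          Δ * Δ * Δ * oscForm (S σ) (T σ) x                       ≡⟨ transform x ⟨
          k ^ 3 * oscForm (S τ) (T τ) (x ⊙ matrix φ)              ≡⟨ cong (k ^ 3 *_) (h (image∈ φ x∈)) ⟩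
          k ^ 3 * 0#                                              ≡⟨ zeroʳ _ ⟩
          0#                                                      ∎) Δ³≢0
      }
      where
      σ↦τ : P σ ▹ φ ∼ P τ
      σ↦τ = möbius-P a b c d h σ τ k e₁ e₂
      transform : ∀ x → k ^ 3 * oscForm (S τ) (T τ) (x ⊙ matrix φ) ≡ Δ * Δ * Δ * oscForm (S σ) (T σ) x
      transform x = begin
        k ^ 3 * oscForm (S τ) (T τ) (x ⊙ sym³ a b c d)    ≡⟨ oscForm-scale k (S τ) (T τ) (x ⊙ sym³ a b c d) ⟨
        oscForm (k * S τ) (k * T τ) (x ⊙ sym³ a b c d)    ≡⟨ cong₂ (λ s t → oscForm s t (x ⊙ sym³ a b c d)) e₁ e₂ ⟨
        oscForm s t (x ⊙ sym³ a b c d)                    ≡⟨ oscForm-image a b c d (S σ) (T σ) x ⟩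
        Δ * Δ * Δ * oscForm (S σ) (T σ) x                 ∎
      image : ∀ x → oscForm (S σ) (T σ) x ≡ 0# → oscForm (S τ) (T τ) (x ⊙ matrix φ) ≡ 0#
      image x h = zero-product (begin
        k ^ 3 * oscForm (S τ) (T τ) (x ⊙ matrix φ)        ≡⟨ transform x ⟩
        Δ * Δ * Δ * oscForm (S σ) (T σ) x                 ≡⟨ cong (Δ * Δ * Δ *_) h ⟩
        Δ * Δ * Δ * 0#                                    ≡⟨ zeroʳ _ ⟩
        0#                                                ∎) (∼-factor≢0 (P σ ▹ φ) (P τ) σ↦τ)

  move-osc : ∀ τ σ → ∃ λ χ → OscMaps (move τ) σ χ
  move-osc (just t) = möbius-osc 1# (- t) 0# 1# (translation-det (- t))
  move-osc ∞        = möbius-osc 0# 1# 1# 0# inversion-det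

  move-osc-at : ∀ τ {σ χ} → Maps (move τ) σ χ → OscMaps (move τ) σ χ
  move-osc-at τ {σ} m = let (χ , h) = move-osc τ σ in
    subst (OscMaps (move τ) σ) (maps-unique (OscMaps.maps-point h) m) h

  move-osc-O : ∀ τ → OscMaps (move τ) τ O
  move-osc-O τ = move-osc-at τ (maps-move τ)

  -- The dual of `OnlyO⇒BaseUnique`: the base parameter is that of the only osculating plane
  -- containing the line.
  OscOnlyO⇒BaseUnique : (S : Family) → (∀ {ℓ} → Family.Member S ℓ → ℓ ⊑osc O) →
    (∀ {ℓ} → Family.Member S ℓ → ∀ χ → ℓ ⊑osc χ → χ ≡ O) → Family.BaseUnique S
  OscOnlyO⇒BaseUnique S ⊑O onlyO {ℓ} {σ} {τ} ℓσ ℓτ = maps-injective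
    (subst (Maps (move τ) σ) (onlyO ℓτ χ (OscMaps.onto h (OscMaps.back (move-osc-O σ) {ℓ} (⊑O ℓσ)))) (OscMaps.maps-point h)) (maps-move τ)
    where
    χ = proj₁ (move-osc τ σ)
    h = proj₂ (move-osc τ σ)

  unscale : ∀ {ℓ x z} (y : Vector₄) k → x * z ≡ 1# → (∀ i → x * y i ≡ k i) → k ∈ᵥ ℓ → y ∈ᵥ ℓ
  unscale {x = x} {z} y k xz≡1 h k∈ = multiple∈ z k∈ λ i → solve F (x ∷ z ∷ y i ∷ k i ∷ [])
    (λ x z y k → y := z :* k given z ∶ x :* y := k and :- y ∶ x :* z := :1 and []) refl (h i) xz≡1

  -- A line through `P O` is determined by its trace on the plane x₃ = 0; the cases follow the first
  -- nonzero coordinate of the trace, scaled to 1.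
  data Pencil (ℓ : Line) : Set where
    secant  : ∀ x δ → ⟪ 1# , x , x * x + δ , 0# ⟫ ∈ᵥ ℓ → Pencil ℓ
    planar  : ∀ x → ⟪ 0# , 1# , x , 0# ⟫ ∈ᵥ ℓ → Pencil ℓ
    tangent : e₂ ∈ᵥ ℓ → Pencil ℓ

  pencil : ∀ ℓ → Pencil ℓ
  pencil ℓ = go (coordinateSection ℓ (# 3))
    where
    go : (∃ λ X → X ∈ₗ ℓ × coord X (# 3) ≡ 0#) → Pencil ℓ
    go (X , X∈ , X₃≡0) with coord X (# 0) ≟ 0# | coord X (# 1) ≟ 0# | coord X (# 2) ≟ 0#
    ... | no x₀≢0 | _ | _ = secant (z * x₁) (z * x₂ + - (z * x₁ * (z * x₁))) (unscale _ (coord X) x₀z≡1 (coordinatewise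
      (*-identityʳ x₀)
      (solve F (x₀ ∷ x₁ ∷ z ∷ []) (λ x₀ x₁ z → x₀ :* (z :* x₁) := x₁ given x₁ ∶ x₀ :* z := :1 and []) refl x₀z≡1)
      (solve F (x₀ ∷ x₁ ∷ x₂ ∷ z ∷ []) (λ x₀ x₁ x₂ z → x₀ :* (z :* x₁ :* (z :* x₁) :+ (z :* x₂ :- z :* x₁ :* (z :* x₁))) := x₂
        given x₂ ∶ x₀ :* z := :1 and []) refl x₀z≡1)
      (trans (zeroʳ x₀) (sym X₃≡0))) (∈ₗ⇒∈ᵥ X∈))
      where
      x₀ = coord X (# 0) ; x₁ = coord X (# 1) ; x₂ = coord X (# 2)
      z = proj₁ (inverse x₀ x₀≢0)
      x₀z≡1 = proj₂ (inverse x₀ x₀≢0)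
    ... | yes x₀≡0 | no x₁≢0 | _ = planar (z * x₂) (unscale _ (coord X) x₁z≡1 (coordinatewise
      (trans (zeroʳ x₁) (sym x₀≡0)) (*-identityʳ x₁)
      (solve F (x₁ ∷ x₂ ∷ z ∷ []) (λ x₁ x₂ z → x₁ :* (z :* x₂) := x₂ given x₂ ∶ x₁ :* z := :1 and []) refl x₁z≡1)
      (trans (zeroʳ x₁) (sym X₃≡0))) (∈ₗ⇒∈ᵥ X∈))
      where
      x₁ = coord X (# 1) ; x₂ = coord X (# 2)
      z = proj₁ (inverse x₁ x₁≢0)
      x₁z≡1 = proj₂ (inverse x₁ x₁≢0)
    ... | yes x₀≡0 | yes x₁≡0 | no x₂≢0 = tangent (unscale _ (coord X) (proj₂ (inverse x₂ x₂≢0)) (coordinatewise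
      (trans (zeroʳ x₂) (sym x₀≡0)) (trans (zeroʳ x₂) (sym x₁≡0)) (*-identityʳ x₂) (trans (zeroʳ x₂) (sym X₃≡0))) (∈ₗ⇒∈ᵥ X∈))
      where x₂ = coord X (# 2)
    ... | yes x₀≡0 | yes x₁≡0 | yes x₂≡0 = ⊥-elim (nonzero X (coordinatewise x₀≡0 x₁≡0 x₂≡0 X₃≡0))

  -- A second common point `P (just v)` would give x = 1/v and x² + δ = 1/v²; at ∞ the same holds
  -- with 0 in place of 1/v.
  secant-onlyO : ∀ {ℓ x δ} → e₃ ∈ᵥ ℓ → ⟪ 1# , x , x * x + δ , 0# ⟫ ∈ᵥ ℓ → δ ≢ 0# → OnlyO ℓ
  secant-onlyO {ℓ} {x} {δ} e₃∈ w∈ δ≢0 χ Pχ∈ = go χ (echelon-coordinates {# 3} {# 0} (echelon refl refl refl refl) e₃∈ w∈ Pχ∈)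
    where
    go : ∀ χ → (∀ k → coord (P χ) k ≡ coord (P χ) (# 3) * e₃ k + coord (P χ) (# 0) * ⟪ 1# , x , x * x + δ , 0# ⟫ k) → χ ≡ O
    go ∞ h = ⊥-elim (δ≢0 (solve F (x ∷ δ ∷ []) (λ x δ → δ := :0
      given x ∶ :0 := :0 :* :0 :+ :1 :* x and :- :1 ∶ :0 := :0 :* :0 :+ :1 :* (x :* x :+ δ) and []) refl (h (# 1)) (h (# 2))))
    go (just v) h with v ≟ 0#
    ... | yes refl = refl
    ... | no  v≢0  = ⊥-elim (*-nonzero (*-nonzero v≢0 (*-nonzero v≢0 v≢0)) (*-nonzero v≢0 δ≢0)
      (solve F (v ∷ x ∷ δ ∷ []) (λ v x δ → v :* (v :* v) :* (v :* δ) := :0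
        given :- v ∶ v := :1 :* :0 :+ v :^ 3 :* (x :* x :+ δ)
        and :1 :+ v :* x ∶ v :^ 2 := :1 :* :0 :+ v :^ 3 :* x and []) refl (h (# 2)) (h (# 1))))

  e₃∈osc⇒O : ∀ {ℓ χ} → e₃ ∈ᵥ ℓ → ℓ ⊑osc χ → χ ≡ O
  e₃∈osc⇒O {ℓ} {χ} e₃∈ h = ST-injective χ O (trans (zeroʳ (T χ)) (sym (trans (*-identityʳ (S χ)) (^3≡0
    (solve F (S χ ∷ T χ ∷ []) (λ s t → s :^ 3 := :0 given :- :1 ∶ :osc s t (:vector :0 :0 :0 :1) := :0 and []) refl (h e₃∈))))))

  oscForm-O : ∀ (x : Vector₄) → oscForm (S O) (T O) x ≡ 0# → x (# 0) ≡ 0#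
  oscForm-O x = solve F (x (# 0) ∷ x (# 1) ∷ x (# 2) ∷ x (# 3) ∷ []) (λ x₀ x₁ x₂ x₃ → x₀ := :0
    given :1 ∶ :osc :0 :1 (:vector x₀ x₁ x₂ x₃) := :0 and []) refl

  ⊑oscO⇒x₀≡0 : ∀ {ℓ x} → ℓ ⊑osc O → x ∈ᵥ ℓ → x (# 0) ≡ 0#
  ⊑oscO⇒x₀≡0 {x = x} h x∈ = oscForm-O x (h x∈)

  x₀≡0⇒⊑oscO : ∀ {ℓ} → (∀ {x} → x ∈ᵥ ℓ → x (# 0) ≡ 0#) → ℓ ⊑osc O
  x₀≡0⇒⊑oscO h {x} x∈ = solve F (x (# 0) ∷ x (# 1) ∷ x (# 2) ∷ x (# 3) ∷ []) (λ x₀ x₁ x₂ x₃ → :osc :0 :1 (:vector x₀ x₁ x₂ x₃) := :0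
    given :1 ∶ x₀ := :0 and []) refl (h x∈)

  secant-⋢osc : ∀ {ℓ x y} → e₃ ∈ᵥ ℓ → ⟪ 1# , x , y , 0# ⟫ ∈ᵥ ℓ → ∀ χ → ¬ ℓ ⊑osc χ
  secant-⋢osc {ℓ} e₃∈ w∈ χ h = 1≢0 (⊑oscO⇒x₀≡0 (subst (ℓ ⊑osc_) (e₃∈osc⇒O {ℓ} {χ} e₃∈ h) h) w∈)

  planar-onlyO : ∀ {ℓ x} → e₃ ∈ᵥ ℓ → ⟪ 0# , 1# , x , 0# ⟫ ∈ᵥ ℓ → OnlyO ℓ
  planar-onlyO {ℓ} {x} e₃∈ w∈ χ Pχ∈ = go χ (echelon-coordinates {# 3} {# 1} (echelon refl refl refl refl) e₃∈ w∈ Pχ∈ (# 0))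
    where
    go : ∀ χ → coord (P χ) (# 0) ≡ coord (P χ) (# 3) * 0# + coord (P χ) (# 1) * 0# → χ ≡ O
    go ∞ h = ⊥-elim (1≢0 (trans h (trans (cong₂ _+_ (zeroʳ _) (zeroʳ _)) (+-identityʳ 0#))))
    go (just v) h = cong just (^3≡0 (trans h (trans (cong₂ _+_ (zeroʳ _) (zeroʳ _)) (+-identityʳ 0#))))

  planar-⊑oscO : ∀ {ℓ x} → e₃ ∈ᵥ ℓ → ⟪ 0# , 1# , x , 0# ⟫ ∈ᵥ ℓ → ℓ ⊑osc O
  planar-⊑oscO {ℓ} e₃∈ w∈ = x₀≡0⇒⊑oscO {ℓ} λ x∈ →
    trans (echelon-coordinates {# 3} {# 1} (echelon refl refl refl refl) e₃∈ w∈ x∈ (# 0)) (trans (cong₂ _+_ (zeroʳ _) (zeroʳ _)) (+-identityʳ 0#))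

  -- The traces on x₂ = 0 and x₁ = 0 either form a basis or one of them is `P O`, since x₀ vanishes
  -- throughout.
  data OscPencil (ℓ : Line) : Set where
    through-O : e₃ ∈ᵥ ℓ → OscPencil ℓ
    axial     : ∀ α β → ⟪ 0# , 1# , 0# , α ⟫ ∈ᵥ ℓ → ⟪ 0# , 0# , 1# , β ⟫ ∈ᵥ ℓ → OscPencil ℓ

  oscPencil : ∀ {ℓ} → ℓ ⊑osc O → OscPencil ℓ
  oscPencil {ℓ} ℓ⊑O = go (coordinateSection ℓ (# 2)) (coordinateSection ℓ (# 1))
    where
    last : ∀ X → X ∈ₗ ℓ → coord X (# 1) ≡ 0# → coord X (# 2) ≡ 0# → e₃ ∈ᵥ ℓ
    last X X∈ x₁≡0 x₂≡0 = unscale e₃ (coord X) (proj₂ (inverse (coord X (# 3)) x₃≢0)) (coordinatewise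
      (trans (zeroʳ _) (sym x₀≡0)) (trans (zeroʳ _) (sym x₁≡0)) (trans (zeroʳ _) (sym x₂≡0)) (*-identityʳ _)) (∈ₗ⇒∈ᵥ X∈)
      where
      x₀≡0 = ⊑oscO⇒x₀≡0 {ℓ} ℓ⊑O (∈ₗ⇒∈ᵥ X∈)
      x₃≢0 : coord X (# 3) ≢ 0#
      x₃≢0 x₃≡0 = nonzero X (coordinatewise x₀≡0 x₁≡0 x₂≡0 x₃≡0)
    go : (∃ λ X → X ∈ₗ ℓ × coord X (# 2) ≡ 0#) → (∃ λ X → X ∈ₗ ℓ × coord X (# 1) ≡ 0#) → OscPencil ℓ
    go (X , X∈ , x₂≡0) (Y , Y∈ , y₁≡0) with coord X (# 1) ≟ 0# | coord Y (# 2) ≟ 0#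
    ... | yes x₁≡0 | _ = through-O (last X X∈ x₁≡0 x₂≡0)
    ... | no _     | yes y₂≡0 = through-O (last Y Y∈ y₁≡0 y₂≡0)
    ... | no x₁≢0  | no y₂≢0 = axial (z * coord X (# 3)) (w * coord Y (# 3))
      (unscale _ (coord X) xz≡1 (coordinatewise (trans (zeroʳ _) (sym (⊑oscO⇒x₀≡0 {ℓ} ℓ⊑O (∈ₗ⇒∈ᵥ X∈)))) (*-identityʳ _) (trans (zeroʳ _) (sym x₂≡0))
        (solve F (coord X (# 1) ∷ z ∷ coord X (# 3) ∷ []) (λ x z y → x :* (z :* y) := y given y ∶ x :* z := :1 and []) refl xz≡1)) (∈ₗ⇒∈ᵥ X∈))
      (unscale _ (coord Y) yw≡1 (coordinatewise (trans (zeroʳ _) (sym (⊑oscO⇒x₀≡0 {ℓ} ℓ⊑O (∈ₗ⇒∈ᵥ Y∈)))) (trans (zeroʳ _) (sym y₁≡0)) (*-identityʳ _)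
        (solve F (coord Y (# 2) ∷ w ∷ coord Y (# 3) ∷ []) (λ x z y → x :* (z :* y) := y given y ∶ x :* z := :1 and []) refl yw≡1)) (∈ₗ⇒∈ᵥ Y∈))
      where
      z = proj₁ (inverse (coord X (# 1)) x₁≢0)
      xz≡1 = proj₂ (inverse (coord X (# 1)) x₁≢0)
      w = proj₁ (inverse (coord Y (# 2)) y₂≢0)
      yw≡1 = proj₂ (inverse (coord Y (# 2)) y₂≢0)

  axial-⊑oscO : ∀ {ℓ α β} → ⟪ 0# , 1# , 0# , α ⟫ ∈ᵥ ℓ → ⟪ 0# , 0# , 1# , β ⟫ ∈ᵥ ℓ → ℓ ⊑osc O
  axial-⊑oscO {ℓ} v∈ w∈ = x₀≡0⇒⊑oscO {ℓ} λ x∈ →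
    trans (echelon-coordinates {# 1} {# 2} (echelon refl refl refl refl) v∈ w∈ x∈ (# 0)) (trans (cong₂ _+_ (zeroʳ _) (zeroʳ _)) (+-identityʳ 0#))

  -- A plane at t ≠ 0 through both basis vectors forces x = 1/t and x² + δ = 1/t² after division by
  -- 3, dually to `secant-onlyO`.
  axial-onlyO : 3 · 1# ≢ 0# → ∀ {ℓ x δ} → ⟪ 0# , 1# , 0# , - (3 · (x * x + δ)) ⟫ ∈ᵥ ℓ → ⟪ 0# , 0# , 1# , 3 · x ⟫ ∈ᵥ ℓ →
    δ ≢ 0# → ∀ χ → ℓ ⊑osc χ → χ ≡ O
  axial-onlyO 3≢0 {ℓ} {x} {δ} v∈ w∈ δ≢0 ∞ h = ⊥-elim (*-nonzero (*-nonzero 3≢0 3≢0) δ≢0 (solve F (x ∷ δ ∷ []) (λ x δ → (3 :· :1) :* (3 :· :1) :* δ := :0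
    given 3 :· :1 ∶ :osc :1 :0 (:vector :0 :1 :0 (:- (3 :· (x :* x :+ δ)))) := :0 and 3 :· x ∶ :osc :1 :0 (:vector :0 :0 :1 (3 :· x)) := :0 and [])
    refl (h v∈) (h w∈)))
  axial-onlyO 3≢0 {ℓ} {x} {δ} v∈ w∈ δ≢0 (just t) h with t ≟ 0#
  ... | yes refl = refl
  ... | no  t≢0  = ⊥-elim (*-nonzero 3≢0 (*-nonzero (*-nonzero t≢0 (*-nonzero t≢0 (*-nonzero t≢0 t≢0))) δ≢0)
    (solve F (t ∷ x ∷ δ ∷ []) (λ t x δ → (3 :· :1) :* (t :* (t :* (t :* t)) :* δ) := :0
      given t ∶ :osc t :1 (:vector :0 :1 :0 (:- (3 :· (x :* x :+ δ)))) := :0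
      and :1 :+ t :* x ∶ :osc t :1 (:vector :0 :0 :1 (3 :· x)) := :0 and []) refl (h v∈) (h w∈)))

  -- The plane at `P O` meets 𝒞 only in `P O`. There x₁ = x₂ = 0, which on such a line makes the
  -- last coordinate vanish too.
  axial-external : ∀ {ℓ α β} → ⟪ 0# , 1# , 0# , α ⟫ ∈ᵥ ℓ → ⟪ 0# , 0# , 1# , β ⟫ ∈ᵥ ℓ → ∀ χ → ¬ coord (P χ) ∈ᵥ ℓ
  axial-external {ℓ} v∈ w∈ ∞ P∈ = 1≢0 (⊑oscO⇒x₀≡0 {ℓ} (axial-⊑oscO {ℓ} v∈ w∈) P∈)
  axial-external {ℓ} {α} {β} v∈ w∈ (just t) P∈ = 1≢0 (solve F (t ∷ α ∷ β ∷ []) (λ t α β → :1 := :0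
    given :1 ∶ :1 := t :^ 2 :* α :+ t :* β and t :* α :+ β ∶ t := :0 and []) refl
    (echelon-coordinates {# 1} {# 2} (echelon refl refl refl refl) v∈ w∈ P∈ (# 3)) (^3≡0 (⊑oscO⇒x₀≡0 {ℓ} (axial-⊑oscO {ℓ} v∈ w∈) P∈)))

-- Transitivity, base points and listings of the families

module ShapeInstances {q} (5≤q : 5 ℕ.≤ q) (F : FiniteField q) where
  open FiniteField F
  open Arithmetic F
  open ProjectiveSpace F
  open TwistedCubic F
  open Linear F
  open Projective F
  open Projectivity
  open Action 5≤q F
  open Families 5≤q F
  open StandardPosition 5≤q F

  module Secant ρ = ShapeTheory (secantShape ρ)
  module TangentLine = ShapeTheory tangentShape
  module Axial ρ = ShapeTheory (axialShape ρ)

  -- Planar lines e₃, (0,1,x,0) with x arbitrary, zero and nonzero. In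
  -- characteristic 2 the latter two families are invariant separately.
  allPlanar : Shape
  allPlanar = planarShape (λ _ → ⊤) (λ _ _ _ → tt) (λ _ _ → tt)

  module AllPlanar = ShapeTheory allPlanar

  module CharacteristicTwo (2≡0 : 2 · 1# ≡ 0#) where
    private
      shift-trivial : ∀ x u → 2 · u + x ≡ x
      shift-trivial x u = solve F (x ∷ u ∷ []) (λ x u → 2 :· u :+ x := x given u ∶ 2 :· :1 := :0 and []) refl 2≡0

    zeroPlanar nonzeroPlanar : Shape
    zeroPlanar = planarShape (_≡ 0#) (λ z _ x≡0 → trans (cong (z *_) x≡0) (zeroʳ z)) (λ u x≡0 → trans (shift-trivial _ u) x≡0)
    nonzeroPlanar = planarShape (_≢ 0#) (λ z z≢0 x≢0 → *-nonzero z≢0 x≢0) (λ u x≢0 e → x≢0 (trans (sym (shift-trivial _ u)) e))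

    module ZeroPlanar = ShapeTheory zeroPlanar
    module NonzeroPlanar = ShapeTheory nonzeroPlanar

    zeroPlanar-transitive : ZeroPlanar.Transitive
    zeroPlanar-transitive = ZeroPlanar.transitive (0# , refl) λ { (x , refl) → 0# , 1# , 1≢0 , (λ _ → refl) ,
      coordinatewise refl refl (solve F (proj₁ (inverse 1# 1≢0) ∷ []) (λ z → :0 := z :* (2 :· :0 :+ :0) given []) refl) refl }

    nonzeroPlanar-transitive : NonzeroPlanar.Transitive
    nonzeroPlanar-transitive = NonzeroPlanar.transitive (1# , 1≢0) λ (x , x≢0) → 0# , x , x≢0 , (λ _ → refl) ,
      coordinatewise refl refl (solve F (x ∷ proj₁ (inverse x x≢0) ∷ []) (λ x z → :1 := z :* (2 :· :0 :+ x)
        given :- :1 ∶ x :* z := :1 and []) refl (proj₂ (inverse x x≢0))) refl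

    zeroPlanar-baseUnique : ZeroPlanar.BaseUnique
    zeroPlanar-baseUnique = OnlyO⇒BaseUnique ZeroPlanar.family
      (λ { (_ , ZeroPlanar.basis v∈ w∈) → e₃∈⇒PO∈ v∈ }) (λ { (_ , ZeroPlanar.basis v∈ w∈) → planar-onlyO v∈ w∈ })

    nonzeroPlanar-baseUnique : NonzeroPlanar.BaseUnique
    nonzeroPlanar-baseUnique = OnlyO⇒BaseUnique NonzeroPlanar.family
      (λ { (_ , NonzeroPlanar.basis v∈ w∈) → e₃∈⇒PO∈ v∈ }) (λ { (_ , NonzeroPlanar.basis v∈ w∈) → planar-onlyO v∈ w∈ })

    zeroPlanar-listing : ZeroPlanar.Listing 1
    zeroPlanar-listing = ZeroPlanar.listing Fin.1↔⊤ (λ _ → 0# , refl) (λ _ _ → refl)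
      λ { (_ , refl) → tt , (λ _ → refl) , (λ _ → refl) }

    nonzeroPlanar-listing : NonzeroPlanar.Listing (Enumeration.size nonzeroElements)
    nonzeroPlanar-listing = NonzeroPlanar.listing ↔.↔-refl (λ i → nz i , satisfies i) (λ _ w≗ → injective (w≗ (# 2)))
      λ (x , x≢0) → let (i , e) = surjective x≢0 in i , (λ _ → refl) , coordinatewise refl refl e refl
      where open Enumeration nonzeroElements renaming (element to nz)

  -- The shear by -x clears x, and the dilation by y then scales y to 1.
  secant-transitive : ∀ ρ → Secant.Transitive ρ
  secant-transitive ρ = Secant.transitive ρ (0# , 1# , 1≢0) λ (x , y , y≢0) → - x , y , y≢0 , (λ _ → refl) ,
    coordinatewise refl (solve F (x ∷ proj₁ (inverse y y≢0) ∷ []) (λ x z → :0 := z :* (:- x :+ x) given []) refl)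
      (solve F (ρ ∷ x ∷ y ∷ proj₁ (inverse y y≢0) ∷ []) (λ ρ x y z →
        :0 :* :0 :+ ρ :* (:1 :* :1) := z :* (:- x :+ x) :* (z :* (:- x :+ x)) :+ ρ :* (z :* y :* (z :* y))
        given :- (ρ :* (y :* z :+ :1)) ∶ y :* z := :1 and []) refl (proj₂ (inverse y y≢0))) refl

  tangent-transitive : TangentLine.Transitive
  tangent-transitive = TangentLine.transitive tt λ _ → 0# , 1# , 1≢0 , (λ _ → refl) , (λ _ → refl)

  -- A shear by u adds 2u to the parameter, so the shear by -x/2 clears it.
  allPlanar-transitive : 2 · 1# ≢ 0# → AllPlanar.Transitive
  allPlanar-transitive 2≢0 = AllPlanar.transitive (0# , tt) λ (x , _) → - (h * x) , 1# , 1≢0 , (λ _ → refl) ,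
    coordinatewise refl refl (solve F (h ∷ x ∷ proj₁ (inverse 1# 1≢0) ∷ []) (λ h x z → :0 := z :* (2 :· :- (h :* x) :+ x)
      given z :* x ∶ (2 :· :1) :* h := :1 and []) refl (proj₂ (inverse (2 · 1#) 2≢0))) refl
    where h = proj₁ (inverse (2 · 1#) 2≢0)

  axial-transitive : ∀ ρ → Axial.Transitive ρ
  axial-transitive ρ = Axial.transitive ρ (0# , 1# , 1≢0) λ (x , y , y≢0) → - x , y , y≢0 ,
    coordinatewise refl refl refl (solve F (ρ ∷ x ∷ y ∷ proj₁ (inverse y y≢0) ∷ []) (λ ρ x y z →
        :- (3 :· (:0 :* :0 :+ ρ :* (:1 :* :1))) := :- (3 :· (z :* (:- x :+ x) :* (z :* (:- x :+ x)) :+ ρ :* (z :* y :* (z :* y))))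
        given 3 :· (ρ :* (y :* z :+ :1)) ∶ y :* z := :1 and []) refl (proj₂ (inverse y y≢0))) ,
    coordinatewise refl refl refl (solve F (x ∷ proj₁ (inverse y y≢0) ∷ []) (λ x z → 3 :· :0 := 3 :· (z :* (:- x :+ x)) given []) refl)

  ρy²≢0 : ∀ {ρ y} → ρ ≢ 0# → y ≢ 0# → ρ * (y * y) ≢ 0#
  ρy²≢0 ρ≢0 y≢0 = *-nonzero ρ≢0 (*-nonzero y≢0 y≢0)

  secant-baseUnique : ∀ {ρ} → ρ ≢ 0# → Secant.BaseUnique ρ
  secant-baseUnique {ρ} ρ≢0 = OnlyO⇒BaseUnique (Secant.family ρ)
    (λ { (_ , Secant.basis v∈ w∈) → e₃∈⇒PO∈ v∈ })
    (λ { ((x , y , y≢0) , Secant.basis v∈ w∈) → secant-onlyO v∈ w∈ (ρy²≢0 ρ≢0 y≢0) })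

  axial-baseUnique : 3 · 1# ≢ 0# → ∀ {ρ} → ρ ≢ 0# → Axial.BaseUnique ρ
  axial-baseUnique 3≢0 {ρ} ρ≢0 = OscOnlyO⇒BaseUnique (Axial.family ρ)
    (λ { {ℓ} (_ , Axial.basis v∈ w∈) → axial-⊑oscO {ℓ} v∈ w∈ })
    (λ { {ℓ} ((x , y , y≢0) , Axial.basis v∈ w∈) → axial-onlyO 3≢0 {ℓ} v∈ w∈ (ρy²≢0 ρ≢0 y≢0) })

  module OddListings (2≢0 : 2 · 1# ≢ 0#) where
    open OddCharacteristic 2≢0

    -- The line depends on y only through y², so y runs over representatives modulo sign.
    secant-listing : ∀ {ρ} → ρ ≢ 0# → Secant.Listing ρ (q ℕ.* half)
    secant-listing {ρ} ρ≢0 = Secant.listing ρ (×↔ cardinality (↔.↔-refl {A = Fin half}))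
      (λ (x , i) → x , positive i , positive-nonzero i) (λ _ w≗ → separate (w≗ (# 1)) (w≗ (# 2)))
      λ (x , y , y≢0) → let (i , e) = positive-root y≢0 in
        (x , i) , (λ _ → refl) , coordinatewise refl refl (cong (λ s → x * x + ρ * s) e) refl
      where
      separate : ∀ {x i x′ i′} → x ≡ x′ → x * x + ρ * (positive i * positive i) ≡ x′ * x′ + ρ * (positive i′ * positive i′) → (x , i) ≡ (x′ , i′)
      separate {x} {i} {x′} {i′} refl e = cong (x ,_) (positive-square-injective (*-cancelˡ ρ≢0
        (solve F (x ∷ ρ ∷ positive i ∷ positive i′ ∷ []) (λ x ρ y z → ρ :* (y :* y) := ρ :* (z :* z)
          given :1 ∶ x :* x :+ ρ :* (y :* y) := x :* x :+ ρ :* (z :* z) and []) refl e)))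

    axial-listing : 3 · 1# ≢ 0# → ∀ {ρ} → ρ ≢ 0# → Axial.Listing ρ (q ℕ.* half)
    axial-listing 3≢0 {ρ} ρ≢0 = Axial.listing ρ (×↔ cardinality (↔.↔-refl {A = Fin half}))
      (λ (x , i) → x , positive i , positive-nonzero i) (λ v≗ w≗ → separate (w≗ (# 3)) (v≗ (# 3)))
      λ (x , y , y≢0) → let (i , e) = positive-root y≢0 in
        (x , i) , coordinatewise refl refl refl (cong (λ s → - (3 · (x * x + ρ * s))) e) , (λ _ → refl)
      where
      separate : ∀ {x i x′ i′} → 3 · x ≡ 3 · x′ →
        - (3 · (x * x + ρ * (positive i * positive i))) ≡ - (3 · (x′ * x′ + ρ * (positive i′ * positive i′))) → (x , i) ≡ (x′ , i′)
      separate {x} {i} {x′} {i′} e f with *-cancelˡ {3 · 1#} {x} {x′} 3≢0 (solve F (x ∷ x′ ∷ []) (λ x y → (3 :· :1) :* x := (3 :· :1) :* y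
        given :1 ∶ 3 :· x := 3 :· y and []) refl e)
      ... | refl = cong (x ,_) (positive-square-injective (*-cancelˡ (*-nonzero 3≢0 ρ≢0)
        (solve F (x ∷ ρ ∷ positive i ∷ positive i′ ∷ []) (λ x ρ y z → (3 :· :1) :* ρ :* (y :* y) := (3 :· :1) :* ρ :* (z :* z)
          given :- :1 ∶ :- (3 :· (x :* x :+ ρ :* (y :* y))) := :- (3 :· (x :* x :+ ρ :* (z :* z))) and []) refl f)))

  module CharacteristicThreeInstances (3≡0 : 3 · 1# ≡ 0#) where
    open CharacteristicThree 3≡0

    module Skew = ShapeTheory skewShape
    module Flat ρ = ShapeTheory (flatShape ρ)

    2≢0 : 2 · 1# ≢ 0#
    2≢0 2≡0 = 1≢0 (solve F [] (:1 := :0 given :1 ∶ 3 :· :1 := :0 and :- :1 ∶ 2 :· :1 := :0 and []) refl 3≡0 2≡0)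

    open OddCharacteristic 2≢0

    cube-injective : Injective _≡_ _≡_ (λ x → x ^ 3)
    cube-injective {x} {y} e = solve F (x ∷ y ∷ []) (λ x y → x := y given :1 ∶ x :- y := :0 and []) refl
      (^3≡0 (solve F (x ∷ y ∷ []) (λ x y → (x :- y) :^ 3 := :0
        given x :* y :* y :- x :* x :* y ∶ 3 :· :1 := :0 and :1 ∶ x :^ 3 := y :^ 3 and []) refl 3≡0 e))

    skew-transitive : Skew.Transitive
    skew-transitive = Skew.transitive (0# , 1# , 1≢0) λ (x , y , y≢0) → - x , y , y≢0 , (λ _ → refl) ,
      coordinatewise refl (solve F (x ∷ y ∷ proj₁ (inverse y y≢0) ∷ []) (λ x y z → :0 :+ :1 := z :* (:- x :+ x) :+ z :* y
          given :- :1 ∶ y :* z := :1 and []) refl (proj₂ (inverse y y≢0)))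
        refl (solve F (x ∷ proj₁ (inverse y y≢0) ∷ []) (λ x z → :0 :^ 3 := (z :* (:- x :+ x)) :^ 3 given []) refl)

    flat-transitive : ∀ ρ → Flat.Transitive ρ
    flat-transitive ρ = Flat.transitive ρ (1# , 1≢0) λ (y , y≢0) → 0# , proj₁ (inverse y y≢0) , unit⇒nonzeroʳ (proj₂ (inverse y y≢0)) , (λ _ → refl) ,
      coordinatewise refl (solve F (ρ ∷ y ∷ proj₁ (inverse y y≢0) ∷ []) (λ ρ y z → ρ :* (:1 :* :1) := ρ :* (z :* y :* (z :* y))
        given :- (ρ :* (y :* z :+ :1)) ∶ y :* z := :1 and []) refl (proj₂ (inverse y y≢0))) refl refl

    -- e₂ (move σ)⁻¹ is the point where the tangent at P σ meets the axis of Γ.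
    axisPoint-separated : ∀ σ τ → let x = (e₂ ⊙ matrix⁻¹ (move σ)) ⊙ matrix (move τ) in
      x (# 0) ≡ 0# × x (# 3) ≡ 0# × (x (# 1) ≡ 0# → σ ≡ τ)
    axisPoint-separated (just s) (just t) =
      solve F (s ∷ t ∷ []) (λ s t → x s t (# 0) := :0 given (s :- t) :* (s :- t) ∶ 3 :· :1 := :0 and []) refl 3≡0 ,
      solve F (s ∷ t ∷ []) (λ s t → x s t (# 3) := :0 given []) refl ,
      λ e → cong just (solve F (s ∷ t ∷ []) (λ s t → s := t given :- :1 ∶ x s t (# 1) := :0 and s :- t ∶ 3 :· :1 := :0 and []) refl e 3≡0)
      where
      x : ∀ {n} → _ → _ → Fin 4 → _
      x {n} s t j = :∑ (λ k → :∑ {n} (λ i → :vector :0 :0 :1 :0 i :* :sym³ (:1 :* :1) (:- (:1 :* :- s)) (:- (:1 :* :0)) (:1 :* :1) i k) :* :sym³ :1 (:- t) :0 :1 k j)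
    axisPoint-separated (just s) ∞ =
      solve F (s ∷ []) (λ s → x s (# 0) := :0 given []) refl ,
      solve F (s ∷ []) (λ s → x s (# 3) := :0 given s :* s ∶ 3 :· :1 := :0 and []) refl 3≡0 ,
      λ e → ⊥-elim (1≢0 (solve F (s ∷ []) (λ s → :1 := :0 given :1 ∶ x s (# 1) := :0 and []) refl e))
      where
      x : ∀ {n} → _ → Fin 4 → _
      x {n} s j = :∑ (λ k → :∑ {n} (λ i → :vector :0 :0 :1 :0 i :* :sym³ (:1 :* :1) (:- (:1 :* :- s)) (:- (:1 :* :0)) (:1 :* :1) i k) :* :sym³ :0 :1 :1 :0 k j)
    axisPoint-separated ∞ (just t) =
      solve F (t ∷ []) (λ t → x t (# 0) := :0 given :- t ∶ 3 :· :1 := :0 and []) refl 3≡0 ,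
      solve F (t ∷ []) (λ t → x t (# 3) := :0 given []) refl ,
      λ e → ⊥-elim (1≢0 (solve F (t ∷ []) (λ t → :1 := :0 given :1 ∶ x t (# 1) := :0 and []) refl e))
      where
      x : ∀ {n} → _ → Fin 4 → _
      x {n} t j = :∑ (λ k → :∑ {n} (λ i → :vector :0 :0 :1 :0 i :* :sym³ (:- :1 :* :0) (:- (:- :1 :* :1)) (:- (:- :1 :* :1)) (:- :1 :* :0) i k) :* :sym³ :1 (:- t) :0 :1 k j)
    axisPoint-separated ∞ ∞ = solve F [] (x (# 0) := :0 given []) refl , solve F [] (x (# 3) := :0 given []) refl , λ _ → refl
      where
      x : ∀ {n} → Fin 4 → _
      x {n} j = :∑ (λ k → :∑ {n} (λ i → :vector :0 :0 :1 :0 i :* :sym³ (:- :1 :* :0) (:- (:- :1 :* :1)) (:- (:- :1 :* :1)) (:- :1 :* :0) i k) :* :sym³ :0 :1 :1 :0 k j)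

    -- When 3 = 0 distinct tangents meet the axis of Γ in distinct points. A member meets the axis
    -- only in `e₂`, the point belonging to its own base parameter.
    axis⇒BaseUnique : (S : Family) → (∀ {ℓ} → Family.Member S ℓ → e₂ ∈ᵥ ℓ) →
      (∀ {ℓ} → Family.Member S ℓ → ∀ {x} → x ∈ᵥ ℓ → x (# 0) ≡ 0# → x (# 3) ≡ 0# → x (# 1) ≡ 0#) → Family.BaseUnique S
    axis⇒BaseUnique S e₂∈ axis {ℓ} {σ} {τ} ℓσ ℓτ = let (x₀≡0 , x₃≡0 , separate) = axisPoint-separated σ τ in
      separate (axis ℓτ (image∈ (move τ) (preimage∈ (move σ) (e₂∈ ℓσ))) x₀≡0 x₃≡0)

    skew-axis : ∀ {ℓ x y} → e₂ ∈ᵥ ℓ → ⟪ 1# , x , 0# , y ⟫ ∈ᵥ ℓ → ∀ {u} → u ∈ᵥ ℓ → u (# 0) ≡ 0# → u (# 1) ≡ 0#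
    skew-axis {x = x} e₂∈ w∈ {u} u∈ u₀≡0 = trans (echelon-coordinates {# 2} {# 0} (echelon refl refl refl refl) e₂∈ w∈ u∈ (# 1))
      (trans (cong (λ z → u (# 2) * 0# + z * x) u₀≡0) (trans (cong₂ _+_ (zeroʳ _) (zeroˡ _)) (+-identityʳ 0#)))

    flat-axis : ∀ {ℓ x} → e₂ ∈ᵥ ℓ → ⟪ 0# , x , 0# , 1# ⟫ ∈ᵥ ℓ → ∀ {u} → u ∈ᵥ ℓ → u (# 3) ≡ 0# → u (# 1) ≡ 0#
    flat-axis {x = x} e₂∈ w∈ {u} u∈ u₃≡0 = trans (echelon-coordinates {# 2} {# 3} (echelon refl refl refl refl) e₂∈ w∈ u∈ (# 1))
      (trans (cong (λ z → u (# 2) * 0# + z * x) u₃≡0) (trans (cong₂ _+_ (zeroʳ _) (zeroˡ _)) (+-identityʳ 0#)))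

    skew-baseUnique : Skew.BaseUnique
    skew-baseUnique = axis⇒BaseUnique Skew.family (λ { (_ , Skew.basis v∈ _) → v∈ })
      (λ { (_ , Skew.basis v∈ w∈) u∈ u₀≡0 _ → skew-axis v∈ w∈ u∈ u₀≡0 })

    flat-baseUnique : ∀ ρ → Flat.BaseUnique ρ
    flat-baseUnique ρ = axis⇒BaseUnique (Flat.family ρ) (λ { (_ , Flat.basis v∈ _) → v∈ })
      (λ { (_ , Flat.basis v∈ w∈) u∈ _ u₃≡0 → flat-axis v∈ w∈ u∈ u₃≡0 })

    skew-listing : Skew.Listing (q ℕ.* Enumeration.size nonzeroElements)
    skew-listing = Skew.listing (×↔ cardinality (↔.↔-refl {A = Fin size}))
      (λ (x , i) → x , nz i , satisfies i) (λ _ w≗ → separate (cube-injective (w≗ (# 3))) (w≗ (# 1)))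
      λ (x , y , y≢0) → let (i , e) = surjective y≢0 in
        (x , i) , (λ _ → refl) , coordinatewise refl (cong (x +_) e) refl refl
      where
      open Enumeration nonzeroElements renaming (element to nz)
      separate : ∀ {x i x′ i′} → x ≡ x′ → x + nz i ≡ x′ + nz i′ → (x , i) ≡ (x′ , i′)
      separate {x} {i} {x′} {i′} refl e = cong (x ,_) (injective (solve F (x ∷ nz i ∷ nz i′ ∷ []) (λ x y z → y := z
        given :1 ∶ x :+ y := x :+ z and []) refl e))

    flat-listing : ∀ {ρ} → ρ ≢ 0# → Flat.Listing ρ half
    flat-listing {ρ} ρ≢0 = Flat.listing ρ ↔.↔-refl (λ i → positive i , positive-nonzero i)
      (λ _ w≗ → positive-square-injective (*-cancelˡ ρ≢0 (w≗ (# 1))))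
      λ (y , y≢0) → let (i , e) = positive-root y≢0 in i , (λ _ → refl) , coordinatewise refl (cong (ρ *_) e) refl refl

-- The line types in standard position

module Classification {q} (5≤q : 5 ℕ.≤ q) (F : FiniteField q) (K : FiniteField (q ℕ.^ 2)) (E : Extension F K) where
  open FiniteField F
  open Arithmetic F
  open ProjectiveSpace F
  open TwistedCubic F
  open LineTypes F K E
  open Linear F
  open Projective F
  open Projectivity
  open Action 5≤q F
  open Families 5≤q F
  open StandardPosition 5≤q F
  open ShapeInstances 5≤q F

  preimageParameter : ∀ φ → φ ∈G → ∀ χ → ∃ λ σ → Maps φ σ χ
  preimageParameter φ φ∈G χ = let (σ , Pχφ⁻¹∼Pσ) = Equivalence.from (φ∈G (P χ ▹ φ ⁻¹)) (χ , ⁻¹-▹ (P χ) φ) in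
    σ , maps (∼-trans (P σ ▹ φ) (P χ ▹ φ ⁻¹ ▹ φ) (P χ)
      (▹-cong (P σ) (P χ ▹ φ ⁻¹) φ (∼-sym (P χ ▹ φ ⁻¹) (P σ) Pχφ⁻¹∼Pσ)) (⁻¹-▹ (P χ) φ))

  -- A line through P τ meets 𝒞 only there iff its translate to P O does.
  onlyO⇒≡ : ∀ τ {ℓ σ} → OnlyO (ℓ ▶ move τ) → coord (P σ) ∈ᵥ ℓ → σ ≡ τ
  onlyO⇒≡ τ {ℓ} {σ} onlyO Pσ∈ℓ = let (χ , σ↦χ) = imageParameter (move τ) (move∈G τ) σ in
    maps-injective (subst (Maps (move τ) σ) (onlyO χ (P∈-image σ↦χ Pσ∈ℓ)) σ↦χ) (maps-move τ)

  BasedUnisecant : Parameter → Pred Line 0ℓ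
  BasedUnisecant τ ℓ = e₃ ∈ᵥ ℓ ▶ move τ × OnlyO (ℓ ▶ move τ)

  unisecant⇒based : ∀ {ℓ} → Unisecant ℓ → ∃ λ τ → BasedUnisecant τ ℓ
  unisecant⇒based {ℓ} (X , ((τ , X∼Pτ) , X∈ℓ) , unique) = τ , PO∈⇒e₃∈ (P∈-image (maps-move τ) Pτ∈ℓ) , λ χ Pχ∈ →
    let (σ , σ↦χ) = preimageParameter (move τ) (move∈G τ) χ
        σ≡τ = P-injective σ τ (∼-trans (P σ) X (P τ) (unique (P σ) (σ , ∼-refl (P σ)) (∈ᵥ⇒∈ₗ (P∈-preimage σ↦χ Pχ∈))) X∼Pτ)
    in maps-unique (subst (λ ρ → Maps (move τ) ρ χ) σ≡τ σ↦χ) (maps-move τ)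
    where
    Pτ∈ℓ : coord (P τ) ∈ᵥ ℓ
    Pτ∈ℓ = ∼∈ (P τ) X (∼-sym X (P τ) X∼Pτ) (∈ₗ⇒∈ᵥ X∈ℓ)

  based⇒unisecant : ∀ τ {ℓ} → BasedUnisecant τ ℓ → Unisecant ℓ
  based⇒unisecant τ {ℓ} (e₃∈ , onlyO) = P τ , ((τ , ∼-refl (P τ)) , ∈ᵥ⇒∈ₗ (P∈-preimage (maps-move τ) (e₃∈⇒PO∈ e₃∈))) ,
    λ { Y (σ , Y∼Pσ) Y∈ℓ → subst (λ ρ → Y ∼ P ρ) (onlyO⇒≡ τ {σ = σ} onlyO (∼∈ (P σ) Y (∼-sym Y (P σ) Y∼Pσ) (∈ₗ⇒∈ᵥ Y∈ℓ))) Y∼Pσ }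

  -- ν(1, x) is the point P (1/x) of 𝒞.
  secant₀-second : ∀ {ℓ x δ} → δ ≡ 0# → e₃ ∈ᵥ ℓ → ⟪ 1# , x , x * x + δ , 0# ⟫ ∈ᵥ ℓ → ∃ λ χ → χ ≢ O × coord (P χ) ∈ᵥ ℓ
  secant₀-second {ℓ} {x} {δ} δ≡0 e₃∈ w∈ with x ≟ 0#
  ... | yes x≡0 = ∞ , (λ ()) , ≗∈ w∈ (coordinatewise refl (sym x≡0)
    (solve F (x ∷ δ ∷ []) (λ x δ → :0 := x :* x :+ δ given :- x ∶ x := :0 and :- :1 ∶ δ := :0 and []) refl x≡0 δ≡0) refl)
  ... | no x≢0 = just z , (λ e → unit⇒nonzeroʳ xz≡1 (just-injective e)) , combination∈ 1# (z ^ 3) e₃∈ w∈ (coordinatewise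
    (solve F (z ∷ []) (λ z → z :^ 3 := :1 :* :0 :+ z :^ 3 :* :1 given []) refl)
    (solve F (x ∷ z ∷ []) (λ x z → z :^ 2 := :1 :* :0 :+ z :^ 3 :* x given :- (z :^ 2) ∶ x :* z := :1 and []) refl xz≡1)
    (solve F (x ∷ z ∷ δ ∷ []) (λ x z δ → z := :1 :* :0 :+ z :^ 3 :* (x :* x :+ δ)
      given :- (z :* (x :* z :+ :1)) ∶ x :* z := :1 and :- (z :^ 3) ∶ δ := :0 and []) refl xz≡1 δ≡0)
    (solve F (z ∷ []) (λ z → :1 := :1 :* :1 :+ z :^ 3 :* :0 given []) refl))
    where
    z = proj₁ (inverse x x≢0)
    xz≡1 = proj₂ (inverse x x≢0)

  second-secant₀ : ∀ {ℓ} χ → χ ≢ O → e₃ ∈ᵥ ℓ → coord (P χ) ∈ᵥ ℓ → Secant.Member 0# ℓ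
  second-secant₀ ∞ χ≢O e₃∈ P∈ = (0# , 1# , 1≢0) , Secant.basis e₃∈ (≗∈ P∈ (coordinatewise refl refl
    (solve F [] (:0 :* :0 :+ :0 :* (:1 :* :1) := :0 given []) refl) refl))
  second-secant₀ (just v) χ≢O e₃∈ P∈ = (z , 1# , 1≢0) , Secant.basis e₃∈ (combination∈ (- (z ^ 3)) (z ^ 3) e₃∈ P∈ (coordinatewise
    (solve F (v ∷ z ∷ []) (λ v z → :1 := :- (z :^ 3) :* :0 :+ z :^ 3 :* v :^ 3
      given :- (:1 :+ v :* z :+ v :* z :* v :* z) ∶ v :* z := :1 and []) refl vz≡1)
    (solve F (v ∷ z ∷ []) (λ v z → z := :- (z :^ 3) :* :0 :+ z :^ 3 :* v :^ 2
      given :- (z :* (:1 :+ v :* z)) ∶ v :* z := :1 and []) refl vz≡1)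
    (solve F (v ∷ z ∷ []) (λ v z → z :* z :+ :0 :* (:1 :* :1) := :- (z :^ 3) :* :0 :+ z :^ 3 :* v
      given :- (z :* z) ∶ v :* z := :1 and []) refl vz≡1)
    (solve F (z ∷ []) (λ z → :0 := :- (z :^ 3) :* :1 :+ z :^ 3 :* :1 given []) refl)))
    where
    z = proj₁ (inverse v (χ≢O ∘ cong just))
    vz≡1 = proj₂ (inverse v (χ≢O ∘ cong just))

  realChord≐ : RealChord ≐ Secant.Based 0#
  realChord≐ = (λ {ℓ} → there {ℓ}) , (λ {ℓ} → back {ℓ})
    where
    there : ∀ {ℓ} → RealChord ℓ → Secant.Based 0# ℓ
    there {ℓ} (X , Y , (σ , X∼Pσ) , (τ , Y∼Pτ) , X≁Y , X∈ℓ , Y∈ℓ) = σ , second-secant₀ χ χ≢O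
        (PO∈⇒e₃∈ (P∈-image (maps-move σ) (∼∈ (P σ) X (∼-sym X (P σ) X∼Pσ) (∈ₗ⇒∈ᵥ X∈ℓ))))
        (P∈-image τ↦χ (∼∈ (P τ) Y (∼-sym Y (P τ) Y∼Pτ) (∈ₗ⇒∈ᵥ Y∈ℓ)))
      where
      χ = proj₁ (imageParameter (move σ) (move∈G σ) τ)
      τ↦χ = proj₂ (imageParameter (move σ) (move∈G σ) τ)
      χ≢O : χ ≢ O
      χ≢O e = X≁Y (∼-trans X (P σ) Y X∼Pσ (∼-sym Y (P σ)
        (subst (λ ρ → Y ∼ P ρ) (maps-injective (subst (Maps (move σ) τ) e τ↦χ) (maps-move σ)) Y∼Pτ)))
    back : ∀ {ℓ} → Secant.Based 0# ℓ → RealChord ℓ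
    back {ℓ} (τ , (x , y , _) , Secant.basis e₃∈ w∈) = conclude (secant₀-second (zeroˡ (y * y)) e₃∈ w∈)
      where
      conclude : (∃ λ χ → χ ≢ O × coord (P χ) ∈ᵥ ℓ ▶ move τ) → RealChord ℓ
      conclude (χ , χ≢O , Pχ∈) = let (σ , σ↦χ) = preimageParameter (move τ) (move∈G τ) χ in
        P τ , P σ , (τ , ∼-refl (P τ)) , (σ , ∼-refl (P σ)) ,
        (λ e → χ≢O (maps-unique σ↦χ (subst (λ ρ → Maps (move τ) ρ O) (P-injective τ σ e) (maps-move τ)))) ,
        ∈ᵥ⇒∈ₗ (P∈-preimage (maps-move τ) (e₃∈⇒PO∈ e₃∈)) , ∈ᵥ⇒∈ₗ (P∈-preimage σ↦χ Pχ∈)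

  -- The unfolding of `X ∈ₚ π` on bare vectors; a proof of incidence is a proof that this form
  -- vanishes.
  planeForm : Plane → Vector₄ → Carrier
  planeForm π x = coord π (# 0) * x (# 0) + (coord π (# 1) * x (# 1) + (coord π (# 2) * x (# 2) + (coord π (# 3) * x (# 3) + 0#)))

  planeForm-combination : ∀ π {a b} {x v w : Vector₄} → (∀ k → x k ≡ a * v k + b * w k) → planeForm π v ≡ 0# → planeForm π w ≡ 0# → planeForm π x ≡ 0#
  planeForm-combination π {a} {b} {x} {v} {w} h hv hw = solve F
    (a ∷ b ∷ coord π (# 0) ∷ coord π (# 1) ∷ coord π (# 2) ∷ coord π (# 3) ∷ x (# 0) ∷ x (# 1) ∷ x (# 2) ∷ x (# 3)
      ∷ v (# 0) ∷ v (# 1) ∷ v (# 2) ∷ v (# 3) ∷ w (# 0) ∷ w (# 1) ∷ w (# 2) ∷ w (# 3) ∷ [])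
    (λ a b p₀ p₁ p₂ p₃ x₀ x₁ x₂ x₃ v₀ v₁ v₂ v₃ w₀ w₁ w₂ w₃ →
      let form = λ y₀ y₁ y₂ y₃ → p₀ :* y₀ :+ (p₁ :* y₁ :+ (p₂ :* y₂ :+ (p₃ :* y₃ :+ :0))) in
      form x₀ x₁ x₂ x₃ := :0 given a ∶ form v₀ v₁ v₂ v₃ := :0 and b ∶ form w₀ w₁ w₂ w₃ := :0
      and p₀ ∶ x₀ := a :* v₀ :+ b :* w₀ and p₁ ∶ x₁ := a :* v₁ :+ b :* w₁ and p₂ ∶ x₂ := a :* v₂ :+ b :* w₂ and p₃ ∶ x₃ := a :* v₃ :+ b :* w₃ and [])
    refl hv hw (h (# 0)) (h (# 1)) (h (# 2)) (h (# 3))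

  echelon-isMeet : ∀ {ℓ π π′ i j v w} → Echelon i j v w → v ∈ᵥ ℓ → w ∈ᵥ ℓ →
    planeForm π v ≡ 0# → planeForm π w ≡ 0# → planeForm π′ v ≡ 0# → planeForm π′ w ≡ 0# →
    (∀ x → planeForm π x ≡ 0# → planeForm π′ x ≡ 0# → SpannedBy x v w) → IsMeet ℓ π π′
  echelon-isMeet {ℓ} {π} {π′} {v = v} {w} ech v∈ w∈ πv πw π′v π′w solutions X = mk⇔
    (λ X∈ → let h = echelon-coordinates ech v∈ w∈ (∈ₗ⇒∈ᵥ X∈) in
      planeForm-combination π {x = coord X} {v} {w} h πv πw , planeForm-combination π′ {x = coord X} {v} {w} h π′v π′w)
    (λ (h , h′) → ∈ᵥ⇒∈ₗ (spanned∈ (solutions (coord X) h h′) v∈ w∈))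

  isMeet⇒∈ : ∀ π π′ {ℓ} → IsMeet ℓ π π′ → ∀ X → planeForm π (coord X) ≡ 0# → planeForm π′ (coord X) ≡ 0# → coord X ∈ᵥ ℓ
  isMeet⇒∈ π π′ meet X h h′ = ∈ₗ⇒∈ᵥ (Equivalence.from (meet X) (h , h′))

  e₀e₁⇒tangent∞ : ∀ {ℓ} → e₀ ∈ᵥ ℓ → e₁ ∈ᵥ ℓ → TangentAt ∞ ℓ
  e₀e₁⇒tangent∞ {ℓ} e₀∈ e₁∈ = echelon-isMeet {ℓ} {x₂=0} {x₃=0} {# 0} {# 1} {e₀} {e₁} (echelon refl refl refl refl) e₀∈ e₁∈
    (solve F [] (:0 :* :1 :+ (:0 :* :0 :+ (:1 :* :0 :+ (:0 :* :0 :+ :0))) := :0 given []) refl)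
    (solve F [] (:0 :* :0 :+ (:0 :* :1 :+ (:1 :* :0 :+ (:0 :* :0 :+ :0))) := :0 given []) refl)
    (solve F [] (:0 :* :1 :+ (:0 :* :0 :+ (:0 :* :0 :+ (:1 :* :0 :+ :0))) := :0 given []) refl)
    (solve F [] (:0 :* :0 :+ (:0 :* :1 :+ (:0 :* :0 :+ (:1 :* :0 :+ :0))) := :0 given []) refl)
    λ x h h′ → x (# 0) , x (# 1) , coordinatewise
      (solve F (x (# 0) ∷ x (# 1) ∷ []) (λ a b → a := a :* :1 :+ b :* :0 given []) refl)
      (solve F (x (# 0) ∷ x (# 1) ∷ []) (λ a b → b := a :* :0 :+ b :* :1 given []) refl)
      (solve F (x (# 0) ∷ x (# 1) ∷ x (# 2) ∷ x (# 3) ∷ []) (λ a b c d → c := a :* :0 :+ b :* :0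
        given :1 ∶ :0 :* a :+ (:0 :* b :+ (:1 :* c :+ (:0 :* d :+ :0))) := :0 and []) refl h)
      (solve F (x (# 0) ∷ x (# 1) ∷ x (# 2) ∷ x (# 3) ∷ []) (λ a b c d → d := a :* :0 :+ b :* :0
        given :1 ∶ :0 :* a :+ (:0 :* b :+ (:0 :* c :+ (:1 :* d :+ :0))) := :0 and []) refl h′)

  tangent≐ : Tangent ≐ TangentLine.Based
  tangent≐ = (λ {ℓ} → there {ℓ}) , (λ {ℓ} → back {ℓ})
    where
    there : ∀ {ℓ} → Tangent ℓ → TangentLine.Based ℓ
    there {ℓ} (just t , P∈ , D∈) = just t , tt , TangentLine.basis
      (PO∈⇒e₃∈ (P∈-image (maps-move (just t)) (∈ₗ⇒∈ᵥ P∈)))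
      (≗∈ (image∈ (translation (- t)) (∈ₗ⇒∈ᵥ D∈)) (coordinatewise
        (solve F (t ∷ []) (claim (# 0)) refl) (solve F (t ∷ []) (claim (# 1)) refl) (solve F (t ∷ []) (claim (# 2)) refl) (solve F (t ∷ []) (claim (# 3)) refl)))
      where
      claim : Fin 4 → _ → Claim 1
      claim k t = :vector :0 :0 :1 :0 k := :∑ (λ i → :vector (3 :· (t :^ 2)) (2 :· t) :1 :0 i :* :sym³ :1 (:- t) :0 :1 i k) given []
    -- The inversion reverses the coordinates, so it takes the basis `e₀`, `e₁` of the tangent at
    -- `P ∞` to `e₃`, `e₂`.
    there {ℓ} (∞ , meet) = ∞ , tt , TangentLine.basis
      (≗∈ (image∈ inversion (isMeet⇒∈ x₂=0 x₃=0 {ℓ} meet (P ∞) (solve F [] (:0 :* :1 :+ (:0 :* :0 :+ (:1 :* :0 :+ (:0 :* :0 :+ :0))) := :0 given []) refl)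
            (solve F [] (:0 :* :1 :+ (:0 :* :0 :+ (:0 :* :0 :+ (:1 :* :0 :+ :0))) := :0 given []) refl)))
        (coordinatewise (solve F [] (claim (:vector :0 :0 :0 :1) (:vector :1 :0 :0 :0) (# 0)) refl) (solve F [] (claim (:vector :0 :0 :0 :1) (:vector :1 :0 :0 :0) (# 1)) refl)
          (solve F [] (claim (:vector :0 :0 :0 :1) (:vector :1 :0 :0 :0) (# 2)) refl) (solve F [] (claim (:vector :0 :0 :0 :1) (:vector :1 :0 :0 :0) (# 3)) refl)))
      (≗∈ (image∈ inversion (isMeet⇒∈ x₂=0 x₃=0 {ℓ} meet ⟨ e₁ , unit (# 1) refl ⟩ (solve F [] (:0 :* :0 :+ (:0 :* :1 :+ (:1 :* :0 :+ (:0 :* :0 :+ :0))) := :0 given []) refl)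
            (solve F [] (:0 :* :0 :+ (:0 :* :1 :+ (:0 :* :0 :+ (:1 :* :0 :+ :0))) := :0 given []) refl)))
        (coordinatewise (solve F [] (claim (:vector :0 :0 :1 :0) (:vector :0 :1 :0 :0) (# 0)) refl) (solve F [] (claim (:vector :0 :0 :1 :0) (:vector :0 :1 :0 :0) (# 1)) refl)
          (solve F [] (claim (:vector :0 :0 :1 :0) (:vector :0 :1 :0 :0) (# 2)) refl) (solve F [] (claim (:vector :0 :0 :1 :0) (:vector :0 :1 :0 :0) (# 3)) refl)))
      where
      claim : (Fin 4 → _) → (Fin 4 → _) → Fin 4 → Claim 0
      claim x y k = x k := :∑ (λ i → y i :* :sym³ :0 :1 :1 :0 i k) given []
    back : ∀ {ℓ} → TangentLine.Based ℓ → Tangent ℓ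
    back {ℓ} (just t , tt , TangentLine.basis e₃∈ e₂∈) = just t , ∈ᵥ⇒∈ₗ (P∈-preimage (maps-move (just t)) (e₃∈⇒PO∈ e₃∈)) ,
      ∈ᵥ⇒∈ₗ (≗∈ (preimage∈ (translation (- t)) e₂∈) (coordinatewise
        (solve F (t ∷ []) (claim (# 0)) refl) (solve F (t ∷ []) (claim (# 1)) refl) (solve F (t ∷ []) (claim (# 2)) refl) (solve F (t ∷ []) (claim (# 3)) refl)))
      where
      claim : Fin 4 → _ → Claim 1
      claim k t = :vector (3 :· (t :^ 2)) (2 :· t) :1 :0 k := :∑ (λ i → :vector :0 :0 :1 :0 i :* :sym³ (:1 :* :1) (:- (:1 :* :- t)) (:- (:1 :* :0)) (:1 :* :1) i k) given []
    back {ℓ} (∞ , tt , TangentLine.basis e₃∈ e₂∈) = ∞ , e₀e₁⇒tangent∞ {ℓ}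
      (≗∈ (P∈-preimage (maps-move ∞) (e₃∈⇒PO∈ e₃∈)) (coordinatewise refl refl refl refl))
      (≗∈ (preimage∈ inversion e₂∈) (coordinatewise (solve F [] (claim (# 0)) refl) (solve F [] (claim (# 1)) refl) (solve F [] (claim (# 2)) refl) (solve F [] (claim (# 3)) refl)))
      where
      claim : Fin 4 → Claim 0
      claim k = :vector :0 :1 :0 :0 k := :∑ (λ i → :vector :0 :0 :1 :0 i :* :sym³ (:- :1 :* :0) (:- (:- :1 :* :1)) (:- (:- :1 :* :1)) (:- :1 :* :0) i k) given []

  -- A Γ-plane containing the line contains its point `P τ`, hence is the osculating plane at that
  -- point.
  inΓ⇒⊑oscO : ∀ τ {ℓ} → e₃ ∈ᵥ ℓ ▶ move τ → InΓPlane ℓ → ℓ ▶ move τ ⊑osc O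
  inΓ⇒⊑oscO τ {ℓ} e₃∈ (σ , ℓ⊆) = subst (ℓ ▶ move τ ⊑osc_) (e₃∈osc⇒O {ℓ ▶ move τ} {proj₁ (move-osc τ σ)} e₃∈ m⊑) m⊑
    where
    m⊑ : ℓ ▶ move τ ⊑osc proj₁ (move-osc τ σ)
    m⊑ = OscMaps.onto (proj₂ (move-osc τ σ)) {ℓ} (⊆ₚ⇒⊑osc {ℓ} σ ℓ⊆)

  ⊑oscO⇒inΓ : ∀ τ {ℓ} → ℓ ▶ move τ ⊑osc O → InΓPlane ℓ
  ⊑oscO⇒inΓ τ {ℓ} m⊑ = τ , ⊑osc⇒⊆ₚ {ℓ} τ (OscMaps.back (move-osc-O τ) {ℓ} m⊑)

  tangent-⊑oscO : ∀ {ℓ} → e₃ ∈ᵥ ℓ → e₂ ∈ᵥ ℓ → ℓ ⊑osc O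
  tangent-⊑oscO {ℓ} e₃∈ e₂∈ = x₀≡0⇒⊑oscO {ℓ} λ x∈ →
    trans (echelon-coordinates {# 3} {# 2} (echelon refl refl refl refl) e₃∈ e₂∈ x∈ (# 0)) (trans (cong₂ _+_ (zeroʳ _) (zeroʳ _)) (+-identityʳ 0#))

  UΓ≐ : UΓ ≐ AllPlanar.Based
  UΓ≐ = (λ {ℓ} → there {ℓ}) , (λ {ℓ} → back {ℓ})
    where
    there : ∀ {ℓ} → UΓ ℓ → AllPlanar.Based ℓ
    there {ℓ} (unisecant , ¬tangent , inΓ) = conclude (unisecant⇒based unisecant)
      where
      conclude : (∃ λ τ → BasedUnisecant τ ℓ) → AllPlanar.Based ℓ
      conclude (τ , e₃∈ , onlyO) with pencil (ℓ ▶ move τ)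
      ... | secant x δ w∈ = ⊥-elim (secant-⋢osc {ℓ ▶ move τ} e₃∈ w∈ O (inΓ⇒⊑oscO τ {ℓ} e₃∈ inΓ))
      ... | planar x w∈ = τ , (x , tt) , AllPlanar.basis e₃∈ w∈
      ... | tangent e₂∈ = ⊥-elim (¬tangent (proj₂ tangent≐ {ℓ} (τ , tt , TangentLine.basis e₃∈ e₂∈)))
    back : ∀ {ℓ} → AllPlanar.Based ℓ → UΓ ℓ
    back {ℓ} (τ , (x , _) , AllPlanar.basis e₃∈ w∈) = based⇒unisecant τ (e₃∈ , onlyO) ,
      (λ t → ¬tangent (proj₁ tangent≐ {ℓ} t)) , ⊑oscO⇒inΓ τ {ℓ} (planar-⊑oscO {ℓ ▶ move τ} e₃∈ w∈)
      where
      onlyO = planar-onlyO e₃∈ w∈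
      e₂∉ : ¬ e₂ ∈ᵥ ℓ ▶ move τ
      e₂∉ e₂∈ = 1≢0 (trans (echelon-coordinates {# 3} {# 1} (echelon refl refl refl refl) e₃∈ w∈ e₂∈ (# 2))
        (solve F (x ∷ []) (λ x → :0 :* :0 :+ :0 :* x := :0 given []) refl))
      ¬tangent : ¬ TangentLine.Based ℓ
      ¬tangent (σ , tt , TangentLine.basis e₃∈′ e₂∈) = e₂∉ (subst (λ ρ → e₂ ∈ᵥ ℓ ▶ move ρ)
        (onlyO⇒≡ τ {σ = σ} onlyO (P∈-preimage (maps-move σ) (e₃∈⇒PO∈ e₃∈′))) e₂∈)

  -- δ = 0 would give a second point on 𝒞. The square class of δ is left open here, since it is
  -- treated differently for even and odd q.
  UnΓ⇒secant : ∀ {ℓ} → UnΓ ℓ → ∃ λ τ → ∃₂ λ x δ → δ ≢ 0# × e₃ ∈ᵥ ℓ ▶ move τ × ⟪ 1# , x , x * x + δ , 0# ⟫ ∈ᵥ ℓ ▶ move τ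
  UnΓ⇒secant {ℓ} (unisecant , ¬inΓ) = conclude (unisecant⇒based unisecant)
    where
    conclude : (∃ λ τ → BasedUnisecant τ ℓ) → ∃ λ τ → ∃₂ λ x δ → δ ≢ 0# × e₃ ∈ᵥ ℓ ▶ move τ × ⟪ 1# , x , x * x + δ , 0# ⟫ ∈ᵥ ℓ ▶ move τ
    conclude (τ , e₃∈ , onlyO) with pencil (ℓ ▶ move τ)
    ... | secant x δ w∈ = τ , x , δ , (λ δ≡0 → let (χ , χ≢O , Pχ∈) = secant₀-second δ≡0 e₃∈ w∈ in χ≢O (onlyO χ Pχ∈)) , e₃∈ , w∈
    ... | planar x w∈ = ⊥-elim (¬inΓ (⊑oscO⇒inΓ τ {ℓ} (planar-⊑oscO {ℓ ▶ move τ} e₃∈ w∈)))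
    ... | tangent e₂∈ = ⊥-elim (¬inΓ (⊑oscO⇒inΓ τ {ℓ} (tangent-⊑oscO {ℓ ▶ move τ} e₃∈ e₂∈)))

  secant⇒UnΓ : ∀ {ρ} → ρ ≢ 0# → ∀ {ℓ} → Secant.Based ρ ℓ → UnΓ ℓ
  secant⇒UnΓ ρ≢0 {ℓ} (τ , (x , y , y≢0) , Secant.basis e₃∈ w∈) =
    based⇒unisecant τ (e₃∈ , secant-onlyO e₃∈ w∈ (ρy²≢0 ρ≢0 y≢0)) , λ inΓ → secant-⋢osc {ℓ ▶ move τ} e₃∈ w∈ O (inΓ⇒⊑oscO τ {ℓ} e₃∈ inΓ)

-- Real axes and external lines in osculating planes

module AxisClassification {q} (5≤q : 5 ℕ.≤ q) (F : FiniteField q) (K : FiniteField (q ℕ.^ 2)) (E : Extension F K) where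
  open FiniteField F
  open Arithmetic F
  open ProjectiveSpace F
  open TwistedCubic F
  open LineTypes F K E
  open Linear F
  open Projective F
  open Projectivity
  open Action 5≤q F
  open Families 5≤q F
  open StandardPosition 5≤q F
  open ShapeInstances 5≤q F
  open Classification 5≤q F K E
  open ≡-Reasoning

  -- The planes at P O and P (1/x) meet in the line with basis
  -- (0,1,0,-3x²), (0,0,1,3x).
  axial₀-second : 3 · 1# ≢ 0# → ∀ {ℓ x δ} → δ ≡ 0# → ⟪ 0# , 1# , 0# , - (3 · (x * x + δ)) ⟫ ∈ᵥ ℓ → ⟪ 0# , 0# , 1# , 3 · x ⟫ ∈ᵥ ℓ →
    ∃ λ χ → χ ≢ O × ℓ ⊑osc χ × (∀ y → y (# 0) ≡ 0# → oscForm (S χ) (T χ) y ≡ 0# → y ∈ᵥ ℓ)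
  axial₀-second 3≢0 {ℓ} {x} {δ} δ≡0 v∈ w∈ = go (x ≟ 0#)
    where
    combine : ∀ (y : Vector₄) → y (# 0) ≡ 0# → y (# 3) ≡ y (# 1) * - (3 · (x * x + δ)) + y (# 2) * (3 · x) → y ∈ᵥ ℓ
    combine y y₀≡0 y₃≡ = combination∈ (y (# 1)) (y (# 2)) v∈ w∈ (coordinatewise
      (trans y₀≡0 (sym (trans (cong₂ _+_ (zeroʳ _) (zeroʳ _)) (+-identityʳ 0#))))
      (solve F (y (# 1) ∷ y (# 2) ∷ []) (λ a b → a := a :* :1 :+ b :* :0 given []) refl)
      (solve F (y (# 1) ∷ y (# 2) ∷ []) (λ a b → b := a :* :0 :+ b :* :1 given []) refl) y₃≡)
    coordinates : ∀ {y} → y ∈ᵥ ℓ → ∀ k → y k ≡ y (# 1) * ⟪ 0# , 1# , 0# , - (3 · (x * x + δ)) ⟫ k + y (# 2) * ⟪ 0# , 0# , 1# , 3 · x ⟫ k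
    coordinates = echelon-coordinates {# 1} {# 2} (echelon refl refl refl refl) v∈ w∈
    go : _ → ∃ λ χ → χ ≢ O × ℓ ⊑osc χ × (∀ y → y (# 0) ≡ 0# → oscForm (S χ) (T χ) y ≡ 0# → y ∈ᵥ ℓ)
    go (yes x≡0) = ∞ , (λ ()) ,
      (λ {y} y∈ → solve F (x ∷ δ ∷ y (# 0) ∷ y (# 1) ∷ y (# 2) ∷ y (# 3) ∷ []) (λ x δ y₀ y₁ y₂ y₃ → :osc :1 :0 (:vector y₀ y₁ y₂ y₃) := :0
        given :- :1 ∶ y₃ := y₁ :* :- (3 :· (x :* x :+ δ)) :+ y₂ :* (3 :· x) and 3 :· (y₁ :* x) :- 3 :· y₂ ∶ x := :0 and 3 :· y₁ ∶ δ := :0 and [])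
        refl (coordinates y∈ (# 3)) x≡0 δ≡0) ,
      λ y y₀≡0 h → combine y y₀≡0 (solve F (x ∷ δ ∷ y (# 0) ∷ y (# 1) ∷ y (# 2) ∷ y (# 3) ∷ [])
        (λ x δ y₀ y₁ y₂ y₃ → y₃ := y₁ :* :- (3 :· (x :* x :+ δ)) :+ y₂ :* (3 :· x)
        given :- :1 ∶ :osc :1 :0 (:vector y₀ y₁ y₂ y₃) := :0 and 3 :· (y₁ :* x) :- 3 :· y₂ ∶ x := :0 and 3 :· y₁ ∶ δ := :0 and []) refl h x≡0 δ≡0)
    go (no x≢0) = just z , (λ e → unit⇒nonzeroʳ xz≡1 (just-injective e)) ,
      (λ {y} y∈ → solve F (x ∷ z ∷ δ ∷ y (# 0) ∷ y (# 1) ∷ y (# 2) ∷ y (# 3) ∷ []) (λ x z δ y₀ y₁ y₂ y₃ → :osc z :1 (:vector y₀ y₁ y₂ y₃) := :0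
        given :1 ∶ y₀ := y₁ :* :0 :+ y₂ :* :0 and :- (z :^ 3) ∶ y₃ := y₁ :* :- (3 :· (x :* x :+ δ)) :+ y₂ :* (3 :· x)
        and 3 :· (y₁ :* z :* (:1 :+ x :* z)) :- 3 :· (y₂ :* z :^ 2) ∶ x :* z := :1 and 3 :· (y₁ :* z :^ 3) ∶ δ := :0 and [])
        refl (coordinates y∈ (# 0)) (coordinates y∈ (# 3)) xz≡1 δ≡0) ,
      λ y y₀≡0 h → combine y y₀≡0 (solve F (x ∷ z ∷ δ ∷ y (# 0) ∷ y (# 1) ∷ y (# 2) ∷ y (# 3) ∷ [])
        (λ x z δ y₀ y₁ y₂ y₃ → y₃ := y₁ :* :- (3 :· (x :* x :+ δ)) :+ y₂ :* (3 :· x)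
        given :- (x :^ 3) ∶ :osc z :1 (:vector y₀ y₁ y₂ y₃) := :0 and x :^ 3 ∶ y₀ := :0 and 3 :· y₁ ∶ δ := :0
        and :- (y₃ :* (:1 :+ x :* z :+ x :^ 2 :* z :^ 2)) :- 3 :· (y₁ :* x :^ 2) :+ 3 :· (y₂ :* x :* (:1 :+ x :* z)) ∶ x :* z := :1 and []) refl h y₀≡0 δ≡0 xz≡1)
      where
      z = proj₁ (inverse x x≢0)
      xz≡1 = proj₂ (inverse x x≢0)

  second-axial₀ : ∀ {ℓ} χ → χ ≢ O → ℓ ⊑osc O → ℓ ⊑osc χ → Axial.Member 0# ℓ
  second-axial₀ {ℓ} χ χ≢O ⊑O ⊑χ = classify (oscPencil {ℓ} ⊑O)
    where
    go : ∀ χ {α β} → χ ≢ O → ⟪ 0# , 1# , 0# , α ⟫ ∈ᵥ ℓ → ⟪ 0# , 0# , 1# , β ⟫ ∈ᵥ ℓ →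
      oscForm (S χ) (T χ) ⟪ 0# , 1# , 0# , α ⟫ ≡ 0# → oscForm (S χ) (T χ) ⟪ 0# , 0# , 1# , β ⟫ ≡ 0# → Axial.Member 0# ℓ
    go ∞ {α} {β} _ v∈ w∈ hv hw = (0# , 1# , 1≢0) , Axial.basis
      (≗∈ v∈ (coordinatewise refl refl refl (solve F (α ∷ []) (λ α → :- (3 :· (:0 :* :0 :+ :0 :* (:1 :* :1))) := α
        given :1 ∶ :osc :1 :0 (:vector :0 :1 :0 α) := :0 and []) refl hv)))
      (≗∈ w∈ (coordinatewise refl refl refl (solve F (β ∷ []) (λ β → 3 :· :0 := β
        given :1 ∶ :osc :1 :0 (:vector :0 :0 :1 β) := :0 and []) refl hw)))
    go (just v) {α} {β} v≢O v∈ w∈ hv hw = (z , 1# , 1≢0) , Axial.basis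
      (≗∈ v∈ (coordinatewise refl refl refl (solve F (v ∷ z ∷ α ∷ []) (λ v z α → :- (3 :· (z :* z :+ :0 :* (:1 :* :1))) := α
        given z :^ 3 ∶ :osc v :1 (:vector :0 :1 :0 α) := :0 and α :* (:1 :+ v :* z :+ v :^ 2 :* z :^ 2) :+ 3 :· (z :^ 2) ∶ v :* z := :1 and []) refl hv vz≡1)))
      (≗∈ w∈ (coordinatewise refl refl refl (solve F (v ∷ z ∷ β ∷ []) (λ v z β → 3 :· z := β
        given z :^ 3 ∶ :osc v :1 (:vector :0 :0 :1 β) := :0 and β :* (:1 :+ v :* z :+ v :^ 2 :* z :^ 2) :- 3 :· (z :* (:1 :+ v :* z)) ∶ v :* z := :1 and []) refl hw vz≡1)))
      where
      z = proj₁ (inverse v (v≢O ∘ cong just))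
      vz≡1 = proj₂ (inverse v (v≢O ∘ cong just))
    classify : OscPencil ℓ → Axial.Member 0# ℓ
    classify (through-O e₃∈)       = ⊥-elim (χ≢O (e₃∈osc⇒O {ℓ} {χ} e₃∈ ⊑χ))
    classify (axial α β v∈ w∈) = go χ χ≢O v∈ w∈ (⊑χ v∈) (⊑χ w∈)

  two-osc : ∀ σ {ℓ} τ → ¬ osc σ ∼ osc τ → ℓ ⊑osc σ → ℓ ⊑osc τ → ∃ λ χ → χ ≢ O × ℓ ▶ move σ ⊑osc O × ℓ ▶ move σ ⊑osc χ
  two-osc σ {ℓ} τ σ≁τ ⊑σ ⊑τ = χ , χ≢O , OscMaps.onto (move-osc-O σ) {ℓ} ⊑σ , OscMaps.onto h {ℓ} ⊑τ
    where
    χ = proj₁ (move-osc σ τ)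
    h = proj₂ (move-osc σ τ)
    χ≢O : χ ≢ O
    χ≢O e = σ≁τ (subst (λ ρ → osc σ ∼ osc ρ) (maps-injective (maps-move σ) (subst (Maps (move σ) τ) e (OscMaps.maps-point h))) (∼-refl (osc σ)))

  realAxis⊑ : ∀ {ℓ s t} → IsMeet ℓ (osc s) (osc t) → ℓ ⊑osc s × ℓ ⊑osc t
  realAxis⊑ {ℓ} {s} {t} meet = ⊆ₚ⇒⊑osc {ℓ} s (λ X X∈ → proj₁ (Equivalence.to (meet X) X∈)) , ⊆ₚ⇒⊑osc {ℓ} t (λ X X∈ → proj₂ (Equivalence.to (meet X) X∈))

  -- `P σ` lies on its own osculating plane, hence on that at τ if the planes coincide, and
  -- `P∈osc⇒≡` applies.
  osc-∼⇒≡ : ∀ σ τ → osc σ ∼ osc τ → σ ≡ τ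
  osc-∼⇒≡ σ τ (c , h) = sym (P∈osc⇒≡ τ σ (zero-product (begin
    c * planeForm (osc τ) (coord (P σ))  ≡⟨ solve F (c ∷ p τ (# 0) ∷ p τ (# 1) ∷ p τ (# 2) ∷ p τ (# 3) ∷ p σ (# 0) ∷ p σ (# 1) ∷ p σ (# 2) ∷ p σ (# 3) ∷ x (# 0) ∷ x (# 1) ∷ x (# 2) ∷ x (# 3) ∷ [])
      (λ c a₀ a₁ a₂ a₃ b₀ b₁ b₂ b₃ x₀ x₁ x₂ x₃ → c :* (a₀ :* x₀ :+ (a₁ :* x₁ :+ (a₂ :* x₂ :+ (a₃ :* x₃ :+ :0)))) := b₀ :* x₀ :+ (b₁ :* x₁ :+ (b₂ :* x₂ :+ (b₃ :* x₃ :+ :0)))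
        given :- x₀ ∶ b₀ := c :* a₀ and :- x₁ ∶ b₁ := c :* a₁ and :- x₂ ∶ b₂ := c :* a₂ and :- x₃ ∶ b₃ := c :* a₃ and []) refl (h (# 0)) (h (# 1)) (h (# 2)) (h (# 3)) ⟩
    planeForm (osc σ) (coord (P σ))      ≡⟨ ⇒∈osc (P σ) σ (trans (oscForm-cong (S σ) (T σ) (P≗ν σ)) (trans (oscForm-ν (S σ) (T σ) (S σ) (T σ))
                                              (solve F (S σ ∷ T σ ∷ []) (λ s t → (t :* s :- s :* t) :^ 3 := :0 given []) refl))) ⟩
    0#                                   ∎) (∼-factor≢0 (osc σ) (osc τ) (c , h))))
    where
    p : Parameter → Vector₄
    p τ = coord (osc τ)
    x = coord (P σ)

  module _ (3≢0 : 3 · 1# ≢ 0#) where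

    realAxis≐ : RealAxis ≐ Axial.Based 0#
    realAxis≐ = (λ {ℓ} → there {ℓ}) , (λ {ℓ} → back {ℓ})
      where
      there : ∀ {ℓ} → RealAxis ℓ → Axial.Based 0# ℓ
      there {ℓ} (s , t , s≁t , meet) =
        let (⊑s , ⊑t) = realAxis⊑ {ℓ} {s} {t} meet
            (χ , χ≢O , ⊑O , ⊑χ) = two-osc s {ℓ} t s≁t ⊑s ⊑t
        in s , second-axial₀ {ℓ ▶ move s} χ χ≢O ⊑O ⊑χ
      back : ∀ {ℓ} → Axial.Based 0# ℓ → RealAxis ℓ
      back {ℓ} (τ , (x , y , _) , Axial.basis v∈ w∈) = conclude (axial₀-second 3≢0 {ℓ ▶ move τ} (zeroˡ (y * y)) v∈ w∈)
        where
        conclude : (∃ λ χ → χ ≢ O × ℓ ▶ move τ ⊑osc χ × (∀ y → y (# 0) ≡ 0# → oscForm (S χ) (T χ) y ≡ 0# → y ∈ᵥ ℓ ▶ move τ)) → RealAxis ℓ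
        conclude (χ , χ≢O , ⊑χ , solutions) = meet-with (preimageParameter (move τ) (move∈G τ) χ)
          where
          meet-with : (∃ λ σ → Maps (move τ) σ χ) → RealAxis ℓ
          meet-with (σ , σ↦χ) = τ , σ , τ≁σ , λ X → mk⇔ (on-planes X) (from-planes X)
            where
            oσ : OscMaps (move τ) σ χ
            oσ = move-osc-at τ σ↦χ
            τ≁σ : ¬ osc τ ∼ osc σ
            τ≁σ e = χ≢O (maps-unique (subst (λ ρ → Maps (move τ) ρ χ) (sym (osc-∼⇒≡ τ σ e)) σ↦χ) (maps-move τ))
            ⊑τ : ℓ ⊑osc τ
            ⊑τ = OscMaps.back (move-osc-O τ) {ℓ} (axial-⊑oscO {ℓ ▶ move τ} v∈ w∈)
            ⊑σ : ℓ ⊑osc σ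
            ⊑σ = OscMaps.back oσ {ℓ} ⊑χ
            on-planes : ∀ X → X ∈ₗ ℓ → X ∈ₚ osc τ × X ∈ₚ osc σ
            on-planes X X∈ = ⊑osc⇒⊆ₚ {ℓ} τ ⊑τ X X∈ , ⊑osc⇒⊆ₚ {ℓ} σ ⊑σ X X∈
            from-planes : ∀ X → X ∈ₚ osc τ × X ∈ₚ osc σ → X ∈ₗ ℓ
            from-planes X (h , h′) = ∈ᵥ⇒∈ₗ (≗∈ (preimage∈ (move τ) image∈m) λ i →
                sym (⊙-inverse (coord X) (matrix (move τ)) (matrix⁻¹ (move τ)) (inverseʳ (move τ)) i))
              where
              image∈m : (coord X ⊙ matrix (move τ)) ∈ᵥ ℓ ▶ move τ
              image∈m = solutions (coord X ⊙ matrix (move τ))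
                (oscForm-O (coord X ⊙ matrix (move τ)) (OscMaps.form-image (move-osc-O τ) (coord X) (∈osc⇒ X τ h)))
                (OscMaps.form-image oσ (coord X) (∈osc⇒ X σ h′))

    EΓ⇒axial : ∀ {ℓ} → EΓ ℓ → ∃ λ τ → ∃₂ λ x δ → δ ≢ 0# ×
      ⟪ 0# , 1# , 0# , - (3 · (x * x + δ)) ⟫ ∈ᵥ ℓ ▶ move τ × ⟪ 0# , 0# , 1# , 3 · x ⟫ ∈ᵥ ℓ ▶ move τ
    EΓ⇒axial {ℓ} (external , (τ , ℓ⊆) , ¬axis) = go (oscPencil {ℓ ▶ move τ} (OscMaps.onto (move-osc-O τ) {ℓ} (⊆ₚ⇒⊑osc {ℓ} τ ℓ⊆)))
      where
      go : OscPencil (ℓ ▶ move τ) → ∃ λ τ → ∃₂ λ x δ → δ ≢ 0# ×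
        ⟪ 0# , 1# , 0# , - (3 · (x * x + δ)) ⟫ ∈ᵥ ℓ ▶ move τ × ⟪ 0# , 0# , 1# , 3 · x ⟫ ∈ᵥ ℓ ▶ move τ
      go (through-O e₃∈) = ⊥-elim (external (P τ , (τ , ∼-refl (P τ)) , ∈ᵥ⇒∈ₗ (P∈-preimage (maps-move τ) (e₃∈⇒PO∈ e₃∈))))
      go (axial α β v∈ w∈) = τ , x , δ , (λ δ≡0 → ¬axis (proj₂ realAxis≐ {ℓ} (τ , (x , 1# , 1≢0) , Axial.basis (≗∈ v∈′ (coordinatewise refl refl refl
          (solve F (x ∷ δ ∷ []) (λ x δ → :- (3 :· (x :* x :+ :0 :* (:1 :* :1))) := :- (3 :· (x :* x :+ δ)) given 3 :· :1 ∶ δ := :0 and []) refl δ≡0))) w∈′))) , v∈′ , w∈′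
        where
        t = proj₁ (inverse (3 · 1#) 3≢0)
        3t≡1 = proj₂ (inverse (3 · 1#) 3≢0)
        -- The equations 3x = β and -3(x² + δ) = α, solved for x and δ with t = 1/3.
        x = t * β
        δ = - (t * α) + - (x * x)
        v∈′ : ⟪ 0# , 1# , 0# , - (3 · (x * x + δ)) ⟫ ∈ᵥ ℓ ▶ move τ
        v∈′ = ≗∈ v∈ (coordinatewise refl refl refl (solve F (t ∷ α ∷ x ∷ []) (λ t α x → :- (3 :· (x :* x :+ (:- (t :* α) :- x :* x))) := α
          given α ∶ (3 :· :1) :* t := :1 and []) refl 3t≡1))
        w∈′ : ⟪ 0# , 0# , 1# , 3 · x ⟫ ∈ᵥ ℓ ▶ move τ
        w∈′ = ≗∈ w∈ (coordinatewise refl refl refl (solve F (t ∷ β ∷ []) (λ t β → 3 :· (t :* β) := β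
          given β ∶ (3 :· :1) :* t := :1 and []) refl 3t≡1))

    axial⇒EΓ : ∀ {ρ} → ρ ≢ 0# → ∀ {ℓ} → Axial.Based ρ ℓ → EΓ ℓ
    axial⇒EΓ {ρ} ρ≢0 {ℓ} (τ , (x , y , y≢0) , Axial.basis v∈ w∈) = external , ⊑oscO⇒inΓ τ {ℓ} (axial-⊑oscO {ℓ ▶ move τ} v∈ w∈) , ¬axis
      where
      no-point : ∀ σ → coord (P σ) ∈ᵥ ℓ → (∃ λ χ → Maps (move τ) σ χ) → Empty.⊥
      no-point σ Pσ∈ (χ , σ↦χ) = axial-external {ℓ ▶ move τ} v∈ w∈ χ (P∈-image σ↦χ Pσ∈)
      external : External ℓ
      external (X , (σ , X∼Pσ) , X∈) = no-point σ (∼∈ (P σ) X (∼-sym X (P σ) X∼Pσ) (∈ₗ⇒∈ᵥ X∈)) (imageParameter (move τ) (move∈G τ) σ)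
      only : ∀ s → ℓ ⊑osc s → (∃ λ χ → OscMaps (move τ) s χ) → s ≡ τ
      only s ⊑s (χ , h) = maps-injective (subst (Maps (move τ) s) χ≡O (OscMaps.maps-point h)) (maps-move τ)
        where
        χ≡O : χ ≡ O
        χ≡O = axial-onlyO 3≢0 {ℓ ▶ move τ} v∈ w∈ (ρy²≢0 ρ≢0 y≢0) χ (OscMaps.onto h {ℓ} ⊑s)
      same : ∀ s t → s ≡ τ → t ≡ τ → osc s ∼ osc t
      same s t refl refl = ∼-refl (osc s)
      -- A real axis lies in two distinct osculating planes, whereas `only` leaves just the one at
      -- τ.
      ¬axis : ¬ RealAxis ℓ
      ¬axis (s , t , s≁t , meet) = let (⊑s , ⊑t) = realAxis⊑ {ℓ} {s} {t} meet in
        s≁t (same s t (only s ⊑s (move-osc τ s)) (only t ⊑t (move-osc τ t)))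

-- Lines meeting the axis of Γ in characteristic 3

module ThreeClassification {q} (5≤q : 5 ℕ.≤ q) (F : FiniteField q) (K : FiniteField (q ℕ.^ 2)) (E : Extension F K)
  (3≡0 : FiniteField._·_ F 3 (FiniteField.1# F) ≡ FiniteField.0# F) where
  open FiniteField F
  open Arithmetic F
  open ProjectiveSpace F
  open TwistedCubic F
  open LineTypes F K E
  open Linear F
  open Projective F
  open Projectivity
  open Action 5≤q F
  open Families 5≤q F
  open StandardPosition 5≤q F
  open ShapeInstances 5≤q F
  open Classification 5≤q F K E
  open CharacteristicThree 3≡0
  open CharacteristicThreeInstances 3≡0
  open OddCharacteristic 2≢0

  module ΓLine = ShapeTheory axisShape

  private
    _:⊙_ : ∀ {n} → (Fin 4 → Expr ℤ n) → (Fin 4 → Fin 4 → Expr ℤ n) → Fin 4 → Expr ℤ n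
    (x :⊙ A) j = :∑ (λ i → x i :* A i j)

    :translation :translation⁻¹ : ∀ {n} → Expr ℤ n → Fin 4 → Fin 4 → Expr ℤ n
    :translation u = :sym³ :1 u :0 :1
    :translation⁻¹ u = :sym³ (:1 :* :1) (:- (:1 :* u)) (:- (:1 :* :0)) (:1 :* :1)

    :inversion :inversion⁻¹ : ∀ {n} → Fin 4 → Fin 4 → Expr ℤ n
    :inversion = :sym³ :0 :1 :1 :0
    :inversion⁻¹ = :sym³ (:- :1 :* :0) (:- (:- :1 :* :1)) (:- (:- :1 :* :1)) (:- :1 :* :0)

  -- The axis of Γ is the set x₀ = x₃ = 0.
  OnAxis : Vector₄ → Set
  OnAxis x = x (# 0) ≡ 0# × x (# 3) ≡ 0#

  -- The coordinates x₁ and x₂ contribute to x₀ and x₃ of the image only with a factor 3, or not at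
  -- all.
  move-axis : ∀ τ x → OnAxis x → OnAxis (x ⊙ matrix (move τ))
  move-axis (just t) x (x₀≡0 , x₃≡0) =
    solve F (t ∷ x (# 0) ∷ x (# 1) ∷ x (# 2) ∷ x (# 3) ∷ []) (λ t x₀ x₁ x₂ x₃ → (:vector x₀ x₁ x₂ x₃ :⊙ :translation (:- t)) (# 0) := :0
      given :1 ∶ x₀ := :0 and :- t :^ 3 ∶ x₃ := :0 and t :^ 2 :* x₂ :- t :* x₁ ∶ 3 :· :1 := :0 and []) refl x₀≡0 x₃≡0 3≡0 ,
    solve F (t ∷ x (# 0) ∷ x (# 1) ∷ x (# 2) ∷ x (# 3) ∷ []) (λ t x₀ x₁ x₂ x₃ → (:vector x₀ x₁ x₂ x₃ :⊙ :translation (:- t)) (# 3) := :0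
      given :1 ∶ x₃ := :0 and []) refl x₃≡0
  move-axis ∞ x (x₀≡0 , x₃≡0) =
    solve F (x (# 0) ∷ x (# 1) ∷ x (# 2) ∷ x (# 3) ∷ []) (λ x₀ x₁ x₂ x₃ → (:vector x₀ x₁ x₂ x₃ :⊙ :inversion) (# 0) := :0
      given :1 ∶ x₃ := :0 and []) refl x₃≡0 ,
    solve F (x (# 0) ∷ x (# 1) ∷ x (# 2) ∷ x (# 3) ∷ []) (λ x₀ x₁ x₂ x₃ → (:vector x₀ x₁ x₂ x₃ :⊙ :inversion) (# 3) := :0
      given :1 ∶ x₀ := :0 and []) refl x₀≡0

  move⁻¹-axis : ∀ τ x → OnAxis x → OnAxis (x ⊙ matrix⁻¹ (move τ))
  move⁻¹-axis (just t) x (x₀≡0 , x₃≡0) =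
    solve F (t ∷ x (# 0) ∷ x (# 1) ∷ x (# 2) ∷ x (# 3) ∷ []) (λ t x₀ x₁ x₂ x₃ → (:vector x₀ x₁ x₂ x₃ :⊙ :translation⁻¹ (:- t)) (# 0) := :0
      given :1 ∶ x₀ := :0 and t :^ 3 ∶ x₃ := :0 and t :^ 2 :* x₂ :+ t :* x₁ ∶ 3 :· :1 := :0 and []) refl x₀≡0 x₃≡0 3≡0 ,
    solve F (t ∷ x (# 0) ∷ x (# 1) ∷ x (# 2) ∷ x (# 3) ∷ []) (λ t x₀ x₁ x₂ x₃ → (:vector x₀ x₁ x₂ x₃ :⊙ :translation⁻¹ (:- t)) (# 3) := :0
      given :1 ∶ x₃ := :0 and []) refl x₃≡0
  move⁻¹-axis ∞ x (x₀≡0 , x₃≡0) =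
    solve F (x (# 0) ∷ x (# 1) ∷ x (# 2) ∷ x (# 3) ∷ []) (λ x₀ x₁ x₂ x₃ → (:vector x₀ x₁ x₂ x₃ :⊙ :inversion⁻¹) (# 0) := :0
      given :1 ∶ x₃ := :0 and []) refl x₃≡0 ,
    solve F (x (# 0) ∷ x (# 1) ∷ x (# 2) ∷ x (# 3) ∷ []) (λ x₀ x₁ x₂ x₃ → (:vector x₀ x₁ x₂ x₃ :⊙ :inversion⁻¹) (# 3) := :0
      given :1 ∶ x₀ := :0 and []) refl x₀≡0

  -- For a line this amounts to being the axis; containment is the form that is carried through
  -- `move` vector by vector.
  ContainsAxis : Pred Line 0ℓ
  ContainsAxis ℓ = ∀ x → OnAxis x → x ∈ᵥ ℓ

  containsAxis : ∀ {ℓ} → e₁ ∈ᵥ ℓ → e₂ ∈ᵥ ℓ → ContainsAxis ℓ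
  containsAxis e₁∈ e₂∈ x (x₀≡0 , x₃≡0) = combination∈ (x (# 1)) (x (# 2)) e₁∈ e₂∈ (coordinatewise
    (trans x₀≡0 (zero₂ _ _)) (solve F (x (# 1) ∷ x (# 2) ∷ []) (λ a b → a := a :* :1 :+ b :* :0 given []) refl)
    (solve F (x (# 1) ∷ x (# 2) ∷ []) (λ a b → b := a :* :0 :+ b :* :1 given []) refl) (trans x₃≡0 (zero₂ _ _)))
    where
    zero₂ : ∀ a b → 0# ≡ a * 0# + b * 0#
    zero₂ a b = solve F (a ∷ b ∷ []) (λ a b → :0 := a :* :0 :+ b :* :0 given []) refl

  containsAxis-move : ∀ τ {ℓ} → ContainsAxis ℓ → ContainsAxis (ℓ ▶ move τ)
  containsAxis-move τ axis x on = ≗∈ (image∈ (move τ) (axis (x ⊙ matrix⁻¹ (move τ)) (move⁻¹-axis τ x on)))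
    (λ i → sym (⊙-inverse x (matrix⁻¹ (move τ)) (matrix (move τ)) (inverseˡ (move τ)) i))

  containsAxis-move⁻¹ : ∀ τ {ℓ} → ContainsAxis (ℓ ▶ move τ) → ContainsAxis ℓ
  containsAxis-move⁻¹ τ axis x on = ≗∈ (preimage∈ (move τ) (axis (x ⊙ matrix (move τ)) (move-axis τ x on)))
    (λ i → sym (⊙-inverse x (matrix (move τ)) (matrix⁻¹ (move τ)) (inverseʳ (move τ)) i))

  planeForm-x₀ : ∀ x → planeForm x₀=0 x ≡ x (# 0)
  planeForm-x₀ x = solve F (x (# 0) ∷ x (# 1) ∷ x (# 2) ∷ x (# 3) ∷ []) (λ x₀ x₁ x₂ x₃ →
    :1 :* x₀ :+ (:0 :* x₁ :+ (:0 :* x₂ :+ (:0 :* x₃ :+ :0))) := x₀ given []) refl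

  planeForm-x₃ : ∀ x → planeForm x₃=0 x ≡ x (# 3)
  planeForm-x₃ x = solve F (x (# 0) ∷ x (# 1) ∷ x (# 2) ∷ x (# 3) ∷ []) (λ x₀ x₁ x₂ x₃ →
    :0 :* x₀ :+ (:0 :* x₁ :+ (:0 :* x₂ :+ (:1 :* x₃ :+ :0))) := x₃ given []) refl

  ΓAxis⇒containsAxis : ∀ {ℓ} → ΓAxis ℓ → ContainsAxis ℓ
  ΓAxis⇒containsAxis {ℓ} meet = containsAxis
    (isMeet⇒∈ x₀=0 x₃=0 {ℓ} meet ⟨ e₁ , unit (# 1) refl ⟩ (planeForm-x₀ e₁) (planeForm-x₃ e₁))
    (isMeet⇒∈ x₀=0 x₃=0 {ℓ} meet ⟨ e₂ , unit (# 2) refl ⟩ (planeForm-x₀ e₂) (planeForm-x₃ e₂))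

  containsAxis⇒ΓAxis : ∀ {ℓ} → ContainsAxis ℓ → ΓAxis ℓ
  containsAxis⇒ΓAxis {ℓ} axis = echelon-isMeet {ℓ} {x₀=0} {x₃=0} {# 1} {# 2} {e₁} {e₂} (echelon refl refl refl refl)
    (axis e₁ (refl , refl)) (axis e₂ (refl , refl)) (planeForm-x₀ e₁) (planeForm-x₀ e₂) (planeForm-x₃ e₁) (planeForm-x₃ e₂)
    λ x h h′ → x (# 1) , x (# 2) , coordinatewise
      (solve F (x (# 0) ∷ x (# 1) ∷ x (# 2) ∷ []) (λ z a b → z := a :* :0 :+ b :* :0 given :1 ∶ z := :0 and []) refl (trans (sym (planeForm-x₀ x)) h))
      (solve F (x (# 1) ∷ x (# 2) ∷ []) (λ a b → a := a :* :1 :+ b :* :0 given []) refl)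
      (solve F (x (# 1) ∷ x (# 2) ∷ []) (λ a b → b := a :* :0 :+ b :* :1 given []) refl)
      (solve F (x (# 3) ∷ x (# 1) ∷ x (# 2) ∷ []) (λ z a b → z := a :* :0 :+ b :* :0 given :1 ∶ z := :0 and []) refl (trans (sym (planeForm-x₃ x)) h′))

  ΓAxis≐ : ΓAxis ≐ ΓLine.Based
  ΓAxis≐ = (λ {ℓ} h → let axis = containsAxis-move O {ℓ} (ΓAxis⇒containsAxis {ℓ} h) in
              O , tt , ΓLine.basis (axis e₁ (refl , refl)) (axis e₂ (refl , refl)))
         , (λ { {ℓ} (τ , tt , ΓLine.basis e₁∈ e₂∈) → containsAxis⇒ΓAxis {ℓ} (containsAxis-move⁻¹ τ {ℓ} (containsAxis e₁∈ e₂∈)) })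

  ΓLine-transitive : ΓLine.Transitive
  ΓLine-transitive = ΓLine.transitive tt λ _ → 0# , 1# , 1≢0 , (λ _ → refl) , (λ _ → refl)

  external-move : ∀ τ {ℓ} → External ℓ → ∀ χ → ¬ coord (P χ) ∈ᵥ ℓ ▶ move τ
  external-move τ {ℓ} external χ Pχ∈ = go (preimageParameter (move τ) (move∈G τ) χ)
    where
    go : (∃ λ σ → Maps (move τ) σ χ) → Empty.⊥
    go (σ , σ↦χ) = external (P σ , (σ , ∼-refl (P σ)) , ∈ᵥ⇒∈ₗ (P∈-preimage σ↦χ Pχ∈))

  move-external : ∀ τ {ℓ} → (∀ χ → ¬ coord (P χ) ∈ᵥ ℓ ▶ move τ) → External ℓ
  move-external τ {ℓ} none (X , (σ , X∼Pσ) , X∈) = go (imageParameter (move τ) (move∈G τ) σ)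
    where
    go : (∃ λ χ → Maps (move τ) σ χ) → Empty.⊥
    go (χ , σ↦χ) = none χ (P∈-image σ↦χ (∼∈ (P σ) X (∼-sym X (P σ) X∼Pσ) (∈ₗ⇒∈ᵥ X∈)))

  -- The tangents meet the axis in all its points.
  e₂-translate : ∀ {ℓ} X → X ∈ₗ ℓ → OnAxis (coord X) → ∃ λ τ → e₂ ∈ᵥ ℓ ▶ move τ
  e₂-translate {ℓ} X X∈ (x₀≡0 , x₃≡0) = go (coord X (# 2) ≟ 0#)
    where
    x₁ = coord X (# 1)
    x₂ = coord X (# 2)
    go : _ → ∃ λ τ → e₂ ∈ᵥ ℓ ▶ move τ
    -- The point is `e₁`, where the tangent at `P ∞` meets the axis.
    go (yes x₂≡0) = ∞ , unscale e₂ (coord X ⊙ matrix inversion) (proj₂ (inverse x₁ x₁≢0)) (coordinatewise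
        (solve F vars (λ x₀ x₁ x₂ x₃ → x₁ :* :0 := (:vector x₀ x₁ x₂ x₃ :⊙ :inversion) (# 0) given :- :1 ∶ x₃ := :0 and []) refl x₃≡0)
        (solve F vars (λ x₀ x₁ x₂ x₃ → x₁ :* :0 := (:vector x₀ x₁ x₂ x₃ :⊙ :inversion) (# 1) given :- :1 ∶ x₂ := :0 and []) refl x₂≡0)
        (solve F vars (λ x₀ x₁ x₂ x₃ → x₁ :* :1 := (:vector x₀ x₁ x₂ x₃ :⊙ :inversion) (# 2) given []) refl)
        (solve F vars (λ x₀ x₁ x₂ x₃ → x₁ :* :0 := (:vector x₀ x₁ x₂ x₃ :⊙ :inversion) (# 3) given :- :1 ∶ x₀ := :0 and []) refl x₀≡0))
        (image∈ inversion (∈ₗ⇒∈ᵥ X∈))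
      where
      vars = coord X (# 0) ∷ x₁ ∷ x₂ ∷ coord X (# 3) ∷ []
      x₁≢0 : x₁ ≢ 0#
      x₁≢0 x₁≡0 = nonzero X (coordinatewise x₀≡0 x₁≡0 x₂≡0 x₃≡0)
    go (no x₂≢0) = just t , unscale e₂ (coord X ⊙ matrix (translation (- t))) (proj₂ (inverse x₂ x₂≢0)) (coordinatewise
        (solve F vars (λ z x₀ x₁ x₂ x₃ → x₂ :* :0 := (:vector x₀ x₁ x₂ x₃ :⊙ :translation (:- :- (z :* x₁))) (# 0)
          given :- :1 ∶ x₀ := :0 and :- ((z :* x₁) :^ 3) ∶ x₃ := :0
          and :- (z :* x₁ :* x₁) :- (z :* x₁) :^ 2 :* x₂ ∶ 3 :· :1 := :0 and []) refl x₀≡0 x₃≡0 3≡0)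
        (solve F vars (λ z x₀ x₁ x₂ x₃ → x₂ :* :0 := (:vector x₀ x₁ x₂ x₃ :⊙ :translation (:- :- (z :* x₁))) (# 1)
          given :- ((z :* x₁) :^ 2) ∶ x₃ := :0 and :- (2 :· x₁) ∶ x₂ :* z := :1 and :- x₁ ∶ 3 :· :1 := :0 and []) refl x₃≡0 x₂z≡1 3≡0)
        (solve F vars (λ z x₀ x₁ x₂ x₃ → x₂ :* :1 := (:vector x₀ x₁ x₂ x₃ :⊙ :translation (:- :- (z :* x₁))) (# 2)
          given :- (z :* x₁) ∶ x₃ := :0 and []) refl x₃≡0)
        (solve F vars (λ z x₀ x₁ x₂ x₃ → x₂ :* :0 := (:vector x₀ x₁ x₂ x₃ :⊙ :translation (:- :- (z :* x₁))) (# 3)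
          given :- :1 ∶ x₃ := :0 and []) refl x₃≡0))
        (image∈ (translation (- t)) (∈ₗ⇒∈ᵥ X∈))
      where
      z = proj₁ (inverse x₂ x₂≢0)
      x₂z≡1 = proj₂ (inverse x₂ x₂≢0)
      -- The tangent at `P (just t)` meets the axis in (0, 2t, 1, 0), and 2t = -t, so t = -x₁/x₂.
      t = - (z * x₁)
      vars = z ∷ coord X (# 0) ∷ x₁ ∷ x₂ ∷ coord X (# 3) ∷ []

  -- The normal form of a line through `e₂`, taken from its trace on x₂ = 0; the case depends on
  -- whether the coordinate x₀ of the trace vanishes.
  data AxisPencil (ℓ : Line) : Set where
    skew : ∀ x y → y ≢ 0# → ⟪ 1# , x + y , 0# , x ^ 3 ⟫ ∈ᵥ ℓ → AxisPencil ℓ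
    flat : ∀ δ → δ ≢ 0# → ⟪ 0# , δ , 0# , 1# ⟫ ∈ᵥ ℓ → AxisPencil ℓ

  axisPencil : ∀ {ℓ} → e₂ ∈ᵥ ℓ → ¬ ContainsAxis ℓ → (∀ χ → ¬ coord (P χ) ∈ᵥ ℓ) → AxisPencil ℓ
  axisPencil {ℓ} e₂∈ ¬axis external = go (coordinateSection ℓ (# 2))
    where
    -- Adding x² times `e₂` gives (1, x, x², x³), a point of 𝒞.
    onCurve : ∀ x → ⟪ 1# , x , 0# , x ^ 3 ⟫ ∈ᵥ ℓ → Empty.⊥
    onCurve x w∈ = by-cases (x ≟ 0#)
      where
      by-cases : _ → Empty.⊥
      by-cases (yes refl) = external ∞ (≗∈ w∈ (coordinatewise refl refl refl (sym (zeroˡ _))))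
      by-cases (no x≢0) = external (just z) (combination∈ (z + - 0#) (z ^ 3) e₂∈ w∈ (coordinatewise
        (solve F (z ∷ []) (λ z → z :^ 3 := (z :- :0) :* :0 :+ z :^ 3 :* :1 given []) refl)
        (solve F (x ∷ z ∷ []) (λ x z → z :^ 2 := (z :- :0) :* :0 :+ z :^ 3 :* x given :- (z :^ 2) ∶ x :* z := :1 and []) refl xz≡1)
        (solve F (z ∷ []) (λ z → z := (z :- :0) :* :1 :+ z :^ 3 :* :0 given []) refl)
        (solve F (x ∷ z ∷ []) (λ x z → :1 := (z :- :0) :* :0 :+ z :^ 3 :* x :^ 3
          given :- (:1 :+ x :* z :+ x :^ 2 :* z :^ 2) ∶ x :* z := :1 and []) refl xz≡1)))
        where
        z = proj₁ (inverse x x≢0)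
        xz≡1 = proj₂ (inverse x x≢0)
    go : (∃ λ Y → Y ∈ₗ ℓ × coord Y (# 2) ≡ 0#) → AxisPencil ℓ
    go (Y , Y∈ , y₂≡0) = by-cases (y₀ ≟ 0#) (y₃ ≟ 0#)
      where
      y₀ = coord Y (# 0)
      y₁ = coord Y (# 1)
      y₃ = coord Y (# 3)
      by-cases : _ → _ → AxisPencil ℓ
      by-cases (no y₀≢0) _ = skew u y y≢0 w∈
        where
        z = proj₁ (inverse y₀ y₀≢0)
        y₀z≡1 = proj₂ (inverse y₀ y₀≢0)
        root = char3⇒cube 3≡0 (z * y₃)
        u = proj₁ root
        y = z * y₁ + - u
        w∈ : ⟪ 1# , u + y , 0# , u ^ 3 ⟫ ∈ᵥ ℓ
        w∈ = unscale _ (coord Y) y₀z≡1 (coordinatewise (*-identityʳ y₀)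
          (solve F (y₀ ∷ y₁ ∷ z ∷ u ∷ []) (λ y₀ y₁ z u → y₀ :* (u :+ (z :* y₁ :- u)) := y₁ given y₁ ∶ y₀ :* z := :1 and []) refl y₀z≡1)
          (trans (zeroʳ y₀) (sym y₂≡0))
          (solve F (y₀ ∷ y₃ ∷ z ∷ u ∷ []) (λ y₀ y₃ z u → y₀ :* u :^ 3 := y₃ given y₀ ∶ u :* u :* u := z :* y₃ and y₃ ∶ y₀ :* z := :1 and [])
            refl (proj₂ root) y₀z≡1)) (∈ₗ⇒∈ᵥ Y∈)
        y≢0 : y ≢ 0#
        y≢0 y≡0 = onCurve u (≗∈ w∈ (coordinatewise refl (sym (trans (cong (u +_) y≡0) (+-identityʳ u))) refl refl))
      by-cases (yes y₀≡0) (no y₃≢0) = flat (z * y₁) δ≢0 w∈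
        where
        z = proj₁ (inverse y₃ y₃≢0)
        y₃z≡1 = proj₂ (inverse y₃ y₃≢0)
        w∈ : ⟪ 0# , z * y₁ , 0# , 1# ⟫ ∈ᵥ ℓ
        w∈ = unscale _ (coord Y) y₃z≡1 (coordinatewise (trans (zeroʳ y₃) (sym y₀≡0))
          (solve F (y₃ ∷ y₁ ∷ z ∷ []) (λ y₃ y₁ z → y₃ :* (z :* y₁) := y₁ given y₁ ∶ y₃ :* z := :1 and []) refl y₃z≡1)
          (trans (zeroʳ y₃) (sym y₂≡0)) (*-identityʳ y₃)) (∈ₗ⇒∈ᵥ Y∈)
        δ≢0 : z * y₁ ≢ 0#
        δ≢0 δ≡0 = external O (≗∈ w∈ (coordinatewise (zeroˡ _) (trans (zeroˡ _) (sym δ≡0)) refl refl))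
      by-cases (yes y₀≡0) (yes y₃≡0) = ⊥-elim (¬axis (containsAxis (unscale e₁ (coord Y) (proj₂ (inverse y₁ y₁≢0)) (coordinatewise
          (trans (zeroʳ y₁) (sym y₀≡0)) (*-identityʳ y₁) (trans (zeroʳ y₁) (sym y₂≡0)) (trans (zeroʳ y₁) (sym y₃≡0))) (∈ₗ⇒∈ᵥ Y∈)) e₂∈))
        where
        y₁≢0 : y₁ ≢ 0#
        y₁≢0 y₁≡0 = nonzero Y (coordinatewise y₀≡0 y₁≡0 y₂≡0 y₃≡0)

  EA⇒pencil : ∀ {ℓ} → EA ℓ → ∃ λ τ → e₂ ∈ᵥ ℓ ▶ move τ × AxisPencil (ℓ ▶ move τ)
  EA⇒pencil {ℓ} (¬axis , external , X , X∈ , X∈x₀ , X∈x₃) =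
    go (e₂-translate {ℓ} X X∈ (trans (sym (planeForm-x₀ (coord X))) X∈x₀ , trans (sym (planeForm-x₃ (coord X))) X∈x₃))
    where
    go : (∃ λ τ → e₂ ∈ᵥ ℓ ▶ move τ) → ∃ λ τ → e₂ ∈ᵥ ℓ ▶ move τ × AxisPencil (ℓ ▶ move τ)
    go (τ , e₂∈) = τ , e₂∈ , axisPencil e₂∈ (λ axis → ¬axis (containsAxis⇒ΓAxis {ℓ} (containsAxis-move⁻¹ τ {ℓ} axis))) (external-move τ {ℓ} external)

  pencil⇒EA : ∀ τ {ℓ} → e₂ ∈ᵥ ℓ ▶ move τ → ¬ e₁ ∈ᵥ ℓ ▶ move τ → (∀ χ → ¬ coord (P χ) ∈ᵥ ℓ ▶ move τ) → EA ℓ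
  pencil⇒EA τ {ℓ} e₂∈ e₁∉ none =
    (λ axis → e₁∉ (containsAxis-move τ {ℓ} (ΓAxis⇒containsAxis {ℓ} axis) e₁ (refl , refl))) ,
    move-external τ {ℓ} none , X , ∈ᵥ⇒∈ₗ (preimage∈ (move τ) e₂∈) , trans (planeForm-x₀ x) (proj₁ on) , trans (planeForm-x₃ x) (proj₂ on)
    where
    x = e₂ ⊙ matrix⁻¹ (move τ)
    on : OnAxis x
    on = move⁻¹-axis τ e₂ (refl , refl)
    X : Point
    X = ⟨ x , (λ h → 1≢0 (trans (sym (⊙-inverse e₂ (matrix⁻¹ (move τ)) (matrix (move τ)) (inverseˡ (move τ)) (# 2)))
      (trans (⊙-cong {x} {λ _ → 0#} (matrix (move τ)) (matrix (move τ)) h (λ _ _ → refl) (# 2))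
        (solve F (matrix (move τ) (# 0) (# 2) ∷ matrix (move τ) (# 1) (# 2) ∷ matrix (move τ) (# 2) (# 2) ∷ matrix (move τ) (# 3) (# 2) ∷ [])
          (λ a b c d → :0 :* a :+ (:0 :* b :+ (:0 :* c :+ (:0 :* d :+ :0))) := :0 given []) refl)))) ⟩

  -- A common point `P (just v)` gives (vx)³ = 1. Cubing is injective in characteristic 3, so vx =
  -- 1, and the coordinate x₁ then forces y = 0.
  skew-external : ∀ {ℓ x y} → y ≢ 0# → e₂ ∈ᵥ ℓ → ⟪ 1# , x + y , 0# , x ^ 3 ⟫ ∈ᵥ ℓ → ∀ χ → ¬ coord (P χ) ∈ᵥ ℓ
  skew-external {ℓ} {x} {y} y≢0 e₂∈ w∈ χ P∈ = go χ (coordinates (# 1)) (coordinates (# 3))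
    where
    coordinates = echelon-coordinates {# 2} {# 0} (echelon refl refl refl refl) e₂∈ w∈ P∈
    go : ∀ χ → coord (P χ) (# 1) ≡ coord (P χ) (# 2) * 0# + coord (P χ) (# 0) * (x + y) →
      coord (P χ) (# 3) ≡ coord (P χ) (# 2) * 0# + coord (P χ) (# 0) * x ^ 3 → Empty.⊥
    go ∞ h₁ h₃ = y≢0 (solve F (x ∷ y ∷ []) (λ x y → y := :0 given :- :1 ∶ :0 := :0 :* :0 :+ :1 :* (x :+ y) and :- :1 ∶ x := :0 and []) refl h₁ x≡0)
      where
      x≡0 : x ≡ 0#
      x≡0 = ^3≡0 (solve F (x ∷ []) (λ x → x :^ 3 := :0 given :- :1 ∶ :0 := :0 :* :0 :+ :1 :* x :^ 3 and []) refl h₃)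
    go (just v) h₁ h₃ = *-nonzero (*-nonzero v≢0 (*-nonzero v≢0 v≢0)) y≢0
      (solve F (v ∷ x ∷ y ∷ []) (λ v x y → v :* (v :* v) :* y := :0
        given :- :1 ∶ v :^ 2 := v :* :0 :+ v :^ 3 :* (x :+ y) and :- (v :^ 2) ∶ v :* x := :1 and []) refl h₁ vx≡1)
      where
      vx≡1 : v * x ≡ 1#
      vx≡1 = cube-injective (solve F (v ∷ x ∷ []) (λ v x → (v :* x) :^ 3 := :1 :^ 3 given :- :1 ∶ :1 := v :* :0 :+ v :^ 3 :* x :^ 3 and []) refl h₃)
      v≢0 : v ≢ 0#
      v≢0 = unit⇒nonzero vx≡1

  flat-external : ∀ {ℓ δ} → δ ≢ 0# → e₂ ∈ᵥ ℓ → ⟪ 0# , δ , 0# , 1# ⟫ ∈ᵥ ℓ → ∀ χ → ¬ coord (P χ) ∈ᵥ ℓ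
  flat-external {ℓ} {δ} δ≢0 e₂∈ w∈ χ P∈ = go χ (coordinates (# 0)) (coordinates (# 1))
    where
    coordinates = echelon-coordinates {# 2} {# 3} (echelon refl refl refl refl) e₂∈ w∈ P∈
    go : ∀ χ → coord (P χ) (# 0) ≡ coord (P χ) (# 2) * 0# + coord (P χ) (# 3) * 0# →
      coord (P χ) (# 1) ≡ coord (P χ) (# 2) * 0# + coord (P χ) (# 3) * δ → Empty.⊥
    go ∞ h₀ _ = 1≢0 (solve F [] (:1 := :0 given :1 ∶ :1 := :0 :* :0 :+ :0 :* :0 and []) refl h₀)
    go (just v) h₀ h₁ = δ≢0 (solve F (v ∷ δ ∷ []) (λ v δ → δ := :0
      given :- :1 ∶ v :^ 2 := v :* :0 :+ :1 :* δ and v ∶ v := :0 and []) refl h₁ v≡0)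
      where
      v≡0 : v ≡ 0#
      v≡0 = ^3≡0 (solve F (v ∷ []) (λ v → v :^ 3 := :0 given :1 ∶ v :^ 3 := v :* :0 :+ :1 :* :0 and []) refl h₀)

  skew⇒EA : ∀ {ℓ} → Skew.Based ℓ → EA ℓ
  skew⇒EA {ℓ} (τ , (x , y , y≢0) , Skew.basis e₂∈ w∈) =
    pencil⇒EA τ {ℓ} e₂∈ (λ e₁∈ → 1≢0 (skew-axis e₂∈ w∈ e₁∈ refl)) (skew-external y≢0 e₂∈ w∈)

  flat⇒EA : ∀ {ρ} → ρ ≢ 0# → ∀ {ℓ} → Flat.Based ρ ℓ → EA ℓ
  flat⇒EA ρ≢0 {ℓ} (τ , (y , y≢0) , Flat.basis e₂∈ w∈) =
    pencil⇒EA τ {ℓ} e₂∈ (λ e₁∈ → 1≢0 (flat-axis e₂∈ w∈ e₁∈ refl)) (flat-external (ρy²≢0 ρ≢0 y≢0) e₂∈ w∈)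

-- The quadratic extension

module QuadraticExtension {q} (5≤q : 5 ℕ.≤ q) (F : FiniteField q) (K : FiniteField (q ℕ.^ 2)) (E : Extension F K) where
  open FiniteField F
  open Arithmetic F
  open LineTypes F K E using (Imaginary; ImaginaryChord; ImaginaryAxis; extend)
  open Extension E
  open IsRingMonomorphism isRingMonomorphism
    using (+-homo; *-homo; -‿homo; 0#-homo; 1#-homo) renaming (injective to ι-injective)
  open ≡-Reasoning
  module K = FiniteField K
  module KA = Arithmetic K

  ι-^ : ∀ x n → ι (x ^ n) ≡ ι x K.^ n
  ι-^ x zero    = 1#-homo
  ι-^ x (suc n) = trans (*-homo x (x ^ n)) (cong (ι x K.*_) (ι-^ x n))

  ^-distrib-*ᴷ : ∀ x y n → (x K.* y) K.^ n ≡ x K.^ n K.* y K.^ n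
  ^-distrib-*ᴷ x y zero    = sym (K.*-identityˡ _)
  ^-distrib-*ᴷ x y (suc n) = solve K (x ∷ y ∷ ((x K.* y) K.^ n) ∷ (x K.^ n) ∷ (y K.^ n) ∷ [])
    (λ x y p a b → x :* y :* p := x :* a :* (y :* b) given x :* y ∶ p := a :* b and []) refl (^-distrib-*ᴷ x y n)

  ι-fermat : ∀ x → ι x K.^ q ≡ ι x
  ι-fermat x = trans (sym (ι-^ x q)) (cong ι (fermat x))

  private
    root : Fin q → K.Carrier
    root i = ι (Inverse.to cardinality i)

    root-injective : Injective _≡_ _≡_ root
    root-injective = to-injective cardinality ∘ ι-injective

  -- (X + a)^q - X^q - a has degree less than q and vanishes on F.
  frobenius-+ : ∀ x a → (x K.+ ι a) K.^ q ≡ x K.^ q K.+ ι a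
  frobenius-+ x a = trans (KA.eval-lower q (ι a) x) (solve K (KA.eval (KA.lower q (ι a)) x ∷ (x K.^ q) ∷ ι a ∷ [])
    (λ u m a → u :+ m := m :+ a given :1 ∶ u := a and []) refl
    (KA.roots⇒constant (KA.lower q (ι a)) (ι a) root (Inverse.from cardinality 0#) root-injective (λ i → on-F (Inverse.to cardinality i)) x))
    where
    on-F : ∀ y → KA.eval (KA.lower q (ι a)) (ι y) ≡ ι a
    on-F y = solve K (KA.eval (KA.lower q (ι a)) (ι y) ∷ ι y ∷ ι a ∷ (ι y K.^ q) ∷ [])
      (λ u y a m → u := a given :- :1 ∶ y :+ a := u :+ m and :- :1 ∶ m := y and []) refl
      (begin
        ι y K.+ ι a                                        ≡⟨ +-homo y a ⟨
        ι (y + a)                                          ≡⟨ ι-fermat (y + a) ⟨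
        ι (y + a) K.^ q                                    ≡⟨ cong (K._^ q) (+-homo y a) ⟩
        (ι y K.+ ι a) K.^ q                                ≡⟨ KA.eval-lower q (ι a) (ι y) ⟩
        KA.eval (KA.lower q (ι a)) (ι y) K.+ ι y K.^ q     ∎)
      (ι-fermat y)

  frobenius-affine : ∀ a b x → (ι a K.+ ι b K.* x) K.^ q ≡ ι a K.+ ι b K.* x K.^ q
  frobenius-affine a b x = begin
    (ι a K.+ ι b K.* x) K.^ q              ≡⟨ cong (K._^ q) (+-commᴷ (ι a) (ι b K.* x)) ⟩
    (ι b K.* x K.+ ι a) K.^ q              ≡⟨ frobenius-+ (ι b K.* x) a ⟩
    (ι b K.* x) K.^ q K.+ ι a              ≡⟨ cong (K._+ ι a) (^-distrib-*ᴷ (ι b) x q) ⟩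
    ι b K.^ q K.* x K.^ q K.+ ι a          ≡⟨ cong (λ y → y K.* x K.^ q K.+ ι a) (ι-fermat b) ⟩
    ι b K.* x K.^ q K.+ ι a                ≡⟨ +-commᴷ (ι b K.* x K.^ q) (ι a) ⟩
    ι a K.+ ι b K.* x K.^ q                ∎
    where
    +-commᴷ : ∀ x y → x K.+ y ≡ y K.+ x
    +-commᴷ x y = solve K (x ∷ y ∷ []) (λ x y → x :+ y := y :+ x given []) refl

  -- By Fermat the q elements of F are roots of X^q - X in K; a fixed t outside F would be one root
  -- too many. The auxiliary `go` abstracts from q so that it can be matched as 2 + n.
  conjugate≢ : ∀ {t} → Imaginary t → t K.^ q ≢ t
  conjugate≢ {t} t∉F fixed = go q root root-injective (λ i → ι-fermat (Inverse.to cardinality i)) fixed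
    (λ i e → t∉F _ e) (ℕ.≤-trans (ℕ.s≤s (ℕ.s≤s ℕ.z≤n)) 5≤q)
    where
    go : ∀ n (root : Fin n → K.Carrier) → Injective _≡_ _≡_ root → (∀ i → root i K.^ n ≡ root i) → t K.^ n ≡ t →
      (∀ i → t ≢ root i) → 2 ℕ.≤ n → Empty.⊥
    go (suc (suc n)) root inj fixed t-fixed t-new _ = KA.few-fixed-powers n roots roots-injective roots-fixed
      where
      roots : Fin (3 ℕ.+ n) → K.Carrier
      roots zero    = t
      roots (suc i) = root i
      roots-injective : Injective _≡_ _≡_ roots
      roots-injective {zero}  {zero}  _ = refl
      roots-injective {zero}  {suc j} e = ⊥-elim (t-new j e)
      roots-injective {suc i} {zero}  e = ⊥-elim (t-new i (sym e))
      roots-injective {suc i} {suc j} e = cong suc (inj e)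
      roots-fixed : ∀ i → roots i K.^ (2 ℕ.+ n) ≡ roots i
      roots-fixed zero    = t-fixed
      roots-fixed (suc i) = fixed i
    go (suc zero) _ _ _ _ _ (ℕ.s≤s ())

  q<q² : q ℕ.< q ℕ.^ 2
  q<q² = subst₂ ℕ._<_ (ℕ.*-identityʳ q) (cong (q ℕ.*_) (sym (ℕ.*-identityʳ q)))
    (ℕ.*-monoʳ-< q {{ℕ.>-nonZero (ℕ.≤-trans (ℕ.s≤s ℕ.z≤n) 5≤q)}} (ℕ.≤-trans (ℕ.s≤s (ℕ.s≤s ℕ.z≤n)) 5≤q))

  imaginary-exists : ∃ Imaginary
  imaginary-exists = proj₁ new , λ s e → proj₂ new (s , sym e)
    where
    new : ∃ λ t → ¬ (∃ λ s → ι s ≡ t)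
    new = missing cardinality K.cardinality ι (¬surjective cardinality K.cardinality q<q² ι)

  ι-difference : ∀ x y → ι (x + - y) ≡ ι x K.+ K.- ι y
  ι-difference x y = trans (+-homo x (- y)) (cong (ι x K.+_) (-‿homo y))

  independent : ∀ {t} → Imaginary t → ∀ a b → ι a K.+ ι b K.* t ≡ K.0# → a ≡ 0# × b ≡ 0#
  independent {t} t∉F a b e = by-cases (b ≟ 0#)
    where
    by-cases : _ → a ≡ 0# × b ≡ 0#
    by-cases (yes b≡0) = ι-injective (trans (solve K (ι a ∷ ι b ∷ t ∷ []) (λ a b t → a := :0
      given :1 ∶ a :+ b :* t := :0 and :- t ∶ b := :0 and []) refl e (trans (cong ι b≡0) 0#-homo)) (sym 0#-homo)) , b≡0
    by-cases (no b≢0) = ⊥-elim (t∉F (- (a * z)) (begin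
      t                           ≡⟨ solve K (ι a ∷ ι b ∷ ι z ∷ t ∷ []) (λ a b z t → t := :- (a :* z)
                                       given z ∶ a :+ b :* t := :0 and :- t ∶ b :* z := :1 and []) refl e
                                       (trans (sym (*-homo b z)) (trans (cong ι bz≡1) 1#-homo)) ⟩
      K.- (ι a K.* ι z)           ≡⟨ cong K.-_ (*-homo a z) ⟨
      K.- ι (a * z)               ≡⟨ -‿homo (a * z) ⟨
      ι (- (a * z))               ∎))
      where
      z = proj₁ (inverse b b≢0)
      bz≡1 = proj₂ (inverse b b≢0)

  components-unique : ∀ {t} → Imaginary t → ∀ {a b c d} → ι a K.+ ι b K.* t ≡ ι c K.+ ι d K.* t → a ≡ c × b ≡ d
  components-unique {t} t∉F {a} {b} {c} {d} e = same a c (proj₁ zeros) , same b d (proj₂ zeros)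
    where
    same : ∀ x y → x + - y ≡ 0# → x ≡ y
    same x y e = solve F (x ∷ y ∷ []) (λ x y → x := y given :1 ∶ x :- y := :0 and []) refl e
    zeros : a + - c ≡ 0# × b + - d ≡ 0#
    zeros = independent t∉F (a + - c) (b + - d) (trans (cong₂ (λ x y → x K.+ y K.* t) (ι-difference a c) (ι-difference b d))
      (solve K (ι a ∷ ι b ∷ ι c ∷ ι d ∷ t ∷ []) (λ a b c d t → (a :- c) :+ (b :- d) :* t := :0
        given :1 ∶ a :+ b :* t := c :+ d :* t and []) refl e))

  -- Independence of 1 and t makes (a, b) ↦ a + bt injective from F × F to K, and both have q²
  -- elements.
  components : ∀ {t} → Imaginary t → ∀ x → ∃₂ λ a b → x ≡ ι a K.+ ι b K.* t
  components {t} t∉F x = let ((a , b) , e) = hit x in a , b , sym e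
    where
    combine : Carrier × Carrier → K.Carrier
    combine (a , b) = ι a K.+ ι b K.* t
    combine-injective : Injective _≡_ _≡_ combine
    combine-injective e = let (a≡c , b≡d) = components-unique t∉F e in cong₂ _,_ a≡c b≡d
    hit : ∀ x → ∃ λ ab → combine ab ≡ x
    hit = injective⇒surjective (subst (λ n → Fin n ↔ (Carrier × Carrier)) (cong (q ℕ.*_) (sym (ℕ.*-identityʳ q))) (×↔ cardinality cardinality))
      K.cardinality combine combine-injective

  record IsRoot (a b : Carrier) (x : K.Carrier) : Set where
    constructor isRoot
    field root-equation : x K.* x ≡ ι a K.+ ι b K.* x

  minimalPolynomial : ∀ {t} → Imaginary t → ∃₂ λ a b → IsRoot a b t
  minimalPolynomial {t} t∉F = let (a , b , e) = components t∉F (t K.* t) in a , b , isRoot e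

  -- Both sides are raised to the power q; since the right side is affine in t over F,
  -- `frobenius-affine` applies to it.
  conjugate-root : ∀ {a b t} → IsRoot a b t → IsRoot a b (t K.^ q)
  conjugate-root {a} {b} {t} (isRoot e) = isRoot (begin
    t K.^ q K.* t K.^ q           ≡⟨ ^-distrib-*ᴷ t t q ⟨
    (t K.* t) K.^ q               ≡⟨ cong (K._^ q) e ⟩
    (ι a K.+ ι b K.* t) K.^ q     ≡⟨ frobenius-affine a b t ⟩
    ι a K.+ ι b K.* t K.^ q       ∎)

-- Imaginary chords and axes

module ImaginaryLines {q} (5≤q : 5 ℕ.≤ q) (F : FiniteField q) (K : FiniteField (q ℕ.^ 2)) (E : Extension F K) where
  open FiniteField F
  open Arithmetic F
  open ProjectiveSpace F
  open TwistedCubic F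
  open LineTypes F K E using (Imaginary; ImaginaryChord; ImaginaryAxis; extend; extendPoint)
  open Extension E
  open IsRingMonomorphism isRingMonomorphism
    using (+-homo; *-homo; -‿homo; 0#-homo; 1#-homo) renaming (injective to ι-injective)
  open Linear F
  open Projective F
  open Projectivity
  open Action 5≤q F
  open Families 5≤q F
  open QuadraticExtension 5≤q F K E
  open ≡-Reasoning
  module PK = ProjectiveSpace K
  module CK = TwistedCubic K
  module LK = Linear K
  module QK = Projective K

  GoodAction : Pred Line 0ℓ → Set
  GoodAction S = ∀ a b c d {e} (h : e * (a * d + - (b * c)) ≡ 1#) {ℓ} → S ℓ → S (ℓ ▶ möbius a b c d h)

  -- G is generated by the maps t ↦ (at + b)/(ct + d).
  möbius-invariant⇒invariant : (S : Pred Line 0ℓ) → (∀ {ℓ m} → ℓ ≅ m → S ℓ → S m) → GoodAction S →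
    ∀ φ → φ ∈G → ∀ {ℓ} → S ℓ → S (ℓ ▶ φ)
  möbius-invariant⇒invariant S respect good φ φ∈G {ℓ} ℓ∈S = go (imageParameter φ φ∈G O)
    where
    -- The inverse of `move τ` is itself given by a fractional linear map, so the hypothesis covers
    -- it.
    unmove : ∀ τ {m} → S (m ▶ move τ) → S m
    unmove (just t) {m} h = respect (≅-trans (scalar⇒▶≅ (m ▶ translation (- t)) _ (translation (- t) ⁻¹) 1# (λ i j →
      trans (sym (matrix-⁻¹ (translation (- t)) i j)) (sym (*-identityˡ _)))) (▶-⁻¹ m (translation (- t))))
      (good _ _ _ _ (inverse-det (translation-det (- t))) h)
    unmove ∞ {m} h = respect (≅-trans (scalar⇒▶≅ (m ▶ inversion) _ (inversion ⁻¹) 1# (λ i j →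
      trans (sym (matrix-⁻¹ inversion i j)) (sym (*-identityˡ _)))) (▶-⁻¹ m inversion))
      (good _ _ _ _ (inverse-det inversion-det) h)
    go : (∃ λ τ → Maps φ O τ) → S (ℓ ▶ φ)
    go (τ , O↦τ) = straighten (fixes-O⇒dilation-shear (φ ⊚ move τ) (⊚∈G φ (move τ) φ∈G (move∈G τ)) (maps-⊚ O↦τ (maps-move τ)))
      where
      straighten : (∃ λ r → ∃₂ λ (r≢0 : r ≢ 0#) u → ∀ ℓ → ℓ ▶ (φ ⊚ move τ) ≅ ℓ ▶ dilation r r≢0 ▶ shear u) → S (ℓ ▶ φ)
      straighten (r , r≢0 , u , h) = unmove τ (respect (≅-trans (≅-sym (h ℓ)) (▶-⊚ ℓ φ (move τ)))
        (good 1# 0# u 1# (shear-det u) (good r 0# 0# 1# (dilation-det r r≢0) ℓ∈S)))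

  private
    _+ʰ_ : ∀ {x y x′ y′} → ι x ≡ x′ → ι y ≡ y′ → ι (x + y) ≡ x′ K.+ y′
    _+ʰ_ {x} {y} p r = trans (+-homo x y) (cong₂ K._+_ p r)

    *³ : ∀ x y z → ι (x * y * z) ≡ ι x K.* ι y K.* ι z
    *³ x y z = trans (*-homo (x * y) z) (cong (K._* ι z) (*-homo x y))

    2·ʰ : ∀ {x x′} → ι x ≡ x′ → ι (2 · x) ≡ 2 K.· x′
    2·ʰ p = p +ʰ (p +ʰ 0#-homo)

    3·ʰ : ∀ {x x′} → ι x ≡ x′ → ι (3 · x) ≡ 3 K.· x′
    3·ʰ p = p +ʰ (p +ʰ (p +ʰ 0#-homo))

  ι-sym³ : ∀ a b c d i j → ι (sym³ a b c d i j) ≡ QK.sym³ (ι a) (ι b) (ι c) (ι d) i j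
  ι-sym³ a b c d = coordinatewise
    (coordinatewise (*³ a a a) (*³ a a c) (*³ a c c) (*³ c c c))
    (coordinatewise (3·ʰ (*³ a a b)) (*³ a a d +ʰ 2·ʰ (*³ a b c)) (2·ʰ (*³ a c d) +ʰ *³ b c c) (3·ʰ (*³ c c d)))
    (coordinatewise (3·ʰ (*³ a b b)) (*³ b b c +ʰ 2·ʰ (*³ a b d)) (2·ʰ (*³ b c d) +ʰ *³ a d d) (3·ʰ (*³ c d d)))
    (coordinatewise (*³ b b b) (*³ b b d) (*³ b d d) (*³ d d d))

  ι-⊙ : ∀ (x : Vector₄) a b c d j → ι ((x ⊙ sym³ a b c d) j) ≡ ((ι ∘ x) PK.⊙ QK.sym³ (ι a) (ι b) (ι c) (ι d)) j
  ι-⊙ x a b c d j = term (# 0) +ʰ (term (# 1) +ʰ (term (# 2) +ʰ (term (# 3) +ʰ 0#-homo)))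
    where
    term : ∀ i → ι (x i * sym³ a b c d i j) ≡ ι (x i) K.* QK.sym³ (ι a) (ι b) (ι c) (ι d) i j
    term i = trans (*-homo (x i) _) (cong (ι (x i) K.*_) (ι-sym³ a b c d i j))

  ι-combination : ∀ a b x y → ι (a * x + b * y) ≡ ι a K.* ι x K.+ ι b K.* ι y
  ι-combination a b x y = *-homo a x +ʰ *-homo b y

  möbius-denominator : ∀ {t} → Imaginary t → ∀ a b c d {e} → e * (a * d + - (b * c)) ≡ 1# → ι c K.* t K.+ ι d ≢ K.0#
  möbius-denominator {t} t∉F a b c d {e} h zero′ = 1≢0 (solve F (a ∷ b ∷ c ∷ d ∷ e ∷ []) (λ a b c d e → :1 := :0
    given :- :1 ∶ e :* (a :* d :- b :* c) := :1 and e :* a ∶ d := :0 and :- (e :* b) ∶ c := :0 and []) refl h (proj₁ zeros) (proj₂ zeros))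
    where
    zeros : d ≡ 0# × c ≡ 0#
    zeros = independent t∉F d c (trans (solve K (ι c ∷ ι d ∷ t ∷ []) (λ c d t → d :+ c :* t := c :* t :+ d given []) refl) zero′)

  -- The value (at + b)/(ct + d) together with its denominator, in the homogeneous form in which
  -- `ν-image` and `oscForm-image` use it.
  record MöbiusImage (t : K.Carrier) (a b c d : Carrier) : Set where
    field
      denominator : K.Carrier
      image       : K.Carrier
      denominator≢0 : denominator ≢ K.0#
      first       : ι a K.* t K.+ ι b K.* K.1# ≡ denominator K.* image
      second      : ι c K.* t K.+ ι d K.* K.1# ≡ denominator K.* K.1#
      imaginary   : Imaginary image

  möbiusImage : ∀ {t} → Imaginary t → ∀ a b c d {e} → e * (a * d + - (b * c)) ≡ 1# → MöbiusImage t a b c d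
  möbiusImage {t} t∉F a b c d {e} h = record
    { denominator = D
    ; image       = t′
    ; denominator≢0 = D≢0
    ; first       = solve K (ι a ∷ ι b ∷ t ∷ D ∷ z ∷ []) (λ a b t D z → a :* t :+ b :* :1 := D :* (z :* (a :* t :+ b))
                      given :- (a :* t :+ b) ∶ D :* z := :1 and []) refl Dz≡1
    ; second      = solve K (ι c ∷ ι d ∷ t ∷ []) (λ c d t → c :* t :+ d :* :1 := (c :* t :+ d) :* :1 given []) refl
    ; imaginary   = t′∉F
    }
    where
    D = ι c K.* t K.+ ι d
    D≢0 = möbius-denominator t∉F a b c d h
    z = proj₁ (K.inverse D D≢0)
    Dz≡1 = proj₂ (K.inverse D D≢0)
    t′ = z K.* (ι a K.* t K.+ ι b)
    -- t′ = s in F would give at + b = s(ct + d), hence a = sc and b = sd.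
    t′∉F : Imaginary t′
    t′∉F s t′≡ιs = 1≢0 (solve F (a ∷ b ∷ c ∷ d ∷ e ∷ s ∷ []) (λ a b c d e s → :1 := :0
        given :- :1 ∶ e :* (a :* d :- b :* c) := :1 and e :* d ∶ a := s :* c and :- (e :* c) ∶ b := s :* d and []) refl h (proj₂ eqs) (proj₁ eqs))
      where
      eqs : b ≡ s * d × a ≡ s * c
      eqs = components-unique t∉F (begin
        ι b K.+ ι a K.* t                           ≡⟨ solve K (ι a ∷ ι b ∷ ι c ∷ ι d ∷ ι s ∷ t ∷ z ∷ []) (λ a b c d s t z →
                                                         b :+ a :* t := s :* d :+ s :* c :* t
                                                         given (c :* t :+ d) ∶ z :* (a :* t :+ b) := s and :- (a :* t :+ b) ∶ (c :* t :+ d) :* z := :1 and []) refl t′≡ιs Dz≡1 ⟩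
        ι s K.* ι d K.+ ι s K.* ι c K.* t           ≡⟨ cong₂ (λ x y → x K.+ y K.* t) (*-homo s d) (*-homo s c) ⟨
        ι (s * d) K.+ ι (s * c) K.* t               ∎)

  imaginary-transitive : ∀ {s t} → Imaginary s → Imaginary t → ∃₂ λ u r → r ≢ 0# × t ≡ ι u K.+ ι r K.* s
  imaginary-transitive {s} {t} s∉F t∉F = let (u , r , e) = components s∉F t in u , r ,
    (λ r≡0 → t∉F u (trans e (trans (cong (λ x → ι u K.+ x K.* s) (trans (cong ι r≡0) 0#-homo))
      (solve K (ι u ∷ s ∷ []) (λ u s → u :+ :0 :* s := u given []) refl)))) , e

  -- With t² = bt + a, the point P t is ι w + t ι v for the following v and w.
  chord-v chord-w : Carrier → Carrier → Vector₄
  chord-v a b = ⟪ b * b + a , b , 1# , 0# ⟫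
  chord-w a b = ⟪ a * b , a , 0# , 1# ⟫

  private
    chord-cubic : ∀ {a b x} → IsRoot a b x → x K.^ 3 ≡ ι (a * b) K.+ x K.* ι (b * b + a)
    chord-cubic {a} {b} {x} (isRoot e) = trans (solve K (ι a ∷ ι b ∷ x ∷ []) (λ a b x → x :^ 3 := a :* b :+ x :* (b :* b :+ a)
        given x :+ b ∶ x :* x := a :+ b :* x and []) refl e)
      (sym (cong₂ (λ y z → y K.+ x K.* z) (*-homo a b) (*-homo b b +ʰ refl)))

  chord-point : ∀ {a b x} → IsRoot a b x → ∀ i → PK.coord (CK.P (just x)) i ≡ ι (chord-w a b i) K.+ x K.* ι (chord-v a b i)
  chord-point {a} {b} {x} e@(isRoot x²) = coordinatewise (chord-cubic e)
    (solve K (ι a ∷ ι b ∷ x ∷ []) (λ a b x → x :^ 2 := a :+ x :* b given :1 ∶ x :* x := a :+ b :* x and []) refl x²)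
    (trans (solve K (x ∷ []) (λ x → x := :0 :+ x :* :1 given []) refl) (sym (cong₂ (λ y z → y K.+ x K.* z) 0#-homo 1#-homo)))
    (trans (solve K (x ∷ []) (λ x → :1 := :1 :+ x :* :0 given []) refl) (sym (cong₂ (λ y z → y K.+ x K.* z) 1#-homo 0#-homo)))

  -- The point is a K-combination of any two F-rational vectors of the line, not necessarily its
  -- given points, so that the property passes to equal lines and to images directly.
  record ChordAt (t : K.Carrier) (ℓ : Line) : Set where
    constructor chordAt
    field
      {y z} : Vector₄
      A B   : K.Carrier
      y∈    : y ∈ᵥ ℓ
      z∈    : z ∈ᵥ ℓ
      onto  : ∀ i → PK.coord (CK.P (just t)) i ≡ A K.* ι (y i) K.+ B K.* ι (z i)

  chordAt-respect : ∀ {t ℓ m} → ℓ ≅ m → ChordAt t ℓ → ChordAt t m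
  chordAt-respect ℓ≅m (chordAt A B y∈ z∈ h) = chordAt A B (≅⇒⊑ ℓ≅m y∈) (≅⇒⊑ ℓ≅m z∈) h

  ∈extend⇒chordAt : ∀ {t ℓ} → CK.P (just t) PK.∈ₗ extend ℓ → ChordAt t ℓ
  ∈extend⇒chordAt {t} {ℓ} (A , B , h) = chordAt A B (pt₁∈ ℓ) (pt₂∈ ℓ) h

  -- The coefficients over K are split along 1 and t. Uniqueness of components, applied to each
  -- coordinate, shows that both rational parts of the point lie on the line.
  chordAt⇒basis : ∀ {t a b ℓ} → Imaginary t → IsRoot a b t → ChordAt t ℓ → chord-v a b ∈ᵥ ℓ × chord-w a b ∈ᵥ ℓ
  chordAt⇒basis {t} {a} {b} {ℓ} t∉F e (chordAt {y} {z} A B y∈ z∈ h) =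
      combination∈ a₁ b₁ y∈ z∈ (λ i → proj₂ (compare i)) , combination∈ a₀ b₀ y∈ z∈ (λ i → proj₁ (compare i))
    where
    a₀ = proj₁ (components t∉F A)
    a₁ = proj₁ (proj₂ (components t∉F A))
    b₀ = proj₁ (components t∉F B)
    b₁ = proj₁ (proj₂ (components t∉F B))
    compare : ∀ i → chord-w a b i ≡ a₀ * y i + b₀ * z i × chord-v a b i ≡ a₁ * y i + b₁ * z i
    compare i = components-unique t∉F (begin
      ι (chord-w a b i) K.+ ι (chord-v a b i) K.* t    ≡⟨ solve K (ι (chord-w a b i) ∷ ι (chord-v a b i) ∷ t ∷ []) (λ w v t → w :+ v :* t := w :+ t :* v given []) refl ⟩
      ι (chord-w a b i) K.+ t K.* ι (chord-v a b i)    ≡⟨ chord-point e i ⟨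
      PK.coord (CK.P (just t)) i                       ≡⟨ h i ⟩
      A K.* ι (y i) K.+ B K.* ι (z i)                  ≡⟨ solve K (A ∷ B ∷ ι (y i) ∷ ι (z i) ∷ ι a₀ ∷ ι a₁ ∷ ι b₀ ∷ ι b₁ ∷ t ∷ []) (λ A B y z a₀ a₁ b₀ b₁ t →
                                                            A :* y :+ B :* z := (a₀ :* y :+ b₀ :* z) :+ (a₁ :* y :+ b₁ :* z) :* t
                                                            given y ∶ A := a₀ :+ a₁ :* t and z ∶ B := b₀ :+ b₁ :* t and []) refl
                                                            (proj₂ (proj₂ (components t∉F A))) (proj₂ (proj₂ (components t∉F B))) ⟩
      (ι a₀ K.* ι (y i) K.+ ι b₀ K.* ι (z i)) K.+ (ι a₁ K.* ι (y i) K.+ ι b₁ K.* ι (z i)) K.* t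
                                                       ≡⟨ cong₂ (λ p r → p K.+ r K.* t) (ι-combination a₀ b₀ (y i) (z i)) (ι-combination a₁ b₁ (y i) (z i)) ⟨
      ι (a₀ * y i + b₀ * z i) K.+ ι (a₁ * y i + b₁ * z i) K.* t ∎)

  basis⇒∈extend : ∀ {x a b ℓ} → IsRoot a b x → chord-v a b ∈ᵥ ℓ → chord-w a b ∈ᵥ ℓ → CK.P (just x) PK.∈ₗ extend ℓ
  basis⇒∈extend {x} {a} {b} {ℓ} e (span α β hv) (span γ δ hw) = ι γ K.+ x K.* ι α , ι δ K.+ x K.* ι β , λ i →
    trans (chord-point e i) (solve K (ι (chord-w a b i) ∷ ι (chord-v a b i) ∷ x ∷ ι α ∷ ι β ∷ ι γ ∷ ι δ ∷ ι (coord (pt₁ ℓ) i) ∷ ι (coord (pt₂ ℓ) i) ∷ [])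
      (λ w v x α β γ δ p r → w :+ x :* v := (γ :+ x :* α) :* p :+ (δ :+ x :* β) :* r
        given :1 ∶ w := γ :* p :+ δ :* r and x ∶ v := α :* p :+ β :* r and []) refl
      (trans (cong ι (hw i)) (ι-combination γ δ _ _)) (trans (cong ι (hv i)) (ι-combination α β _ _)))

  chord-unique : ∀ {t ℓ m} → Imaginary t → ChordAt t ℓ → ChordAt t m → ℓ ≅ m
  chord-unique {t} t∉F ℓ∋ m∋ =
    let (a , b , e) = minimalPolynomial t∉F
        (v∈ℓ , w∈ℓ) = chordAt⇒basis t∉F e ℓ∋
        (v∈m , w∈m) = chordAt⇒basis t∉F e m∋
    in echelon-≅ {# 2} {# 3} (echelon refl refl refl refl) v∈ℓ w∈ℓ v∈m w∈m

  chordAt-möbius : ∀ a b c d {e} (h : e * (a * d + - (b * c)) ≡ 1#) {t ℓ} (img : MöbiusImage t a b c d) →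
    ChordAt t ℓ → ChordAt (MöbiusImage.image img) (ℓ ▶ möbius a b c d h)
  chordAt-möbius a b c d {e} h {t} {ℓ} img (chordAt {y} {z} A B y∈ z∈ Pt) =
      chordAt (w³ K.* A) (w³ K.* B) (image∈ (möbius a b c d h) y∈) (image∈ (möbius a b c d h) z∈) λ i →
        solve K (PK.coord (CK.P (just image)) i ∷ (D K.^ 3) ∷ w³ ∷ A ∷ B ∷ ι ((y ⊙ M) i) ∷ ι ((z ⊙ M) i) ∷ [])
          (λ P D³ w³ A B y z → P := w³ :* A :* y :+ w³ :* B :* z
            given w³ ∶ D³ :* P := A :* y :+ B :* z and :- P ∶ D³ :* w³ := :1 and []) refl (scaled i) D³w³≡1
    where
    open MöbiusImage img renaming (denominator to D; denominator≢0 to D≢0)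
    M = sym³ a b c d
    Mᴷ = QK.sym³ (ι a) (ι b) (ι c) (ι d)
    -- The coordinates of the cubic are of degree 3 in the parameter, so the denominator enters as
    -- D³.
    D³≢0 = KA.*-nonzero D≢0 (KA.*-nonzero D≢0 (KA.*-nonzero D≢0 K.1≢0))
    w³ = proj₁ (K.inverse (D K.^ 3) D³≢0)
    D³w³≡1 = proj₂ (K.inverse (D K.^ 3) D³≢0)
    scaled : ∀ i → D K.^ 3 K.* PK.coord (CK.P (just image)) i ≡ A K.* ι ((y ⊙ M) i) K.+ B K.* ι ((z ⊙ M) i)
    scaled i = begin
      D K.^ 3 K.* PK.coord (CK.P (just image)) i                       ≡⟨ cong (D K.^ 3 K.*_) (QK.P≗ν (just image) i) ⟩
      D K.^ 3 K.* QK.ν image K.1# i                                    ≡⟨ QK.ν-scale D image K.1# i ⟨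
      QK.ν (D K.* image) (D K.* K.1#) i                                ≡⟨ cong₂ (λ s t → QK.ν s t i) first second ⟨
      QK.ν (ι a K.* t K.+ ι b K.* K.1#) (ι c K.* t K.+ ι d K.* K.1#) i ≡⟨ QK.ν-image (ι a) (ι b) (ι c) (ι d) t K.1# i ⟨
      (QK.ν t K.1# PK.⊙ Mᴷ) i                                          ≡⟨ LK.⊙-combination {QK.ν t K.1#} {ι ∘ y} {ι ∘ z} {A} {B} Mᴷ
                                                                            (λ k → trans (sym (QK.P≗ν (just t) k)) (Pt k)) i ⟩
      A K.* ((ι ∘ y) PK.⊙ Mᴷ) i K.+ B K.* ((ι ∘ z) PK.⊙ Mᴷ) i          ≡⟨ cong₂ (λ p r → A K.* p K.+ B K.* r) (ι-⊙ y a b c d i) (ι-⊙ z a b c d i) ⟨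
      A K.* ι ((y ⊙ M) i) K.+ B K.* ι ((z ⊙ M) i)                      ∎

  imaginaryChord⇒ : ∀ {ℓ} → ImaginaryChord ℓ → ∃ λ t → Imaginary t × ChordAt t ℓ
  imaginaryChord⇒ (t , t∉F , P∈ , _) = t , t∉F , ∈extend⇒chordAt P∈

  -- The conjugate satisfies the same quadratic equation, so its point is a combination of the same
  -- two rational vectors.
  ⇒imaginaryChord : ∀ {ℓ} → (∃ λ t → Imaginary t × ChordAt t ℓ) → ImaginaryChord ℓ
  ⇒imaginaryChord {ℓ} (t , t∉F , on) = t , t∉F , basis⇒∈extend {ℓ = ℓ} e v∈ w∈ , basis⇒∈extend {ℓ = ℓ} (conjugate-root e) v∈ w∈
    where
    e = proj₂ (proj₂ (minimalPolynomial t∉F))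
    v∈ = proj₁ (chordAt⇒basis t∉F e on)
    w∈ = proj₂ (chordAt⇒basis t∉F e on)

  -- An invariant family indexed by K \ F with one line for each element is an orbit.
  module Transported (At : K.Carrier → Pred Line 0ℓ)
    (respect : ∀ {t ℓ m} → ℓ ≅ m → At t ℓ → At t m)
    (unique : ∀ {t ℓ m} → Imaginary t → At t ℓ → At t m → ℓ ≅ m)
    (transport : ∀ a b c d {e} (h : e * (a * d + - (b * c)) ≡ 1#) {t ℓ} (img : MöbiusImage t a b c d) →
      At t ℓ → At (MöbiusImage.image img) (ℓ ▶ möbius a b c d h))
    (exists : ∀ {t} → Imaginary t → ∃ (At t)) where

    Indexed : Pred Line 0ℓ
    Indexed ℓ = ∃ λ t → Imaginary t × At t ℓ

    indexed-invariant : ∀ φ → φ ∈G → ∀ {ℓ} → Indexed ℓ → Indexed (ℓ ▶ φ)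
    indexed-invariant = möbius-invariant⇒invariant Indexed (λ { ℓ≅m (t , t∉F , h) → t , t∉F , respect ℓ≅m h })
      λ { a b c d h (t , t∉F , at) → let img = möbiusImage t∉F a b c d h in MöbiusImage.image img , MöbiusImage.imaginary img , transport a b c d h img at }

    isOrbit : IsOrbit Indexed
    isOrbit = ℓ₀ , (λ { (t , t∉F , at) → connect t∉F at }) , λ { {m} (φ , φ∈G , e) →
        let (t , t∉F , h) = indexed-invariant φ φ∈G (t₀ , t₀∉F , ℓ₀-at) in t , t∉F , respect (≅-trans (▶≅▸ ℓ₀ φ) (equal e)) h }
      where
      t₀ = proj₁ imaginary-exists
      t₀∉F = proj₂ imaginary-exists
      ℓ₀ = proj₁ (exists t₀∉F)
      ℓ₀-at = proj₂ (exists t₀∉F)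
      connect : ∀ {t m} → Imaginary t → At t m → Orbit ℓ₀ m
      connect {t} {m} t∉F m-at = go (imaginary-transitive t₀∉F t∉F)
        where
        go : (∃₂ λ u r → r ≢ 0# × t ≡ ι u K.+ ι r K.* t₀) → Orbit ℓ₀ m
        go (u , r , r≢0 , e) = φ , möbius∈G r u 0# 1# det , ≅⇒≈ (≅-trans (≅-sym (▶≅▸ ℓ₀ φ)) (unique t∉F (transport r u 0# 1# det img ℓ₀-at) m-at))
          where
          z = proj₁ (inverse r r≢0)
          det : z * (r * 1# + - (u * 0#)) ≡ 1#
          det = solve F (r ∷ z ∷ u ∷ []) (λ r z u → z :* (r :* :1 :- u :* :0) := :1 given :1 ∶ r :* z := :1 and []) refl (proj₂ (inverse r r≢0))
          φ = möbius r u 0# 1# det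
          -- Given by hand with denominator 1, so that the image is `t` itself and not merely an
          -- expression equal to it.
          img : MöbiusImage t₀ r u 0# 1#
          img = record
            { denominator = K.1#
            ; image       = t
            ; denominator≢0 = K.1≢0
            ; first       = solve K (ι r ∷ ι u ∷ t₀ ∷ t ∷ []) (λ r u t₀ t → r :* t₀ :+ u :* :1 := :1 :* t given :- :1 ∶ t := u :+ r :* t₀ and []) refl e
            ; second      = solve K (ι 0# ∷ ι 1# ∷ t₀ ∷ []) (λ o i t₀ → o :* t₀ :+ i :* :1 := :1 :* :1 given t₀ ∶ o := :0 and :1 ∶ i := :1 and []) refl 0#-homo 1#-homo
            ; imaginary   = t∉F
            }

  imaginaryChord-isOrbit : IsOrbit ImaginaryChord
  imaginaryChord-isOrbit = let (ℓ₀ , S⊆ , ⊆S) = isOrbit in ℓ₀ , (λ {ℓ} h → S⊆ {ℓ} (imaginaryChord⇒ {ℓ} h)) , λ {ℓ} h → ⇒imaginaryChord {ℓ} (⊆S {ℓ} h)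
    where
    exists : ∀ {t} → Imaginary t → ∃ (ChordAt t)
    exists {t} t∉F = let (a , b , e) = minimalPolynomial t∉F
                         ℓ = echelonLine (# 2) (# 3) {chord-v a b} {chord-w a b} (echelon refl refl refl refl)
      in ℓ , ∈extend⇒chordAt {ℓ = ℓ} (basis⇒∈extend {ℓ = ℓ} e (pt₁∈ ℓ) (pt₂∈ ℓ))
    open Transported ChordAt chordAt-respect chord-unique chordAt-möbius exists

  module _ (3≢0 : 3 · 1# ≢ 0#) where
    private
      third = proj₁ (inverse (3 · 1#) 3≢0)
      3·third≡1 = proj₂ (inverse (3 · 1#) 3≢0)

    -- With t² = bt + a, the form of the osculating plane at t is
    -- rational₀ + t · rational₁.
    rational₀ rational₁ : Carrier → Carrier → Vector₄ → Carrier
    rational₀ a b x = x (# 0) + 3 · (a * x (# 2)) + - (a * b * x (# 3))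
    rational₁ a b x = - (3 · x (# 1)) + 3 · (b * x (# 2)) + - ((b * b + a) * x (# 3))

    osc-splitᴷ : ∀ {a b s} → IsRoot a b s → ∀ (X : LK.Vector₄) → QK.oscForm s K.1# X ≡
      (X (# 0) K.+ 3 K.· (ι a K.* X (# 2)) K.+ K.- (ι a K.* ι b K.* X (# 3)))
      K.+ (K.- (3 K.· X (# 1)) K.+ 3 K.· (ι b K.* X (# 2)) K.+ K.- ((ι b K.* ι b K.+ ι a) K.* X (# 3))) K.* s
    osc-splitᴷ {a} {b} {s} (isRoot e) X = solve K (ι a ∷ ι b ∷ s ∷ X (# 0) ∷ X (# 1) ∷ X (# 2) ∷ X (# 3) ∷ [])
      (λ a b s x₀ x₁ x₂ x₃ → :osc s :1 (:vector x₀ x₁ x₂ x₃) :=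
        (x₀ :+ 3 :· (a :* x₂) :- a :* b :* x₃) :+ (:- (3 :· x₁) :+ 3 :· (b :* x₂) :- (b :* b :+ a) :* x₃) :* s
        given 3 :· x₂ :- (s :+ b) :* x₃ ∶ s :* s := a :+ b :* s and []) refl e

    osc-split : ∀ {a b s} → IsRoot a b s → ∀ (x : Vector₄) → QK.oscForm s K.1# (ι ∘ x) ≡ ι (rational₀ a b x) K.+ ι (rational₁ a b x) K.* s
    osc-split {a} {b} {s} e x = trans (osc-splitᴷ e (ι ∘ x)) (sym (cong₂ (λ p r → p K.+ r K.* s)
      ((refl +ʰ 3·ʰ (*-homo a (x (# 2)))) +ʰ trans (-‿homo _) (cong K.-_ (*³ a b (x (# 3)))))
      ((trans (-‿homo _) (cong K.-_ (3·ʰ refl)) +ʰ 3·ʰ (*-homo b (x (# 2)))) +ʰ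
        trans (-‿homo _) (cong K.-_ (trans (*-homo _ _) (cong (K._* ι (x (# 3))) (*-homo b b +ʰ refl)))))))

    -- Only the F-rational vectors of the line are tested; this determines the line already, since
    -- the form splits along 1 and t.
    OscAt : K.Carrier → Pred Line 0ℓ
    OscAt t ℓ = ∀ x → x ∈ᵥ ℓ → QK.oscForm t K.1# (ι ∘ x) ≡ K.0#

    -- The basis of solutions of `rational₀` = `rational₁` = 0 with x₂ and x₃ free; solving for x₁
    -- requires the inverse of 3.
    axis-v axis-w : Carrier → Carrier → Vector₄
    axis-v a b = ⟪ - (3 · a) , b , 1# , 0# ⟫
    axis-w a b = ⟪ a * b , - (third * (b * b + a)) , 0# , 1# ⟫

    axisLine : Carrier → Carrier → Line
    axisLine a b = echelonLine (# 2) (# 3) {axis-v a b} {axis-w a b} (echelon refl refl refl refl)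

    rational-solution : ∀ {a b} x → rational₀ a b x ≡ 0# → rational₁ a b x ≡ 0# → ∀ k → x k ≡ x (# 2) * axis-v a b k + x (# 3) * axis-w a b k
    rational-solution {a} {b} x h₀ h₁ = coordinatewise
      (solve F vars (λ a b t x₀ x₁ x₂ x₃ → x₀ := x₂ :* :- (3 :· a) :+ x₃ :* (a :* b)
        given :1 ∶ x₀ :+ 3 :· (a :* x₂) :- a :* b :* x₃ := :0 and []) refl h₀)
      (solve F vars (λ a b t x₀ x₁ x₂ x₃ → x₁ := x₂ :* b :+ x₃ :* :- (t :* (b :* b :+ a))
        given :- t ∶ :- (3 :· x₁) :+ 3 :· (b :* x₂) :- (b :* b :+ a) :* x₃ := :0 and :- x₁ :+ b :* x₂ ∶ (3 :· :1) :* t := :1 and []) refl h₁ 3·third≡1)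
      (solve F vars (λ a b t x₀ x₁ x₂ x₃ → x₂ := x₂ :* :1 :+ x₃ :* :0 given []) refl)
      (solve F vars (λ a b t x₀ x₁ x₂ x₃ → x₃ := x₂ :* :0 :+ x₃ :* :1 given []) refl)
      where vars = a ∷ b ∷ third ∷ x (# 0) ∷ x (# 1) ∷ x (# 2) ∷ x (# 3) ∷ []

    solution-rational : ∀ {a b} x → (∀ k → x k ≡ x (# 2) * axis-v a b k + x (# 3) * axis-w a b k) → rational₀ a b x ≡ 0# × rational₁ a b x ≡ 0#
    solution-rational {a} {b} x h =
      solve F vars (λ a b t x₀ x₁ x₂ x₃ → x₀ :+ 3 :· (a :* x₂) :- a :* b :* x₃ := :0
        given :1 ∶ x₀ := x₂ :* :- (3 :· a) :+ x₃ :* (a :* b) and []) refl (h (# 0)) ,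
      solve F vars (λ a b t x₀ x₁ x₂ x₃ → :- (3 :· x₁) :+ 3 :· (b :* x₂) :- (b :* b :+ a) :* x₃ := :0
        given :- (3 :· :1) ∶ x₁ := x₂ :* b :+ x₃ :* :- (t :* (b :* b :+ a)) and x₃ :* (b :* b :+ a) ∶ (3 :· :1) :* t := :1 and []) refl (h (# 1)) 3·third≡1
      where vars = a ∷ b ∷ third ∷ x (# 0) ∷ x (# 1) ∷ x (# 2) ∷ x (# 3) ∷ []

    oscAt-rational : ∀ {t a b ℓ} → Imaginary t → IsRoot a b t → OscAt t ℓ → ∀ {x} → x ∈ᵥ ℓ → rational₀ a b x ≡ 0# × rational₁ a b x ≡ 0#
    oscAt-rational t∉F e at {x} x∈ = independent t∉F _ _ (trans (sym (osc-split e x)) (at x x∈))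

    oscAt⇒axisLine : ∀ {t a b ℓ} → Imaginary t → IsRoot a b t → OscAt t ℓ → ℓ ≅ axisLine a b
    oscAt⇒axisLine {t} {a} {b} {ℓ} t∉F e at = ⊑⇒≅ λ {x} x∈ →
      let (h₀ , h₁) = oscAt-rational t∉F e at x∈ in
      combination∈ (x (# 2)) (x (# 3)) (pt₁∈ (axisLine a b)) (pt₂∈ (axisLine a b)) (rational-solution x h₀ h₁)

    axisLine-oscAt : ∀ {t a b} → IsRoot a b t → OscAt t (axisLine a b)
    axisLine-oscAt {t} {a} {b} e x x∈ = let (h₀ , h₁) = solution-rational x (echelon-coordinates {# 2} {# 3} (echelon refl refl refl refl)
                                                          (pt₁∈ (axisLine a b)) (pt₂∈ (axisLine a b)) x∈)
      in vanish e x h₀ h₁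
      where
      vanish : ∀ {s} → IsRoot a b s → ∀ x → rational₀ a b x ≡ 0# → rational₁ a b x ≡ 0# → QK.oscForm s K.1# (ι ∘ x) ≡ K.0#
      vanish {s} e x h₀ h₁ = trans (osc-split e x) (solve K (ι (rational₀ a b x) ∷ ι (rational₁ a b x) ∷ s ∷ []) (λ p r s → p :+ r :* s := :0
        given :1 ∶ p := :0 and s ∶ r := :0 and []) refl (trans (cong ι h₀) 0#-homo) (trans (cong ι h₁) 0#-homo))

    oscAt-respect : ∀ {t ℓ m} → ℓ ≅ m → OscAt t ℓ → OscAt t m
    oscAt-respect ℓ≅m at x x∈ = at x (≅⇒⊑ (≅-sym ℓ≅m) x∈)

    oscAt-unique : ∀ {t ℓ m} → Imaginary t → OscAt t ℓ → OscAt t m → ℓ ≅ m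
    oscAt-unique t∉F ℓ-at m-at = let (a , b , e) = minimalPolynomial t∉F in
      ≅-trans (oscAt⇒axisLine t∉F e ℓ-at) (≅-sym (oscAt⇒axisLine t∉F e m-at))

    oscAt-möbius : ∀ a b c d {e} (h : e * (a * d + - (b * c)) ≡ 1#) {t ℓ} (img : MöbiusImage t a b c d) →
      OscAt t ℓ → OscAt (MöbiusImage.image img) (ℓ ▶ möbius a b c d h)
    oscAt-möbius a b c d {e} h {t} {ℓ} img at x x∈ = KA.zero-product (begin
        D K.^ 3 K.* QK.oscForm image K.1# (ι ∘ x)           ≡⟨ QK.oscForm-scale D image K.1# (ι ∘ x) ⟨
        QK.oscForm (D K.* image) (D K.* K.1#) (ι ∘ x)       ≡⟨ cong₂ (λ s t → QK.oscForm s t (ι ∘ x)) first second ⟨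
        QK.oscForm s′ t′ (ι ∘ x)                            ≡⟨ QK.oscForm-cong s′ t′ (λ i → trans (cong ι (sym (⊙-inverse x (matrix⁻¹ φ) (matrix φ) (inverseˡ φ) i))) (ι-⊙ y a b c d i)) ⟩
        QK.oscForm s′ t′ ((ι ∘ y) PK.⊙ Mᴷ)                  ≡⟨ QK.oscForm-image (ι a) (ι b) (ι c) (ι d) t K.1# (ι ∘ y) ⟩
        Δ K.* Δ K.* Δ K.* QK.oscForm t K.1# (ι ∘ y)         ≡⟨ cong (Δ K.* Δ K.* Δ K.*_) (at y (preimage∈ φ x∈)) ⟩
        Δ K.* Δ K.* Δ K.* K.0#                              ≡⟨ K.zeroʳ _ ⟩
        K.0#                                                ∎)
        (KA.*-nonzero D≢0 (KA.*-nonzero D≢0 (KA.*-nonzero D≢0 K.1≢0)))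
      where
      open MöbiusImage img renaming (denominator to D; denominator≢0 to D≢0)
      φ = möbius a b c d h
      y = x ⊙ matrix⁻¹ φ
      Mᴷ = QK.sym³ (ι a) (ι b) (ι c) (ι d)
      Δ = ι a K.* ι d K.+ K.- (ι b K.* ι c)
      s′ = ι a K.* t K.+ ι b K.* K.1#
      t′ = ι c K.* t K.+ ι d K.* K.1#

    imaginaryAxis⇒ : ∀ {ℓ} → ImaginaryAxis ℓ → ∃ λ t → Imaginary t × OscAt t ℓ
    imaginaryAxis⇒ {ℓ} (t , t∉F , meet) = t , t∉F , λ { x (span α β h) → begin
        QK.oscForm t K.1# (ι ∘ x)                                ≡⟨ QK.oscForm-cong t K.1# (λ i → trans (cong ι (h i)) (ι-combination α β _ _)) ⟩
        QK.oscForm t K.1# (λ i → ι α K.* ι (coord (pt₁ ℓ) i) K.+ ι β K.* ι (coord (pt₂ ℓ) i))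
                                                                 ≡⟨ QK.oscForm-combination t K.1# (ι α) (ι β) (ι ∘ coord (pt₁ ℓ)) (ι ∘ coord (pt₂ ℓ)) ⟩
        ι α K.* QK.oscForm t K.1# (ι ∘ coord (pt₁ ℓ)) K.+ ι β K.* QK.oscForm t K.1# (ι ∘ coord (pt₂ ℓ))
                                                                 ≡⟨ solve K (ι α ∷ ι β ∷ QK.oscForm t K.1# (ι ∘ coord (pt₁ ℓ)) ∷ QK.oscForm t K.1# (ι ∘ coord (pt₂ ℓ)) ∷ [])
                                                                      (λ a b x y → a :* x :+ b :* y := :0 given a ∶ x := :0 and b ∶ y := :0 and []) refl
                                                                      (on (PK.pt₁ (extend ℓ)) (LK.∈ᵥ⇒∈ₗ (LK.pt₁∈ (extend ℓ)))) (on (PK.pt₂ (extend ℓ)) (LK.∈ᵥ⇒∈ₗ (LK.pt₂∈ (extend ℓ)))) ⟩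
        K.0#                                                     ∎ }
      where
      on : ∀ X → X PK.∈ₗ extend ℓ → QK.oscForm t K.1# (PK.coord X) ≡ K.0#
      on X X∈ = QK.∈osc⇒ X (just t) (proj₁ (Equivalence.to (meet X) X∈))

    ⇒imaginaryAxis : ∀ {ℓ} → (∃ λ t → Imaginary t × OscAt t ℓ) → ImaginaryAxis ℓ
    ⇒imaginaryAxis {ℓ} (t , t∉F , at) = go (minimalPolynomial t∉F)
      where
      go : (∃₂ λ a b → IsRoot a b t) → ImaginaryAxis ℓ
      go (a , b , e) = t , t∉F , λ X → mk⇔ (forward X) (backward X)
        where
        s = t K.^ q
        s-root = conjugate-root e
        p = coord (pt₁ ℓ)
        r = coord (pt₂ ℓ)
        form-zero : ∀ {u} → IsRoot a b u → ∀ x → x ∈ᵥ ℓ → QK.oscForm u K.1# (ι ∘ x) ≡ K.0#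
        form-zero {u} u-root x x∈ = trans (osc-split u-root x) (solve K (ι (rational₀ a b x) ∷ ι (rational₁ a b x) ∷ u ∷ []) (λ p r s → p :+ r :* s := :0
          given :1 ∶ p := :0 and s ∶ r := :0 and []) refl (trans (cong ι (proj₁ zeros)) 0#-homo) (trans (cong ι (proj₂ zeros)) 0#-homo))
          where zeros = oscAt-rational t∉F e at x∈
        on-plane : ∀ {u} → IsRoot a b u → ∀ X → X PK.∈ₗ extend ℓ → X PK.∈ₚ CK.osc (just u)
        on-plane {u} u-root X (A , B , h) = QK.⇒∈osc X (just u) (begin
          QK.oscForm u K.1# (PK.coord X)                                       ≡⟨ QK.oscForm-cong u K.1# h ⟩
          QK.oscForm u K.1# (λ i → A K.* ι (p i) K.+ B K.* ι (r i))            ≡⟨ QK.oscForm-combination u K.1# A B (ι ∘ p) (ι ∘ r) ⟩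
          A K.* QK.oscForm u K.1# (ι ∘ p) K.+ B K.* QK.oscForm u K.1# (ι ∘ r)  ≡⟨ solve K (A ∷ B ∷ QK.oscForm u K.1# (ι ∘ p) ∷ QK.oscForm u K.1# (ι ∘ r) ∷ [])
                                                                                    (λ a b x y → a :* x :+ b :* y := :0 given a ∶ x := :0 and b ∶ y := :0 and []) refl
                                                                                    (form-zero u-root p (pt₁∈ ℓ)) (form-zero u-root r (pt₂∈ ℓ)) ⟩
          K.0#                                                                 ∎)
        forward : ∀ X → X PK.∈ₗ extend ℓ → X PK.∈ₚ CK.osc (just t) × X PK.∈ₚ CK.osc (just s)
        forward X X∈ = on-plane e X X∈ , on-plane s-root X X∈
        backward : ∀ X → X PK.∈ₚ CK.osc (just t) × X PK.∈ₚ CK.osc (just s) → X PK.∈ₗ extend ℓ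
        backward X (h , h′) = x₂ K.* ι α K.+ x₃ K.* ι γ , x₂ K.* ι β K.+ x₃ K.* ι δ , λ i →
            trans (in-span i) (solve K (x₂ ∷ x₃ ∷ ι (axis-v a b i) ∷ ι (axis-w a b i) ∷ ι α ∷ ι β ∷ ι γ ∷ ι δ ∷ ι (p i) ∷ ι (r i) ∷ [])
              (λ x₂ x₃ v w α β γ δ p r → x₂ :* v :+ x₃ :* w := (x₂ :* α :+ x₃ :* γ) :* p :+ (x₂ :* β :+ x₃ :* δ) :* r
                given x₂ ∶ v := α :* p :+ β :* r and x₃ ∶ w := γ :* p :+ δ :* r and []) refl
              (trans (cong ι (_∈ᵥ_.combination v∈ i)) (ι-combination α β _ _)) (trans (cong ι (_∈ᵥ_.combination w∈ i)) (ι-combination γ δ _ _)))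
          where
          x₀ = PK.coord X (# 0)
          x₁ = PK.coord X (# 1)
          x₂ = PK.coord X (# 2)
          x₃ = PK.coord X (# 3)
          axis≅ = ≅⇒⊑ (≅-sym (oscAt⇒axisLine t∉F e at))
          v∈ : axis-v a b ∈ᵥ ℓ
          v∈ = axis≅ (pt₁∈ (axisLine a b))
          w∈ : axis-w a b ∈ᵥ ℓ
          w∈ = axis≅ (pt₂∈ (axisLine a b))
          open _∈ᵥ_ v∈ using () renaming (a to α; b to β)
          open _∈ᵥ_ w∈ using () renaming (a to γ; b to δ)
          R₀ = x₀ K.+ 3 K.· (ι a K.* x₂) K.+ K.- (ι a K.* ι b K.* x₃)
          R₁ = K.- (3 K.· x₁) K.+ 3 K.· (ι b K.* x₂) K.+ K.- ((ι b K.* ι b K.+ ι a) K.* x₃)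
          at-t : R₀ K.+ R₁ K.* t ≡ K.0#
          at-t = trans (sym (osc-splitᴷ e (PK.coord X))) (QK.∈osc⇒ X (just t) h)
          at-s : R₀ K.+ R₁ K.* s ≡ K.0#
          at-s = trans (sym (osc-splitᴷ s-root (PK.coord X))) (QK.∈osc⇒ X (just s) h′)
          -- Subtracting the two equations leaves (s - t)R₁ = 0, and the conjugates s and t are
          -- distinct.
          R₁≡0 : R₁ ≡ K.0#
          R₁≡0 = KA.zero-product (solve K (R₀ ∷ R₁ ∷ s ∷ t ∷ []) (λ R₀ R₁ s t → (s :- t) :* R₁ := :0
            given :1 ∶ R₀ :+ R₁ :* s := :0 and :- :1 ∶ R₀ :+ R₁ :* t := :0 and []) refl at-s at-t) (KA.difference≢0 (conjugate≢ t∉F))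
          R₀≡0 : R₀ ≡ K.0#
          R₀≡0 = solve K (R₀ ∷ R₁ ∷ t ∷ []) (λ R₀ R₁ t → R₀ := :0 given :1 ∶ R₀ :+ R₁ :* t := :0 and :- t ∶ R₁ := :0 and []) refl at-t R₁≡0
          ι-third : (3 K.· K.1#) K.* ι third ≡ K.1#
          ι-third = trans (sym (trans (*-homo (3 · 1#) third) (cong (K._* ι third) (3·ʰ 1#-homo)))) (trans (cong ι 3·third≡1) 1#-homo)
          in-span : ∀ i → PK.coord X i ≡ x₂ K.* ι (axis-v a b i) K.+ x₃ K.* ι (axis-w a b i)
          in-span = coordinatewise
            (trans (solve K (ι a ∷ ι b ∷ x₀ ∷ x₂ ∷ x₃ ∷ []) (λ a b x₀ x₂ x₃ → x₀ := x₂ :* :- (3 :· a) :+ x₃ :* (a :* b)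
              given :1 ∶ x₀ :+ 3 :· (a :* x₂) :- a :* b :* x₃ := :0 and []) refl R₀≡0)
              (sym (cong₂ (λ v w → x₂ K.* v K.+ x₃ K.* w) (trans (-‿homo _) (cong K.-_ (3·ʰ refl))) (*-homo a b))))
            (trans (solve K (ι a ∷ ι b ∷ ι third ∷ x₁ ∷ x₂ ∷ x₃ ∷ []) (λ a b t x₁ x₂ x₃ → x₁ := x₂ :* b :+ x₃ :* :- (t :* (b :* b :+ a))
              given :- t ∶ :- (3 :· x₁) :+ 3 :· (b :* x₂) :- (b :* b :+ a) :* x₃ := :0 and :- x₁ :+ b :* x₂ ∶ (3 :· :1) :* t := :1 and []) refl R₁≡0 ι-third)
              (sym (cong (λ w → x₂ K.* ι b K.+ x₃ K.* w) (trans (-‿homo _) (cong K.-_ (trans (*-homo _ _) (cong (ι third K.*_) (*-homo b b +ʰ refl))))))))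
            (trans (solve K (x₂ ∷ x₃ ∷ []) (λ x₂ x₃ → x₂ := x₂ :* :1 :+ x₃ :* :0 given []) refl) (sym (cong₂ (λ v w → x₂ K.* v K.+ x₃ K.* w) 1#-homo 0#-homo)))
            (trans (solve K (x₂ ∷ x₃ ∷ []) (λ x₂ x₃ → x₃ := x₂ :* :0 :+ x₃ :* :1 given []) refl) (sym (cong₂ (λ v w → x₂ K.* v K.+ x₃ K.* w) 0#-homo 1#-homo)))

    imaginaryAxis-isOrbit : IsOrbit ImaginaryAxis
    imaginaryAxis-isOrbit = let (ℓ₀ , S⊆ , ⊆S) = isOrbit in ℓ₀ , (λ {ℓ} h → S⊆ {ℓ} (imaginaryAxis⇒ {ℓ} h)) , λ {ℓ} h → ⇒imaginaryAxis {ℓ} (⊆S {ℓ} h)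
      where
      exists : ∀ {t} → Imaginary t → ∃ (OscAt t)
      exists t∉F = let (a , b , e) = minimalPolynomial t∉F in axisLine a b , axisLine-oscAt e
      open Transported OscAt oscAt-respect oscAt-unique oscAt-möbius exists

-- Reguli

module Reguli {q} (5≤q : 5 ℕ.≤ q) (F : FiniteField q) (K : FiniteField (q ℕ.^ 2)) (E : Extension F K)
  (2≡0 : FiniteField._·_ F 2 (FiniteField.1# F) ≡ FiniteField.0# F) where
  open FiniteField F
  open Arithmetic F
  open ProjectiveSpace F
  open TwistedCubic F
  open LineTypes F K E
  open Linear F
  open Projective F
  open Projectivity
  open Action 5≤q F
  open Families 5≤q F
  open StandardPosition 5≤q F
  open ShapeInstances 5≤q F
  open CharacteristicTwo 2≡0
  open Classification 5≤q F K E

  record RulingBasis (v w : Parameter → Vector₄) (ℓ : Line) (σ : Parameter) : Set where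
    constructor ruled
    field
      v∈ : v σ ∈ᵥ ℓ
      w∈ : w σ ∈ᵥ ℓ

  -- The two families of lines on the quadric x₀x₃ = x₁x₂.
  v₁ w₁ v₂ w₂ : Parameter → Vector₄
  v₁ σ = ⟪ S σ , 0# , T σ , 0# ⟫
  w₁ σ = ⟪ 0# , S σ , 0# , T σ ⟫
  v₂ σ = ⟪ S σ , T σ , 0# , 0# ⟫
  w₂ σ = ⟪ 0# , 0# , S σ , T σ ⟫

  Ruling₁ Ruling₂ : Line → Parameter → Set
  Ruling₁ = RulingBasis v₁ w₁
  Ruling₂ = RulingBasis v₂ w₂

  -- With 2 = 0 the direction (3t², 2t, 1, 0) becomes (t², 0, 1, 0), so the ruling parameter is t²;
  -- every element is a square, which gives the converse.
  tangent⇒ruling₁ : ∀ {ℓ} → Tangent ℓ → ∃ (Ruling₁ ℓ)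
  tangent⇒ruling₁ {ℓ} (just t , P∈ , D∈) = just (t ^ 2) , ruled v∈
      (combination∈ 1# t (∈ₗ⇒∈ᵥ P∈) v∈ (coordinatewise
        (solve F (t ∷ []) (λ t → :0 := :1 :* t :^ 3 :+ t :* t :^ 2 given :- (t :^ 3) ∶ 2 :· :1 := :0 and []) refl 2≡0)
        (solve F (t ∷ []) (λ t → t :^ 2 := :1 :* t :^ 2 :+ t :* :0 given []) refl)
        (solve F (t ∷ []) (λ t → :0 := :1 :* t :+ t :* :1 given :- t ∶ 2 :· :1 := :0 and []) refl 2≡0)
        (solve F (t ∷ []) (λ t → :1 := :1 :* :1 :+ t :* :0 given []) refl)))
    where
    v∈ : v₁ (just (t ^ 2)) ∈ᵥ ℓ
    v∈ = ≗∈ (∈ₗ⇒∈ᵥ D∈) (coordinatewise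
      (solve F (t ∷ []) (λ t → t :^ 2 := 3 :· (t :^ 2) given :- (t :^ 2) ∶ 2 :· :1 := :0 and []) refl 2≡0)
      (solve F (t ∷ []) (λ t → :0 := 2 :· t given :- t ∶ 2 :· :1 := :0 and []) refl 2≡0) refl refl)
  tangent⇒ruling₁ {ℓ} (∞ , meet) = ∞ , ruled
    (isMeet⇒∈ x₂=0 x₃=0 {ℓ} meet (P ∞) (solve F [] (:0 :* :1 :+ (:0 :* :0 :+ (:1 :* :0 :+ (:0 :* :0 :+ :0))) := :0 given []) refl)
            (solve F [] (:0 :* :1 :+ (:0 :* :0 :+ (:0 :* :0 :+ (:1 :* :0 :+ :0))) := :0 given []) refl) ≗e₀)
    (isMeet⇒∈ x₂=0 x₃=0 {ℓ} meet ⟨ e₁ , unit (# 1) refl ⟩ (solve F [] (:0 :* :0 :+ (:0 :* :1 :+ (:1 :* :0 :+ (:0 :* :0 :+ :0))) := :0 given []) refl)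
            (solve F [] (:0 :* :0 :+ (:0 :* :1 :+ (:0 :* :0 :+ (:1 :* :0 :+ :0))) := :0 given []) refl) ≗e₁)
    where
    _≗e₀ : coord (P ∞) ∈ᵥ ℓ → v₁ ∞ ∈ᵥ ℓ
    h ≗e₀ = ≗∈ h (coordinatewise refl refl refl refl)
    _≗e₁ : e₁ ∈ᵥ ℓ → w₁ ∞ ∈ᵥ ℓ
    h ≗e₁ = ≗∈ h (coordinatewise refl refl refl refl)

  ruling₁⇒tangent : ∀ {ℓ} → ∃ (Ruling₁ ℓ) → Tangent ℓ
  ruling₁⇒tangent {ℓ} (∞ , ruled v∈ w∈) = ∞ , e₀e₁⇒tangent∞ {ℓ} (≗∈ v∈ (coordinatewise refl refl refl refl)) (≗∈ w∈ (coordinatewise refl refl refl refl))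
  ruling₁⇒tangent {ℓ} (just s , ruled v∈ w∈) = just t ,
    ∈ᵥ⇒∈ₗ (combination∈ t 1# v∈ w∈ (coordinatewise
      (solve F (t ∷ s ∷ []) (λ t s → t :^ 3 := t :* s :+ :1 :* :0 given t ∶ t :* t := s and []) refl t²≡s)
      (solve F (t ∷ s ∷ []) (λ t s → t :^ 2 := t :* :0 :+ :1 :* s given :1 ∶ t :* t := s and []) refl t²≡s)
      (solve F (t ∷ []) (λ t → t := t :* :1 :+ :1 :* :0 given []) refl)
      (solve F (t ∷ []) (λ t → :1 := t :* :0 :+ :1 :* :1 given []) refl))) ,
    ∈ᵥ⇒∈ₗ (≗∈ v∈ (coordinatewise
      (solve F (t ∷ s ∷ []) (λ t s → 3 :· (t :^ 2) := s given :1 ∶ t :* t := s and t :^ 2 ∶ 2 :· :1 := :0 and []) refl t²≡s 2≡0)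
      (solve F (t ∷ []) (λ t → 2 :· t := :0 given t ∶ 2 :· :1 := :0 and []) refl 2≡0) refl refl))
    where
    t = proj₁ (char2⇒square 2≡0 s)
    t²≡s = proj₂ (char2⇒square 2≡0 s)

  -- Undoing the move turns `e₁` into (3t, 1, 0, 0) = (t, 1, 0, 0), and (t³, t², t, 1) = t²(t, 1, 0,
  -- 0) + (0, 0, t, 1), so the ruling parameter is the base parameter.
  planar⇒ruling₂ : ∀ {ℓ} → ZeroPlanar.Based ℓ → ∃ (Ruling₂ ℓ)
  planar⇒ruling₂ {ℓ} (τ , (_ , refl) , ZeroPlanar.basis e₃∈ w∈) = τ , from τ (P∈-preimage (maps-move τ) (e₃∈⇒PO∈ e₃∈)) (preimage∈ (move τ) w∈)
    where
    from : ∀ τ → coord (P τ) ∈ᵥ ℓ → (e₁ ⊙ matrix⁻¹ (move τ)) ∈ᵥ ℓ → Ruling₂ ℓ τ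
    from ∞ P∈ w∈ = ruled (≗∈ P∈ (coordinatewise refl refl refl refl)) (≗∈ w∈ (coordinatewise
      (solve F [] (claim (:vector :0 :0 :1 :0) (# 0)) refl) (solve F [] (claim (:vector :0 :0 :1 :0) (# 1)) refl) (solve F [] (claim (:vector :0 :0 :1 :0) (# 2)) refl) (solve F [] (claim (:vector :0 :0 :1 :0) (# 3)) refl)))
      where
      claim : (Fin 4 → _) → Fin 4 → Claim 0
      claim x k = x k := :∑ (λ i → :vector :0 :1 :0 :0 i :* :sym³ (:- :1 :* :0) (:- (:- :1 :* :1)) (:- (:- :1 :* :1)) (:- :1 :* :0) i k) given []
    from (just t) P∈ w∈ = ruled v∈ (combination∈ 1# (- (t ^ 2)) P∈ v∈ (coordinatewise
        (solve F (t ∷ []) (λ t → :0 := :1 :* t :^ 3 :+ :- (t :^ 2) :* t given []) refl)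
        (solve F (t ∷ []) (λ t → :0 := :1 :* t :^ 2 :+ :- (t :^ 2) :* :1 given []) refl)
        (solve F (t ∷ []) (λ t → t := :1 :* t :+ :- (t :^ 2) :* :0 given []) refl)
        (solve F (t ∷ []) (λ t → :1 := :1 :* :1 :+ :- (t :^ 2) :* :0 given []) refl)))
      where
      x : Expr ℤ 1 → Fin 4 → Expr ℤ 1
      x t k = :∑ (λ i → :vector :0 :1 :0 :0 i :* :sym³ (:1 :* :1) (:- (:1 :* :- t)) (:- (:1 :* :0)) (:1 :* :1) i k)
      v∈ : v₂ (just t) ∈ᵥ ℓ
      v∈ = ≗∈ w∈ (coordinatewise
        (solve F (t ∷ []) (λ t → t := x t (# 0) given :- t ∶ 2 :· :1 := :0 and []) refl 2≡0)
        (solve F (t ∷ []) (λ t → :1 := x t (# 1) given []) refl)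
        (solve F (t ∷ []) (λ t → :0 := x t (# 2) given []) refl)
        (solve F (t ∷ []) (λ t → :0 := x t (# 3) given []) refl))

  ruling₂⇒planar : ∀ {ℓ} → ∃ (Ruling₂ ℓ) → ZeroPlanar.Based ℓ
  ruling₂⇒planar {ℓ} (∞ , ruled v∈ w∈) = ∞ , (0# , refl) , ZeroPlanar.basis
    (PO∈⇒e₃∈ (P∈-image (maps-move ∞) (≗∈ v∈ (coordinatewise refl refl refl refl))))
    (≗∈ (image∈ inversion w∈) (coordinatewise (solve F [] (claim (# 0)) refl) (solve F [] (claim (# 1)) refl) (solve F [] (claim (# 2)) refl) (solve F [] (claim (# 3)) refl)))
    where
    claim : Fin 4 → Claim 0
    claim k = :vector :0 :1 :0 :0 k := :∑ (λ i → :vector :0 :0 :1 :0 i :* :sym³ :0 :1 :1 :0 i k) given []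
  ruling₂⇒planar {ℓ} (just t , ruled v∈ w∈) = just t , (0# , refl) , ZeroPlanar.basis
    (PO∈⇒e₃∈ (P∈-image (maps-move (just t)) (combination∈ (t ^ 2) 1# v∈ w∈ (coordinatewise
        (solve F (t ∷ []) (λ t → t :^ 3 := t :^ 2 :* t :+ :1 :* :0 given []) refl)
        (solve F (t ∷ []) (λ t → t :^ 2 := t :^ 2 :* :1 :+ :1 :* :0 given []) refl)
        (solve F (t ∷ []) (λ t → t := t :^ 2 :* :0 :+ :1 :* t given []) refl)
        (solve F (t ∷ []) (λ t → :1 := t :^ 2 :* :0 :+ :1 :* :1 given []) refl)))))
    (≗∈ (image∈ (translation (- t)) v∈) (coordinatewise
      (solve F (t ∷ []) (λ t → :0 := x t (# 0) given t ∶ 2 :· :1 := :0 and []) refl 2≡0)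
      (solve F (t ∷ []) (λ t → :1 := x t (# 1) given []) refl)
      (solve F (t ∷ []) (λ t → :0 := x t (# 2) given []) refl)
      (solve F (t ∷ []) (λ t → :0 := x t (# 3) given []) refl)))
    where
    x : Expr ℤ 1 → Fin 4 → Expr ℤ 1
    x t k = :∑ (λ i → :vector t :1 :0 :0 i :* :sym³ :1 (:- t) :0 :1 i k)

  ruling₁-relation : ∀ {ℓ} σ → Ruling₁ ℓ σ → ∀ {x} → x ∈ᵥ ℓ → T σ * x (# 0) ≡ S σ * x (# 2) × T σ * x (# 1) ≡ S σ * x (# 3)
  ruling₁-relation (just s) (ruled v∈ w∈) {x} x∈ =
    solve F (s ∷ x (# 0) ∷ x (# 2) ∷ x (# 3) ∷ []) (λ s x₀ x₂ x₃ → :1 :* x₀ := s :* x₂ given :1 ∶ x₀ := x₂ :* s :+ x₃ :* :0 and []) refl (h (# 0)) ,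
    solve F (s ∷ x (# 1) ∷ x (# 2) ∷ x (# 3) ∷ []) (λ s x₁ x₂ x₃ → :1 :* x₁ := s :* x₃ given :1 ∶ x₁ := x₂ :* :0 :+ x₃ :* s and []) refl (h (# 1))
    where h = echelon-coordinates {# 2} {# 3} (echelon refl refl refl refl) v∈ w∈ x∈
  ruling₁-relation ∞ (ruled v∈ w∈) {x} x∈ =
    solve F (x (# 0) ∷ x (# 1) ∷ x (# 2) ∷ []) (λ x₀ x₁ x₂ → :0 :* x₀ := :1 :* x₂ given :- :1 ∶ x₂ := x₀ :* :0 :+ x₁ :* :0 and []) refl (h (# 2)) ,
    solve F (x (# 0) ∷ x (# 1) ∷ x (# 3) ∷ []) (λ x₀ x₁ x₃ → :0 :* x₁ := :1 :* x₃ given :- :1 ∶ x₃ := x₀ :* :0 :+ x₁ :* :0 and []) refl (h (# 3))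
    where h = echelon-coordinates {# 0} {# 1} (echelon refl refl refl refl) v∈ w∈ x∈

  ruling₂-relation : ∀ {ℓ} σ → Ruling₂ ℓ σ → ∀ {x} → x ∈ᵥ ℓ → T σ * x (# 0) ≡ S σ * x (# 1) × T σ * x (# 2) ≡ S σ * x (# 3)
  ruling₂-relation (just s) (ruled v∈ w∈) {x} x∈ =
    solve F (s ∷ x (# 0) ∷ x (# 1) ∷ x (# 3) ∷ []) (λ s x₀ x₁ x₃ → :1 :* x₀ := s :* x₁ given :1 ∶ x₀ := x₁ :* s :+ x₃ :* :0 and []) refl (h (# 0)) ,
    solve F (s ∷ x (# 1) ∷ x (# 2) ∷ x (# 3) ∷ []) (λ s x₁ x₂ x₃ → :1 :* x₂ := s :* x₃ given :1 ∶ x₂ := x₁ :* :0 :+ x₃ :* s and []) refl (h (# 2))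
    where h = echelon-coordinates {# 1} {# 3} (echelon refl refl refl refl) v∈ w∈ x∈
  ruling₂-relation ∞ (ruled v∈ w∈) {x} x∈ =
    solve F (x (# 0) ∷ x (# 1) ∷ x (# 2) ∷ []) (λ x₀ x₁ x₂ → :0 :* x₀ := :1 :* x₁ given :- :1 ∶ x₁ := x₀ :* :0 :+ x₂ :* :0 and []) refl (h (# 1)) ,
    solve F (x (# 0) ∷ x (# 2) ∷ x (# 3) ∷ []) (λ x₀ x₂ x₃ → :0 :* x₂ := :1 :* x₃ given :- :1 ∶ x₃ := x₀ :* :0 :+ x₂ :* :0 and []) refl (h (# 3))
    where h = echelon-coordinates {# 0} {# 2} (echelon refl refl refl refl) v∈ w∈ x∈

  proportion-unique : ∀ σ τ {x y} → T σ * x ≡ S σ * y → T τ * x ≡ S τ * y → ¬ (x ≡ 0# × y ≡ 0#) → σ ≡ τ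
  proportion-unique σ τ {x} {y} e f xy≢0 = go (x ≟ 0#) (y ≟ 0#)
    where
    Δ = T σ * S τ + - (S σ * T τ)
    zero⇒≡ : Δ ≡ 0# → σ ≡ τ
    zero⇒≡ h = ST-injective σ τ (solve F (T σ ∷ S τ ∷ S σ ∷ T τ ∷ []) (λ a b c d → a :* b := c :* d given :1 ∶ a :* b :- c :* d := :0 and []) refl h)
    go : _ → _ → σ ≡ τ
    go (yes x≡0) (yes y≡0) = ⊥-elim (xy≢0 (x≡0 , y≡0))
    go (no x≢0) _ = zero⇒≡ (zero-product (solve F (S σ ∷ T σ ∷ S τ ∷ T τ ∷ x ∷ y ∷ []) (λ s t s′ t′ x y → x :* (t :* s′ :- s :* t′) := :0
      given s′ ∶ t :* x := s :* y and :- s ∶ t′ :* x := s′ :* y and []) refl e f) x≢0)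
    go (yes _) (no y≢0) = zero⇒≡ (zero-product (solve F (S σ ∷ T σ ∷ S τ ∷ T τ ∷ x ∷ y ∷ []) (λ s t s′ t′ x y → y :* (t :* s′ :- s :* t′) := :0
      given t′ ∶ t :* x := s :* y and :- t ∶ t′ :* x := s′ :* y and []) refl e f) y≢0)

  nonzero-pair : ∀ {x y} → (x ≡ 0# × y ≡ 0#) ⊎ ¬ (x ≡ 0# × y ≡ 0#)
  nonzero-pair {x} {y} = go (x ≟ 0#) (y ≟ 0#)
    where
    go : _ → _ → (x ≡ 0# × y ≡ 0#) ⊎ ¬ (x ≡ 0# × y ≡ 0#)
    go (yes x≡0) (yes y≡0) = inj₁ (x≡0 , y≡0)
    go (no x≢0) _ = inj₂ (x≢0 ∘ proj₁)
    go (yes _) (no y≢0) = inj₂ (y≢0 ∘ proj₂)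

  ruling₁-≅ : ∀ {ℓ m} σ → Ruling₁ ℓ σ → Ruling₁ m σ → ℓ ≅ m
  ruling₁-≅ (just s) (ruled v∈ w∈) (ruled v∈′ w∈′) = echelon-≅ {# 2} {# 3} (echelon refl refl refl refl) v∈ w∈ v∈′ w∈′
  ruling₁-≅ ∞        (ruled v∈ w∈) (ruled v∈′ w∈′) = echelon-≅ {# 0} {# 1} (echelon refl refl refl refl) v∈ w∈ v∈′ w∈′

  ruling₂-≅ : ∀ {ℓ m} σ → Ruling₂ ℓ σ → Ruling₂ m σ → ℓ ≅ m
  ruling₂-≅ (just s) (ruled v∈ w∈) (ruled v∈′ w∈′) = echelon-≅ {# 1} {# 3} (echelon refl refl refl refl) v∈ w∈ v∈′ w∈′
  ruling₂-≅ ∞        (ruled v∈ w∈) (ruled v∈′ w∈′) = echelon-≅ {# 0} {# 2} (echelon refl refl refl refl) v∈ w∈ v∈′ w∈′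

  -- The ruling parameter is the ratio x₀ : x₂ = x₁ : x₃ and is determined by any single point, at
  -- which one of the two pairs is nonzero.
  ruling₁-skew : ∀ {ℓ m σ τ} → Ruling₁ ℓ σ → Ruling₁ m τ → ∀ X → coord X ∈ᵥ ℓ → coord X ∈ᵥ m → σ ≡ τ
  ruling₁-skew {σ = σ} {τ} ℓσ mτ X X∈ℓ X∈m = go (nonzero-pair {coord X (# 0)} {coord X (# 2)})
    where
    r = ruling₁-relation σ ℓσ X∈ℓ
    s = ruling₁-relation τ mτ X∈m
    go : _ → σ ≡ τ
    go (inj₂ ≢0) = proportion-unique σ τ (proj₁ r) (proj₁ s) ≢0
    go (inj₁ (x₀≡0 , x₂≡0)) = proportion-unique σ τ (proj₂ r) (proj₂ s) λ (x₁≡0 , x₃≡0) → nonzero X (coordinatewise x₀≡0 x₁≡0 x₂≡0 x₃≡0)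

  ruling₂-skew : ∀ {ℓ m σ τ} → Ruling₂ ℓ σ → Ruling₂ m τ → ∀ X → coord X ∈ᵥ ℓ → coord X ∈ᵥ m → σ ≡ τ
  ruling₂-skew {σ = σ} {τ} ℓσ mτ X X∈ℓ X∈m = go (nonzero-pair {coord X (# 0)} {coord X (# 1)})
    where
    r = ruling₂-relation σ ℓσ X∈ℓ
    s = ruling₂-relation τ mτ X∈m
    go : _ → σ ≡ τ
    go (inj₂ ≢0) = proportion-unique σ τ (proj₁ r) (proj₁ s) ≢0
    go (inj₁ (x₀≡0 , x₁≡0)) = proportion-unique σ τ (proj₂ r) (proj₂ s) λ (x₂≡0 , x₃≡0) → nonzero X (coordinatewise x₀≡0 x₁≡0 x₂≡0 x₃≡0)

  -- The quadric x₀x₃ = x₁x₂, with a plus sign as in `OnQuadric`; the two agree because 2 = 0.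
  quadric : Vector₄ → Carrier
  quadric x = x (# 0) * x (# 3) + x (# 1) * x (# 2)

  proportional⇒product : ∀ σ {x y z w} → T σ * x ≡ S σ * y → T σ * z ≡ S σ * w → x * w ≡ y * z
  proportional⇒product (just s) {x} {y} {z} {w} e f = solve F (s ∷ x ∷ y ∷ z ∷ w ∷ []) (λ s x y z w → x :* w := y :* z
    given w ∶ :1 :* x := s :* y and :- y ∶ :1 :* z := s :* w and []) refl e f
  proportional⇒product ∞ {x} {y} {z} {w} e f = solve F (x ∷ y ∷ z ∷ w ∷ []) (λ x y z w → x :* w := y :* z
    given z ∶ :0 :* x := :1 :* y and :- x ∶ :0 :* z := :1 :* w and []) refl e f

  OnQuadricᵥ : Pred Line 0ℓ
  OnQuadricᵥ ℓ = ∀ x → x ∈ᵥ ℓ → quadric x ≡ 0#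

  ruling₁⇒onQuadric : ∀ {ℓ} → ∃ (Ruling₁ ℓ) → OnQuadricᵥ ℓ
  ruling₁⇒onQuadric (σ , r) x x∈ = let (e , f) = ruling₁-relation σ r x∈ in
    solve F (x (# 0) ∷ x (# 1) ∷ x (# 2) ∷ x (# 3) ∷ []) (λ x₀ x₁ x₂ x₃ → x₀ :* x₃ :+ x₁ :* x₂ := :0
      given :1 ∶ x₀ :* x₃ := x₂ :* x₁ and x₁ :* x₂ ∶ 2 :· :1 := :0 and []) refl (proportional⇒product σ e f) 2≡0

  ruling₂⇒onQuadric : ∀ {ℓ} → ∃ (Ruling₂ ℓ) → OnQuadricᵥ ℓ
  ruling₂⇒onQuadric (σ , r) x x∈ = let (e , f) = ruling₂-relation σ r x∈ in
    solve F (x (# 0) ∷ x (# 1) ∷ x (# 2) ∷ x (# 3) ∷ []) (λ x₀ x₁ x₂ x₃ → x₀ :* x₃ :+ x₁ :* x₂ := :0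
      given :1 ∶ x₀ :* x₃ := x₁ :* x₂ and x₁ :* x₂ ∶ 2 :· :1 := :0 and []) refl (proportional⇒product σ e f) 2≡0

  -- Polarisation: the form vanishes at x, y and x + y, hence so does its associated bilinear form
  -- at (x, y).
  polar : ∀ {ℓ} → OnQuadricᵥ ℓ → ∀ {x y} → x ∈ᵥ ℓ → y ∈ᵥ ℓ →
    x (# 0) * y (# 3) + x (# 3) * y (# 0) + x (# 1) * y (# 2) + x (# 2) * y (# 1) ≡ 0#
  polar on {x} {y} x∈ y∈ = solve F (x (# 0) ∷ x (# 1) ∷ x (# 2) ∷ x (# 3) ∷ y (# 0) ∷ y (# 1) ∷ y (# 2) ∷ y (# 3) ∷ [])
    (λ x₀ x₁ x₂ x₃ y₀ y₁ y₂ y₃ → x₀ :* y₃ :+ x₃ :* y₀ :+ x₁ :* y₂ :+ x₂ :* y₁ := :0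
      given :1 ∶ (:1 :* x₀ :+ :1 :* y₀) :* (:1 :* x₃ :+ :1 :* y₃) :+ (:1 :* x₁ :+ :1 :* y₁) :* (:1 :* x₂ :+ :1 :* y₂) := :0
      and :- :1 ∶ x₀ :* x₃ :+ x₁ :* x₂ := :0 and :- :1 ∶ y₀ :* y₃ :+ y₁ :* y₂ := :0 and []) refl
    (on (λ i → 1# * x i + 1# * y i) (combination∈ 1# 1# x∈ y∈ (λ _ → refl))) (on x x∈) (on y y∈)

  private
    scaled : ∀ {ℓ} X i → coord X ∈ᵥ ℓ → coord X i ≢ 0# → ∀ v → (∀ k → coord X i * v k ≡ coord X k) → v ∈ᵥ ℓ
    scaled X i X∈ Xᵢ≢0 v h = unscale v (coord X) (proj₂ (inverse (coord X i) Xᵢ≢0)) h X∈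

  -- A second point of a line through e₀ decides its ruling.
  e₀-ruling : ∀ {ℓ} → OnQuadricᵥ ℓ → e₀ ∈ᵥ ℓ → ∃ (Ruling₁ ℓ) ⊎ ∃ (Ruling₂ ℓ)
  e₀-ruling {ℓ} on e₀∈ = go (coordinateSection ℓ (# 0))
    where
    go : (∃ λ Y → Y ∈ₗ ℓ × coord Y (# 0) ≡ 0#) → ∃ (Ruling₁ ℓ) ⊎ ∃ (Ruling₂ ℓ)
    go (Y , Y∈ , y₀≡0) = by-cases (y₁ ≟ 0#) (y₂ ≟ 0#)
      where
      y = coord Y
      y₁ = y (# 1)
      y₂ = y (# 2)
      y∈ : y ∈ᵥ ℓ
      y∈ = ∈ₗ⇒∈ᵥ Y∈
      y₃≡0 : y (# 3) ≡ 0#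
      y₃≡0 = solve F (y (# 0) ∷ y (# 1) ∷ y (# 2) ∷ y (# 3) ∷ []) (λ y₀ y₁ y₂ y₃ → y₃ := :0
        given :1 ∶ :1 :* y₃ :+ :0 :* y₀ :+ :0 :* y₂ :+ :0 :* y₁ := :0 and []) refl (polar {ℓ} on e₀∈ y∈)
      by-cases : _ → _ → ∃ (Ruling₁ ℓ) ⊎ ∃ (Ruling₂ ℓ)
      by-cases (yes y₁≡0) (yes y₂≡0) = ⊥-elim (nonzero Y (coordinatewise y₀≡0 y₁≡0 y₂≡0 y₃≡0))
      by-cases (yes y₁≡0) (no y₂≢0) = inj₂ (∞ , ruled (≗∈ e₀∈ (coordinatewise refl refl refl refl)) (scaled Y (# 2) y∈ y₂≢0 (w₂ ∞)
        (coordinatewise (trans (zeroʳ _) (sym y₀≡0)) (trans (zeroʳ _) (sym y₁≡0)) (*-identityʳ _) (trans (zeroʳ _) (sym y₃≡0)))))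
      by-cases (no y₁≢0) (yes y₂≡0) = inj₁ (∞ , ruled (≗∈ e₀∈ (coordinatewise refl refl refl refl)) (scaled Y (# 1) y∈ y₁≢0 (w₁ ∞)
        (coordinatewise (trans (zeroʳ _) (sym y₀≡0)) (*-identityʳ _) (trans (zeroʳ _) (sym y₂≡0)) (trans (zeroʳ _) (sym y₃≡0)))))
      by-cases (no y₁≢0) (no y₂≢0) = ⊥-elim (*-nonzero y₁≢0 y₂≢0 (solve F (y (# 0) ∷ y (# 1) ∷ y (# 2) ∷ y (# 3) ∷ []) (λ y₀ y₁ y₂ y₃ → y₁ :* y₂ := :0
        given :1 ∶ y₀ :* y₃ :+ y₁ :* y₂ := :0 and :- y₃ ∶ y₀ := :0 and []) refl (on y y∈) y₀≡0))

  -- The trace on x₂ = 0 satisfies y₁ = s y₃ by polarity and y₀y₃ = 0. So it is the second basis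
  -- vector of the first ruling if y₃ ≠ 0, and `e₀` otherwise.
  v₁-ruling : ∀ {ℓ} s → OnQuadricᵥ ℓ → v₁ (just s) ∈ᵥ ℓ → ∃ (Ruling₁ ℓ) ⊎ ∃ (Ruling₂ ℓ)
  v₁-ruling {ℓ} s on v∈ = go (coordinateSection ℓ (# 2))
    where
    go : (∃ λ Y → Y ∈ₗ ℓ × coord Y (# 2) ≡ 0#) → ∃ (Ruling₁ ℓ) ⊎ ∃ (Ruling₂ ℓ)
    go (Y , Y∈ , y₂≡0) = by-cases (y (# 3) ≟ 0#)
      where
      y = coord Y
      y∈ : y ∈ᵥ ℓ
      y∈ = ∈ₗ⇒∈ᵥ Y∈
      y₁≡ : y (# 1) ≡ y (# 3) * s
      y₁≡ = solve F (s ∷ y (# 0) ∷ y (# 1) ∷ y (# 2) ∷ y (# 3) ∷ []) (λ s y₀ y₁ y₂ y₃ → y₁ := y₃ :* s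
        given :1 ∶ s :* y₃ :+ :0 :* y₀ :+ :0 :* y₂ :+ :1 :* y₁ := :0 and :- (s :* y₃) ∶ 2 :· :1 := :0 and []) refl (polar {ℓ} on v∈ y∈) 2≡0
      y₀y₃≡0 : y (# 3) * y (# 0) ≡ 0#
      y₀y₃≡0 = solve F (y (# 0) ∷ y (# 1) ∷ y (# 2) ∷ y (# 3) ∷ []) (λ y₀ y₁ y₂ y₃ → y₃ :* y₀ := :0
        given :1 ∶ y₀ :* y₃ :+ y₁ :* y₂ := :0 and :- y₁ ∶ y₂ := :0 and []) refl (on y y∈) y₂≡0
      by-cases : _ → ∃ (Ruling₁ ℓ) ⊎ ∃ (Ruling₂ ℓ)
      by-cases (no y₃≢0) = inj₁ (just s , ruled v∈ (scaled Y (# 3) y∈ y₃≢0 (w₁ (just s))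
        (coordinatewise (trans (zeroʳ _) (sym (zero-product y₀y₃≡0 y₃≢0))) (sym y₁≡) (trans (zeroʳ _) (sym y₂≡0)) (*-identityʳ _))))
      by-cases (yes y₃≡0) = e₀-ruling {ℓ} on (scaled Y (# 0) y∈ y₀≢0 e₀
        (coordinatewise (*-identityʳ _) (trans (zeroʳ _) (sym y₁≡0)) (trans (zeroʳ _) (sym y₂≡0)) (trans (zeroʳ _) (sym y₃≡0))))
        where
        y₁≡0 : y (# 1) ≡ 0#
        y₁≡0 = trans y₁≡ (trans (cong (_* s) y₃≡0) (zeroˡ s))
        y₀≢0 : y (# 0) ≢ 0#
        y₀≢0 y₀≡0 = nonzero Y (coordinatewise y₀≡0 y₁≡0 y₂≡0 y₃≡0)

  v₂-ruling : ∀ {ℓ} s → OnQuadricᵥ ℓ → v₂ (just s) ∈ᵥ ℓ → ∃ (Ruling₁ ℓ) ⊎ ∃ (Ruling₂ ℓ)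
  v₂-ruling {ℓ} s on v∈ = go (coordinateSection ℓ (# 1))
    where
    go : (∃ λ Y → Y ∈ₗ ℓ × coord Y (# 1) ≡ 0#) → ∃ (Ruling₁ ℓ) ⊎ ∃ (Ruling₂ ℓ)
    go (Y , Y∈ , y₁≡0) = by-cases (y (# 3) ≟ 0#)
      where
      y = coord Y
      y∈ : y ∈ᵥ ℓ
      y∈ = ∈ₗ⇒∈ᵥ Y∈
      y₂≡ : y (# 2) ≡ y (# 3) * s
      y₂≡ = solve F (s ∷ y (# 0) ∷ y (# 1) ∷ y (# 2) ∷ y (# 3) ∷ []) (λ s y₀ y₁ y₂ y₃ → y₂ := y₃ :* s
        given :1 ∶ s :* y₃ :+ :0 :* y₀ :+ :1 :* y₂ :+ :0 :* y₁ := :0 and :- (s :* y₃) ∶ 2 :· :1 := :0 and []) refl (polar {ℓ} on v∈ y∈) 2≡0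
      y₀y₃≡0 : y (# 3) * y (# 0) ≡ 0#
      y₀y₃≡0 = solve F (y (# 0) ∷ y (# 1) ∷ y (# 2) ∷ y (# 3) ∷ []) (λ y₀ y₁ y₂ y₃ → y₃ :* y₀ := :0
        given :1 ∶ y₀ :* y₃ :+ y₁ :* y₂ := :0 and :- y₂ ∶ y₁ := :0 and []) refl (on y y∈) y₁≡0
      by-cases : _ → ∃ (Ruling₁ ℓ) ⊎ ∃ (Ruling₂ ℓ)
      by-cases (no y₃≢0) = inj₂ (just s , ruled v∈ (scaled Y (# 3) y∈ y₃≢0 (w₂ (just s))
        (coordinatewise (trans (zeroʳ _) (sym (zero-product y₀y₃≡0 y₃≢0))) (trans (zeroʳ _) (sym y₁≡0)) (sym y₂≡) (*-identityʳ _))))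
      by-cases (yes y₃≡0) = e₀-ruling {ℓ} on (scaled Y (# 0) y∈ y₀≢0 e₀
        (coordinatewise (*-identityʳ _) (trans (zeroʳ _) (sym y₁≡0)) (trans (zeroʳ _) (sym y₂≡0)) (trans (zeroʳ _) (sym y₃≡0))))
        where
        y₂≡0 : y (# 2) ≡ 0#
        y₂≡0 = trans y₂≡ (trans (cong (_* s) y₃≡0) (zeroˡ s))
        y₀≢0 : y (# 0) ≢ 0#
        y₀≢0 y₀≡0 = nonzero Y (coordinatewise y₀≡0 y₁≡0 y₂≡0 y₃≡0)

  -- On x₃ = 0 the quadric is x₁x₂ = 0, so the trace of the line there is `e₀` or a first basis
  -- vector of one of the rulings.
  onQuadric⇒ruling : ∀ {ℓ} → OnQuadricᵥ ℓ → ∃ (Ruling₁ ℓ) ⊎ ∃ (Ruling₂ ℓ)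
  onQuadric⇒ruling {ℓ} on = go (coordinateSection ℓ (# 3))
    where
    go : (∃ λ X → X ∈ₗ ℓ × coord X (# 3) ≡ 0#) → ∃ (Ruling₁ ℓ) ⊎ ∃ (Ruling₂ ℓ)
    go (X , X∈ , x₃≡0) = by-cases (x (# 1) ≟ 0#) (x (# 2) ≟ 0#)
      where
      x = coord X
      x∈ : x ∈ᵥ ℓ
      x∈ = ∈ₗ⇒∈ᵥ X∈
      by-cases : _ → _ → ∃ (Ruling₁ ℓ) ⊎ ∃ (Ruling₂ ℓ)
      by-cases (yes x₁≡0) (yes x₂≡0) = e₀-ruling {ℓ} on (scaled X (# 0) x∈ (λ x₀≡0 → nonzero X (coordinatewise x₀≡0 x₁≡0 x₂≡0 x₃≡0)) e₀
        (coordinatewise (*-identityʳ _) (trans (zeroʳ _) (sym x₁≡0)) (trans (zeroʳ _) (sym x₂≡0)) (trans (zeroʳ _) (sym x₃≡0))))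
      by-cases (yes x₁≡0) (no x₂≢0) = v₁-ruling {ℓ} (z * x (# 0)) on (scaled X (# 2) x∈ x₂≢0 _ (coordinatewise
          (solve F (x (# 2) ∷ z ∷ x (# 0) ∷ []) (λ x z y → x :* (z :* y) := y given y ∶ x :* z := :1 and []) refl xz≡1)
          (trans (zeroʳ _) (sym x₁≡0)) (*-identityʳ _) (trans (zeroʳ _) (sym x₃≡0))))
        where
        z = proj₁ (inverse (x (# 2)) x₂≢0)
        xz≡1 = proj₂ (inverse (x (# 2)) x₂≢0)
      by-cases (no x₁≢0) (yes x₂≡0) = v₂-ruling {ℓ} (z * x (# 0)) on (scaled X (# 1) x∈ x₁≢0 _ (coordinatewise
          (solve F (x (# 1) ∷ z ∷ x (# 0) ∷ []) (λ x z y → x :* (z :* y) := y given y ∶ x :* z := :1 and []) refl xz≡1)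
          (*-identityʳ _) (trans (zeroʳ _) (sym x₂≡0)) (trans (zeroʳ _) (sym x₃≡0))))
        where
        z = proj₁ (inverse (x (# 1)) x₁≢0)
        xz≡1 = proj₂ (inverse (x (# 1)) x₁≢0)
      by-cases (no x₁≢0) (no x₂≢0) = ⊥-elim (*-nonzero x₁≢0 x₂≢0 (solve F (x (# 0) ∷ x (# 1) ∷ x (# 2) ∷ x (# 3) ∷ []) (λ x₀ x₁ x₂ x₃ → x₁ :* x₂ := :0
        given :1 ∶ x₀ :* x₃ :+ x₁ :* x₂ := :0 and :- x₀ ∶ x₃ := :0 and []) refl (on x x∈) x₃≡0))

  private
    :permute :permute⁻¹ : Fin 4 → Fin 4 → Expr ℤ 0
    :permute zero                   = :vector :1 :0 :0 :0
    :permute (suc zero)             = :vector :0 :0 :1 :0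
    :permute (suc (suc zero))       = :vector :0 :0 :0 :1
    :permute (suc (suc (suc zero))) = :vector :0 :1 :0 :0
    :permute⁻¹ zero                   = :vector :1 :0 :0 :0
    :permute⁻¹ (suc zero)             = :vector :0 :0 :0 :1
    :permute⁻¹ (suc (suc zero))       = :vector :0 :1 :0 :0
    :permute⁻¹ (suc (suc (suc zero))) = :vector :0 :0 :1 :0

    permute permute⁻¹ : Matrix
    permute i j = evaluate F (:permute i j) []
    permute⁻¹ i j = evaluate F (:permute⁻¹ i j) []

    :I : Fin 4 → Fin 4 → Expr ℤ 0
    :I i j with i Fin.≟ j
    ... | yes _ = :1
    ... | no  _ = :0

    right left : Fin 4 → Fin 4 → Claim 0
    right i j = :∑ (λ k → :permute i k :* :permute⁻¹ k j) := :I i j given []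
    left  i j = :∑ (λ k → :permute⁻¹ i k :* :permute k j) := :I i j given []

  -- (x₀, x₁, x₂, x₃) ↦ (x₀, x₃, x₁, x₂)
  permutation : Projectivity
  permutation = record
    { matrix   = permute
    ; matrix⁻¹ = permute⁻¹
    ; inverseʳ = coordinatewise
        (coordinatewise (solve F [] (right (# 0) (# 0)) refl) (solve F [] (right (# 0) (# 1)) refl) (solve F [] (right (# 0) (# 2)) refl) (solve F [] (right (# 0) (# 3)) refl))
        (coordinatewise (solve F [] (right (# 1) (# 0)) refl) (solve F [] (right (# 1) (# 1)) refl) (solve F [] (right (# 1) (# 2)) refl) (solve F [] (right (# 1) (# 3)) refl))
        (coordinatewise (solve F [] (right (# 2) (# 0)) refl) (solve F [] (right (# 2) (# 1)) refl) (solve F [] (right (# 2) (# 2)) refl) (solve F [] (right (# 2) (# 3)) refl))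
        (coordinatewise (solve F [] (right (# 3) (# 0)) refl) (solve F [] (right (# 3) (# 1)) refl) (solve F [] (right (# 3) (# 2)) refl) (solve F [] (right (# 3) (# 3)) refl))
    ; inverseˡ = coordinatewise
        (coordinatewise (solve F [] (left (# 0) (# 0)) refl) (solve F [] (left (# 0) (# 1)) refl) (solve F [] (left (# 0) (# 2)) refl) (solve F [] (left (# 0) (# 3)) refl))
        (coordinatewise (solve F [] (left (# 1) (# 0)) refl) (solve F [] (left (# 1) (# 1)) refl) (solve F [] (left (# 1) (# 2)) refl) (solve F [] (left (# 1) (# 3)) refl))
        (coordinatewise (solve F [] (left (# 2) (# 0)) refl) (solve F [] (left (# 2) (# 1)) refl) (solve F [] (left (# 2) (# 2)) refl) (solve F [] (left (# 2) (# 3)) refl))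
        (coordinatewise (solve F [] (left (# 3) (# 0)) refl) (solve F [] (left (# 3) (# 1)) refl) (solve F [] (left (# 3) (# 2)) refl) (solve F [] (left (# 3) (# 3)) refl))
    }

  quadric≡ : ∀ (x : Vector₄) → let y = x ⊙ permute in y (# 0) * y (# 1) + y (# 2) * y (# 3) ≡ quadric x
  quadric≡ x = solve F (x (# 0) ∷ x (# 1) ∷ x (# 2) ∷ x (# 3) ∷ []) (λ x₀ x₁ x₂ x₃ →
    (x₀ :* :1 :+ (x₁ :* :0 :+ (x₂ :* :0 :+ (x₃ :* :0 :+ :0)))) :* (x₀ :* :0 :+ (x₁ :* :0 :+ (x₂ :* :0 :+ (x₃ :* :1 :+ :0))))
    :+ (x₀ :* :0 :+ (x₁ :* :1 :+ (x₂ :* :0 :+ (x₃ :* :0 :+ :0)))) :* (x₀ :* :0 :+ (x₁ :* :0 :+ (x₂ :* :1 :+ (x₃ :* :0 :+ :0))))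
    := x₀ :* x₃ :+ x₁ :* x₂ given []) refl

  onQuadric⇒ᵥ : ∀ {ℓ} → (∀ X → X ∈ₗ ℓ → OnQuadric permutation X) → OnQuadricᵥ ℓ
  onQuadric⇒ᵥ {ℓ} on x x∈ = go (Fin.all? (λ i → x i ≟ 0#))
    where
    go : _ → quadric x ≡ 0#
    go (yes x≡0) = solve F (x (# 0) ∷ x (# 1) ∷ x (# 2) ∷ x (# 3) ∷ []) (λ x₀ x₁ x₂ x₃ → x₀ :* x₃ :+ x₁ :* x₂ := :0
      given x₃ ∶ x₀ := :0 and x₂ ∶ x₁ := :0 and []) refl (x≡0 (# 0)) (x≡0 (# 1))
    go (no x≢0) = trans (sym (quadric≡ x)) (on ⟨ x , x≢0 ⟩ (∈ᵥ⇒∈ₗ x∈))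

  complementaryReguli : ∀ {R : Pred Line 0ℓ} → ZeroPlanar.Based ≐ R → ComplementaryReguli Tangent R
  complementaryReguli {R} (planar⊆R , R⊆planar) =
    (permutation , λ ℓ → mk⇔ (split {ℓ}) (on {ℓ})) , tangents-skew , R-skew
    where
    split : ∀ {ℓ} → (∀ X → X ∈ₗ ℓ → OnQuadric permutation X) → Tangent ℓ ⊎ R ℓ
    split {ℓ} h = go (onQuadric⇒ruling {ℓ} (onQuadric⇒ᵥ {ℓ} h))
      where
      go : ∃ (Ruling₁ ℓ) ⊎ ∃ (Ruling₂ ℓ) → Tangent ℓ ⊎ R ℓ
      go (inj₁ r) = inj₁ (ruling₁⇒tangent r)
      go (inj₂ r) = inj₂ (planar⊆R (ruling₂⇒planar r))
    on : ∀ {ℓ} → Tangent ℓ ⊎ R ℓ → ∀ X → X ∈ₗ ℓ → OnQuadric permutation X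
    on {ℓ} (inj₁ t) X X∈ = trans (quadric≡ (coord X)) (ruling₁⇒onQuadric {ℓ} (tangent⇒ruling₁ {ℓ} t) (coord X) (∈ₗ⇒∈ᵥ X∈))
    on {ℓ} (inj₂ r) X X∈ = trans (quadric≡ (coord X)) (ruling₂⇒onQuadric {ℓ} (planar⇒ruling₂ {ℓ} (R⊆planar r)) (coord X) (∈ₗ⇒∈ᵥ X∈))
    tangents-skew : PairwiseSkew Tangent
    tangents-skew ℓ m tℓ tm ℓ≉m (X , X∈ℓ , X∈m) = go (tangent⇒ruling₁ {ℓ} tℓ) (tangent⇒ruling₁ {m} tm)
      where
      go : ∃ (Ruling₁ ℓ) → ∃ (Ruling₁ m) → Empty.⊥
      go (σ , rℓ) (τ , rm) = ℓ≉m (≅⇒≈ (ruling₁-≅ τ (subst (Ruling₁ ℓ) (ruling₁-skew rℓ rm X (∈ₗ⇒∈ᵥ X∈ℓ) (∈ₗ⇒∈ᵥ X∈m)) rℓ) rm))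
    R-skew : PairwiseSkew R
    R-skew ℓ m Rℓ Rm ℓ≉m (X , X∈ℓ , X∈m) = go (planar⇒ruling₂ {ℓ} (R⊆planar Rℓ)) (planar⇒ruling₂ {m} (R⊆planar Rm))
      where
      go : ∃ (Ruling₂ ℓ) → ∃ (Ruling₂ m) → Empty.⊥
      go (σ , rℓ) (τ , rm) = ℓ≉m (≅⇒≈ (ruling₂-≅ τ (subst (Ruling₂ ℓ) (ruling₂-skew rℓ rm X (∈ₗ⇒∈ᵥ X∈ℓ) (∈ₗ⇒∈ᵥ X∈m)) rℓ) rm))

-- Closed forms of the orbit sizes

private
  -- Truncated subtraction and division are both eliminated by one additive identity, which the
  -- semiring solver can check.
  half-difference : ∀ a b c → c ≡ a ℕ.* 2 ℕ.+ b → a ≡ (c ℕ.∸ b) / 2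
  half-difference a b _ refl = sym (trans (cong (_/ 2) (ℕ.m+n∸n≡m (a ℕ.* 2) b)) (m*n/n≡m a 2))

size-[q+1] : ∀ q → suc q ℕ.* 1 ≡ q ℕ.+ 1
size-[q+1] = solve-∀

size-[q²-1] : ∀ {q n} → q ≡ suc n → suc q ℕ.* n ≡ q ℕ.^ 2 ℕ.∸ 1
size-[q²-1] {n = n} refl = sym (trans (cong (ℕ._∸ 1) (lemma n)) (ℕ.m+n∸n≡m (suc (suc n) ℕ.* n) 1))
  where
  lemma : ∀ n → suc n ℕ.* (suc n ℕ.* 1) ≡ suc (suc n) ℕ.* n ℕ.+ 1
  lemma = solve-∀

size-[q³-q] : ∀ {q n} → q ≡ suc n → suc q ℕ.* (q ℕ.* n) ≡ q ℕ.^ 3 ℕ.∸ q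
size-[q³-q] {n = n} refl = sym (trans (cong (ℕ._∸ suc n) (lemma n)) (ℕ.m+n∸n≡m (suc (suc n) ℕ.* (suc n ℕ.* n)) (suc n)))
  where
  lemma : ∀ n → suc n ℕ.* (suc n ℕ.* (suc n ℕ.* 1)) ≡ suc (suc n) ℕ.* (suc n ℕ.* n) ℕ.+ suc n
  lemma = solve-∀

size-[q²-1]/2 : ∀ {q h} → q ≡ suc (h ℕ.+ h) → suc q ℕ.* h ≡ (q ℕ.^ 2 ℕ.∸ 1) / 2
size-[q²-1]/2 {h = h} refl = half-difference _ 1 _ (lemma h)
  where
  lemma : ∀ h → suc (h ℕ.+ h) ℕ.* (suc (h ℕ.+ h) ℕ.* 1) ≡ suc (suc (h ℕ.+ h)) ℕ.* h ℕ.* 2 ℕ.+ 1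
  lemma = solve-∀

size-[q³-q]/2 : ∀ {q h} → q ≡ suc (h ℕ.+ h) → suc q ℕ.* (q ℕ.* h) ≡ (q ℕ.^ 3 ℕ.∸ q) / 2
size-[q³-q]/2 {h = h} refl = half-difference _ (suc (h ℕ.+ h)) _ (lemma h)
  where
  lemma : ∀ h → suc (h ℕ.+ h) ℕ.* (suc (h ℕ.+ h) ℕ.* (suc (h ℕ.+ h) ℕ.* 1)) ≡
    suc (suc (h ℕ.+ h)) ℕ.* (suc (h ℕ.+ h) ℕ.* h) ℕ.* 2 ℕ.+ suc (h ℕ.+ h)
  lemma = solve-∀

-- Integer divisibility is divisibility of absolute values, here of q + 0.
q≡0[3] : ∀ {q ξ} → ξ ≡ 0ℤ → ℤ.+ 3 ℤ.∣ (ℤ.+ q ℤ.- ξ) → 3 ∣ q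
q≡0[3] {q} refl = subst (3 ∣_) (ℕ.+-identityʳ q)

-- If 3 also divided q it would divide the difference 1. For ξ = 1 the bound on q excludes q = 0, so
-- that q - 1 is a natural number.
q≢0[3] : ∀ {q ξ} → ξ ≡ -1ℤ ⊎ ξ ≡ 0ℤ ⊎ ξ ≡ 1ℤ → ξ ≢ 0ℤ → ℤ.+ 3 ℤ.∣ (ℤ.+ q ℤ.- ξ) → 5 ℕ.≤ q → 3 ∤ q
q≢0[3] {q} (inj₁ refl) ξ≢0 3∣q+1 5≤q 3∣q with ∣1⇒≡1 (∣m+n∣m⇒∣n 3∣q+1 3∣q)
... | ()
q≢0[3] (inj₂ (inj₁ refl)) ξ≢0 = ⊥-elim (ξ≢0 refl)
q≢0[3] {suc n} (inj₂ (inj₂ refl)) ξ≢0 3∣n 5≤q 3∣1+n with ∣1⇒≡1 (∣m+n∣m⇒∣n (subst (3 ∣_) (ℕ.+-comm 1 n) 3∣1+n) 3∣n)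
... | ()

-- Assembling the orbits

module OrbitTheorems {q} (q-prime-power : IsPrimePower q) (5≤q : 5 ℕ.≤ q)
  (F : FiniteField q) (K : FiniteField (q ℕ.^ 2)) (E : Extension F K) where
  open FiniteField F
  open Arithmetic F
  open ProjectiveSpace F
  open TwistedCubic F
  open LineTypes F K E
  open Linear F
  open Projective F
  open Projectivity
  open Action 5≤q F
  open Families 5≤q F
  open StandardPosition 5≤q F
  open ShapeInstances 5≤q F
  open Classification 5≤q F K E
  open AxisClassification 5≤q F K E

  2∣q⇒2≡0 : 2 ∣ q → 2 · 1# ≡ 0#
  2∣q⇒2≡0 = prime-divisor⇒·1≡0 q-prime-power prime[2]

  3∣q⇒3≡0 : 3 ∣ q → 3 · 1# ≡ 0#
  3∣q⇒3≡0 = prime-divisor⇒·1≡0 q-prime-power (from-yes (prime? 3))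

  2≡0⇒3≢0 : 2 · 1# ≡ 0# → 3 · 1# ≢ 0#
  2≡0⇒3≢0 2≡0 3≡0 = 1≢0 (solve F [] (:1 := :0 given :1 ∶ 3 :· :1 := :0 and :- :1 ∶ 2 :· :1 := :0 and []) refl 3≡0 2≡0)

  nonSquare⇒≢0 : ∀ {ρ} → NonSquare ρ → ρ ≢ 0#
  nonSquare⇒≢0 ρ-nonsquare ρ≡0 = ρ-nonsquare (0# , trans ρ≡0 (sym (zeroˡ 0#)))

  union≐ : ∀ {R A B C D : Pred Line 0ℓ} → R ≐ (A ∪ B) → A ≐ C → B ≐ D → R ≐ (C ∪ D)
  union≐ (R⊆ , ⊆R) (A⊆C , C⊆A) (B⊆D , D⊆B) =
    (λ r → Sum.map (λ a → A⊆C a) (λ b → B⊆D b) (R⊆ r)) , λ h → ⊆R (Sum.map (λ c → C⊆A c) (λ d → D⊆B d) h)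

  realChord-isOrbit : IsOrbit RealChord
  realChord-isOrbit = Secant.≐Based⇒IsOrbit 0# (secant-transitive 0#) (0# , 1# , 1≢0) {RealChord} realChord≐

  tangent-isOrbit : IsOrbit Tangent
  tangent-isOrbit = TangentLine.≐Based⇒IsOrbit tangent-transitive tt {Tangent} tangent≐

  UΓ-isOrbit : 2 · 1# ≢ 0# → IsOrbit UΓ
  UΓ-isOrbit 2≢0 = AllPlanar.≐Based⇒IsOrbit (allPlanar-transitive 2≢0) (0# , tt) {UΓ} UΓ≐

  realAxis-isOrbit : 3 · 1# ≢ 0# → IsOrbit RealAxis
  realAxis-isOrbit 3≢0 = Axial.≐Based⇒IsOrbit 0# (axial-transitive 0#) (0# , 1# , 1≢0) {RealAxis} (realAxis≐ 3≢0)

  secant-based : ∀ {ρ δ τ ℓ} x y → y ≢ 0# → ρ * (y * y) ≡ δ → e₃ ∈ᵥ ℓ ▶ move τ → ⟪ 1# , x , x * x + δ , 0# ⟫ ∈ᵥ ℓ ▶ move τ → Secant.Based ρ ℓ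
  secant-based {τ = τ} x y y≢0 refl e₃∈ w∈ = τ , (x , y , y≢0) , Secant.basis e₃∈ w∈

  axial-based : ∀ {ρ δ τ ℓ} x y → y ≢ 0# → ρ * (y * y) ≡ δ → ⟪ 0# , 1# , 0# , - (3 · (x * x + δ)) ⟫ ∈ᵥ ℓ ▶ move τ → ⟪ 0# , 0# , 1# , 3 · x ⟫ ∈ᵥ ℓ ▶ move τ → Axial.Based ρ ℓ
  axial-based {τ = τ} x y y≢0 refl v∈ w∈ = τ , (x , y , y≢0) , Axial.basis v∈ w∈

  ℓ-UnΓ-based : ∀ ρ → Secant.Based ρ (ℓ-UnΓ ρ)
  ℓ-UnΓ-based ρ = Secant.based ρ {ℓ-UnΓ ρ} {0# , 1# , 1≢0} (Secant.basis (pt₁∈ (ℓ-UnΓ ρ)) (≗∈ (pt₂∈ (ℓ-UnΓ ρ))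
    (coordinatewise refl refl (solve F (ρ ∷ []) (λ ρ → :0 :* :0 :+ ρ :* (:1 :* :1) := ρ given []) refl) refl)))

  secant≐orbit : ∀ ρ → Secant.Based ρ ≐ Orbit (ℓ-UnΓ ρ)
  secant≐orbit ρ = Secant.Based⇒Orbit ρ (secant-transitive ρ) {ℓ-UnΓ ρ} (ℓ-UnΓ-based ρ)

  -- Equality would make ρ the square of y/z; this separates the orbits that differ by a square
  -- class.
  ratio-square : ∀ {ρ y z} → NonSquare ρ → z ≢ 0# → 1# * (y * y) ≢ ρ * (z * z)
  ratio-square {ρ} {y} {z} ρ-nonsquare z≢0 e = ρ-nonsquare (y * w , solve F (ρ ∷ y ∷ z ∷ w ∷ []) (λ ρ y z w → ρ := y :* w :* (y :* w)
    given :- (w :* w) ∶ :1 :* (y :* y) := ρ :* (z :* z) and :- (ρ :* (z :* w :+ :1)) ∶ z :* w := :1 and []) refl e (proj₂ (inverse z z≢0)))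
    where w = proj₁ (inverse z z≢0)

  axialLine : Carrier → Line
  axialLine ρ = Axial.lineOf ρ (0# , 1# , 1≢0)

  axial≐orbit : ∀ ρ → Axial.Based ρ ≐ Orbit (axialLine ρ)
  axial≐orbit ρ = Axial.Based⇒Orbit ρ (axial-transitive ρ) {axialLine ρ} (Axial.based ρ (Axial.lineOf-basis ρ (0# , 1# , 1≢0)))

  axialLine-isMeet : ∀ ρ → IsMeet (axialLine ρ) π₀ (π-EΓ ρ)
  axialLine-isMeet ρ = echelon-isMeet {axialLine ρ} {π₀} {π-EΓ ρ} {# 1} {# 2} {v} {w} (echelon refl refl refl refl) (pt₁∈ (axialLine ρ)) (pt₂∈ (axialLine ρ))
    (solve F (ρ ∷ []) (λ ρ → :1 :* :0 :+ (:0 :* :1 :+ (:0 :* :0 :+ (:0 :* :- (3 :· (:0 :* :0 :+ ρ :* (:1 :* :1))) :+ :0))) := :0 given []) refl)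
    (solve F (ρ ∷ []) (λ ρ → :1 :* :0 :+ (:0 :* :0 :+ (:0 :* :1 :+ (:0 :* (3 :· :0) :+ :0))) := :0 given []) refl)
    (solve F (ρ ∷ []) (λ ρ → :0 :* :0 :+ (:- (3 :· ρ) :* :1 :+ (:0 :* :0 :+ (:- :1 :* :- (3 :· (:0 :* :0 :+ ρ :* (:1 :* :1))) :+ :0))) := :0 given []) refl)
    (solve F (ρ ∷ []) (λ ρ → :0 :* :0 :+ (:- (3 :· ρ) :* :0 :+ (:0 :* :1 :+ (:- :1 :* (3 :· :0) :+ :0))) := :0 given []) refl)
    λ x h h′ → x (# 1) , x (# 2) , coordinatewise
      (solve F (x (# 0) ∷ x (# 1) ∷ x (# 2) ∷ x (# 3) ∷ []) (λ x₀ x₁ x₂ x₃ → x₀ := x₁ :* :0 :+ x₂ :* :0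
        given :1 ∶ :1 :* x₀ :+ (:0 :* x₁ :+ (:0 :* x₂ :+ (:0 :* x₃ :+ :0))) := :0 and []) refl h)
      (solve F (x (# 1) ∷ x (# 2) ∷ []) (λ x₁ x₂ → x₁ := x₁ :* :1 :+ x₂ :* :0 given []) refl)
      (solve F (x (# 1) ∷ x (# 2) ∷ []) (λ x₁ x₂ → x₂ := x₁ :* :0 :+ x₂ :* :1 given []) refl)
      (solve F (ρ ∷ x (# 0) ∷ x (# 1) ∷ x (# 2) ∷ x (# 3) ∷ []) (λ ρ x₀ x₁ x₂ x₃ → x₃ := x₁ :* :- (3 :· (:0 :* :0 :+ ρ :* (:1 :* :1))) :+ x₂ :* (3 :· :0)
        given :- :1 ∶ :0 :* x₀ :+ (:- (3 :· ρ) :* x₁ :+ (:0 :* x₂ :+ (:- :1 :* x₃ :+ :0))) := :0 and []) refl h′)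
    where
    v = ⟪ 0# , 1# , 0# , - (3 · (0# * 0# + ρ * (1# * 1#))) ⟫
    w = ⟪ 0# , 0# , 1# , 3 · 0# ⟫

  -- Parameters can be compared only at a common base. It is common because the line lies in a
  -- single osculating plane, whatever the square class.
  axial-sameBase : 3 · 1# ≢ 0# → ∀ {ρ ρ′ ℓ σ τ} → ρ ≢ 0# → ρ′ ≢ 0# → Axial.Member ρ (ℓ ▶ move σ) → Axial.Member ρ′ (ℓ ▶ move τ) → σ ≡ τ
  axial-sameBase 3≢0 {ℓ = ℓ} {σ} {τ} ρ≢0 ρ′≢0 (_ , Axial.basis v∈ w∈) ((x , y , y≢0) , Axial.basis v∈′ w∈′) = go (move-osc τ σ)
    where
    go : (∃ λ χ → OscMaps (move τ) σ χ) → σ ≡ τ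
    go (χ , h) = maps-injective (subst (Maps (move τ) σ) χ≡O (OscMaps.maps-point h)) (maps-move τ)
      where
      χ≡O : χ ≡ O
      χ≡O = axial-onlyO 3≢0 {ℓ ▶ move τ} v∈′ w∈′ (ρy²≢0 ρ′≢0 y≢0) χ
        (OscMaps.onto h {ℓ} (OscMaps.back (move-osc-O σ) {ℓ} (axial-⊑oscO {ℓ ▶ move σ} v∈ w∈)))

  secant-separate : ∀ {ρ ρ′ ℓ τ} → ρ ≢ 0# → Secant.Based ρ ℓ → Secant.Member ρ′ (ℓ ▶ move τ) → Secant.Member ρ (ℓ ▶ move τ)
  secant-separate {ρ} {ρ′} {ℓ} {τ} ρ≢0 (σ , h@((x , y , y≢0) , Secant.basis e₃∈ w∈)) (_ , Secant.basis e₃∈′ _) =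
    subst (λ κ → Secant.Member ρ (ℓ ▶ move κ)) (sym (onlyO⇒≡ σ {ℓ} {τ} (secant-onlyO e₃∈ w∈ (ρy²≢0 ρ≢0 y≢0))
      (P∈-preimage (maps-move τ) (e₃∈⇒PO∈ e₃∈′)))) h

  secants-disjoint : ∀ {ρ ℓ} → NonSquare ρ → Secant.Based 1# ℓ → Secant.Based ρ ℓ → Empty.⊥
  secants-disjoint {ρ} {ℓ} ρ-nonsquare b₁ (τ , h@((x′ , y′ , y′≢0) , Secant.basis e₃∈′ w∈′)) = compare (secant-separate {τ = τ} 1≢0 b₁ h)
    where
    compare : Secant.Member 1# (ℓ ▶ move τ) → Empty.⊥
    compare ((x , y , y≢0) , Secant.basis e₃∈ w∈) = ratio-square ρ-nonsquare y′≢0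
      (solve F (x ∷ y ∷ x′ ∷ y′ ∷ ρ ∷ []) (λ x y x′ y′ ρ → :1 :* (y :* y) := ρ :* (y′ :* y′)
        given :- :1 ∶ x′ :* x′ :+ ρ :* (y′ :* y′) := :0 :* :0 :+ :1 :* (x :* x :+ :1 :* (y :* y)) and x′ :+ x ∶ x′ := :0 :* :0 :+ :1 :* x and [])
        refl (coordinates (# 2)) (coordinates (# 1)))
      where coordinates = echelon-coordinates {# 3} {# 0} (echelon refl refl refl refl) e₃∈ w∈ w∈′

  axials-disjoint : 3 · 1# ≢ 0# → ∀ {ρ ℓ} → NonSquare ρ → Axial.Based 1# ℓ → Axial.Based ρ ℓ → Empty.⊥
  axials-disjoint 3≢0 {ρ} {ℓ} ρ-nonsquare (σ , h) (τ , h′) = compare (subst (λ κ → Axial.Member 1# (ℓ ▶ move κ))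
      (axial-sameBase 3≢0 {ℓ = ℓ} {σ} {τ} 1≢0 (nonSquare⇒≢0 ρ-nonsquare) h h′) h) h′
    where
    compare : Axial.Member 1# (ℓ ▶ move τ) → Axial.Member ρ (ℓ ▶ move τ) → Empty.⊥
    compare ((x , y , y≢0) , Axial.basis v∈ w∈) ((x′ , y′ , y′≢0) , Axial.basis v∈′ w∈′) = ratio-square ρ-nonsquare y′≢0 (*-cancelˡ 3≢0
      (solve F (x ∷ y ∷ x′ ∷ y′ ∷ ρ ∷ []) (λ x y x′ y′ ρ → (3 :· :1) :* (:1 :* (y :* y)) := (3 :· :1) :* (ρ :* (y′ :* y′))
        given :1 ∶ :- (3 :· (x′ :* x′ :+ ρ :* (y′ :* y′))) := :1 :* :- (3 :· (x :* x :+ :1 :* (y :* y))) :+ :0 :* (3 :· x)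
        and x′ :+ x ∶ 3 :· x′ := :0 :* :- (3 :· (x :* x :+ :1 :* (y :* y))) :+ :1 :* (3 :· x) and [])
        refl (echelon-coordinates {# 1} {# 2} (echelon refl refl refl refl) v∈ w∈ v∈′ (# 3))
        (echelon-coordinates {# 1} {# 2} (echelon refl refl refl refl) v∈ w∈ w∈′ (# 3))))

  module EvenOrder (2≡0 : 2 · 1# ≡ 0#) where
    open CharacteristicTwo 2≡0
    open Reguli 5≤q F K E 2≡0 using (complementaryReguli)

    root-nonzero : ∀ {y δ} → y * y ≡ δ → δ ≢ 0# → y ≢ 0#
    root-nonzero y²≡δ δ≢0 refl = δ≢0 (trans (sym y²≡δ) (zeroˡ 0#))

    UnΓ-isOrbit : IsOrbit UnΓ
    UnΓ-isOrbit = Secant.≐Based⇒IsOrbit 1# (secant-transitive 1#) (0# , 1# , 1≢0) {UnΓ}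
      ((λ {ℓ} h → there {ℓ} (UnΓ⇒secant {ℓ} h)) , λ {ℓ} → secant⇒UnΓ 1≢0 {ℓ})
      where
      there : ∀ {ℓ} → (∃ λ τ → ∃₂ λ x δ → δ ≢ 0# × e₃ ∈ᵥ ℓ ▶ move τ × ⟪ 1# , x , x * x + δ , 0# ⟫ ∈ᵥ ℓ ▶ move τ) → Secant.Based 1# ℓ
      there {ℓ} (τ , x , δ , δ≢0 , e₃∈ , w∈) = let (y , y²≡δ) = char2⇒square 2≡0 δ in
        secant-based {τ = τ} {ℓ} x y (root-nonzero y²≡δ δ≢0) (trans (*-identityˡ _) y²≡δ) e₃∈ w∈

    EΓ-isOrbit : IsOrbit EΓ
    EΓ-isOrbit = Axial.≐Based⇒IsOrbit 1# (axial-transitive 1#) (0# , 1# , 1≢0) {EΓ}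
      ((λ {ℓ} h → there {ℓ} (EΓ⇒axial 3≢0 {ℓ} h)) , λ {ℓ} → axial⇒EΓ 3≢0 1≢0 {ℓ})
      where
      3≢0 = 2≡0⇒3≢0 2≡0
      there : ∀ {ℓ} → (∃ λ τ → ∃₂ λ x δ → δ ≢ 0# × ⟪ 0# , 1# , 0# , - (3 · (x * x + δ)) ⟫ ∈ᵥ ℓ ▶ move τ × ⟪ 0# , 0# , 1# , 3 · x ⟫ ∈ᵥ ℓ ▶ move τ) → Axial.Based 1# ℓ
      there {ℓ} (τ , x , δ , δ≢0 , v∈ , w∈) = let (y , y²≡δ) = char2⇒square 2≡0 δ in
        axial-based {τ = τ} {ℓ} x y (root-nonzero y²≡δ δ≢0) (trans (*-identityˡ _) y²≡δ) v∈ w∈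

    zero≐ : ZeroPlanar.Based ≐ Orbit ℓ-UΓ₁
    zero≐ = ZeroPlanar.Based⇒Orbit zeroPlanar-transitive {ℓ-UΓ₁} (ZeroPlanar.based {ℓ-UΓ₁} {0# , refl}
      (ZeroPlanar.basis (pt₁∈ ℓ-UΓ₁) (pt₂∈ ℓ-UΓ₁)))

    nonzero≐ : NonzeroPlanar.Based ≐ Orbit ℓ-UΓ₂
    nonzero≐ = NonzeroPlanar.Based⇒Orbit nonzeroPlanar-transitive {ℓ-UΓ₂} (NonzeroPlanar.based {ℓ-UΓ₂} {1# , 1≢0}
      (NonzeroPlanar.basis (pt₁∈ ℓ-UΓ₂) (pt₂∈ ℓ-UΓ₂)))

    UΓ-split : UΓ ≐ (ZeroPlanar.Based ∪ NonzeroPlanar.Based)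
    UΓ-split = (λ {ℓ} h → there {ℓ} (proj₁ UΓ≐ {ℓ} h)) , (λ {ℓ} h → proj₂ UΓ≐ {ℓ} (back {ℓ} h))
      where
      there : ∀ {ℓ} → AllPlanar.Based ℓ → ZeroPlanar.Based ℓ ⊎ NonzeroPlanar.Based ℓ
      there {ℓ} (τ , (x , _) , AllPlanar.basis v∈ w∈) = go (x ≟ 0#)
        where
        go : Dec (x ≡ 0#) → ZeroPlanar.Based ℓ ⊎ NonzeroPlanar.Based ℓ
        go (yes x≡0) = inj₁ (τ , (x , x≡0) , ZeroPlanar.basis v∈ w∈)
        go (no  x≢0) = inj₂ (τ , (x , x≢0) , NonzeroPlanar.basis v∈ w∈)
      back : ∀ {ℓ} → ZeroPlanar.Based ℓ ⊎ NonzeroPlanar.Based ℓ → AllPlanar.Based ℓ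
      back (inj₁ (τ , (x , _) , ZeroPlanar.basis v∈ w∈)) = τ , (x , tt) , AllPlanar.basis v∈ w∈
      back (inj₂ (τ , (x , _) , NonzeroPlanar.basis v∈ w∈)) = τ , (x , tt) , AllPlanar.basis v∈ w∈

    planars-disjoint : ∀ {ℓ} → ZeroPlanar.Based ℓ → NonzeroPlanar.Based ℓ → Empty.⊥
    planars-disjoint {ℓ} (σ , (_ , refl) , ZeroPlanar.basis v∈ w∈) (τ , h@((x , x≢0) , NonzeroPlanar.basis v∈′ w∈′)) =
      compare (subst (λ κ → NonzeroPlanar.Member (ℓ ▶ move κ)) (onlyO⇒≡ σ {ℓ} {τ} (planar-onlyO v∈ w∈) (P∈-preimage (maps-move τ) (e₃∈⇒PO∈ v∈′))) h)
      where
      compare : NonzeroPlanar.Member (ℓ ▶ move σ) → Empty.⊥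
      compare ((x , x≢0) , NonzeroPlanar.basis _ w∈′) = x≢0 (trans (echelon-coordinates {# 3} {# 1} (echelon refl refl refl refl) v∈ w∈ w∈′ (# 2))
        (solve F [] (:0 :* :0 :+ :1 :* :0 := :0 given []) refl))

    UΓ-orbits :
      UΓ ≐ (Orbit ℓ-UΓ₁ ∪ Orbit ℓ-UΓ₂)
      × Orbit ℓ-UΓ₁ ⊥ Orbit ℓ-UΓ₂
      × HasSize (Orbit ℓ-UΓ₁) (q ℕ.+ 1)
      × HasSize (Orbit ℓ-UΓ₂) (q ℕ.^ 2 ℕ.∸ 1)
      × ComplementaryReguli Tangent (Orbit ℓ-UΓ₁)
    UΓ-orbits = union≐ {UΓ} {ZeroPlanar.Based} {NonzeroPlanar.Based} {Orbit ℓ-UΓ₁} {Orbit ℓ-UΓ₂} UΓ-split zero≐ nonzero≐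
      , (λ { {ℓ} (o₁ , o₂) → planars-disjoint (proj₂ zero≐ {ℓ} o₁) (proj₂ nonzero≐ {ℓ} o₂) })
      , ZeroPlanar.orbit-size zeroPlanar-baseUnique {ℓ-UΓ₁} zero≐ zeroPlanar-listing (size-[q+1] q)
      , NonzeroPlanar.orbit-size nonzeroPlanar-baseUnique {ℓ-UΓ₂} nonzero≐ nonzeroPlanar-listing (size-[q²-1] q≡1+nonzero)
      , complementaryReguli zero≐

  module OddOrder (2≢0 : 2 · 1# ≢ 0#) where
    open OddCharacteristic 2≢0
    open OddListings 2≢0

    UnΓ-split : ∀ {ρ} → NonSquare ρ → UnΓ ≐ (Secant.Based 1# ∪ Secant.Based ρ)
    UnΓ-split {ρ} ρ-nonsquare = (λ {ℓ} h → there {ℓ} (UnΓ⇒secant {ℓ} h)) , λ { {ℓ} (inj₁ b) → secant⇒UnΓ 1≢0 {ℓ} b ; {ℓ} (inj₂ b) → secant⇒UnΓ (nonSquare⇒≢0 ρ-nonsquare) {ℓ} b }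
      where
      there : ∀ {ℓ} → (∃ λ τ → ∃₂ λ x δ → δ ≢ 0# × e₃ ∈ᵥ ℓ ▶ move τ × ⟪ 1# , x , x * x + δ , 0# ⟫ ∈ᵥ ℓ ▶ move τ) → Secant.Based 1# ℓ ⊎ Secant.Based ρ ℓ
      there {ℓ} (τ , x , δ , δ≢0 , e₃∈ , w∈) = go (square-classes ρ-nonsquare δ≢0)
        where
        go : _ → Secant.Based 1# ℓ ⊎ Secant.Based ρ ℓ
        go (inj₁ (y , y≢0 , e)) = inj₁ (secant-based {τ = τ} {ℓ} x y y≢0 e e₃∈ w∈)
        go (inj₂ (y , y≢0 , e)) = inj₂ (secant-based {τ = τ} {ℓ} x y y≢0 e e₃∈ w∈)

    EΓ-split : 3 · 1# ≢ 0# → ∀ {ρ} → NonSquare ρ → EΓ ≐ (Axial.Based 1# ∪ Axial.Based ρ)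
    EΓ-split 3≢0 {ρ} ρ-nonsquare = (λ {ℓ} h → there {ℓ} (EΓ⇒axial 3≢0 {ℓ} h)) , λ { {ℓ} (inj₁ b) → axial⇒EΓ 3≢0 1≢0 {ℓ} b ; {ℓ} (inj₂ b) → axial⇒EΓ 3≢0 (nonSquare⇒≢0 ρ-nonsquare) {ℓ} b }
      where
      there : ∀ {ℓ} → (∃ λ τ → ∃₂ λ x δ → δ ≢ 0# × ⟪ 0# , 1# , 0# , - (3 · (x * x + δ)) ⟫ ∈ᵥ ℓ ▶ move τ × ⟪ 0# , 0# , 1# , 3 · x ⟫ ∈ᵥ ℓ ▶ move τ) → Axial.Based 1# ℓ ⊎ Axial.Based ρ ℓ
      there {ℓ} (τ , x , δ , δ≢0 , v∈ , w∈) = go (square-classes ρ-nonsquare δ≢0)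
        where
        go : _ → Axial.Based 1# ℓ ⊎ Axial.Based ρ ℓ
        go (inj₁ (y , y≢0 , e)) = inj₁ (axial-based {τ = τ} {ℓ} x y y≢0 e v∈ w∈)
        go (inj₂ (y , y≢0 , e)) = inj₂ (axial-based {τ = τ} {ℓ} x y y≢0 e v∈ w∈)

    UnΓ-orbits : ∀ ρ → NonSquare ρ →
      UnΓ ≐ (Orbit (ℓ-UnΓ 1#) ∪ Orbit (ℓ-UnΓ ρ))
      × Orbit (ℓ-UnΓ 1#) ⊥ Orbit (ℓ-UnΓ ρ)
      × HasSize (Orbit (ℓ-UnΓ 1#)) ((q ℕ.^ 3 ℕ.∸ q) / 2)
      × HasSize (Orbit (ℓ-UnΓ ρ)) ((q ℕ.^ 3 ℕ.∸ q) / 2)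
    UnΓ-orbits ρ ρ-nonsquare = union≐ {UnΓ} {Secant.Based 1#} {Secant.Based ρ} {Orbit (ℓ-UnΓ 1#)} {Orbit (ℓ-UnΓ ρ)} (UnΓ-split ρ-nonsquare) (secant≐orbit 1#) (secant≐orbit ρ)
      , (λ { {ℓ} (o₁ , o₂) → secants-disjoint {ρ} {ℓ} ρ-nonsquare (proj₂ (secant≐orbit 1#) {ℓ} o₁) (proj₂ (secant≐orbit ρ) {ℓ} o₂) })
      , size 1# 1≢0 , size ρ (nonSquare⇒≢0 ρ-nonsquare)
      where
      size : ∀ ρ → ρ ≢ 0# → HasSize (Orbit (ℓ-UnΓ ρ)) ((q ℕ.^ 3 ℕ.∸ q) / 2)
      size ρ ρ≢0 = Secant.orbit-size ρ (secant-baseUnique ρ≢0) {ℓ-UnΓ ρ} (secant≐orbit ρ) (secant-listing ρ≢0) (size-[q³-q]/2 {h = half} q≡1+2half)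

    EΓ-orbits : 3 · 1# ≢ 0# → ∀ ρ → NonSquare ρ → ∃₂ λ ℓ₁ ℓ₂ →
      IsMeet ℓ₁ π₀ (π-EΓ 1#) × IsMeet ℓ₂ π₀ (π-EΓ ρ)
      × EΓ ≐ (Orbit ℓ₁ ∪ Orbit ℓ₂)
      × Orbit ℓ₁ ⊥ Orbit ℓ₂
      × HasSize (Orbit ℓ₁) ((q ℕ.^ 3 ℕ.∸ q) / 2)
      × HasSize (Orbit ℓ₂) ((q ℕ.^ 3 ℕ.∸ q) / 2)
    EΓ-orbits 3≢0 ρ ρ-nonsquare = axialLine 1# , axialLine ρ , axialLine-isMeet 1# , axialLine-isMeet ρ
      , union≐ {EΓ} {Axial.Based 1#} {Axial.Based ρ} {Orbit (axialLine 1#)} {Orbit (axialLine ρ)} (EΓ-split 3≢0 ρ-nonsquare) (axial≐orbit 1#) (axial≐orbit ρ)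
      , (λ { {ℓ} (o₁ , o₂) → axials-disjoint 3≢0 {ρ} {ℓ} ρ-nonsquare (proj₂ (axial≐orbit 1#) {ℓ} o₁) (proj₂ (axial≐orbit ρ) {ℓ} o₂) })
      , size 1# 1≢0 , size ρ (nonSquare⇒≢0 ρ-nonsquare)
      where
      size : ∀ ρ → ρ ≢ 0# → HasSize (Orbit (axialLine ρ)) ((q ℕ.^ 3 ℕ.∸ q) / 2)
      size ρ ρ≢0 = Axial.orbit-size ρ (axial-baseUnique 3≢0 ρ≢0) {axialLine ρ} (axial≐orbit ρ) (axial-listing 3≢0 ρ≢0) (size-[q³-q]/2 {h = half} q≡1+2half)

  module TernaryOrder (3≡0 : 3 · 1# ≡ 0#) where
    open CharacteristicThree 3≡0
    open CharacteristicThreeInstances 3≡0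
    open OddCharacteristic 2≢0
    open ThreeClassification 5≤q F K E 3≡0

    ΓAxis-isOrbit : IsOrbit ΓAxis
    ΓAxis-isOrbit = ΓLine.≐Based⇒IsOrbit ΓLine-transitive tt {ΓAxis} ΓAxis≐

    private
      :reversed : (x y : Fin 4 → _) → Fin 4 → Claim 1
      :reversed x y k = x k := :∑ (λ i → y i :* :sym³ :0 :1 :1 :0 i k) given []

      reverse-e₁ : ∀ {ℓ} → e₁ ∈ᵥ ℓ → e₂ ∈ᵥ ℓ ▶ move ∞
      reverse-e₁ e₁∈ = ≗∈ (image∈ inversion e₁∈) (coordinatewise (solve F (0# ∷ []) (λ _ → claim (# 0)) refl) (solve F (0# ∷ []) (λ _ → claim (# 1)) refl)
          (solve F (0# ∷ []) (λ _ → claim (# 2)) refl) (solve F (0# ∷ []) (λ _ → claim (# 3)) refl))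
        where claim = :reversed (:vector :0 :0 :1 :0) (:vector :0 :1 :0 :0)

    -- `ℓ-EA₁` passes through `e₁`, where the tangent at `P ∞` meets the axis, so its base parameter
    -- is ∞. The inversion turns (0, 0, 1, 1) into (1, 1, 0, 0), the normal form with x = 0 and y =
    -- 1.
    skew≐ : Skew.Based ≐ Orbit ℓ-EA₁
    skew≐ = Skew.Based⇒Orbit skew-transitive {ℓ-EA₁} (∞ , (0# , 1# , 1≢0) , Skew.basis (reverse-e₁ (pt₁∈ ℓ-EA₁))
      (≗∈ (image∈ inversion (pt₂∈ ℓ-EA₁)) (coordinatewise (solve F (0# ∷ []) (λ _ → claim (# 0)) refl) (solve F (0# ∷ []) (λ _ → claim (# 1)) refl)
          (solve F (0# ∷ []) (λ _ → claim (# 2)) refl) (solve F (0# ∷ []) (λ _ → claim (# 3)) refl))))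
      where claim = :reversed (:vector :1 (:0 :+ :1) :0 (:0 :^ 3)) (:vector :0 :0 :1 :1)

    flat≐ : ∀ ρ → Flat.Based ρ ≐ Orbit (ℓ-EA ρ)
    flat≐ ρ = Flat.Based⇒Orbit ρ (flat-transitive ρ) {ℓ-EA ρ} (∞ , (1# , 1≢0) , Flat.basis (reverse-e₁ (pt₁∈ (ℓ-EA ρ)))
      (≗∈ (image∈ inversion (pt₂∈ (ℓ-EA ρ))) (coordinatewise (solve F (ρ ∷ []) (λ ρ → claim ρ (# 0)) refl) (solve F (ρ ∷ []) (λ ρ → claim ρ (# 1)) refl)
          (solve F (ρ ∷ []) (λ ρ → claim ρ (# 2)) refl) (solve F (ρ ∷ []) (λ ρ → claim ρ (# 3)) refl))))
      where
      claim : _ → Fin 4 → Claim 1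
      claim ρ = :reversed (:vector :0 (ρ :* (:1 :* :1)) :0 :1) (:vector :1 :0 ρ :0)

    EA-split : ∀ {ρ} → NonSquare ρ → EA ≐ (Skew.Based ∪ (Flat.Based 1# ∪ Flat.Based ρ))
    EA-split {ρ} ρ-nonsquare = (λ {ℓ} h → there {ℓ} (EA⇒pencil {ℓ} h)) ,
        λ { {ℓ} (inj₁ b) → skew⇒EA {ℓ} b ; {ℓ} (inj₂ (inj₁ b)) → flat⇒EA 1≢0 {ℓ} b ; {ℓ} (inj₂ (inj₂ b)) → flat⇒EA (nonSquare⇒≢0 ρ-nonsquare) {ℓ} b }
      where
      there : ∀ {ℓ} → (∃ λ τ → e₂ ∈ᵥ ℓ ▶ move τ × AxisPencil (ℓ ▶ move τ)) → Skew.Based ℓ ⊎ (Flat.Based 1# ℓ ⊎ Flat.Based ρ ℓ)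
      there {ℓ} (τ , e₂∈ , skew x y y≢0 w∈) = inj₁ (τ , (x , y , y≢0) , Skew.basis e₂∈ w∈)
      there {ℓ} (τ , e₂∈ , flat δ δ≢0 w∈) = inj₂ (go (square-classes ρ-nonsquare δ≢0))
        where
        go : _ → Flat.Based 1# ℓ ⊎ Flat.Based ρ ℓ
        go (inj₁ (y , y≢0 , e)) = inj₁ (τ , (y , y≢0) , Flat.basis e₂∈ (≗∈ w∈ (coordinatewise refl e refl refl)))
        go (inj₂ (y , y≢0 , e)) = inj₂ (τ , (y , y≢0) , Flat.basis e₂∈ (≗∈ w∈ (coordinatewise refl e refl refl)))

    axis-sameBase : ∀ {ℓ σ τ} → e₂ ∈ᵥ ℓ ▶ move σ → (∀ {x} → x ∈ᵥ ℓ ▶ move τ → x (# 0) ≡ 0# → x (# 3) ≡ 0# → x (# 1) ≡ 0#) → σ ≡ τ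
    axis-sameBase {ℓ} {σ} {τ} e₂∈ axis = let (x₀≡0 , x₃≡0 , separate) = axisPoint-separated σ τ in
      separate (axis (image∈ (move τ) (preimage∈ (move σ) e₂∈)) x₀≡0 x₃≡0)

    skew-flat-disjoint : ∀ {ρ ℓ} → Skew.Based ℓ → Flat.Based ρ ℓ → Empty.⊥
    skew-flat-disjoint {ρ} {ℓ} (σ , (x , y , y≢0) , Skew.basis v∈ w∈) (τ , h@(_ , Flat.basis v∈′ w∈′)) =
      compare (subst (λ κ → Flat.Member ρ (ℓ ▶ move κ)) (axis-sameBase {ℓ} {τ} {σ} v∈′ (λ u∈ u₀≡0 _ → skew-axis v∈ w∈ u∈ u₀≡0)) h)
      where
      compare : Flat.Member ρ (ℓ ▶ move σ) → Empty.⊥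
      compare (_ , Flat.basis _ w∈′) = 1≢0 (trans (echelon-coordinates {# 2} {# 0} (echelon refl refl refl refl) v∈ w∈ w∈′ (# 3))
        (solve F (x ∷ []) (λ x → :0 :* :0 :+ :0 :* x :^ 3 := :0 given []) refl))

    flats-disjoint : ∀ {ρ ℓ} → NonSquare ρ → Flat.Based 1# ℓ → Flat.Based ρ ℓ → Empty.⊥
    flats-disjoint {ρ} {ℓ} ρ-nonsquare (σ , (y , _) , Flat.basis v∈ w∈) (τ , h@(_ , Flat.basis v∈′ w∈′)) =
      compare (subst (λ κ → Flat.Member ρ (ℓ ▶ move κ)) (axis-sameBase {ℓ} {τ} {σ} v∈′ (λ u∈ _ u₃≡0 → flat-axis v∈ w∈ u∈ u₃≡0)) h)
      where
      compare : Flat.Member ρ (ℓ ▶ move σ) → Empty.⊥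
      compare ((y′ , y′≢0) , Flat.basis _ w∈′) = ratio-square ρ-nonsquare y′≢0
        (solve F (y ∷ y′ ∷ ρ ∷ []) (λ y y′ ρ → :1 :* (y :* y) := ρ :* (y′ :* y′)
          given :- :1 ∶ ρ :* (y′ :* y′) := :0 :* :0 :+ :1 :* (:1 :* (y :* y)) and []) refl
          (echelon-coordinates {# 2} {# 3} (echelon refl refl refl refl) v∈ w∈ w∈′ (# 1)))

    EA-orbits : ∀ ρ → NonSquare ρ →
      EA ≐ (Orbit ℓ-EA₁ ∪ Orbit (ℓ-EA 1#) ∪ Orbit (ℓ-EA ρ))
      × Orbit ℓ-EA₁ ⊥ Orbit (ℓ-EA 1#)
      × Orbit ℓ-EA₁ ⊥ Orbit (ℓ-EA ρ)
      × Orbit (ℓ-EA 1#) ⊥ Orbit (ℓ-EA ρ)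
      × HasSize (Orbit ℓ-EA₁) (q ℕ.^ 3 ℕ.∸ q)
      × HasSize (Orbit (ℓ-EA 1#)) ((q ℕ.^ 2 ℕ.∸ 1) / 2)
      × HasSize (Orbit (ℓ-EA ρ)) ((q ℕ.^ 2 ℕ.∸ 1) / 2)
    EA-orbits ρ ρ-nonsquare =
        union≐ {EA} {Skew.Based} {Flat.Based 1# ∪ Flat.Based ρ} {Orbit ℓ-EA₁} {Orbit (ℓ-EA 1#) ∪ Orbit (ℓ-EA ρ)} (EA-split ρ-nonsquare) skew≐
          (union≐ {Flat.Based 1# ∪ Flat.Based ρ} {Flat.Based 1#} {Flat.Based ρ} {Orbit (ℓ-EA 1#)} {Orbit (ℓ-EA ρ)} ((λ h → h) , λ h → h) (flat≐ 1#) (flat≐ ρ))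
      , (λ { {ℓ} (o₁ , o₂) → skew-flat-disjoint {1#} {ℓ} (proj₂ skew≐ {ℓ} o₁) (proj₂ (flat≐ 1#) {ℓ} o₂) })
      , (λ { {ℓ} (o₁ , o₂) → skew-flat-disjoint {ρ} {ℓ} (proj₂ skew≐ {ℓ} o₁) (proj₂ (flat≐ ρ) {ℓ} o₂) })
      , (λ { {ℓ} (o₁ , o₂) → flats-disjoint {ρ} {ℓ} ρ-nonsquare (proj₂ (flat≐ 1#) {ℓ} o₁) (proj₂ (flat≐ ρ) {ℓ} o₂) })
      , Skew.orbit-size skew-baseUnique {ℓ-EA₁} skew≐ skew-listing (size-[q³-q] q≡1+nonzero)
      , size 1# 1≢0 , size ρ (nonSquare⇒≢0 ρ-nonsquare)
      where
      size : ∀ ρ → ρ ≢ 0# → HasSize (Orbit (ℓ-EA ρ)) ((q ℕ.^ 2 ℕ.∸ 1) / 2)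
      size ρ ρ≢0 = Flat.orbit-size ρ (flat-baseUnique ρ) {ℓ-EA ρ} (flat≐ ρ) (flat-listing ρ≢0) (size-[q²-1]/2 {h = half} q≡1+2half)

open import Data.Integer as ℤ using (ℤ; +_; 0ℤ; 1ℤ; -1ℤ)
open import Data.Integer.Divisibility as ℤ using ()
open import Data.Nat using (ℕ; _≤_; _+_; _∸_; _*_; _^_; _/_)
open import Data.Nat.Divisibility using (_∣_; _∤_)
open import Data.Product using (∃₂; _×_)
open import Data.Sum using (_⊎_)
open import Relation.Binary.PropositionalEquality using (_≡_; _≢_)
open import Relation.Unary using (_≐_; _∪_; _⊥_; Satisfiable)

theorem3p1 :
  (q : ℕ) → IsPrimePower q → 5 ≤ q →
  (ξ : ℤ) → ξ ≡ -1ℤ ⊎ ξ ≡ 0ℤ ⊎ ξ ≡ 1ℤ → + 3 ℤ.∣ (+ q ℤ.- ξ) →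
  (F : FiniteField q) (K : FiniteField (q ^ 2)) (E : Extension F K) →
  let open FiniteField F using (Carrier)
      open FiniteField F using (NonSquare)
      open FiniteField F using (1#)
      open ProjectiveSpace F
      open TwistedCubic F
      open LineTypes F K E
  in
  -- (i)
  ( IsOrbit RealChord × IsOrbit Tangent × IsOrbit ImaginaryChord
  × (2 ∤ q → IsOrbit UΓ)
  × (2 ∣ q → IsOrbit UnΓ × IsOrbit EΓ)
  × (ξ ≢ 0ℤ → IsOrbit RealAxis × IsOrbit ImaginaryAxis)
  × (ξ ≡ 0ℤ → IsOrbit ΓAxis) )
  ×
  -- (ii)
  ( 2 ∣ q → 8 ≤ q →
    UΓ ≐ (Orbit ℓ-UΓ₁ ∪ Orbit ℓ-UΓ₂)
    × Orbit ℓ-UΓ₁ ⊥ Orbit ℓ-UΓ₂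
    × HasSize (Orbit ℓ-UΓ₁) (q + 1)
    × HasSize (Orbit ℓ-UΓ₂) (q ^ 2 ∸ 1)
    × ComplementaryReguli Tangent (Orbit ℓ-UΓ₁) )
  ×
  -- (iii)
  ( 2 ∤ q → 5 ≤ q →
    Satisfiable NonSquare
    × ((ρ : Carrier) → NonSquare ρ →
        UnΓ ≐ (Orbit (ℓ-UnΓ 1#) ∪ Orbit (ℓ-UnΓ ρ))
        × Orbit (ℓ-UnΓ 1#) ⊥ Orbit (ℓ-UnΓ ρ)
        × HasSize (Orbit (ℓ-UnΓ 1#)) ((q ^ 3 ∸ q) / 2)
        × HasSize (Orbit (ℓ-UnΓ ρ)) ((q ^ 3 ∸ q) / 2)) )
  ×
  -- (iv)
  ( 2 ∤ q → 5 ≤ q → ξ ≢ 0ℤ →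
    Satisfiable NonSquare
    × ((ρ : Carrier) → NonSquare ρ →
        ∃₂ λ ℓ₁ ℓ₂ →
        IsMeet ℓ₁ π₀ (π-EΓ 1#) × IsMeet ℓ₂ π₀ (π-EΓ ρ)
        × EΓ ≐ (Orbit ℓ₁ ∪ Orbit ℓ₂)
        × Orbit ℓ₁ ⊥ Orbit ℓ₂
        × HasSize (Orbit ℓ₁) ((q ^ 3 ∸ q) / 2)
        × HasSize (Orbit ℓ₂) ((q ^ 3 ∸ q) / 2)) )
  ×
  -- (v)
  ( ξ ≡ 0ℤ → 9 ≤ q →
    Satisfiable NonSquare
    × ((ρ : Carrier) → NonSquare ρ →
        EA ≐ (Orbit ℓ-EA₁ ∪ Orbit (ℓ-EA 1#) ∪ Orbit (ℓ-EA ρ))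
        × Orbit ℓ-EA₁ ⊥ Orbit (ℓ-EA 1#)
        × Orbit ℓ-EA₁ ⊥ Orbit (ℓ-EA ρ)
        × Orbit (ℓ-EA 1#) ⊥ Orbit (ℓ-EA ρ)
        × HasSize (Orbit ℓ-EA₁) (q ^ 3 ∸ q)
        × HasSize (Orbit (ℓ-EA 1#)) ((q ^ 2 ∸ 1) / 2)
        × HasSize (Orbit (ℓ-EA ρ)) ((q ^ 2 ∸ 1) / 2)) )
theorem3p1 q q-prime-power 5≤q ξ ξ∈ 3∣q-ξ F K E =
  ( realChord-isOrbit , tangent-isOrbit , imaginaryChord-isOrbit
  , (λ 2∤q → UΓ-isOrbit (2∤q⇒2≢0 2∤q))
  , (λ 2∣q → EvenOrder.UnΓ-isOrbit (2∣q⇒2≡0 2∣q) , EvenOrder.EΓ-isOrbit (2∣q⇒2≡0 2∣q))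
  , (λ ξ≢0 → realAxis-isOrbit (3≢0 ξ≢0) , imaginaryAxis-isOrbit (3≢0 ξ≢0))
  , (λ ξ≡0 → TernaryOrder.ΓAxis-isOrbit (3≡0 ξ≡0)) )
  , (λ 2∣q _ → EvenOrder.UΓ-orbits (2∣q⇒2≡0 2∣q))
  , (λ 2∤q _ → let 2≢0 = 2∤q⇒2≢0 2∤q in
      OddCharacteristic.nonSquare-exists 2≢0 , OddOrder.UnΓ-orbits 2≢0)
  , (λ 2∤q _ ξ≢0 → let 2≢0 = 2∤q⇒2≢0 2∤q in
      OddCharacteristic.nonSquare-exists 2≢0 , OddOrder.EΓ-orbits 2≢0 (3≢0 ξ≢0))
  , (λ ξ≡0 _ →
      OddCharacteristic.nonSquare-exists (3≡0⇒2≢0 (3≡0 ξ≡0)) , TernaryOrder.EA-orbits (3≡0 ξ≡0))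
  where
  open FiniteField F using (_·_; 0#)
  open Arithmetic F
  open OrbitTheorems q-prime-power 5≤q F K E
  open ImaginaryLines 5≤q F K E
  3≢0 : ξ ≢ 0ℤ → 3 · FiniteField.1# F ≢ 0#
  3≢0 ξ≢0 = 3∤q⇒3≢0 (q≢0[3] ξ∈ ξ≢0 3∣q-ξ 5≤q)
  3≡0 : ξ ≡ 0ℤ → 3 · FiniteField.1# F ≡ 0#
  3≡0 ξ≡0 = 3∣q⇒3≡0 (q≡0[3] ξ≡0 3∣q-ξ)
  3≡0⇒2≢0 : 3 · FiniteField.1# F ≡ 0# → 2 · FiniteField.1# F ≢ 0#
  3≡0⇒2≢0 3≡0 2≡0 = 2≡0⇒3≢0 2≡0 3≡0
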